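{- Let $N=\binom{n}{2}$ and let $(\mathcal{G}(n,m))_{m=0}^{N}$ be the Erdős–Rényi random graph process on vertex set $[n]=\{1,\dots,n\}$. Let $$M=\min\{m : \mathcal{G}(n,m) \text{ is connected}\}.$$ Then asymptotically almost surely (i.e., with probability tending to $1$ as $n\to\infty$), $$a_f(\mathcal{G}(n,M)) = a_u(\mathcal{G}(n,M)) = 1.$$
   Context: Random graph process: let $e_1,\dots,e_N$ be a uniformly random permutation of the edges of $K_n$ and set $\mathcal{G}(n,m)=([n],\{e_1,\dots,e_m\})$; thus at each step one new edge chosen uniformly at random among missing edges is added. Acquisition: in a graph $G$, each vertex initially has weight $1$. A unit acquisition move transfers one unit of weight from a vertex $u$ to a neighbouring vertex $v$, provided that immediately before the move the weight on $v$ is at least the weight on $u$. A fractional acquisition move transfers an arbitrary positive (possibly non-integer) amount of weight from $u$ to a neighbour $v$, under the same condition that immediately before the move the weight on $v$ is at least the weight on $u$. An acquisition protocol is a maximal sequence of such moves; the residual set is the set of vertices with positive weight at the end. The unit acquisition number $a_u(G)$ (resp. fractional acquisition number $a_f(G)$) is the minimum size of a residual set over all protocols using unit (resp. fractional) acquisition moves.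
   Formalization: In fractional acquisition moves the vertex weights and the transferred amounts are rational rather than real numbers, so the minimum defining the fractional acquisition number ranges over protocols with rational amounts. -}

module Defs where

open import Data.Nat as ℕ using (ℕ; zero; suc; _∸_)
open import Data.Nat.Combinatorics using (_C_)
open import Data.Fin as Fin using (Fin)
open import Data.Fin.Properties using () renaming (_≟_ to _≟ᶠ_)
open import Data.Rational as ℚ using (ℚ; 0ℚ; 1ℚ)
open import Data.Rational.Properties using () renaming (_<?_ to _<?ℚ_)
open import Data.Product using (_×_; _,_; Σ; ∃; ∃-syntax)
open import Data.Sum using (_⊎_)
open import Data.List using (List; length; filter; allFin; take)
open import Data.List.Membership.Propositional using (_∈_)
open import Data.List.Relation.Unary.All using (All)
open import Data.List.Relation.Unary.Unique.Propositional using (Unique)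
open import Relation.Binary.Construct.Closure.ReflexiveTransitive using (Star)
open import Relation.Nullary using (¬_; does)
open import Relation.Binary.PropositionalEquality using (_≡_)
open import Data.Bool using (if_then_else_)

EdgeList : ℕ → Set
EdgeList n = List (Fin n × Fin n)

Adj : ∀ {n} → EdgeList n → Fin n → Fin n → Set
Adj E u v = ((u , v) ∈ E) ⊎ ((v , u) ∈ E)

Connected : ∀ {n} → EdgeList n → Set
Connected {n} E = (u v : Fin n) → Star (Adj E) u v

-- Random graph process: an ordering of the edges of K_n.
-- An edge of K_n is a pair (i , j) with i < j; an ordering is a list of
-- such pairs without repetitions that contains every edge of K_n.

IsEdgeOrdering : ∀ {n} → EdgeList n → Set
IsEdgeOrdering {n} σ =
  All (λ e → Fin.toℕ (Data.Product.proj₁ e) ℕ.< Fin.toℕ (Data.Product.proj₂ e)) σ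
  × Unique σ
  × ((i j : Fin n) → Fin.toℕ i ℕ.< Fin.toℕ j → (i , j) ∈ σ)
  where import Data.Product

Gnm : ∀ {n} → EdgeList n → ℕ → EdgeList n
Gnm σ m = take m σ

IsHittingTime : ∀ {n} → EdgeList n → ℕ → Set
IsHittingTime σ M = Connected (Gnm σ M) × (∀ m → m ℕ.< M → ¬ Connected (Gnm σ m))

UWeight : ℕ → Set
UWeight n = Fin n → ℕ

utransfer : ∀ {n} → UWeight n → Fin n → Fin n → ℕ → UWeight n
utransfer w u v t x =
  if does (x ≟ᶠ u) then w x ∸ t
  else if does (x ≟ᶠ v) then w x ℕ.+ t
  else w x

data UMove {n} (E : EdgeList n) : UWeight n → UWeight n → Set where
  umove : ∀ {w} u v → Adj E u v → 1 ℕ.≤ w u → w u ℕ.≤ w v →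
          UMove E w (utransfer w u v 1)

uResidualSize : ∀ {n} → UWeight n → ℕ
uResidualSize {n} w = length (filter (λ x → 1 ℕ.≤? w x) (allFin n))

UResidual : ∀ {n} → EdgeList n → ℕ → Set
UResidual {n} E k =
  ∃[ w ] Star (UMove E) (λ _ → 1) w × (∀ w' → ¬ UMove E w w') × uResidualSize w ≡ k

UnitAcqNumber : ∀ {n} → EdgeList n → ℕ → Set
UnitAcqNumber E k = UResidual E k × (∀ j → UResidual E j → k ℕ.≤ j)

FWeight : ℕ → Set
FWeight n = Fin n → ℚ

ftransfer : ∀ {n} → FWeight n → Fin n → Fin n → ℚ → FWeight n
ftransfer w u v t x =
  if does (x ≟ᶠ u) then w x ℚ.- t
  else if does (x ≟ᶠ v) then w x ℚ.+ t
  else w x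

data FMove {n} (E : EdgeList n) : FWeight n → FWeight n → Set where
  fmove : ∀ {w} u v t → Adj E u v → 0ℚ ℚ.< t → t ℚ.≤ w u → w u ℚ.≤ w v →
          FMove E w (ftransfer w u v t)

fResidualSize : ∀ {n} → FWeight n → ℕ
fResidualSize {n} w = length (filter (λ x → 0ℚ <?ℚ w x) (allFin n))

FResidual : ∀ {n} → EdgeList n → ℕ → Set
FResidual {n} E k =
  ∃[ w ] Star (FMove E) (λ _ → 1ℚ) w × (∀ w' → ¬ FMove E w w') × fResidualSize w ≡ k

FracAcqNumber : ∀ {n} → EdgeList n → ℕ → Set
FracAcqNumber E k = FResidual E k × (∀ j → FResidual E j → k ℕ.≤ j)

GoodOrdering : ∀ {n} → EdgeList n → Set
GoodOrdering σ =
  ∃[ M ] IsHittingTime σ M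
       × FracAcqNumber (Gnm σ M) 1
       × UnitAcqNumber (Gnm σ M) 1

-- "with probability at least 1 - 1/k": there is a set S of distinct edge
-- orderings, all satisfying P, such that the number of orderings not in S
-- (out of N! with N = n C 2) is at most N!/k.
ProbAtLeast1-1/ : (n : ℕ) → (EdgeList n → Set) → ℕ → Set
ProbAtLeast1-1/ n P k =
  ∃[ S ] Unique S × All (λ σ → IsEdgeOrdering {n} σ × P σ) S
       × k ℕ.* ((n C 2) ℕ.! ∸ length S) ℕ.≤ (n C 2) ℕ.!

module Submission where

open import Defs
open import Data.Bool using (Bool; true; false; _∧_; _∨_; not; if_then_else_)
open import Data.Bool.Properties using () renaming (_≟_ to _≟ᵇ_)
open import Data.Empty using (⊥; ⊥-elim)
import Data.Fin as Fin
open import Data.Fin using (Fin; zero; suc; toℕ)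
import Data.Fin.Properties as Finₚ
open import Data.Fin.Properties using (_≟_; any?)
open import Data.List using (List; []; _∷_; _++_; length; map; filter; allFin; take; drop; concatMap; tabulate; cartesianProduct)
open import Data.List.Membership.Propositional using (_∈_; _∉_)
open import Data.List.Membership.Propositional.Properties using (∈-++⁺ˡ; ∈-++⁺ʳ; ∈-++⁻; ∈-allFin; ∈-filter⁺; ∈-filter⁻; ∈-cartesianProduct⁺; ∈-∃++)
open import Data.List.Properties using (length-++; length-map; length-take; take-all; ++-assoc; ++-identityʳ)
open import Data.List.Relation.Binary.Permutation.Propositional using (_↭_; prep; swap; ↭-sym) renaming (refl to ↭-refl; trans to ↭-trans)
open import Data.List.Relation.Binary.Permutation.Propositional.Properties using (↭-length; ∈-resp-↭; shift)
open import Data.List.Relation.Unary.All as All using (All; []; _∷_)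
open import Data.List.Relation.Unary.AllPairs using ([]; _∷_)
open import Data.List.Relation.Unary.Any using (here; there)
open import Data.List.Relation.Unary.Unique.Propositional using (Unique)
open import Data.List.Relation.Unary.Unique.Propositional.Properties using (allFin⁺) renaming (++⁺ to Unique-++; filter⁺ to Unique-filter; cartesianProduct⁺ to Unique-cartesianProduct)
open import Data.Nat renaming (_≟_ to _≟ⁿ_)
open import Data.Nat.Combinatorics using (_C_; nCk+nC[k+1]≡[n+1]C[k+1]; nC1≡n)
open import Data.Nat.Properties hiding (_≟_)
open import Data.Nat.Tactic.RingSolver using (solve-∀)
open import Data.Product using (Σ; ∃; ∃-syntax; _×_; _,_; proj₁; proj₂)
open import Data.Product.Properties using (≡-dec)
open import Data.Rational as ℚ using (ℚ; 0ℚ; 1ℚ)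
import Data.Rational.Properties as ℚₚ
open import Data.Sum using (_⊎_; inj₁; inj₂)
open import Data.Unit using (⊤; tt)
open import Function using (_∘_; id)
open import Relation.Binary.Construct.Closure.ReflexiveTransitive using (Star; ε; _◅_; _◅◅_)
open import Relation.Binary.Definitions using (tri<; tri≈; tri>)
open import Relation.Binary.PropositionalEquality using (_≡_; _≢_; refl; sym; trans; cong; cong₂; subst; subst₂; _≗_; module ≡-Reasoning)
open import Relation.Nullary using (¬_; Dec; yes; no; does; ¬?; _×-dec_)
open import Relation.Nullary.Decidable using (decidable-stable)
import Relation.Unary as U

-- Expose the edges in three rounds, ending at times m₁ < m₋ < m₊, so that with high probability M lies between
-- m₋ and m₊. At time m₁ every two disjoint vertex sets of size μ are joined by an edge, so a Friedman–Pippenger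
-- embedding finds a complete binary "core" tree of height h, where 2^h = μ, in which a core vertex at height t also has
-- two gadgets of t + 2 vertices that it can absorb, and a spare child. All but 18μ vertices of the graph lie
-- in the base: outside the tree and adjacent to both a core vertex and a spare. If every core vertex absorbs one gadget, weights strictly increase
-- towards the root, so whatever hangs below the base flows to the root along the core tree. The choice between
-- the two gadgets leaves freedom to avoid the few "weak" vertices, those without a base neighbour at time m₋.
-- Weak vertices are pairwise far apart at time m₊, hence each can be routed through a neighbour whose
-- base vertex first absorbs its own spare; at time M no vertex is isolated, so everything is collected.
-- A single unit protocol therefore ends at one vertex, and it is also a fractional protocol.
--
-- Probabilities are counts over orderings: 𝔼 L f sums f over the orderings of L, and the probability that the
-- first m edges avoid f given ones is a ratio of falling factorials. The time m₋ is chosen where the expected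
-- number of isolated vertices is about n^(1/6): they exist by Chebyshev's inequality, so M > m₋, while short
-- walks between weak vertices are rare in the union bound.

-- A unit that arrives at a vertex of weight `w` can leave again only if the next vertex weighs at
-- least `w + 1`; hence the strict growth along the core. Gadgets of `t + 2` vertices make even a
-- core leaf (weight 3) heavier than a base vertex that has absorbed its spare (weight 2). The
-- structure must depend on the first `m₁` edges alone, for then the later edges are still a uniform
-- ordering of the rest. The scales follow: `μ` is `n` divided by about the fourth root of `log n`,
-- so that about `n (n / μ)²` edges, of order `n` times the square root of `log n`, join all pairs
-- of large sets, while so short a round changes avoidance probabilities only by factors `n^o(1)`.
-- At time `m₋` a given vertex is isolated with probability about `n^(-5/6)`. Two weak vertices must
-- both avoid the base, which misses a small share of the vertices; the crude exponent 3/2 in place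
-- of 2 yields about `n^(-5/4)`, and this still beats the `n` choices of a first vertex times the
-- `n^o(1)` weight of walks of length at most 6.

-- Finite sums and cardinalities of Boolean sets.

⟦_⟧ : Bool → ℕ
⟦ true ⟧ = 1
⟦ false ⟧ = 0

∑ : ∀ {n} → (Fin n → ℕ) → ℕ
∑ {zero} f = 0
∑ {suc n} f = f zero + ∑ (f ∘ suc)

card : ∀ {n} → (Fin n → Bool) → ℕ
card p = ∑ λ i → ⟦ p i ⟧

∑-mono : ∀ {n} {f g : Fin n → ℕ} → (∀ i → f i ≤ g i) → ∑ f ≤ ∑ g
∑-mono {zero} h = z≤n
∑-mono {suc n} h = +-mono-≤ (h zero) (∑-mono (h ∘ suc))

∑-cong : ∀ {n} {f g : Fin n → ℕ} → f ≗ g → ∑ f ≡ ∑ g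
∑-cong {zero} h = refl
∑-cong {suc n} h = cong₂ _+_ (h zero) (∑-cong (h ∘ suc))

+-interchange : ∀ a b c d → (a + b) + (c + d) ≡ (a + c) + (b + d)
+-interchange = solve-∀

∑-+ : ∀ {n} (f g : Fin n → ℕ) → ∑ (λ i → f i + g i) ≡ ∑ f + ∑ g
∑-+ {zero} f g = refl
∑-+ {suc n} f g = trans (cong (f zero + g zero +_) (∑-+ (f ∘ suc) (g ∘ suc)))
  (+-interchange (f zero) (g zero) _ _)

∑-*ˡ : ∀ {n} c (f : Fin n → ℕ) → ∑ (λ i → c * f i) ≡ c * ∑ f
∑-*ˡ {zero} c f = sym (*-zeroʳ c)
∑-*ˡ {suc n} c f = trans (cong (c * f zero +_) (∑-*ˡ c (f ∘ suc))) (sym (*-distribˡ-+ c (f zero) _))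

∑-const : ∀ {n} c → ∑ {n} (λ _ → c) ≡ n * c
∑-const {zero} c = refl
∑-const {suc n} c = cong (c +_) (∑-const {n} c)

∑-swap : ∀ {m n} (f : Fin m → Fin n → ℕ) → ∑ (λ i → ∑ (f i)) ≡ ∑ (λ j → ∑ (λ i → f i j))
∑-swap {zero} {n} f = sym (trans (∑-const {n} 0) (*-zeroʳ n))
∑-swap {suc m} f = trans (cong (∑ (f zero) +_) (∑-swap (f ∘ suc))) (sym (∑-+ (f zero) _))

term≤∑ : ∀ {n} (f : Fin n → ℕ) i → f i ≤ ∑ f
term≤∑ f zero = m≤m+n _ _
term≤∑ f (suc i) = ≤-trans (term≤∑ (f ∘ suc) i) (m≤n+m _ _)

∑-bound : ∀ {n} (f : Fin n → ℕ) c → (∀ i → f i ≤ c) → ∑ f ≤ n * c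
∑-bound {n} f c h = ≤-trans (∑-mono h) (≤-reflexive (∑-const {n} c))

∑>0 : ∀ {n} (f : Fin n → ℕ) → 0 < ∑ f → ∃[ i ] 0 < f i
∑>0 {zero} f ()
∑>0 {suc n} f h with f zero in eq
... | suc a = zero , subst (0 <_) (sym eq) z<s
... | zero with ∑>0 (f ∘ suc) h
... | i , q = suc i , q

anyᵇ : ∀ {n} → (Fin n → Bool) → Bool
anyᵇ {zero} p = false
anyᵇ {suc n} p = p zero ∨ anyᵇ (p ∘ suc)

∨-introʳ : ∀ {a b} → b ≡ true → a ∨ b ≡ true
∨-introʳ {false} h = h
∨-introʳ {true} h = refl

∨-introˡ : ∀ {a b} → a ≡ true → a ∨ b ≡ true
∨-introˡ {true} h = refl

∨-elim : ∀ {a b} → a ∨ b ≡ true → a ≡ true ⊎ b ≡ true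
∨-elim {true} h = inj₁ refl
∨-elim {false} h = inj₂ h

∧-intro : ∀ {a b} → a ≡ true → b ≡ true → a ∧ b ≡ true
∧-intro refl refl = refl

∧-elim : ∀ {a b} → a ∧ b ≡ true → a ≡ true × b ≡ true
∧-elim {true} {true} h = refl , refl

not-true : ∀ {a} → a ≡ false → not a ≡ true
not-true refl = refl

not-false : ∀ {a} → not a ≡ true → a ≡ false
not-false {false} h = refl

true≢false : ∀ {a} → a ≡ true → a ≡ false → ⊥
true≢false refl ()

¬true : ∀ {a} → ¬ (a ≡ true) → a ≡ false
¬true {true} h = ⊥-elim (h refl)
¬true {false} h = refl

bool? : ∀ a → (a ≡ true) ⊎ (a ≡ false)
bool? true = inj₁ refl
bool? false = inj₂ refl

anyᵇ-intro : ∀ {n} {p : Fin n → Bool} i → p i ≡ true → anyᵇ p ≡ true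
anyᵇ-intro zero h = ∨-introˡ h
anyᵇ-intro {p = p} (suc i) h = ∨-introʳ {p zero} (anyᵇ-intro i h)

anyᵇ-elim : ∀ {n} {p : Fin n → Bool} → anyᵇ p ≡ true → ∃[ i ] p i ≡ true
anyᵇ-elim {suc n} {p} h with ∨-elim {p zero} h
... | inj₁ q = zero , q
... | inj₂ q with anyᵇ-elim q
... | i , r = suc i , r

⟦⟧≤1 : ∀ b → ⟦ b ⟧ ≤ 1
⟦⟧≤1 true = ≤-refl
⟦⟧≤1 false = z≤n

⟦⟧-mono : ∀ {a b} → (a ≡ true → b ≡ true) → ⟦ a ⟧ ≤ ⟦ b ⟧
⟦⟧-mono {false} h = z≤n
⟦⟧-mono {true} h rewrite h refl = ≤-refl

⟦∨⟧≤ : ∀ a b → ⟦ a ∨ b ⟧ ≤ ⟦ a ⟧ + ⟦ b ⟧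
⟦∨⟧≤ true b = s≤s z≤n
⟦∨⟧≤ false b = ≤-refl

⟦not⟧ : ∀ a → ⟦ a ⟧ + ⟦ not a ⟧ ≡ 1
⟦not⟧ true = refl
⟦not⟧ false = refl

card-mono : ∀ {n} {p q : Fin n → Bool} → (∀ i → p i ≡ true → q i ≡ true) → card p ≤ card q
card-mono h = ∑-mono λ i → ⟦⟧-mono (h i)

card-cong : ∀ {n} {p q : Fin n → Bool} → p ≗ q → card p ≡ card q
card-cong h = ∑-cong λ i → cong ⟦_⟧ (h i)

card-∨ : ∀ {n} (p q : Fin n → Bool) → card (λ i → p i ∨ q i) ≤ card p + card q
card-∨ p q = ≤-trans (∑-mono λ i → ⟦∨⟧≤ (p i) (q i)) (≤-reflexive (∑-+ (⟦_⟧ ∘ p) (⟦_⟧ ∘ q)))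

card≤n : ∀ {n} (p : Fin n → Bool) → card p ≤ n
card≤n {n} p = ≤-trans (∑-bound _ 1 λ i → ⟦⟧≤1 (p i)) (≤-reflexive (*-identityʳ n))

card-not : ∀ {n} (p : Fin n → Bool) → card p + card (not ∘ p) ≡ n
card-not {n} p = trans (sym (∑-+ (⟦_⟧ ∘ p) (⟦_⟧ ∘ not ∘ p))) (trans (∑-cong λ i → ⟦not⟧ (p i)) (trans (∑-const {n} 1) (*-identityʳ n)))

card>0 : ∀ {n} (p : Fin n → Bool) → 0 < card p → ∃[ i ] p i ≡ true
card>0 p h with ∑>0 _ h
... | i , q with p i in eq
... | true = i , eq

infix 4 _==_
_==_ : ∀ {n} → Fin n → Fin n → Bool
i == j = does (i ≟ j)

==-refl : ∀ {n} (i : Fin n) → (i == i) ≡ true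
==-refl i with i ≟ i
... | yes _ = refl
... | no h = ⊥-elim (h refl)

==-true : ∀ {n} {i j : Fin n} → (i == j) ≡ true → i ≡ j
==-true {i = i} {j} h with i ≟ j
... | yes e = e

==-false : ∀ {n} {i j : Fin n} → i ≢ j → (i == j) ≡ false
==-false {i = i} {j} h with i ≟ j
... | yes e = ⊥-elim (h e)
... | no _ = refl

∑-single : ∀ {n} (i : Fin n) (f : Fin n → ℕ) → (∀ j → j ≢ i → f j ≡ 0) → ∑ f ≡ f i
∑-single {suc n} zero f h = trans (cong (f zero +_) (trans (∑-cong λ j → h (suc j) λ ()) (trans (∑-const {n} 0) (*-zeroʳ n)))) (+-identityʳ _)
∑-single (suc i) f h = cong₂ _+_ (h zero λ ()) (∑-single i (f ∘ suc) λ j ne → h (suc j) λ { refl → ne refl })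

card-single : ∀ {n} (i : Fin n) → card (_== i) ≡ 1
card-single i = trans (∑-single i _ λ j ne → cong ⟦_⟧ (==-false ne)) (cong ⟦_⟧ (==-refl i))

-- Finite search over sets; the property only has to respect extensional equality.
searchᵇ : ∀ n {Q : (Fin n → Bool) → Set} → (∀ {p q} → p ≗ q → Q p → Q q) → (∀ p → Dec (Q p)) → Dec (∃ Q)
searchᵇ zero {Q} ext d with d (λ ())
... | yes q = yes (_ , q)
... | no h = no λ { (p , q) → h (ext (λ ()) q) }
searchᵇ (suc n) {Q} ext d = decide (searchᵇ n {Q ∘ cons true} (λ e → ext (cons-cong e)) (d ∘ cons true))
                                   (searchᵇ n {Q ∘ cons false} (λ e → ext (cons-cong e)) (d ∘ cons false))
  where
  cons : Bool → (Fin n → Bool) → Fin (suc n) → Bool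
  cons b p zero = b
  cons b p (suc i) = p i
  cons-cong : ∀ {b p q} → p ≗ q → cons b p ≗ cons b q
  cons-cong e zero = refl
  cons-cong e (suc i) = e i
  cons-η : ∀ p {b} → p zero ≡ b → p ≗ cons b (p ∘ suc)
  cons-η p e zero = e
  cons-η p e (suc i) = refl
  decide : Dec (∃ (Q ∘ cons true)) → Dec (∃ (Q ∘ cons false)) → Dec (∃ Q)
  decide (yes (p , q)) _ = yes (_ , q)
  decide _ (yes (p , q)) = yes (_ , q)
  decide (no h) (no h') = no λ { (p , q) → refute p q (bool? (p zero)) }
    where
    refute : ∀ p → Q p → (p zero ≡ true) ⊎ (p zero ≡ false) → ⊥
    refute p q (inj₁ e) = h (_ , ext (cons-η p e) q)
    refute p q (inj₂ e) = h' (_ , ext (cons-η p e) q)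

-- Cells of the core tree and the structure to be embedded.

record Cell (n : ℕ) : Set where
  no-eta-equality
  field
    center spare : Fin n
    height : ℕ
    G : Bool → List (Fin n)
open Cell public

flat : ∀ {n} → Cell n → List (Fin n)
flat c = center c ∷ (G c false ++ G c true ++ spare c ∷ [])

flats : ∀ {n} → List (Cell n) → List (Fin n)
flats = concatMap flat

-- Eats c L: starting from unit weights, c can collect the weight of all of L.
data Eats {n} (adj : Fin n → Fin n → Bool) : Fin n → List (Fin n) → Set where
  eats-none : ∀ {c} → Eats adj c []
  absorb : ∀ {c r L₁ L₂} → Eats adj c L₁ → adj c r ≡ true → Eats adj r L₂ → length L₂ ≤ length L₁ →
           Eats adj c (L₁ ++ r ∷ L₂)

record CellOK {n} (adj : Fin n → Fin n → Bool) (c : Cell n) : Set where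
  field
    eats : ∀ i → Eats adj (center c) (G c i)
    lengths : ∀ i → length (G c i) ≡ height c + 2
    spareAdj : adj (center c) (spare c) ≡ true

-- All that the deterministic consolidation needs from the graph at time `m₁`. As `flats` lists
-- every tree vertex, `distinct` says at once that cells are disjoint and that the parts of each
-- cell are.
record Structure {n} (adj : Fin n → Fin n → Bool) (h μ : ℕ) : Set where
  field
    cells : List (Cell n)
    distinct : Unique (flats cells)
    top : Cell n
    top∈ : top ∈ cells
    ok : ∀ {c} → c ∈ cells → CellOK adj c
    parent : ∀ {c} → c ∈ cells → center c ≡ center top ⊎
             (∃[ p ] p ∈ cells × height p ≡ suc (height c) × adj (center p) (center c) ≡ true)
    bounded : ∀ {c} → c ∈ cells → height c ≤ h
    base : Fin n → Bool
    base∉ : ∀ {v} → base v ≡ true → v ∉ flats cells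
    base-parent : ∀ {v} → base v ≡ true → ∃[ c ] c ∈ cells × adj (center c) v ≡ true
    base-spare : ∀ {v} → base v ≡ true → ∃[ c ] c ∈ cells × adj (spare c) v ≡ true
    base-large : n ≤ card base + 18 * μ

mem : ∀ {n} → Fin n → List (Fin n) → Bool
mem x [] = false
mem x (y ∷ L) = (x == y) ∨ mem x L

mem⇒∈ : ∀ {n} {x : Fin n} L → mem x L ≡ true → x ∈ L
mem⇒∈ {x = x} (y ∷ L) h with x ≟ y
... | yes e = here e
... | no _ = there (mem⇒∈ L h)

∈⇒mem : ∀ {n} {x : Fin n} {L} → x ∈ L → mem x L ≡ true
∈⇒mem {x = x} (here refl) = ∨-introˡ (==-refl x)
∈⇒mem {x = x} {y ∷ L} (there m) = ∨-introʳ {x == y} (∈⇒mem m)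

card-mem≤ : ∀ {n} (L : List (Fin n)) → card (λ x → mem x L) ≤ length L
card-mem≤ {n} [] = ≤-reflexive (trans (∑-const {n} 0) (*-zeroʳ n))
card-mem≤ (y ∷ L) = ≤-trans (card-∨ (_== y) (λ x → mem x L)) (+-mono-≤ (≤-reflexive (card-single y)) (card-mem≤ L))

card-mem≥ : ∀ {n} {L : List (Fin n)} → Unique L → length L ≤ card (λ x → mem x L)
card-mem≥ [] = z≤n
card-mem≥ {L = y ∷ L} (y∉ ∷ u) = begin
    suc (length L)                                        ≤⟨ s≤s (card-mem≥ u) ⟩
    1 + card (λ x → mem x L)                              ≡⟨ cong (_+ card (λ x → mem x L)) (sym (card-single y)) ⟩
    card (_== y) + card (λ x → mem x L)                   ≡⟨ sym (∑-+ (λ x → ⟦ x == y ⟧) (λ x → ⟦ mem x L ⟧)) ⟩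
    ∑ (λ x → ⟦ x == y ⟧ + ⟦ mem x L ⟧)                    ≤⟨ ∑-mono pt ⟩
    card (λ x → (x == y) ∨ mem x L)                       ∎
  where
  open ≤-Reasoning
  pt : ∀ x → ⟦ x == y ⟧ + ⟦ mem x L ⟧ ≤ ⟦ (x == y) ∨ mem x L ⟧
  pt x with x ≟ y
  ... | no _ = ≤-refl
  ... | yes refl with mem x L in e
  ... | false = ≤-refl
  ... | true = ⊥-elim (All.lookup y∉ (mem⇒∈ L e) refl)

center∈flat : ∀ {n} (c : Cell n) → center c ∈ flat c
center∈flat c = here refl

spare∈flat : ∀ {n} (c : Cell n) → spare c ∈ flat c
spare∈flat c = there (∈-++⁺ʳ (G c false) (∈-++⁺ʳ (G c true) (here refl)))

∈-flats : ∀ {n} {c : Cell n} {cs x} → c ∈ cs → x ∈ flat c → x ∈ flats cs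
∈-flats (here refl) m = ∈-++⁺ˡ m
∈-flats {cs = c ∷ cs} (there k) m = ∈-++⁺ʳ (flat c) (∈-flats k m)

flats-∈ : ∀ {n} (cs : List (Cell n)) {x} → x ∈ flats cs → ∃[ c ] c ∈ cs × x ∈ flat c
flats-∈ (c ∷ cs) m with ∈-++⁻ (flat c) m
... | inj₁ k = c , here refl , k
... | inj₂ k with flats-∈ cs k
... | c' , k' , m' = c' , there k' , m'

unique-++ˡ : ∀ {A : Set} (xs : List A) {ys} → Unique (xs ++ ys) → Unique xs
unique-++ˡ [] u = []
unique-++ˡ (x ∷ xs) (a ∷ u) = All.tabulate (λ m → All.lookup a (∈-++⁺ˡ m)) ∷ unique-++ˡ xs u

unique-++ʳ : ∀ {A : Set} (xs : List A) {ys} → Unique (xs ++ ys) → Unique ys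
unique-++ʳ [] u = u
unique-++ʳ (x ∷ xs) (a ∷ u) = unique-++ʳ xs u

unique-disjoint : ∀ {A : Set} (xs : List A) {ys x} → Unique (xs ++ ys) → x ∈ xs → x ∈ ys → ⊥
unique-disjoint (x ∷ xs) (a ∷ u) (here refl) k = All.lookup a (∈-++⁺ʳ xs k) refl
unique-disjoint (x ∷ xs) (a ∷ u) (there m) k = unique-disjoint xs u m k

owner-unique : ∀ {n} {cs : List (Cell n)} {c c' x} → Unique (flats cs) → c ∈ cs → c' ∈ cs → x ∈ flat c → x ∈ flat c' → c ≡ c'
owner-unique u (here refl) (here refl) m m' = refl
owner-unique {cs = c ∷ cs} u (here refl) (there k') m m' = ⊥-elim (unique-disjoint (flat c) u m (∈-flats k' m'))
owner-unique {cs = c ∷ cs} u (there k) (here refl) m m' = ⊥-elim (unique-disjoint (flat c) u m' (∈-flats k m))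
owner-unique {cs = c ∷ cs} u (there k) (there k') m m' = owner-unique (unique-++ʳ (flat c) u) k k' m m'

map-preimage : ∀ {A B : Set} (f : A → B) {y} (ds : List A) → y ∈ map f ds → ∃[ d ] d ∈ ds × f d ≡ y
map-preimage f (d ∷ ds) (here refl) = d , here refl , refl
map-preimage f (d ∷ ds) (there m) with map-preimage f ds m
... | d' , k , e = d' , there k , e

map-unique : ∀ {n} (f : Cell n → Fin n) → (∀ c → f c ∈ flat c) → ∀ {cs} → Unique (flats cs) → Unique (map f cs)
map-unique f h {[]} u = []
map-unique {n} f h {c ∷ cs} u = All.tabulate apart ∷ map-unique f h (unique-++ʳ (flat c) u)
  where
  apart : ∀ {y} → y ∈ map f cs → f c ≢ y
  apart m e with map-preimage f cs m
  ... | d , k , refl = unique-disjoint (flat c) u (h c) (subst (_∈ flats cs) (sym e) (∈-flats k (h d)))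


-- Friedman–Pippenger tree embedding

module Embedding {n : ℕ} (adj : Fin n → Fin n → Bool)
                 (adj-sym : ∀ u v → adj u v ≡ true → adj v u ≡ true) (μ d : ℕ) (μ>0 : 0 < μ)
                 (joined : ∀ (A B : Fin n → Bool) → (∀ i → A i ≡ true → B i ≡ false) → μ ≤ card A → μ ≤ card B →
                           ∃[ a ] ∃[ b ] A a ≡ true × B b ≡ true × adj a b ≡ true) where

  Γ : (Fin n → Bool) → Fin n → Bool
  Γ X y = anyᵇ λ x → X x ∧ adj x y

  Γ-intro : ∀ {X} x {y} → X x ≡ true → adj x y ≡ true → Γ X y ≡ true
  Γ-intro x h k = anyᵇ-intro x (∧-intro h k)

  Γ-elim : ∀ {X y} → Γ X y ≡ true → ∃[ x ] X x ≡ true × adj x y ≡ true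
  Γ-elim {X} {y} h with anyᵇ-elim {p = λ x → X x ∧ adj x y} h
  ... | x , q = x , ∧-elim q

  Γ-mono : ∀ {X Y} → (∀ x → X x ≡ true → Y x ≡ true) → ∀ y → Γ X y ≡ true → Γ Y y ≡ true
  Γ-mono h y q with Γ-elim q
  ... | x , a , b = Γ-intro x (h x a) b

  _∪_ _∩_ : (Fin n → Bool) → (Fin n → Bool) → Fin n → Bool
  (X ∪ Y) i = X i ∨ Y i
  (X ∩ Y) i = X i ∧ Y i

  need : (Fin n → ℕ) → (Fin n → Bool) → ℕ
  need B X = ∑ λ x → ⟦ X x ⟧ * B x

  free : (Fin n → Bool) → (Fin n → Bool) → Fin n → Bool
  free W X y = not (W y) ∧ Γ X y

  avail : (Fin n → Bool) → (Fin n → Bool) → ℕ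
  avail W X = card (free W X)

  free-elim : ∀ {W X y} → free W X y ≡ true → W y ≡ false × Γ X y ≡ true
  free-elim {W} {X} {y} h with ∧-elim {not (W y)} h
  ... | a , b = not-false a , b

  free-intro : ∀ {W X y} → W y ≡ false → Γ X y ≡ true → free W X y ≡ true
  free-intro a b = ∧-intro (not-true a) b

  avail-mono : ∀ {W X Y} → (∀ y → W y ≡ false → Γ X y ≡ true → Γ Y y ≡ true) → avail W X ≤ avail W Y
  avail-mono {W} {X} {Y} h = card-mono λ y q → let a , b = free-elim {W} {X} q in free-intro {W} {Y} a (h y a b)

  -- W is the set of used vertices and B x the number of children that x may still be asked for.
  Good : (Fin n → Bool) → (Fin n → ℕ) → Set
  Good W B = ∀ X → card X ≤ μ + μ → need B X ≤ avail W X

  -- The counted set is disjoint from `X` and sends no edge to it, so `joined` forbids it to reach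
  -- size `μ`.
  nonneighbours<μ : ∀ X → μ ≤ card X → card (λ y → not (Γ X y ∨ X y)) < μ
  nonneighbours<μ X h = ≰⇒> λ k → contra k
    where
    contra : μ ≤ card (λ y → not (Γ X y ∨ X y)) → ⊥
    contra k with joined X (λ y → not (Γ X y ∨ X y)) (λ i q → cong not (∨-introʳ {Γ X i} q)) h k
    ... | a , b , Xa , Yb , e = true≢false (∨-introˡ {Γ X b} {X b} (Γ-intro a Xa e)) (not-false Yb)

  -- Sets of size between `μ` and `2 μ` have room to spare, so that the inequality in `Good` can be
  -- tight only below `μ`.
  large-avail : ∀ W X → μ ≤ card X → n < avail W X + card W + card X + μ
  large-avail W X h = begin-strict
    n                                                            ≡⟨ sym (card-not λ y → Γ X y ∨ X y) ⟩
    card (λ y → Γ X y ∨ X y) + card (λ y → not (Γ X y ∨ X y))    <⟨ +-monoʳ-< _ (nonneighbours<μ X h) ⟩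
    card (λ y → Γ X y ∨ X y) + μ                                 ≤⟨ +-monoˡ-≤ μ split ⟩
    avail W X + card W + card X + μ                              ∎
    where
    open ≤-Reasoning
    cover : ∀ y → Γ X y ≡ true → free W X y ∨ W y ≡ true
    cover y q with bool? (W y)
    ... | inj₁ w = ∨-introʳ {free W X y} w
    ... | inj₂ w = ∨-introˡ (free-intro {W} {X} w q)
    split : card (λ y → Γ X y ∨ X y) ≤ avail W X + card W + card X
    split = ≤-trans (card-∨ (Γ X) X) (+-monoˡ-≤ (card X)
      (≤-trans (card-mono cover) (card-∨ (free W X) W)))

  _⊕_ : (Fin n → Bool) → Fin n → Fin n → Bool
  (W ⊕ y) x = W x ∨ (x == y)

  spend : (Fin n → ℕ) → Fin n → Fin n → ℕ
  spend B v x = B x ∸ ⟦ x == v ⟧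

  card-⊕ : ∀ W y → card (W ⊕ y) ≤ card W + 1
  card-⊕ W y = ≤-trans (card-∨ W (_== y)) (+-monoʳ-≤ (card W) (≤-reflexive (card-single y)))

  need-⊕ : ∀ B X v → X v ≡ false → need B (X ⊕ v) ≡ need B X + B v
  need-⊕ B X v h = trans (∑-cong pt) (trans (∑-+ (λ x → ⟦ X x ⟧ * B x) (λ x → ⟦ x == v ⟧ * B x))
      (cong (need B X +_) (trans (∑-single v _ λ j ne → cong (λ b → ⟦ b ⟧ * B j) (==-false ne))
        (trans (cong (λ b → ⟦ b ⟧ * B v) (==-refl v)) (+-identityʳ _)))))
    where
    pt : ∀ x → ⟦ X x ∨ (x == v) ⟧ * B x ≡ ⟦ X x ⟧ * B x + ⟦ x == v ⟧ * B x
    pt x with x ≟ v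
    ... | yes refl rewrite h = refl
    ... | no _ with X x
    ... | true = sym (+-identityʳ _)
    ... | false = refl

  module Step (W : Fin n → Bool) (B : Fin n → ℕ) (good : Good W B) (B≤d : ∀ x → B x ≤ d)
              (room : card W + (d + d + 3) * μ < n) (v : Fin n) (Bv : 1 ≤ B v) where

    -- Under `good` the second condition is an equality: such a set can spare none of its free
    -- neighbours.
    Crit : (Fin n → Bool) → Set
    Crit X = card X ≤ μ + μ × avail W X ≤ need B X

    need≤ : ∀ X → need B X ≤ d * card X
    need≤ X = ≤-trans (∑-mono λ x → ≤-trans (*-monoʳ-≤ ⟦ X x ⟧ (B≤d x)) (≤-reflexive (*-comm ⟦ X x ⟧ d)))
                      (≤-reflexive (∑-*ˡ d (⟦_⟧ ∘ X)))

    crit-small : ∀ X → Crit X → card X < μ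
    crit-small X (c , a) = ≰⇒> λ k → <-irrefl refl (begin-strict
        n                                   <⟨ large-avail W X k ⟩
        avail W X + card W + card X + μ     ≤⟨ +-monoˡ-≤ μ (+-mono-≤ (+-monoˡ-≤ (card W) (≤-trans a (≤-trans (need≤ X) (*-monoʳ-≤ d c)))) c) ⟩
        d * (μ + μ) + card W + (μ + μ) + μ  ≡⟨ arith d μ (card W) ⟩
        card W + (d + d + 3) * μ            <⟨ room ⟩
        n                                   ∎)
      where
      open ≤-Reasoning
      arith : ∀ d μ w → d * (μ + μ) + w + (μ + μ) + μ ≡ w + (d + d + 3) * μ
      arith = solve-∀

    need-modular : ∀ X Y → need B (X ∪ Y) + need B (X ∩ Y) ≡ need B X + need B Y
    need-modular X Y = trans (sym (∑-+ _ (λ x → ⟦ X x ∧ Y x ⟧ * B x))) (trans (∑-cong pt) (∑-+ (λ x → ⟦ X x ⟧ * B x) _))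
      where
      pt : ∀ x → ⟦ X x ∨ Y x ⟧ * B x + ⟦ X x ∧ Y x ⟧ * B x ≡ ⟦ X x ⟧ * B x + ⟦ Y x ⟧ * B x
      pt x with X x | Y x
      ... | true | true = refl
      ... | true | false = refl
      ... | false | true = +-identityʳ _
      ... | false | false = refl

    avail-submodular : ∀ X Y → avail W (X ∪ Y) + avail W (X ∩ Y) ≤ avail W X + avail W Y
    avail-submodular X Y = ≤-trans (≤-reflexive (sym (∑-+ (⟦_⟧ ∘ free W (X ∪ Y)) _)))
                             (≤-trans (∑-mono pt) (≤-reflexive (∑-+ (⟦_⟧ ∘ free W X) _)))
      where
      both : ∀ a b c d → (c ≡ true → a ≡ true ⊎ b ≡ true) → (d ≡ true → a ≡ true × b ≡ true) →
             ⟦ c ⟧ + ⟦ d ⟧ ≤ ⟦ a ⟧ + ⟦ b ⟧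
      both a b c true h k with k refl
      ... | refl , refl = +-monoˡ-≤ 1 (⟦⟧≤1 c)
      both a b false false h k = z≤n
      both a b true false h k with h refl
      ... | inj₁ refl = s≤s z≤n
      ... | inj₂ refl = m≤n+m 1 ⟦ a ⟧
      pt : ∀ y → ⟦ free W (X ∪ Y) y ⟧ + ⟦ free W (X ∩ Y) y ⟧ ≤ ⟦ free W X y ⟧ + ⟦ free W Y y ⟧
      pt y = both (free W X y) (free W Y y) _ _ f g
        where
        f : free W (X ∪ Y) y ≡ true → free W X y ≡ true ⊎ free W Y y ≡ true
        f q with free-elim {W} {X ∪ Y} q
        ... | w , e with Γ-elim e
        ... | x , m , a with ∨-elim {X x} m
        ... | inj₁ m' = inj₁ (free-intro {W} {X} w (Γ-intro x m' a))
        ... | inj₂ m' = inj₂ (free-intro {W} {Y} w (Γ-intro x m' a))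
        g : free W (X ∩ Y) y ≡ true → free W X y ≡ true × free W Y y ≡ true
        g q with free-elim {W} {X ∩ Y} q
        ... | w , e with Γ-elim e
        ... | x , m , a with ∧-elim {X x} m
        ... | m₁ , m₂ = free-intro {W} {X} w (Γ-intro x m₁ a) , free-intro {W} {Y} w (Γ-intro x m₂ a)

    -- `avail` is submodular, being a coverage function, while `need` is modular; tightness
    -- therefore passes to unions. The range up to `2 μ` in `Good` admits the union of two critical
    -- sets, which by `crit-small` is then again below `μ`.
    crit-∪ : ∀ X Y → Crit X → Crit Y → Crit (X ∪ Y)
    crit-∪ X Y cX cY = size , +-cancelʳ-≤ (avail W (X ∩ Y)) _ _ (begin
        avail W (X ∪ Y) + avail W (X ∩ Y)   ≤⟨ avail-submodular X Y ⟩
        avail W X + avail W Y               ≤⟨ +-mono-≤ (proj₂ cX) (proj₂ cY) ⟩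
        need B X + need B Y                 ≡⟨ sym (need-modular X Y) ⟩
        need B (X ∪ Y) + need B (X ∩ Y)     ≤⟨ +-monoʳ-≤ (need B (X ∪ Y)) (good (X ∩ Y)
                                                (≤-trans (card-mono λ i q → proj₁ (∧-elim {X i} q)) (proj₁ cX))) ⟩
        need B (X ∪ Y) + avail W (X ∩ Y)    ∎)
      where
      open ≤-Reasoning
      size : card (X ∪ Y) ≤ μ + μ
      size = ≤-trans (card-∨ X Y) (+-mono-≤ (<⇒≤ (crit-small X cX)) (<⇒≤ (crit-small Y cY)))

    crit-∅ : Crit (λ _ → false)
    crit-∅ = ≤-trans (≤-reflexive zeros) z≤n , ≤-trans (card-mono {p = free W (λ _ → false)} {q = λ _ → false} nothing) (≤-trans (≤-reflexive zeros) z≤n)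
      where
      zeros : card {n} (λ _ → false) ≡ 0
      zeros = trans (∑-const {n} 0) (*-zeroʳ n)
      nothing : ∀ y → free W (λ _ → false) y ≡ true → false ≡ true
      nothing y q with Γ-elim {λ _ → false} {y} (proj₂ (free-elim {W} {λ _ → false} {y} q))
      ... | _ , () , _

    Bad : Fin n → (Fin n → Bool) → Set
    Bad y X = card X ≤ μ + μ × avail (W ⊕ y) X < need (spend B v) X

    spend-need : ∀ X → need (spend B v) X + ⟦ X v ⟧ ≡ need B X
    spend-need X = trans (cong (need (spend B v) X +_) (sym atv)) (trans (sym (∑-+ (λ x → ⟦ X x ⟧ * spend B v x) (λ x → ⟦ x == v ⟧ * ⟦ X x ⟧))) (∑-cong pt))
      where
      atv : ∑ (λ x → ⟦ x == v ⟧ * ⟦ X x ⟧) ≡ ⟦ X v ⟧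
      atv = trans (∑-single v _ λ j ne → cong (λ b → ⟦ b ⟧ * ⟦ X j ⟧) (==-false ne))
              (trans (cong (λ b → ⟦ b ⟧ * ⟦ X v ⟧) (==-refl v)) (+-identityʳ _))
      pt : ∀ x → ⟦ X x ⟧ * (B x ∸ ⟦ x == v ⟧) + ⟦ x == v ⟧ * ⟦ X x ⟧ ≡ ⟦ X x ⟧ * B x
      pt x with x ≟ v
      ... | no _ = +-identityʳ _
      ... | yes refl with X x
      ... | false = refl
      ... | true = trans (cong (_+ 1) (+-identityʳ (B x ∸ 1))) (trans (m∸n+n≡m Bv) (sym (+-identityʳ _)))

    loses : ∀ y X → avail W X ≤ avail (W ⊕ y) X + 1
    loses y X = ≤-trans (card-mono f) (≤-trans (card-∨ (free (W ⊕ y) X) (_== y)) (+-monoʳ-≤ _ (≤-reflexive (card-single y))))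
      where
      f : ∀ z → free W X z ≡ true → free (W ⊕ y) X z ∨ (z == y) ≡ true
      f z q with z ≟ y
      ... | yes _ = ∨-introʳ {not (W z ∨ true) ∧ Γ X z} refl
      ... | no _ with free-elim {W} {X} q
      ... | a , b rewrite a | b = refl

    -- Taking `y` lowers `avail` by at most one, and only if `y` is a neighbour of `X`; spending at
    -- `v` lowers `need` by one exactly when `v` lies in `X`. A violation thus leaves just one
    -- possibility.
    bad⇒crit : ∀ y X → Bad y X → Crit X × X v ≡ false × Γ X y ≡ true
    bad⇒crit y X (c , lt) with bool? (X v) | bool? (Γ X y)
    ... | inj₁ xv | _ = ⊥-elim (<-irrefl refl (begin-strict
        need B X                            ≤⟨ good X c ⟩
        avail W X                           ≤⟨ loses y X ⟩
        avail (W ⊕ y) X + 1                 <⟨ +-monoˡ-< 1 lt ⟩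
        need (spend B v) X + 1              ≡⟨ cong (λ b → need (spend B v) X + ⟦ b ⟧) (sym xv) ⟩
        need (spend B v) X + ⟦ X v ⟧        ≡⟨ spend-need X ⟩
        need B X                            ∎))
      where open ≤-Reasoning
    ... | inj₂ xv | inj₂ g = ⊥-elim (<-irrefl refl (begin-strict
        need B X                            ≤⟨ good X c ⟩
        avail W X                           ≤⟨ card-mono f ⟩
        avail (W ⊕ y) X                     <⟨ lt ⟩
        need (spend B v) X                  ≤⟨ m≤m+n _ _ ⟩
        need (spend B v) X + ⟦ X v ⟧        ≡⟨ spend-need X ⟩
        need B X                            ∎))
      where
      open ≤-Reasoning
      f : ∀ z → free W X z ≡ true → free (W ⊕ y) X z ≡ true
      f z q with z ≟ y
      ... | yes refl = ⊥-elim (true≢false (proj₂ (free-elim {W} {X} q)) g)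
      ... | no _ with free-elim {W} {X} q
      ... | a , b rewrite a | b = refl
    ... | inj₂ xv | inj₁ g = (c , ≤-pred (begin-strict
        avail W X                           ≤⟨ loses y X ⟩
        avail (W ⊕ y) X + 1                 <⟨ +-monoˡ-< 1 lt ⟩
        need (spend B v) X + 1              ≡⟨ +-comm _ 1 ⟩
        suc (need (spend B v) X)            ≤⟨ s≤s (≤-trans (m≤m+n _ _) (≤-reflexive (spend-need X))) ⟩
        suc (need B X)                      ∎)) , xv , g
      where open ≤-Reasoning

    bad? : ∀ y → Dec (∃ (Bad y))
    bad? y = searchᵇ n ext (λ X → (card X ≤? μ + μ) ×-dec (avail (W ⊕ y) X <? need (spend B v) X))
      where
      Γ-cong : ∀ {p q} → p ≗ q → Γ p y ≡ true → Γ q y ≡ true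
      Γ-cong e = Γ-mono (λ x h → trans (sym (e x)) h) y
      avail-cong : ∀ {p q} → p ≗ q → avail (W ⊕ y) p ≤ avail (W ⊕ y) q
      avail-cong e = avail-mono λ z _ → Γ-mono (λ x h → trans (sym (e x)) h) z
      ext : ∀ {p q} → p ≗ q → Bad y p → Bad y q
      ext {p} {q} e (c , lt) = subst (_≤ μ + μ) (card-cong e) c ,
        ≤-<-trans (avail-cong (sym ∘ e)) (subst (avail (W ⊕ y) p <_) (∑-cong λ x → cong (λ b → ⟦ b ⟧ * spend B v x) (e x)) lt)

    no-bad⇒good : ∀ y → ¬ ∃ (Bad y) → Good (W ⊕ y) (spend B v)
    no-bad⇒good y h X c = ≮⇒≥ λ lt → h (X , c , lt)

    -- Unites the sets that refuse the free neighbours of `v` into one critical set. The family `f`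
    -- serves the induction only; it is applied to the identity.
    covering : ∀ k (f : Fin k → Fin n) → (∀ i → W (f i) ≡ false → adj v (f i) ≡ true → ∃ (Bad (f i))) →
               ∃[ X ] Crit X × X v ≡ false × (∀ i → W (f i) ≡ false → adj v (f i) ≡ true → Γ X (f i) ≡ true)
    covering zero f h = (λ _ → false) , crit-∅ , refl , λ ()
    covering (suc k) f h with covering k (f ∘ suc) (h ∘ suc)
    ... | X , cX , Xv , cov = decide (bool? (W (f zero))) (bool? (adj v (f zero)))
      where
      P = ∃[ X ] Crit X × X v ≡ false × (∀ i → W (f i) ≡ false → adj v (f i) ≡ true → Γ X (f i) ≡ true)
      skip : ¬ (W (f zero) ≡ false × adj v (f zero) ≡ true) → P
      skip never = X , cX , Xv , λ { zero w a → ⊥-elim (never (w , a)) ; (suc i) w a → cov i w a }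
      decide : (W (f zero) ≡ true) ⊎ (W (f zero) ≡ false) → (adj v (f zero) ≡ true) ⊎ (adj v (f zero) ≡ false) → P
      decide (inj₁ w) _ = skip λ { (w' , _) → true≢false w w' }
      decide _ (inj₂ a) = skip λ { (_ , a') → true≢false a' a }
      decide (inj₂ w) (inj₁ a) with h zero w a
      ... | Y , bY with bad⇒crit (f zero) Y bY
      ... | cY , Yv , g = (X ∪ Y) , crit-∪ X Y cX cY , trans (cong (_∨ Y v) Xv) Yv ,
            λ { zero _ _ → Γ-mono (λ x m → ∨-introʳ {X x} m) (f zero) g
              ; (suc i) w' a' → Γ-mono (λ x m → ∨-introˡ m) (f (suc i)) (cov i w' a') }

    Candidate : Fin n → Set
    Candidate y = W y ≡ false × adj v y ≡ true × ¬ ∃ (Bad y)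

    candidate? : ∀ y → Dec (Candidate y)
    candidate? y = (W y ≟ᵇ false) ×-dec (adj v y ≟ᵇ true) ×-dec ¬? (bad? y)

    -- If every free neighbour of `v` were refused, the set from `covering` would already have all
    -- of them as neighbours. Adding `v` to it would raise `need` by `B v`, at least one, but not
    -- `avail`, against `good`.
    step : ∃[ y ] W y ≡ false × adj v y ≡ true × Good (W ⊕ y) (spend B v)
    step with any? candidate?
    ... | yes (y , w , a , nb) = y , w , a , no-bad⇒good y nb
    ... | no none with covering n id (λ y w a → decidable-stable (bad? y) λ nb → none (y , w , a , nb))
    ... | X , cX , Xv , cov = ⊥-elim (<-irrefl refl (begin-strict
        need B X              <⟨ m<m+n (need B X) Bv ⟩
        need B X + B v        ≡⟨ sym (need-⊕ B X v Xv) ⟩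
        need B (X ⊕ v)        ≤⟨ good (X ⊕ v) size ⟩
        avail W (X ⊕ v)       ≤⟨ avail-mono absorbed ⟩
        avail W X             ≤⟨ proj₂ cX ⟩
        need B X              ∎))
      where
      open ≤-Reasoning
      size : card (X ⊕ v) ≤ μ + μ
      size = ≤-trans (card-⊕ X v) (+-mono-≤ (<⇒≤ (crit-small X cX)) μ>0)
      absorbed : ∀ y → W y ≡ false → Γ (X ⊕ v) y ≡ true → Γ X y ≡ true
      absorbed y w g with Γ-elim g
      ... | x , m , a with ∨-elim {X x} m
      ... | inj₁ q = Γ-intro x q a
      ... | inj₂ q with ==-true {i = x} {v} q
      ... | refl = cov y w a

  external : (Fin n → Bool) → Fin n → Bool
  external X y = Γ X y ∧ not (X y)

  Γ-cong : ∀ {p q} → p ≗ q → ∀ y → Γ p y ≡ true → Γ q y ≡ true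
  Γ-cong e = Γ-mono λ x h → trans (sym (e x)) h

  external-mono : ∀ {p q} → p ≗ q → card (external p) ≤ card (external q)
  external-mono {p} {q} e = card-mono f
    where
    f : ∀ y → external p y ≡ true → external q y ≡ true
    f y h with ∧-elim {Γ p y} h
    ... | a , b = ∧-intro (Γ-cong e y a) (trans (cong not (sym (e y))) b)

  -- `joined` says nothing about small sets, some of which may fail to expand. A largest such set of
  -- size at most `μ` is given up; what remains expands.
  Contracting : (Fin n → Bool) → Set
  Contracting X = card X ≤ μ × card (external X) ≤ d * card X

  contracting-ext : ∀ {p q} → p ≗ q → Contracting p → Contracting q
  contracting-ext {p} {q} e (a , b) = subst (_≤ μ) (card-cong e) a ,
    ≤-trans (external-mono (sym ∘ e)) (subst (λ c → card (external p) ≤ d * c) (card-cong e) b)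

  contracting? : ∀ X → Dec (Contracting X)
  contracting? X = (card X ≤? μ) ×-dec (card (external X) ≤? d * card X)

  zeros : card {n} (λ _ → false) ≡ 0
  zeros = trans (∑-const {n} 0) (*-zeroʳ n)

  contracting-∅ : Contracting (λ _ → false)
  contracting-∅ = ≤-trans (≤-reflexive zeros) z≤n ,
    ≤-trans (card-mono {p = external (λ _ → false)} {q = λ _ → false} nothing) (≤-trans (≤-reflexive zeros) z≤n)
    where
    nothing : ∀ y → external (λ _ → false) y ≡ true → false ≡ true
    nothing y q with Γ-elim {λ _ → false} {y} (proj₁ (∧-elim {Γ (λ _ → false) y} q))
    ... | _ , () , _

  largest : ∃[ X ] Contracting X × (∀ Y → Contracting Y → card Y ≤ card X)
  largest = go n (λ Y _ → card≤n Y)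
    where
    go : ∀ k → (∀ Y → Contracting Y → card Y ≤ k) → ∃[ X ] Contracting X × (∀ Y → Contracting Y → card Y ≤ card X)
    go zero h = (λ _ → false) , contracting-∅ , λ Y c → ≤-trans (h Y c) z≤n
    go (suc k) h with searchᵇ n {λ X → Contracting X × card X ≡ suc k}
                        (λ e → λ { (c , s) → contracting-ext e c , trans (sym (card-cong e)) s })
                        (λ X → contracting? X ×-dec (card X ≟ⁿ suc k))
    ... | yes (X , c , s) = X , c , λ Y c' → ≤-trans (h Y c') (≤-reflexive (sym s))
    ... | no none = go k λ Y c → ≤-pred (≤∧≢⇒< (h Y c) λ s → none (Y , c , s))

  record State : Set where
    field
      W : Fin n → Bool
      B : Fin n → ℕ
      good : Good W B
      B≤d : ∀ x → B x ≤ d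
      unused : ∀ x → W x ≡ false → B x ≡ d
  open State

  private
    X₀ = proj₁ largest

    -- The abandoned vertices count as used and ask for nothing, so `Good` is a condition on the
    -- part of a set outside `X₀` only.
    B₀ : Fin n → ℕ
    B₀ x = if X₀ x then 0 else d

  -- A small set that failed could be joined to `X₀`: the union is a larger contracting set, or has
  -- more than `μ` vertices and then too few neighbours. Above `μ` `large-avail` suffices. The
  -- inequality is strict because the root of the tree takes away one more vertex.
  expands : (d + d + 4) * μ < n → ∀ X → (∀ x → X x ≡ true → X₀ x ≡ false) → 1 ≤ card X → card X ≤ μ + μ →
            d * card X < card (λ y → not (X₀ y) ∧ Γ X y)
  expands room X disj X>0 c with card X ≤? μ
  ... | yes c' = ≰⇒> contra
    where
    open ≤-Reasoning
    U = X₀ ∪ X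
    cardU : card U ≡ card X₀ + card X
    cardU = trans (∑-cong pt) (∑-+ (⟦_⟧ ∘ X₀) (⟦_⟧ ∘ X))
      where
      pt : ∀ x → ⟦ X₀ x ∨ X x ⟧ ≡ ⟦ X₀ x ⟧ + ⟦ X x ⟧
      pt x with X x | disj x
      ... | true | q rewrite q refl = refl
      ... | false | _ with X₀ x
      ... | true = refl
      ... | false = refl
    cover : ∀ y → external U y ≡ true → external X₀ y ∨ (not (X₀ y) ∧ Γ X y) ≡ true
    cover y h with ∧-elim {Γ U y} h
    ... | g , nu with Γ-elim g | X₀ y in e₀
    ... | x , m , a | true = ⊥-elim (true≢false {not true} nu refl)
    ... | x , m , a | false with ∨-elim {X₀ x} m
    ... | inj₁ q = ∨-introˡ (∧-intro (Γ-intro x q a) refl)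
    ... | inj₂ q = ∨-introʳ {Γ X₀ y ∧ true} (Γ-intro x q a)
    contra : card (λ y → not (X₀ y) ∧ Γ X y) ≤ d * card X → ⊥
    contra k with card U ≤? μ
    ... | yes small = <-irrefl refl (begin-strict
      card X₀             <⟨ m<m+n (card X₀) X>0 ⟩
      card X₀ + card X    ≡⟨ sym cardU ⟩
      card U              ≤⟨ proj₂ (proj₂ largest) U (small , ext≤) ⟩
      card X₀             ∎)
      where
      ext≤ : card (external U) ≤ d * card U
      ext≤ = begin
        card (external U)                                             ≤⟨ card-mono cover ⟩
        card (λ y → external X₀ y ∨ (not (X₀ y) ∧ Γ X y))             ≤⟨ card-∨ (external X₀) _ ⟩
        card (external X₀) + card (λ y → not (X₀ y) ∧ Γ X y)          ≤⟨ +-mono-≤ (proj₂ (proj₁ (proj₂ largest))) k ⟩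
        d * card X₀ + d * card X                                      ≡⟨ sym (*-distribˡ-+ d (card X₀) (card X)) ⟩
        d * (card X₀ + card X)                                        ≡⟨ cong (d *_) (sym cardU) ⟩
        d * card U                                                    ∎
    ... | no large = <-irrefl refl (begin-strict
      n                                                                ≡⟨ sym (card-not λ y → Γ U y ∨ U y) ⟩
      card (λ y → Γ U y ∨ U y) + card (λ y → not (Γ U y ∨ U y))        <⟨ +-monoʳ-< _ (nonneighbours<μ U (<⇒≤ (≰⇒> large))) ⟩
      card (λ y → Γ U y ∨ U y) + μ                                     ≤⟨ +-monoˡ-≤ μ (≤-trans (card-mono split) (card-∨ (external U) U)) ⟩
      card (external U) + card U + μ                                   ≤⟨ +-monoˡ-≤ μ (+-mono-≤ (≤-trans (card-mono cover) (card-∨ (external X₀) _)) (≤-reflexive cardU)) ⟩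
      card (external X₀) + card (λ y → not (X₀ y) ∧ Γ X y) + (card X₀ + card X) + μ
                                                                       ≤⟨ +-monoˡ-≤ μ (+-mono-≤ (+-mono-≤ (≤-trans (proj₂ (proj₁ (proj₂ largest))) (*-monoʳ-≤ d (proj₁ (proj₁ (proj₂ largest)))))
                                                                            (≤-trans k (*-monoʳ-≤ d c'))) (+-mono-≤ (proj₁ (proj₁ (proj₂ largest))) c')) ⟩
      d * μ + d * μ + (μ + μ) + μ                                      ≡⟨ arith d μ ⟩
      (d + d + 3) * μ                                                  ≤⟨ *-monoˡ-≤ μ (+-monoʳ-≤ (d + d) (n≤1+n 3)) ⟩
      (d + d + 4) * μ                                                  <⟨ room ⟩
      n                                                                ∎)
      where
      arith : ∀ d μ → d * μ + d * μ + (μ + μ) + μ ≡ (d + d + 3) * μ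
      arith = solve-∀
      split : ∀ y → Γ U y ∨ U y ≡ true → external U y ∨ U y ≡ true
      split y h with U y in eu
      ... | true = ∨-introʳ {Γ U y ∧ false} refl
      ... | false with ∨-elim {Γ U y} h
      ... | inj₁ g = ∨-introˡ (∧-intro g refl)
  ... | no big = +-cancelʳ-< (μ + (μ + μ) + μ) _ _ (begin-strict
      d * card X + (μ + (μ + μ) + μ)   ≤⟨ +-monoˡ-≤ _ (*-monoʳ-≤ d c) ⟩
      d * (μ + μ) + (μ + (μ + μ) + μ)  ≡⟨ arith d μ ⟩
      (d + d + 4) * μ                  <⟨ room ⟩
      n                                <⟨ large-avail X₀ X (<⇒≤ (≰⇒> big)) ⟩
      avail X₀ X + card X₀ + card X + μ ≤⟨ +-monoˡ-≤ μ (+-mono-≤ (+-monoʳ-≤ (avail X₀ X) (proj₁ (proj₁ (proj₂ largest)))) c) ⟩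
      avail X₀ X + μ + (μ + μ) + μ     ≡⟨ arith' (avail X₀ X) μ ⟩
      avail X₀ X + (μ + (μ + μ) + μ)   ∎)
      where
      open ≤-Reasoning
      arith : ∀ d μ → d * (μ + μ) + (μ + (μ + μ) + μ) ≡ (d + d + 4) * μ
      arith = solve-∀
      arith' : ∀ a μ → a + μ + (μ + μ) + μ ≡ a + (μ + (μ + μ) + μ)
      arith' = solve-∀

  initial : (d + d + 4) * μ < n → Σ State λ st → ∃[ ρ ] W st ρ ≡ true × B st ρ ≡ d × card (W st) ≤ μ + 1
  initial room = st , ρ , ∨-introʳ {X₀ ρ} (==-refl ρ) , cong (λ b → if b then 0 else d) ρ∉ ,
      ≤-trans (card-⊕ X₀ ρ) (+-monoˡ-≤ 1 X₀≤μ)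
    where
    open ≤-Reasoning
    X₀≤μ : card X₀ ≤ μ
    X₀≤μ = proj₁ (proj₁ (proj₂ largest))
    outside : 0 < card (not ∘ X₀)
    outside = +-cancelˡ-< (card X₀) _ _ (begin-strict
      card X₀ + 0            ≡⟨ +-identityʳ _ ⟩
      card X₀                ≤⟨ X₀≤μ ⟩
      μ                      ≤⟨ m≤m*n μ (d + d + 4) {{subst NonZero (+-comm 4 (d + d)) _}} ⟩
      μ * (d + d + 4)        ≡⟨ *-comm μ _ ⟩
      (d + d + 4) * μ        <⟨ room ⟩
      n                      ≡⟨ sym (card-not X₀) ⟩
      card X₀ + card (not ∘ X₀) ∎)
    ρ = proj₁ (card>0 (not ∘ X₀) outside)
    ρ∉ : X₀ ρ ≡ false
    ρ∉ = not-false (proj₂ (card>0 (not ∘ X₀) outside))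
    good₀ : Good (X₀ ⊕ ρ) B₀
    good₀ X c with 1 ≤? card Y
      where
      Y : Fin n → Bool
      Y x = X x ∧ not (X₀ x)
    ... | yes Y>0 = begin
        need B₀ X                                       ≤⟨ ∑-mono pt ⟩
        ∑ (λ x → d * ⟦ Y x ⟧)                           ≡⟨ ∑-*ˡ d (⟦_⟧ ∘ Y) ⟩
        d * card Y                                      ≤⟨ ≤-pred (begin
          suc (d * card Y)                                ≤⟨ expands room Y (λ x h → not-false (proj₂ (∧-elim {X x} h))) Y>0
                                                               (≤-trans (card-mono λ x h → proj₁ (∧-elim {X x} h)) c) ⟩
          avail X₀ Y                                      ≤⟨ card-mono f ⟩
          card (λ y → free (X₀ ⊕ ρ) Y y ∨ (y == ρ))       ≤⟨ card-∨ (free (X₀ ⊕ ρ) Y) (_== ρ) ⟩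
          avail (X₀ ⊕ ρ) Y + card (_== ρ)                 ≡⟨ cong (avail (X₀ ⊕ ρ) Y +_) (card-single ρ) ⟩
          avail (X₀ ⊕ ρ) Y + 1                            ≡⟨ +-comm _ 1 ⟩
          suc (avail (X₀ ⊕ ρ) Y)                          ∎) ⟩
        avail (X₀ ⊕ ρ) Y                                ≤⟨ avail-mono (λ y _ → Γ-mono (λ x h → proj₁ (∧-elim {X x} h)) y) ⟩
        avail (X₀ ⊕ ρ) X                                ∎
      where
      Y : Fin n → Bool
      Y x = X x ∧ not (X₀ x)
      f : ∀ y → free X₀ Y y ≡ true → free (X₀ ⊕ ρ) Y y ∨ (y == ρ) ≡ true
      f y h with y ≟ ρ
      ... | yes _ = ∨-introʳ {not (X₀ y ∨ true) ∧ Γ Y y} refl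
      ... | no _ with free-elim {X₀} {Y} h
      ... | a , b rewrite a | b = refl
      pt : ∀ x → ⟦ X x ⟧ * B₀ x ≤ d * ⟦ X x ∧ not (X₀ x) ⟧
      pt x with X x | X₀ x
      ... | false | _ = z≤n
      ... | true | true = z≤n
      ... | true | false = ≤-reflexive (trans (+-identityʳ d) (sym (*-identityʳ d)))
    ... | no Y≤0 = ≤-trans (≤-trans (∑-mono pt) (≤-reflexive (∑-*ˡ d (λ x → ⟦ X x ∧ not (X₀ x) ⟧))))
                     (≤-trans (*-monoʳ-≤ d (≤-pred (≰⇒> Y≤0))) (≤-trans (≤-reflexive (*-zeroʳ d)) z≤n))
      where
      pt : ∀ x → ⟦ X x ⟧ * B₀ x ≤ d * ⟦ X x ∧ not (X₀ x) ⟧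
      pt x with X x | X₀ x
      ... | false | _ = z≤n
      ... | true | true = z≤n
      ... | true | false = ≤-reflexive (trans (+-identityʳ d) (sym (*-identityʳ d)))
    B₀≤d : ∀ x → B₀ x ≤ d
    B₀≤d x with X₀ x
    ... | true = z≤n
    ... | false = ≤-refl
    fresh₀ : ∀ x → (X₀ ⊕ ρ) x ≡ false → B₀ x ≡ d
    fresh₀ x h with X₀ x
    ... | false = refl
    st : State
    st = record { W = X₀ ⊕ ρ ; B = B₀ ; good = good₀ ; B≤d = B₀≤d ; unused = fresh₀ }

  Room : State → ℕ → Set
  Room st s = card (W st) + s + (d + d + 3) * μ < n

  -- `L` lists the vertices taken while building below `v`, and `k` bounds the cost to the budget of
  -- `v`. By `others` the earlier vertices keep their budgets, so separate branches do not
  -- interfere.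
  record Ext (st st' : State) (v : Fin n) (k : ℕ) (L : List (Fin n)) : Set where
    field
      mono : ∀ x → W st x ≡ true → W st' x ≡ true
      fresh : ∀ {x} → x ∈ L → W st x ≡ false
      taken : ∀ {x} → x ∈ L → W st' x ≡ true
      uniq : Unique L
      size : card (W st') ≤ card (W st) + length L
      others : ∀ x → W st x ≡ true → x ≢ v → B st' x ≡ B st x
      atv : B st v ≤ B st' v + k
  open Ext

  ext-refl : ∀ {st v} → Ext st st v 0 []
  ext-refl = record { mono = λ _ h → h ; fresh = λ () ; taken = λ () ; uniq = [] ; size = m≤m+n _ _
                    ; others = λ _ _ _ → refl ; atv = m≤m+n _ _ }

  ext-∘ : ∀ {st st₁ st₂ v k₁ k₂ L₁ L₂} → Ext st st₁ v k₁ L₁ → Ext st₁ st₂ v k₂ L₂ → Ext st st₂ v (k₁ + k₂) (L₁ ++ L₂)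
  ext-∘ {st} {st₁} {st₂} {v} {k₁} {k₂} {L₁} {L₂} e₁ e₂ = record
    { mono = λ x h → mono e₂ x (mono e₁ x h)
    ; fresh = λ m → fr (∈-++⁻ L₁ m)
    ; taken = λ m → tk (∈-++⁻ L₁ m)
    ; uniq = Unique-++ (uniq e₁) (uniq e₂) λ { (a , b) → true≢false (taken e₁ a) (fresh e₂ b) }
    ; size = begin
        card (W st₂)                                ≤⟨ size e₂ ⟩
        card (W st₁) + length L₂                    ≤⟨ +-monoˡ-≤ _ (size e₁) ⟩
        card (W st) + length L₁ + length L₂         ≡⟨ +-assoc (card (W st)) _ _ ⟩
        card (W st) + (length L₁ + length L₂)       ≡⟨ cong (card (W st) +_) (sym (length-++ L₁)) ⟩
        card (W st) + length (L₁ ++ L₂)             ∎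
    ; others = λ x h ne → trans (others e₂ x (mono e₁ x h) ne) (others e₁ x h ne)
    ; atv = begin
        B st v              ≤⟨ atv e₁ ⟩
        B st₁ v + k₁        ≤⟨ +-monoˡ-≤ k₁ (atv e₂) ⟩
        B st₂ v + k₂ + k₁   ≡⟨ +-assoc (B st₂ v) k₂ k₁ ⟩
        B st₂ v + (k₂ + k₁) ≡⟨ cong (B st₂ v +_) (+-comm k₂ k₁) ⟩
        B st₂ v + (k₁ + k₂) ∎ }
    where
    open ≤-Reasoning
    fr : ∀ {x} → x ∈ L₁ ⊎ x ∈ L₂ → W st x ≡ false
    fr (inj₁ a) = fresh e₁ a
    fr (inj₂ b) = ¬true λ h → true≢false (mono e₁ _ h) (fresh e₂ b)
    tk : ∀ {x} → x ∈ L₁ ⊎ x ∈ L₂ → W st₂ x ≡ true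
    tk (inj₁ a) = mono e₂ _ (taken e₁ a)
    tk (inj₂ b) = taken e₂ b

  room-after : ∀ {st st' v k L s t} → Ext st st' v k L → length L + s ≤ t → Room st t → Room st' s
  room-after {st} {st'} {L = L} {s} {t} e h r = ≤-<-trans (+-monoˡ-≤ _ (begin
      card (W st') + s               ≤⟨ +-monoˡ-≤ s (size e) ⟩
      card (W st) + length L + s     ≡⟨ +-assoc (card (W st)) _ s ⟩
      card (W st) + (length L + s)   ≤⟨ +-monoʳ-≤ (card (W st)) h ⟩
      card (W st) + t                ∎)) r
    where open ≤-Reasoning

  newChild : ∀ st v → W st v ≡ true → 1 ≤ B st v → Room st 1 →
             ∃[ r ] Σ State λ st' → adj v r ≡ true × Ext st st' v 1 (r ∷ []) × W st' r ≡ true × B st' r ≡ d × r ≢ v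
  newChild st v Wv Bv room with Step.step (W st) (B st) (good st) (B≤d st) (≤-<-trans (+-monoˡ-≤ _ (m≤m+n (card (W st)) 1)) room) v Bv
  ... | r , w , a , g = r , st' , a , ext , Wr , Br , r≢v
    where
    r≢v : r ≢ v
    r≢v refl = true≢false Wv w
    Wr : W st r ∨ (r == r) ≡ true
    Wr = ∨-introʳ {W st r} (==-refl r)
    Br : B st r ∸ ⟦ r == v ⟧ ≡ d
    Br rewrite ==-false r≢v = unused st r w
    unused' : ∀ x → W st x ∨ (x == r) ≡ false → spend (B st) v x ≡ d
    unused' x h with x ≟ v
    ... | yes refl = ⊥-elim (true≢false (∨-introˡ {W st x} {x == r} Wv) h)
    ... | no _ = unused st x (¬true λ q → true≢false (∨-introˡ {W st x} {x == r} q) h)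
    st' : State
    st' = record { W = W st ⊕ r ; B = spend (B st) v ; good = g
                 ; B≤d = λ x → ≤-trans (m∸n≤m (B st x) ⟦ x == v ⟧) (B≤d st x) ; unused = unused' }
    others' : ∀ x → W st x ≡ true → x ≢ v → B st x ∸ ⟦ x == v ⟧ ≡ B st x
    others' x _ ne rewrite ==-false ne = refl
    atv' : B st v ≤ B st v ∸ ⟦ v == v ⟧ + 1
    atv' rewrite ==-refl v = ≤-reflexive (sym (m∸n+n≡m Bv))
    ext : Ext st st' v 1 (r ∷ [])
    ext = record { mono = λ x h → ∨-introˡ h ; fresh = λ { (here refl) → w } ; taken = λ { (here refl) → Wr }
                 ; uniq = [] ∷ [] ; size = card-⊕ (W st) r ; others = others' ; atv = atv' }

  -- All that is built below `r` is charged to `r`, which lies outside the old state; `v` pays for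
  -- `r` alone.
  ext-child : ∀ {st st₁ st₂ v r k L} → W st v ≡ true → Ext st st₁ v 1 (r ∷ []) → Ext st₁ st₂ r k L → Ext st st₂ v 1 (r ∷ L)
  ext-child {st} {st₁} {st₂} {v} {r} {k} {L} Wv e₁ e₂ = record
    { mono = λ x h → mono e₂ x (mono e₁ x h)
    ; fresh = λ { (here refl) → fresh e₁ (here refl) ; (there m) → ¬true λ h → true≢false (mono e₁ _ h) (fresh e₂ m) }
    ; taken = λ { (here refl) → mono e₂ _ (taken e₁ (here refl)) ; (there m) → taken e₂ m }
    ; uniq = All.tabulate (λ m → λ { refl → true≢false (taken e₁ (here refl)) (fresh e₂ m) }) ∷ uniq e₂
    ; size = ≤-trans (size e₂) (≤-trans (+-monoˡ-≤ _ (size e₁)) (≤-reflexive (+-assoc (card (W st)) 1 _)))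
    ; others = λ x h ne → trans (others e₂ x (mono e₁ x h) (ne' x h)) (others e₁ x h ne)
    ; atv = ≤-trans (atv e₁) (+-monoˡ-≤ 1 (≤-reflexive (sym (others e₂ v (mono e₁ v Wv) (ne' v Wv))))) }
    where
    ne' : ∀ x → W st x ≡ true → x ≢ r
    ne' x h refl = true≢false h (fresh e₁ (here refl))

  ⌈s/2⌉<2^j : ∀ s j → suc s < 2 ^ suc j → ⌈ s /2⌉ < 2 ^ j
  ⌈s/2⌉<2^j s j h = ≰⇒> λ k → <-irrefl refl (begin-strict
      suc s                        <⟨ h ⟩
      2 ^ j + (2 ^ j + 0)          ≡⟨ cong (2 ^ j +_) (+-identityʳ (2 ^ j)) ⟩
      2 ^ j + 2 ^ j                ≤⟨ +-mono-≤ k (≤-trans k (⌊n/2⌋≤⌈n/2⌉ (suc s))) ⟩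
      ⌊ suc s /2⌋ + ⌈ suc s /2⌉    ≡⟨ ⌊n/2⌋+⌈n/2⌉≡n (suc s) ⟩
      suc s                        ∎)
    where open ≤-Reasoning

  -- Binomial-tree-like: each half is at most as heavy as the weight already collected.
  gadget : ∀ j s → s < 2 ^ j → j ≤ d → ∀ st v → W st v ≡ true → j ≤ B st v → Room st s →
           ∃[ L ] Σ State λ st' → Eats adj v L × length L ≡ s × Ext st st' v j L
  gadget zero zero _ _ st v _ _ _ = [] , st , eats-none , refl , ext-refl
  gadget zero (suc s) (s≤s ())
  gadget (suc j) zero _ _ st v _ _ _ = [] , st , eats-none , refl ,
    record { mono = λ _ h → h ; fresh = λ () ; taken = λ () ; uniq = [] ; size = m≤m+n _ _
           ; others = λ _ _ _ → refl ; atv = m≤m+n _ _ }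
  gadget (suc j) (suc s) lt jd st v Wv Bv room
    with gadget j ⌈ s /2⌉ (⌈s/2⌉<2^j s j lt) (≤-trans (n≤1+n j) jd) st v Wv (≤-trans (n≤1+n j) Bv)
           (≤-<-trans (+-monoˡ-≤ _ (+-monoʳ-≤ (card (W st)) (≤-trans (⌈n/2⌉≤n s) (n≤1+n s)))) room)
  ... | L₁ , st₁ , eats₁ , len₁ , e₁
    with newChild st₁ v (mono e₁ v Wv)
           (+-cancelʳ-≤ j 1 (B st₁ v) (≤-trans Bv (atv e₁)))
           (room-after e₁ (≤-trans (≤-reflexive (trans (cong (_+ 1) len₁) (+-comm _ 1))) (s≤s (⌈n/2⌉≤n s))) room)
  ... | r , st₂ , a , e₂ , Wr , Br , r≢v
    with gadget j ⌊ s /2⌋ (≤-<-trans (⌊n/2⌋≤⌈n/2⌉ s) (⌈s/2⌉<2^j s j lt)) (≤-trans (n≤1+n j) jd) st₂ r Wr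
           (subst (j ≤_) (sym Br) (≤-trans (n≤1+n j) jd)) (room-after (ext-∘ e₁ e₂) total room)
    where
    total : length (L₁ ++ r ∷ []) + ⌊ s /2⌋ ≤ suc s
    total = ≤-reflexive (trans (cong (_+ ⌊ s /2⌋) (trans (length-++ L₁) (cong (_+ 1) len₁))) (trans (solve3 ⌈ s /2⌉ ⌊ s /2⌋) (cong suc (⌊n/2⌋+⌈n/2⌉≡n s))))
      where
      solve3 : ∀ a b → a + 1 + b ≡ suc (b + a)
      solve3 = solve-∀
  ... | L₂ , st₃ , eats₂ , len₂ , e₃ =
    L₁ ++ r ∷ L₂ , st₃ , absorb eats₁ a eats₂ (≤-trans (≤-reflexive len₂) (≤-trans (⌊n/2⌋≤⌈n/2⌉ s) (≤-reflexive (sym len₁)))) ,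
    trans (length-++ L₁) (trans (cong₂ _+_ len₁ (cong suc len₂)) (trans (+-suc ⌈ s /2⌉ ⌊ s /2⌋) (cong suc (trans (+-comm ⌈ s /2⌉ _) (⌊n/2⌋+⌈n/2⌉≡n s))))) ,
    subst (λ k → Ext st st₃ v k (L₁ ++ r ∷ L₂)) (+-comm j 1) (ext-∘ e₁ (ext-child (mono e₁ v Wv) e₂ e₃))

-- The core tree with its gadgets and spares.

module Cores {n : ℕ} (adj : Fin n → Fin n → Bool)
             (adj-sym : ∀ u v → adj u v ≡ true → adj v u ≡ true) (μ d : ℕ) (μ>0 : 0 < μ)
             (joined : ∀ (A B : Fin n → Bool) → (∀ i → A i ≡ true → B i ≡ false) → μ ≤ card A → μ ≤ card B →
                       ∃[ a ] ∃[ b ] A a ≡ true × B b ≡ true × adj a b ≡ true) where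
  open Embedding adj adj-sym μ d μ>0 joined
  open State
  open Ext

  record CoreTree (t : ℕ) (v : Fin n) (cs : List (Cell n)) : Set where
    field
      root : ∃[ c ] c ∈ cs × center c ≡ v × height c ≡ t
      ok : ∀ {c} → c ∈ cs → CellOK adj c
      parent : ∀ {c} → c ∈ cs → (center c ≡ v × height c ≡ t) ⊎ (∃[ p ] p ∈ cs × height p ≡ suc (height c) × adj (center p) (center c) ≡ true)
      bounded : ∀ {c} → c ∈ cs → height c ≤ t
      many : 2 ^ t ≤ length cs

  -- Number of tree vertices other than the root: a cell of height `t` has `2 t + 5` vertices
  -- besides its center, namely two gadgets of `t + 2` and a spare, and each of the two subtrees
  -- brings its own root.
  coreSize : ℕ → ℕ
  coreSize zero = 5
  coreSize (suc t) = (suc t + suc t + 5) + ((1 + coreSize t) + (1 + coreSize t))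

  coreSize-bound : ∀ t → coreSize t + (t + t + 11) ≡ 16 * 2 ^ t
  coreSize-bound zero = refl
  coreSize-bound (suc t) = trans (arith (coreSize t) t) (trans (cong (2 *_) (coreSize-bound t)) (arith' (2 ^ t)))
    where
    arith : ∀ s t → (suc t + suc t + 5) + ((1 + s) + (1 + s)) + (suc t + suc t + 11) ≡ 2 * (s + (t + t + 11))
    arith = solve-∀
    arith' : ∀ p → 2 * (16 * p) ≡ 16 * (2 * p)
    arith' = solve-∀

  cellAt : ∀ j t → t + 2 < 2 ^ j → j ≤ d → ∀ st v → W st v ≡ true → j + j + 1 ≤ B st v → Room st (t + t + 5) →
           ∃[ c ] ∃[ L ] Σ State λ st' → CellOK adj c × center c ≡ v × height c ≡ t × flat c ≡ v ∷ L ×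
             length L ≡ t + t + 5 × Ext st st' v (j + j + 1) L
  cellAt j t lt jd st v Wv Bv room
    with gadget j (t + 2) lt jd st v Wv (≤-trans (≤-trans (m≤m+n j j) (m≤m+n _ 1)) Bv)
           (≤-<-trans (+-monoˡ-≤ _ (+-monoʳ-≤ (card (W st)) (≤-trans (m≤m+n (t + 2) (t + 3)) (≤-reflexive (arith t))))) room)
    where
    arith : ∀ t → t + 2 + (t + 3) ≡ t + t + 5
    arith = solve-∀
  ... | L₁ , st₁ , eats₁ , len₁ , e₁
    with gadget j (t + 2) lt jd st₁ v (mono e₁ v Wv) (≤-trans (m≤m+n j 1) (+-cancelʳ-≤ j _ _ (≤-trans (≤-trans (≤-reflexive (arith₁ j)) Bv) (atv e₁))))
           (room-after e₁ (≤-trans (≤-reflexive (cong (_+ (t + 2)) len₁)) (≤-trans (m≤m+n _ 1) (≤-reflexive (arith₂ t)))) room)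
    where
    arith₁ : ∀ j → j + 1 + j ≡ j + j + 1
    arith₁ = solve-∀
    arith₂ : ∀ t → t + 2 + (t + 2) + 1 ≡ t + t + 5
    arith₂ = solve-∀
  ... | L₂ , st₂ , eats₂ , len₂ , e₂
    with newChild st₂ v (mono e₂ v (mono e₁ v Wv))
           (+-cancelʳ-≤ (j + j) _ _ (≤-trans (≤-trans (≤-reflexive (+-comm 1 (j + j))) Bv) (atv (ext-∘ e₁ e₂))))
           (room-after (ext-∘ e₁ e₂) (≤-reflexive (trans (cong (_+ 1) (trans (length-++ L₁) (cong₂ _+_ len₁ len₂))) (arith₂ t))) room)
    where
    arith₂ : ∀ t → t + 2 + (t + 2) + 1 ≡ t + t + 5
    arith₂ = solve-∀
  ... | s , st₃ , a , e₃ , _ =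
    record { center = v ; spare = s ; height = t ; G = g } , L₁ ++ L₂ ++ s ∷ [] , st₃ ,
    record { eats = λ { false → eats₁ ; true → eats₂ } ; lengths = λ { false → len₁ ; true → len₂ } ; spareAdj = a } ,
    refl , refl , refl ,
    trans (length-++ L₁) (trans (cong₂ _+_ len₁ (trans (length-++ L₂) (cong (_+ 1) len₂))) (arith t)) ,
    subst₂ (Ext st st₃ v) (sym (+-assoc j j 1)) refl (ext-∘ e₁ (ext-∘ e₂ e₃))
    where
    g : Bool → List (Fin n)
    g false = L₁
    g true = L₂
    arith : ∀ t → t + 2 + (t + 2 + 1) ≡ t + t + 5
    arith = solve-∀

  flats-++ : ∀ (cs ds : List (Cell n)) → flats (cs ++ ds) ≡ flats cs ++ flats ds
  flats-++ [] ds = refl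
  flats-++ (c ∷ cs) ds = trans (cong (flat c ++_) (flats-++ cs ds)) (sym (++-assoc (flat c) (flats cs) (flats ds)))

  CoreBelow : ℕ → ℕ → State → Fin n → Set
  CoreBelow t k st v = ∃[ cs ] ∃[ L ] Σ State λ st' →
    CoreTree t v cs × flats cs ≡ v ∷ L × length L ≡ coreSize t × Ext st st' v k L

  ext-weaken : ∀ {st st' v k k' L} → k ≤ k' → Ext st st' v k L → Ext st st' v k' L
  ext-weaken {st' = st'} {v} h e = record { mono = mono e ; fresh = fresh e ; taken = taken e ; uniq = uniq e ; size = size e
                               ; others = others e ; atv = ≤-trans (atv e) (+-monoʳ-≤ (B st' v) h) }

  attachCore : ∀ t k → (∀ st r → W st r ≡ true → d ≤ B st r → Room st (coreSize t) → CoreBelow t k st r) →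
               ∀ st v → W st v ≡ true → 1 ≤ B st v → Room st (1 + coreSize t) →
               ∃[ r ] ∃[ cs ] ∃[ L ] Σ State λ st' → CoreTree t r cs × flats cs ≡ r ∷ L × length L ≡ coreSize t ×
                 adj v r ≡ true × Ext st st' v 1 (r ∷ L)
  attachCore t k build st v Wv Bv room
    with newChild st v Wv Bv (≤-<-trans (+-monoˡ-≤ _ (+-monoʳ-≤ (card (W st)) (m≤m+n 1 _))) room)
  ... | r , st₁ , a , e₁ , Wr , Br , _ with build st₁ r Wr (≤-reflexive (sym Br)) (room-after e₁ ≤-refl room)
  ... | cs , L , st₂ , tr , fl , len , e₂ = r , cs , L , st₂ , tr , fl , len , a , ext-child Wv e₁ e₂

  joinTrees : ∀ {t v v₁ v₂ c cs₁ cs₂} → CellOK adj c → center c ≡ v → height c ≡ suc t →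
              adj v v₁ ≡ true → CoreTree t v₁ cs₁ → adj v v₂ ≡ true → CoreTree t v₂ cs₂ → CoreTree (suc t) v (c ∷ cs₁ ++ cs₂)
  joinTrees {t} {v} {v₁} {v₂} {c} {cs₁} {cs₂} okc refl ht a₁ tr₁ a₂ tr₂ =
    record { root = c , here refl , refl , ht ; ok = ok' ; parent = par ; bounded = bnd
           ; many = ≤-trans (+-mono-≤ (many tr₁) (≤-trans (≤-reflexive (+-identityʳ (2 ^ t))) (many tr₂)))
                      (≤-trans (≤-reflexive (sym (length-++ cs₁))) (n≤1+n _)) }
    where
    open CoreTree
    ok' : ∀ {x} → x ∈ c ∷ cs₁ ++ cs₂ → CellOK adj x
    ok' (here refl) = okc
    ok' (there m) with ∈-++⁻ cs₁ m
    ... | inj₁ m' = ok tr₁ m'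
    ... | inj₂ m' = ok tr₂ m'
    bnd : ∀ {x} → x ∈ c ∷ cs₁ ++ cs₂ → height x ≤ suc t
    bnd (here refl) = ≤-reflexive ht
    bnd (there m) with ∈-++⁻ cs₁ m
    ... | inj₁ m' = m≤n⇒m≤1+n (bounded tr₁ m')
    ... | inj₂ m' = m≤n⇒m≤1+n (bounded tr₂ m')
    par : ∀ {x} → x ∈ c ∷ cs₁ ++ cs₂ → (center x ≡ v × height x ≡ suc t) ⊎
          (∃[ p ] p ∈ c ∷ cs₁ ++ cs₂ × height p ≡ suc (height x) × adj (center p) (center x) ≡ true)
    par (here refl) = inj₁ (refl , ht)
    par (there m) with ∈-++⁻ cs₁ m
    par (there m) | inj₁ m' with parent tr₁ m'
    ... | inj₁ (refl , h) = inj₂ (c , here refl , trans ht (cong suc (sym h)) , a₁)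
    ... | inj₂ (p , q , h , a) = inj₂ (p , there (∈-++⁺ˡ q) , h , a)
    par (there m) | inj₂ m' with parent tr₂ m'
    ... | inj₁ (refl , h) = inj₂ (c , here refl , trans ht (cong suc (sym h)) , a₂)
    ... | inj₂ (p , q , h , a) = inj₂ (p , there (∈-++⁺ʳ cs₁ q) , h , a)

  Attached : ℕ → State → Fin n → Set
  Attached t st v = ∃[ r ] ∃[ cs ] ∃[ L ] Σ State λ st' → CoreTree t r cs × flats cs ≡ r ∷ L × length L ≡ coreSize t ×
                 adj v r ≡ true × Ext st st' v 1 (r ∷ L)

  NewCell : ℕ → ℕ → State → Fin n → Set
  NewCell j t st v = ∃[ c ] ∃[ L ] Σ State λ st' → CellOK adj c × center c ≡ v × height c ≡ t × flat c ≡ v ∷ L ×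
             length L ≡ t + t + 5 × Ext st st' v (j + j + 1) L

  single : ∀ {j st v} → NewCell j 0 st v → CoreBelow 0 (j + j + 3) st v
  single {j} (c , L , st' , ok , refl , ht , fl , len , e) = c ∷ [] , L , st' ,
    record { root = c , here refl , refl , ht ; ok = λ { (here refl) → ok } ; parent = λ { (here refl) → inj₁ (refl , ht) }
           ; bounded = λ { (here refl) → ≤-reflexive ht } ; many = s≤s z≤n } ,
    trans (++-identityʳ (flat c)) fl , len , ext-weaken (+-monoʳ-≤ (j + j) (s≤s z≤n)) e

  twoChildren : ∀ j t st v → W st v ≡ true → j + j + 3 ≤ B st v → Room st (coreSize (suc t)) →
    (∀ st v → W st v ≡ true → 1 ≤ B st v → Room st (1 + coreSize t) → Attached t st v) →
    NewCell j (suc t) st v → CoreBelow (suc t) (j + j + 3) st v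
  twoChildren j t st v Wv Bv room attach (c , L₀ , st₀ , okc , cv , ht , fl₀ , len₀ , e₀) = first
      (attach st₀ v (mono e₀ v Wv) (+-cancelʳ-≤ (j + j + 1) 1 _ (≤-trans (≤-trans (≤-trans (≤-reflexive (+-comm 1 (j + j + 1)))
        (≤-trans (≤-reflexive (+-assoc (j + j) 1 1)) (+-monoʳ-≤ (j + j) (s≤s (s≤s z≤n))))) Bv) (atv e₀)))
        (room-after e₀ (≤-trans (≤-reflexive (cong (_+ (1 + coreSize t)) len₀)) (+-monoʳ-≤ (suc t + suc t + 5) (m≤m+n _ _))) room))
    where
    arith₀ : ∀ j → 1 + (j + j + 1 + 1) ≡ j + j + 3
    arith₀ = solve-∀
    second : ∀ {v₁ cs₁ L₁ st₁} → CoreTree t v₁ cs₁ → flats cs₁ ≡ v₁ ∷ L₁ → length L₁ ≡ coreSize t →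
             adj v v₁ ≡ true → Ext st₀ st₁ v 1 (v₁ ∷ L₁) → Attached t st₁ v → CoreBelow (suc t) (j + j + 3) st v
    second {v₁} {cs₁} {L₁} tr₁ fl₁ len₁ a₁ e₁ (v₂ , cs₂ , L₂ , st₂ , tr₂ , fl₂ , len₂ , a₂ , e₂) =
      c ∷ cs₁ ++ cs₂ , (L₀ ++ v₁ ∷ L₁) ++ v₂ ∷ L₂ , st₂ , joinTrees okc cv ht a₁ tr₁ a₂ tr₂ ,
      trans (cong (flat c ++_) (trans (flats-++ cs₁ cs₂) (cong₂ _++_ fl₁ fl₂)))
        (trans (cong (_++ (v₁ ∷ L₁) ++ v₂ ∷ L₂) fl₀) (cong (v ∷_) (sym (++-assoc L₀ (v₁ ∷ L₁) (v₂ ∷ L₂))))) ,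
      trans (length-++ (L₀ ++ v₁ ∷ L₁)) (trans (cong₂ _+_ (trans (length-++ L₀) (cong₂ _+_ len₀ (cong suc len₁))) (cong suc len₂))
        (+-assoc (suc t + suc t + 5) _ _)) ,
      ext-weaken (≤-reflexive (trans (+-comm (j + j + 1 + 1) 1) (arith₀ j))) (ext-∘ (ext-∘ e₀ e₁) e₂)
    first : Attached t st₀ v → CoreBelow (suc t) (j + j + 3) st v
    first (v₁ , cs₁ , L₁ , st₁ , tr₁ , fl₁ , len₁ , a₁ , e₁) = second tr₁ fl₁ len₁ a₁ e₁
      (attach st₁ v (mono e₁ v (mono e₀ v Wv))
         (+-cancelʳ-≤ (j + j + 1 + 1) 1 _ (≤-trans (≤-trans (≤-reflexive (arith₀ j)) Bv) (atv (ext-∘ e₀ e₁))))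
         (room-after (ext-∘ e₀ e₁) (≤-reflexive (trans (cong (_+ (1 + coreSize t)) (trans (length-++ L₀) (cong₂ _+_ len₀ (cong suc len₁))))
           (+-assoc (suc t + suc t + 5) (1 + coreSize t) (1 + coreSize t)))) room))

  -- A center pays at most `j` children for each gadget, one for the spare and two for the core
  -- tree, hence `j + j + 3`.
  core : ∀ j t → t + 2 < 2 ^ j → j + j + 3 ≤ d → ∀ st v → W st v ≡ true → d ≤ B st v → Room st (coreSize t) →
         CoreBelow t (j + j + 3) st v
  core j zero lt jd st v Wv Bv room = single {j}
    (cellAt j zero lt (≤-trans (≤-trans (m≤m+n j j) (m≤m+n _ 3)) jd) st v Wv
           (≤-trans (≤-trans (+-monoʳ-≤ (j + j) (s≤s z≤n)) jd) Bv) room)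
  core j (suc t) lt jd st v Wv Bv room = twoChildren j t st v Wv (≤-trans jd Bv) room
    (attachCore t (j + j + 3) (core j t (<-trans (n<1+n _) lt) jd))
    (cellAt j (suc t) lt (≤-trans (≤-trans (m≤m+n j j) (m≤m+n _ 3)) jd) st v Wv
           (≤-trans (≤-trans (+-monoʳ-≤ (j + j) (s≤s z≤n)) jd) Bv)
           (≤-<-trans (+-monoˡ-≤ _ (+-monoʳ-≤ (card (W st)) (m≤m+n _ _))) room))

  -- The factor `d + d + 20` adds up one for the abandoned set, 16 for the tree and `d + d + 3` for
  -- the embedding step. There are at least `2 ^ h = μ` centers and as many spares, so `joined`
  -- leaves fewer than `μ` vertices without a center and fewer than `μ` without a spare among their
  -- neighbours; with the tree this makes `18 * μ`.
  structure : ∀ h j → μ ≡ 2 ^ h → h + 2 < 2 ^ j → j + j + 3 ≤ d → (d + d + 20) * μ < n → Structure adj h μ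
  structure h j μ≡ lt jd room = assemble (initial (≤-<-trans (*-monoˡ-≤ μ (+-monoʳ-≤ (d + d) (s≤s (s≤s (s≤s (s≤s z≤n)))))) room))
    where
    size≤ : 1 + coreSize h ≤ 16 * μ
    size≤ = ≤-trans (≤-trans (≤-reflexive (+-comm 1 (coreSize h))) (+-monoʳ-≤ (coreSize h) (≤-trans (s≤s z≤n) (m≤n+m 11 (h + h)))))
              (≤-reflexive (trans (coreSize-bound h) (cong (16 *_) (sym μ≡))))
    room₀ : ∀ w → w ≤ μ + 1 → w + coreSize h + (d + d + 3) * μ < n
    room₀ w w≤ = ≤-<-trans (begin
        w + coreSize h + (d + d + 3) * μ           ≤⟨ +-monoˡ-≤ _ (+-monoˡ-≤ (coreSize h) w≤) ⟩
        μ + 1 + coreSize h + (d + d + 3) * μ       ≡⟨ cong (_+ (d + d + 3) * μ) (+-assoc μ 1 (coreSize h)) ⟩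
        μ + (1 + coreSize h) + (d + d + 3) * μ     ≤⟨ +-monoˡ-≤ _ (+-monoʳ-≤ μ size≤) ⟩
        μ + 16 * μ + (d + d + 3) * μ               ≡⟨ arith μ d ⟩
        (d + d + 20) * μ                           ∎) room
      where
      open ≤-Reasoning
      arith : ∀ μ d → μ + 16 * μ + (d + d + 3) * μ ≡ (d + d + 20) * μ
      arith = solve-∀
    finish : ∀ {ρ st} → W st ρ ≡ true → CoreBelow h (j + j + 3) st ρ → Structure adj h μ
    finish {ρ} {st} Wρ (cs , L , st' , tr , fl , len , e) = record
      { cells = cs ; distinct = un ; top = proj₁ (root tr) ; top∈ = proj₁ (proj₂ (root tr))
      ; ok = ok tr ; parent = par ; bounded = bounded tr ; base = base ; base∉ = λ {v} b m → true≢false (∈⇒mem m) (not-false (proj₁ (∧-elim {not (mem v (flats cs))} b)))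
      ; base-parent = λ {v} b → via center (proj₁ (∧-elim {Γ (at center) v} (proj₂ (∧-elim {not (mem v (flats cs))} b))))
      ; base-spare = λ {v} b → via spare (proj₂ (∧-elim {Γ (at center) v} (proj₂ (∧-elim {not (mem v (flats cs))} b))))
      ; base-large = large }
      where
      open CoreTree
      un : Unique (flats cs)
      un = subst Unique (sym fl) (All.tabulate (λ m → λ { refl → true≢false Wρ (fresh e m) }) ∷ uniq e)
      par : ∀ {c} → c ∈ cs → center c ≡ center (proj₁ (root tr)) ⊎
            (∃[ p ] p ∈ cs × height p ≡ suc (height c) × adj (center p) (center c) ≡ true)
      par m with parent tr m
      ... | inj₁ (q , _) = inj₁ (trans q (sym (proj₁ (proj₂ (proj₂ (root tr))))))
      ... | inj₂ q = inj₂ q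
      at : (Cell n → Fin n) → Fin n → Bool
      at f x = mem x (map f cs)
      base : Fin n → Bool
      base v = not (mem v (flats cs)) ∧ (Γ (at center) v ∧ Γ (at spare) v)
      via : ∀ f {v} → Γ (at f) v ≡ true → ∃[ c ] c ∈ cs × adj (f c) v ≡ true
      via f g with Γ-elim g
      ... | x , m , a with map-preimage f cs (mem⇒∈ (map f cs) m)
      ... | c , k , refl = c , k , a
      missed : (Cell n → Fin n) → Fin n → Bool
      missed f v = not (mem v (flats cs)) ∧ not (Γ (at f) v)
      missed<μ : ∀ f → (∀ c → f c ∈ flat c) → card (missed f) ≤ μ
      missed<μ f in-flat = <⇒≤ (≰⇒> λ big → contra (joined (at f) (missed f) disjoint many' big))
        where
        many' : μ ≤ card (at f)
        many' = ≤-trans (≤-reflexive μ≡) (≤-trans (many tr) (≤-trans (≤-reflexive (sym (length-map f cs))) (card-mem≥ (map-unique f in-flat {cs} un))))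
        disjoint : ∀ i → at f i ≡ true → missed f i ≡ false
        disjoint i m with map-preimage f cs (mem⇒∈ (map f cs) m)
        ... | c , k , refl rewrite ∈⇒mem (∈-flats k (in-flat c)) = refl
        contra : ∃[ a ] ∃[ b ] at f a ≡ true × missed f b ≡ true × adj a b ≡ true → ⊥
        contra (a , b , p , q , r) = true≢false (Γ-intro a p r) (not-false (proj₂ (∧-elim {not (mem b (flats cs))} q)))
      outside : ∀ v → not (base v) ≡ true → mem v (flats cs) ∨ (missed center v ∨ missed spare v) ≡ true
      outside v h with mem v (flats cs) | Γ (at center) v | Γ (at spare) v
      ... | true | _ | _ = refl
      ... | false | true | true = h
      ... | false | true | false = refl
      ... | false | false | _ = refl
      large : n ≤ card base + 18 * μ
      large = begin
        n                                                     ≡⟨ sym (card-not base) ⟩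
        card base + card (not ∘ base)                         ≤⟨ +-monoʳ-≤ (card base) (begin
          card (not ∘ base)                                     ≤⟨ card-mono outside ⟩
          card (λ v → mem v (flats cs) ∨ (missed center v ∨ missed spare v)) ≤⟨ card-∨ (λ v → mem v (flats cs)) _ ⟩
          card (λ v → mem v (flats cs)) + card (λ v → missed center v ∨ missed spare v)
                                                                ≤⟨ +-mono-≤ (≤-trans (card-mem≤ (flats cs)) flats≤) (≤-trans (card-∨ (missed center) _) (+-mono-≤ (missed<μ center center∈flat) (missed<μ spare spare∈flat))) ⟩
          16 * μ + (μ + μ)                                      ≡⟨ arith μ ⟩
          18 * μ                                                ∎) ⟩
        card base + 18 * μ                                    ∎
        where
        open ≤-Reasoning
        arith : ∀ μ → 16 * μ + (μ + μ) ≡ 18 * μ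
        arith = solve-∀
        flats≤ : length (flats cs) ≤ 16 * μ
        flats≤ = ≤-trans (≤-reflexive (trans (cong length fl) (cong suc len))) size≤
    assemble : Σ State (λ st → ∃[ ρ ] W st ρ ≡ true × B st ρ ≡ d × card (W st) ≤ μ + 1) → Structure adj h μ
    assemble (st , ρ , Wρ , Bρ , w≤) = finish Wρ (core j h lt jd st ρ Wρ (≤-reflexive (sym Bρ)) (room₀ (card (W st)) w≤))

-- Acquisition protocols

module Acquisition {n : ℕ} (E : EdgeList n) (loopless : ∀ u → ¬ Adj E u u) where

  -- Weightings are functions and extensionality is not assumed, so a protocol is asked for from
  -- every pointwise copy of `f`, and it reaches `g` pointwise.
  Can : (Fin n → ℕ) → (Fin n → ℕ) → Set
  Can f g = ∀ w → w ≗ f → ∃[ w' ] Star (UMove E) w w' × w' ≗ g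

  can-refl : ∀ {f g} → f ≗ g → Can f g
  can-refl e w h = w , ε , λ x → trans (h x) (e x)

  can-∘ : ∀ {f g h} → Can f g → Can g h → Can f h
  can-∘ p q w e with p w e
  ... | w₁ , s₁ , e₁ with q w₁ e₁
  ... | w₂ , s₂ , e₂ = w₂ , s₁ ◅◅ s₂ , e₂

  utransfer-cong : ∀ {f g : Fin n → ℕ} u v t → f ≗ g → utransfer f u v t ≗ utransfer g u v t
  utransfer-cong u v t e x with x ≟ u
  ... | yes _ = cong (_∸ t) (e x)
  ... | no _ with x ≟ v
  ... | yes _ = cong (_+ t) (e x)
  ... | no _ = e x

  at-source : ∀ (f : Fin n → ℕ) u v t → utransfer f u v t u ≡ f u ∸ t
  at-source f u v t with u ≟ u
  ... | yes _ = refl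
  ... | no h = ⊥-elim (h refl)

  at-target : ∀ (f : Fin n → ℕ) u v t → v ≢ u → utransfer f u v t v ≡ f v + t
  at-target f u v t ne with v ≟ u
  ... | yes e = ⊥-elim (ne e)
  ... | no _ with v ≟ v
  ... | yes _ = refl
  ... | no h = ⊥-elim (h refl)

  elsewhere : ∀ (f : Fin n → ℕ) u v t {x} → x ≢ u → x ≢ v → utransfer f u v t x ≡ f x
  elsewhere f u v t {x} h k with x ≟ u
  ... | yes e = ⊥-elim (h e)
  ... | no _ with x ≟ v
  ... | yes e = ⊥-elim (k e)
  ... | no _ = refl

  adj≢ : ∀ {u v} → Adj E u v → v ≢ u
  adj≢ a refl = loopless _ a

  can-move : ∀ {f} u v → Adj E u v → 1 ≤ f u → f u ≤ f v → Can f (utransfer f u v 1)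
  can-move {f} u v a p q w e = _ , umove u v a (subst (1 ≤_) (sym (e u)) p) (subst₂ _≤_ (sym (e u)) (sym (e v)) q) ◅ ε ,
    utransfer-cong u v 1 e

  -- Each unit makes the source lighter and the target heavier, so the condition on weights survives
  -- until all `t` units have moved.
  can-transfer : ∀ {f} u v → Adj E u v → f u ≤ f v → ∀ t → t ≤ f u → Can f (utransfer f u v t)
  can-transfer {f} u v a q zero _ = can-refl same
    where
    same : f ≗ utransfer f u v 0
    same x with x ≟ u
    ... | yes _ = refl
    ... | no _ with x ≟ v
    ... | yes _ = sym (+-identityʳ _)
    ... | no _ = refl
  can-transfer {f} u v a q (suc t) h = can-∘ (can-transfer u v a q t (<⇒≤ h))
      (can-∘ (can-move u v a (subst (1 ≤_) (sym (at-source f u v t)) (m<n⇒0<n∸m h))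
               (subst₂ _≤_ (sym (at-source f u v t)) (sym (at-target f u v t (adj≢ a))) (≤-trans (m∸n≤m (f u) t) (≤-trans q (m≤m+n _ t)))))
             (can-refl twice))
    where
    twice : utransfer (utransfer f u v t) u v 1 ≗ utransfer f u v (suc t)
    twice x with x ≟ u
    ... | yes refl with u ≟ u
    ... | yes _ = trans (∸-+-assoc (f u) t 1) (cong (f u ∸_) (+-comm t 1))
    ... | no h = ⊥-elim (h refl)
    twice x | no ne with x ≟ v
    ... | no k = refl
    ... | yes refl = (trans (+-assoc (f x) t 1) (cong (f x +_) (+-comm t 1)))

  collected : (Fin n → ℕ) → Fin n → List (Fin n) → Fin n → ℕ
  collected f c L x = if x == c then suc (length L) else (if mem x L then 0 else f x)

  at-center : ∀ f c L → collected f c L c ≡ suc (length L)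
  at-center f c L rewrite ==-refl c = refl

  at-eaten : ∀ f c L {x} → x ≢ c → x ∈ L → collected f c L x ≡ 0
  at-eaten f c L ne m rewrite ==-false ne | ∈⇒mem m = refl

  mem-false : ∀ {x : Fin n} {L} → x ∉ L → mem x L ≡ false
  mem-false {L = L} h = ¬true λ q → h (mem⇒∈ L q)

  at-other : ∀ f c L {x} → x ≢ c → x ∉ L → collected f c L x ≡ f x
  at-other f c L ne m rewrite ==-false ne | mem-false m = refl

  -- When `r` hands over, it weighs `suc (length L₂)` and `c` weighs `suc (length L₁)`, so the
  -- length condition of `absorb` is exactly the legality of the transfer.
  collect : ∀ {adj} → (∀ {u v} → adj u v ≡ true → Adj E u v) → ∀ {c L} → Eats adj c L → Unique (c ∷ L) →
            ∀ {f} → f c ≡ 1 → (∀ {x} → x ∈ L → f x ≡ 1) → Can f (collected f c L)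
  collect real {c} eats-none u {f} fc _ = can-refl same
    where
    same : f ≗ collected f c []
    same x with x ≟ c
    ... | yes refl = fc
    ... | no _ = refl
  collect {adj} real {c} (absorb {r = r} {L₁} {L₂} e₁ a e₂ le) (c∉ ∷ u) {f} fc fL =
      can-∘ (collect real e₁ (All.tabulate (λ m → All.lookup c∉ (∈-++⁺ˡ m)) ∷ unique-++ˡ L₁ u) fc (λ m → fL (∈-++⁺ˡ m)))
        (can-∘ (collect real e₂ u₂ f₁r f₁L) (can-∘ (can-transfer r c (flip (real a)) weights (suc (length L₂)) (≤-reflexive (sym f₂r))) (can-refl result)))
    where
    flip : ∀ {u v} → Adj E u v → Adj E v u
    flip (inj₁ p) = inj₂ p
    flip (inj₂ p) = inj₁ p
    u₂ : Unique (r ∷ L₂)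
    u₂ = unique-++ʳ L₁ u
    r≢c : r ≢ c
    r≢c e = All.lookup c∉ (∈-++⁺ʳ L₁ (here refl)) (sym e)
    L₂≢c : ∀ {x} → x ∈ L₂ → x ≢ c
    L₂≢c m e = All.lookup c∉ (∈-++⁺ʳ L₁ (there m)) (sym e)
    f₁ = collected f c L₁
    f₁r : f₁ r ≡ 1
    f₁r = trans (at-other f c L₁ r≢c (λ m → unique-disjoint L₁ u m (here refl))) (fL (∈-++⁺ʳ L₁ (here refl)))
    f₁L : ∀ {x} → x ∈ L₂ → f₁ x ≡ 1
    f₁L m = trans (at-other f c L₁ (L₂≢c m) (λ k → unique-disjoint L₁ u k (there m))) (fL (∈-++⁺ʳ L₁ (there m)))
    f₂ = collected f₁ r L₂
    f₂r : f₂ r ≡ suc (length L₂)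
    f₂r = at-center f₁ r L₂
    f₂c : f₂ c ≡ suc (length L₁)
    f₂c = trans (at-other f₁ r L₂ (r≢c ∘ sym) (λ m → L₂≢c m refl)) (at-center f c L₁)
    weights : f₂ r ≤ f₂ c
    weights = subst₂ _≤_ (sym f₂r) (sym f₂c) (s≤s le)
    L = L₁ ++ r ∷ L₂
    value : ∀ x → Dec (x ≡ c) → Dec (x ≡ r) → (mem x L₁ ≡ true) ⊎ (mem x L₁ ≡ false) → (mem x L₂ ≡ true) ⊎ (mem x L₂ ≡ false) →
            utransfer f₂ r c (suc (length L₂)) x ≡ collected f c L x
    value x (yes refl) _ _ _ = trans (at-target f₂ r x _ (r≢c ∘ sym)) (trans (cong (_+ suc (length L₂)) f₂c)
      (trans (cong suc (sym (length-++ L₁))) (sym (at-center f x L))))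
    value x (no x≢c) (yes refl) _ _ = trans (at-source f₂ x c (suc (length L₂))) (trans (cong (_∸ suc (length L₂)) f₂r)
      (trans (n∸n≡0 (length L₂)) (sym (at-eaten f c L x≢c (∈-++⁺ʳ L₁ (here refl))))))
    value x (no x≢c) (no x≢r) (inj₁ m) _ = trans (elsewhere f₂ r c _ x≢r x≢c) (trans (at-other f₁ r L₂ x≢r (λ k → unique-disjoint L₁ u (mem⇒∈ L₁ m) (there k)))
      (trans (at-eaten f c L₁ x≢c (mem⇒∈ L₁ m)) (sym (at-eaten f c L x≢c (∈-++⁺ˡ (mem⇒∈ L₁ m))))))
    value x (no x≢c) (no x≢r) (inj₂ _) (inj₁ m) = trans (elsewhere f₂ r c _ x≢r x≢c) (trans (at-eaten f₁ r L₂ x≢r (mem⇒∈ L₂ m))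
      (sym (at-eaten f c L x≢c (∈-++⁺ʳ L₁ (there (mem⇒∈ L₂ m))))))
    value x (no x≢c) (no x≢r) (inj₂ p) (inj₂ q) = trans (elsewhere f₂ r c _ x≢r x≢c) (trans (at-other f₁ r L₂ x≢r (λ k → true≢false (∈⇒mem k) q))
      (trans (at-other f c L₁ x≢c (λ k → true≢false (∈⇒mem k) p)) (sym (at-other f c L x≢c none))))
      where
      none : x ∉ L₁ ++ r ∷ L₂
      none k with ∈-++⁻ L₁ k
      ... | inj₁ k' = true≢false (∈⇒mem k') p
      ... | inj₂ (here e) = x≢r e
      ... | inj₂ (there k') = true≢false (∈⇒mem k') q
    result : utransfer f₂ r c (suc (length L₂)) ≗ collected f c L
    result x = value x (x ≟ c) (x ≟ r) (bool? (mem x L₁)) (bool? (mem x L₂))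

  module CollectAll {adj} (real : ∀ {u v} → adj u v ≡ true → Adj E u v) (g : Fin n → List (Fin n))
                    (eats : ∀ v → Eats adj v (g v)) (uniq : ∀ v → Unique (v ∷ g v))
                    (disjoint : ∀ {x v v'} → x ∈ g v → x ∈ g v' → v ≡ v') (inert : ∀ {x v} → x ∈ g v → g x ≡ []) where

    eatenBy : List (Fin n) → Fin n → Bool
    eatenBy [] x = false
    eatenBy (v ∷ vs) x = mem x (g v) ∨ eatenBy vs x

    eatenBy-elim : ∀ vs {x} → eatenBy vs x ≡ true → ∃[ v ] v ∈ vs × x ∈ g v
    eatenBy-elim (v ∷ vs) {x} h with ∨-elim {mem x (g v)} h
    ... | inj₁ m = v , here refl , mem⇒∈ (g v) m
    ... | inj₂ m with eatenBy-elim vs m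
    ... | v' , k , p = v' , there k , p

    eatenBy-intro : ∀ {vs v x} → v ∈ vs → x ∈ g v → eatenBy vs x ≡ true
    eatenBy-intro (here refl) m = ∨-introˡ (∈⇒mem m)
    eatenBy-intro {v' ∷ vs} {x = x} (there k) m = ∨-introʳ {mem x (g v')} (eatenBy-intro k m)

    weight : List (Fin n) → Fin n → ℕ
    weight vs x = if eatenBy vs x then 0 else (if mem x vs then suc (length (g x)) else 1)

    -- Eaten vertices eat nothing and nobody is eaten twice, so the collections do not disturb each
    -- other, whatever the order of `vs`.
    collectAll : ∀ vs → Unique vs → Can (λ _ → 1) (weight vs)
    collectAll [] _ = can-refl λ _ → refl
    collectAll (v ∷ vs) (v∉ ∷ u) = can-∘ (collectAll vs u) (extend (g v) refl)
      where
      extend : ∀ L → g v ≡ L → Can (weight vs) (weight (v ∷ vs))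
      extend [] eq = can-refl same
        where
        same : weight vs ≗ weight (v ∷ vs)
        same x rewrite cong (mem x) eq with eatenBy vs x | x ≟ v
        ... | true | _ = refl
        ... | false | no _ = refl
        ... | false | yes refl with mem x vs
        ... | true = refl
        ... | false = sym (cong (suc ∘ length) eq)
      extend (y ∷ ys) eq = can-∘ (collect real (eats v) (uniq v) wv wL) (can-refl result)
        where
        notEaten : ∀ vs → eatenBy vs v ≡ false
        notEaten vs = ¬true λ q → contra (eatenBy-elim vs q)
          where
          contra : ∃[ v' ] v' ∈ vs × v ∈ g v' → ⊥
          contra (v' , _ , m) with trans (sym eq) (inert m)
          ... | ()
        v∉vs : mem v vs ≡ false
        v∉vs = mem-false λ m → All.lookup v∉ m refl
        wv : weight vs v ≡ 1
        wv rewrite notEaten vs | v∉vs = refl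
        wL : ∀ {x} → x ∈ g v → weight vs x ≡ 1
        wL {x} m = trans (cong (λ b → if b then 0 else (if mem x vs then suc (length (g x)) else 1))
            (¬true λ q → let v' , k , m' = eatenBy-elim vs q in All.lookup v∉ k (disjoint m m')))
            (one (mem x vs))
          where
          one : ∀ b → (if b then suc (length (g x)) else 1) ≡ 1
          one true = cong (suc ∘ length) (inert m)
          one false = refl
        value : ∀ x → Dec (x ≡ v) → (mem x (g v) ≡ true) ⊎ (mem x (g v) ≡ false) → collected (weight vs) v (g v) x ≡ weight (v ∷ vs) x
        value x (yes refl) _ = trans (at-center (weight vs) x (g x)) (sym (trans
          (cong (λ b → if b then 0 else (if mem x (x ∷ vs) then suc (length (g x)) else 1)) (notEaten (x ∷ vs)))
          (cong (λ b → if b then suc (length (g x)) else 1) (∈⇒mem {L = x ∷ vs} (here refl)))))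
        value x (no ne) (inj₁ m) = trans (at-eaten (weight vs) v (g v) ne (mem⇒∈ (g v) m))
          (sym (cong (λ b → if b ∨ eatenBy vs x then 0 else (if mem x (v ∷ vs) then suc (length (g x)) else 1)) m))
        value x (no ne) (inj₂ m) = trans (at-other (weight vs) v (g v) ne (λ k → true≢false (∈⇒mem k) m))
          (sym (cong₂ (λ b b' → if b ∨ eatenBy vs x then 0 else (if b' ∨ mem x vs then suc (length (g x)) else 1)) m (==-false ne)))
        result : collected (weight vs) v (g v) ≗ weight (v ∷ vs)
        result x = value x (x ≟ v) (bool? (mem x (g v)))

-- From a final weighting to the two acquisition numbers.

count-tabulate : ∀ {A : Set} {P : A → Set} (P? : U.Decidable P) {k} (f : Fin k → A) →
                 length (filter P? (tabulate f)) ≡ ∑ λ i → ⟦ does (P? (f i)) ⟧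
count-tabulate P? {zero} f = refl
count-tabulate P? {suc k} f with does (P? (f zero))
... | true = cong suc (count-tabulate P? (f ∘ suc))
... | false = count-tabulate P? (f ∘ suc)

does-true : ∀ {A : Set} (d : Dec A) → A → does d ≡ true
does-true (yes _) _ = refl
does-true (no h) a = ⊥-elim (h a)

does-false : ∀ {A : Set} (d : Dec A) → ¬ A → does d ≡ false
does-false (yes a) h = ⊥-elim (h a)
does-false (no _) _ = refl

count-one : ∀ {n} {P : Fin n → Set} (P? : U.Decidable P) (ρ : Fin n) → P ρ → (∀ v → v ≢ ρ → ¬ P v) → length (filter P? (allFin n)) ≡ 1
count-one P? ρ p h = trans (count-tabulate P? id) (trans (∑-single ρ _ λ j ne → cong ⟦_⟧ (does-false (P? j) (h j ne))) (cong ⟦_⟧ (does-true (P? ρ) p)))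

count-pos : ∀ {n} {P : Fin n → Set} (P? : U.Decidable P) (x : Fin n) → P x → 1 ≤ length (filter P? (allFin n))
count-pos P? x p = ≤-trans (≤-reflexive (sym (cong ⟦_⟧ (does-true (P? x) p)))) (≤-trans (term≤∑ (λ i → ⟦ does (P? i) ⟧) x)
                     (≤-reflexive (sym (count-tabulate P? id))))

fromℕ : ℕ → ℚ
fromℕ zero = 0ℚ
fromℕ (suc k) = fromℕ k ℚ.+ 1ℚ

0<1ℚ : 0ℚ ℚ.< 1ℚ
0<1ℚ = ℚₚ.positive⁻¹ 1ℚ

fromℕ-suc> : ∀ q → q ℚ.< q ℚ.+ 1ℚ
fromℕ-suc> q = subst (ℚ._< q ℚ.+ 1ℚ) (ℚₚ.+-identityʳ q) (ℚₚ.+-monoʳ-< q 0<1ℚ)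

fromℕ-mono : ∀ {a b} → a ≤ b → fromℕ a ℚ.≤ fromℕ b
fromℕ-mono {zero} {zero} z≤n = ℚₚ.≤-refl
fromℕ-mono {zero} {suc b} z≤n = ℚₚ.≤-trans (fromℕ-mono {zero} {b} z≤n) (ℚₚ.<⇒≤ (fromℕ-suc> (fromℕ b)))
fromℕ-mono (s≤s h) = ℚₚ.+-monoˡ-≤ 1ℚ (fromℕ-mono h)

fromℕ-pos : ∀ {a} → 1 ≤ a → 1ℚ ℚ.≤ fromℕ a
fromℕ-pos {suc a} _ = subst (ℚ._≤ fromℕ a ℚ.+ 1ℚ) (ℚₚ.+-identityˡ 1ℚ) (ℚₚ.+-monoˡ-≤ 1ℚ (fromℕ-mono {zero} {a} z≤n))

fromℕ-pred : ∀ {a} → 1 ≤ a → fromℕ (a ∸ 1) ≡ fromℕ a ℚ.- 1ℚ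
fromℕ-pred {suc a} _ = sym (trans (ℚₚ.+-assoc (fromℕ a) 1ℚ (ℚ.- 1ℚ)) (trans (cong (fromℕ a ℚ.+_) (ℚₚ.+-inverseʳ 1ℚ)) (ℚₚ.+-identityʳ _)))

module Outcome {n : ℕ} (E : EdgeList n) (loopless : ∀ u → ¬ Adj E u u) where
  open Acquisition E loopless

  -- This is the lower bound: the target of a move has positive weight after it, so no protocol
  -- leaves an empty residual set.
  unit-positive : ∀ {w w'} → Star (UMove E) w w' → (∃[ x ] 1 ≤ w x) → ∃[ x ] 1 ≤ w' x
  unit-positive ε h = h
  unit-positive (umove {w} u v a p q ◅ s) _ = unit-positive s (v , subst (1 ≤_) (sym (at-target w u v 1 (adj≢ a))) (m≤n+m 1 (w v)))

  f-target : ∀ (f : Fin n → ℚ) u v t → v ≢ u → ftransfer f u v t v ≡ f v ℚ.+ t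
  f-target f u v t ne with v ≟ u
  ... | yes e = ⊥-elim (ne e)
  ... | no _ with v ≟ v
  ... | yes _ = refl
  ... | no h = ⊥-elim (h refl)

  frac-positive : ∀ {w w'} → Star (FMove E) w w' → (∃[ x ] 0ℚ ℚ.< w x) → ∃[ x ] 0ℚ ℚ.< w' x
  frac-positive ε h = h
  frac-positive (fmove {w} u v t a p q r ◅ s) _ = frac-positive s (v , subst (0ℚ ℚ.<_) (sym (f-target w u v t (adj≢ a)))
    (subst (ℚ._< w v ℚ.+ t) (ℚₚ.+-identityʳ 0ℚ) (ℚₚ.+-mono-< (ℚₚ.<-≤-trans p (ℚₚ.≤-trans q r)) p)))

  frac-of-unit : ∀ {w w'} → Star (UMove E) w w' → ∀ f → f ≗ fromℕ ∘ w → ∃[ f' ] Star (FMove E) f f' × f' ≗ fromℕ ∘ w'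
  frac-of-unit ε f e = f , ε , e
  frac-of-unit (umove {w} u v a p q ◅ s) f e with frac-of-unit s (ftransfer f u v 1ℚ) lifted
    where
    lifted : ftransfer f u v 1ℚ ≗ fromℕ ∘ utransfer w u v 1
    lifted x with x ≟ u
    ... | yes refl = trans (cong (ℚ._- 1ℚ) (e x)) (sym (fromℕ-pred p))
    ... | no _ with x ≟ v
    ... | yes refl = trans (cong (ℚ._+ 1ℚ) (e x)) (cong fromℕ (+-comm 1 (w x)))
    ... | no _ = e x
  ... | f' , s' , e' = f' , fmove u v 1ℚ a 0<1ℚ (subst (1ℚ ℚ.≤_) (sym (e u)) (fromℕ-pos p))
                              (subst₂ ℚ._≤_ (sym (e u)) (sym (e v)) (fromℕ-mono q)) ◅ s' , e'

  module _ {g : Fin n → ℕ} (ρ : Fin n) (can : Can (λ _ → 1) g) (off : ∀ v → v ≢ ρ → g v ≡ 0) (on : 1 ≤ g ρ) where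

    private
      w = proj₁ (can (λ _ → 1) λ _ → refl)
      s = proj₁ (proj₂ (can (λ _ → 1) λ _ → refl))
      w≗g = proj₂ (proj₂ (can (λ _ → 1) λ _ → refl))
      frac = frac-of-unit s (λ _ → 1ℚ) (λ _ → sym (ℚₚ.+-identityˡ 1ℚ))
      f = proj₁ frac
      f≗g : f ≗ fromℕ ∘ g
      f≗g x = trans (proj₂ (proj₂ frac) x) (cong fromℕ (w≗g x))

      only : ∀ v → 1 ≤ w v → v ≡ ρ
      only v p with v ≟ ρ
      ... | yes e = e
      ... | no ne with subst (1 ≤_) (trans (w≗g v) (off v ne)) p
      ... | ()

      f-off : ∀ v → v ≢ ρ → ¬ 0ℚ ℚ.< f v
      f-off v ne p = ℚₚ.<-irrefl refl (subst (0ℚ ℚ.<_) (trans (f≗g v) (cong fromℕ (off v ne))) p)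

      f-only : ∀ v → 0ℚ ℚ.< f v → v ≡ ρ
      f-only v p with v ≟ ρ
      ... | yes e = e
      ... | no ne = ⊥-elim (f-off v ne p)

      -- The protocol is maximal: source and target of a further move would both carry weight, hence
      -- both be `ρ`, and there are no loops.
      ustuck : ∀ {u} → u ≗ w → ∀ w' → ¬ UMove E u w'
      ustuck e _ (umove u v a p q) with only u (subst (1 ≤_) (e u) p) | only v (subst (1 ≤_) (e v) (≤-trans p q))
      ... | refl | refl = loopless ρ a

      fstuck : ∀ {u} → u ≗ f → ∀ w' → ¬ FMove E u w'
      fstuck e _ (fmove u v t a p q r) with f-only u (subst (0ℚ ℚ.<_) (e u) (ℚₚ.<-≤-trans p q))
                                          | f-only v (subst (0ℚ ℚ.<_) (e v) (ℚₚ.<-≤-trans p (ℚₚ.≤-trans q r)))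
      ... | refl | refl = loopless ρ a

    unit-one : UnitAcqNumber E 1
    unit-one = (w , s , ustuck (λ _ → refl) , count-one (λ x → 1 ≤? w x) ρ (subst (1 ≤_) (sym (w≗g ρ)) on)
                  (λ v ne p → ne (only v p))) ,
               λ { j (w' , s' , _ , refl) → let x , p = unit-positive s' (ρ , ≤-refl) in count-pos (λ x → 1 ≤? w' x) x p }

    frac-one : FracAcqNumber E 1
    frac-one = (f , proj₁ (proj₂ frac) , fstuck (λ _ → refl) , count-one (λ x → 0ℚ ℚₚ.<? f x) ρ
                  (subst (0ℚ ℚ.<_) (sym (f≗g ρ)) (ℚₚ.<-≤-trans 0<1ℚ (fromℕ-pos on))) f-off) ,
               λ { j (w' , s' , _ , refl) → let x , p = frac-positive s' (ρ , 0<1ℚ) in count-pos (λ x → 0ℚ ℚₚ.<? w' x) x p }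

-- Draining all weight to a root along parent pointers.

module Flow {n : ℕ} (E : EdgeList n) (loopless : ∀ u → ¬ Adj E u u) (ρ : Fin n) (par : Fin n → Fin n)
            (lev : Fin n → ℕ) (top : ℕ) (lev≤top : ∀ v → lev v ≤ top) (leaf : Fin n → Bool) where
  open Acquisition E loopless

  -- By `inner` a leaf is never the parent of a live vertex. It relays nothing and may be as heavy
  -- as its parent; any other vertex must be strictly lighter, to leave room for a unit in transit.
  record Downhill (f : Fin n → ℕ) (v : Fin n) : Set where
    field
      alive : 1 ≤ f (par v)
      edge : Adj E v (par v)
      lower : lev (par v) < lev v
      inner : leaf (par v) ≡ false
      strict : leaf v ≡ false → f v < f (par v)
      weak : f v ≤ f (par v)
  open Downhill

  Inv : (Fin n → ℕ) → Set
  Inv f = ∀ v → v ≢ ρ → 1 ≤ f v → Downhill f v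

  moved : (Fin n → ℕ) → Fin n → Fin n → Fin n → ℕ
  moved f v u = utransfer f v u 1

  relay : ∀ f {u v p} → u ≢ v → p ≢ v → p ≢ u → utransfer (moved f v u) u p 1 ≗ moved f v p
  relay f {u} {v} {p} u≢v p≢v p≢u x = value (x ≟ u) (x ≟ p) (x ≟ v)
    where
    value : Dec (x ≡ u) → Dec (x ≡ p) → Dec (x ≡ v) → utransfer (moved f v u) u p 1 x ≡ moved f v p x
    value (yes refl) _ _ = trans (at-source (moved f v u) x p 1) (trans (cong (_∸ 1) (at-target f v x 1 u≢v))
      (trans (m+n∸n≡m (f x) 1) (sym (elsewhere f v p 1 u≢v (p≢u ∘ sym)))))
    value (no x≢u) (yes refl) _ = trans (at-target (moved f v u) u x 1 p≢u) (trans (cong (_+ 1) (elsewhere f v u 1 p≢v p≢u))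
      (sym (at-target f v x 1 p≢v)))
    value (no x≢u) (no x≢p) (yes refl) = trans (elsewhere (moved f x u) u p 1 x≢u x≢p) (trans (at-source f x u 1) (sym (at-source f x p 1)))
    value (no x≢u) (no x≢p) (no x≢v) = trans (elsewhere (moved f v u) u p 1 x≢u x≢p) (trans (elsewhere f v u 1 x≢v x≢u) (sym (elsewhere f v p 1 x≢v x≢p)))

  lev≢ : ∀ {u v} → lev u < lev v → u ≢ v
  lev≢ h refl = <-irrefl refl h

  -- In transit the weighting is `f` with one unit of `v` placed on `u`. Then `u` weighs `f u + 1`,
  -- and `strict` is what lets it pass the unit on. `k` bounds the number of remaining steps by the
  -- level.
  climb : ∀ f → Inv f → ∀ v k u → lev u < k → lev u < lev v → 1 ≤ f u → leaf u ≡ false → Can (moved f v u) (moved f v ρ)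
  climb f inv v zero u () _ _ _
  climb f inv v (suc k) u lt below p nl with u ≟ ρ
  ... | yes refl = can-refl λ _ → refl
  ... | no u≢ρ = can-∘ (can-move u (par u) (edge D) pos le)
        (can-∘ (can-refl (relay f u≢v p≢v p≢u)) (climb f inv v k (par u) (<-≤-trans (lower D) (≤-pred lt)) (<-trans (lower D) below) (alive D) (inner D)))
    where
    D = inv u u≢ρ p
    u≢v = lev≢ below
    p≢u = lev≢ (lower D)
    p≢v = lev≢ (<-trans (lower D) below)
    atu : moved f v u u ≡ f u + 1
    atu = at-target f v u 1 u≢v
    pos : 1 ≤ moved f v u u
    pos = subst (1 ≤_) (sym atu) (m≤n+m 1 (f u))
    le : moved f v u u ≤ moved f v u (par u)
    le = subst₂ _≤_ (trans (+-comm 1 (f u)) (sym atu)) (sym (elsewhere f v u 1 p≢v p≢u)) (strict D nl)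

  push : ∀ f → Inv f → ∀ v → v ≢ ρ → 1 ≤ f v → Can f (moved f v ρ)
  push f inv v ne p = can-∘ (can-move v (par v) (edge D) p (weak D))
      (climb f inv v (lev v) (par v) (lower D) (lower D) (alive D) (inner D))
    where D = inv v ne p

  -- Passing from a vertex to a live child raises the level, which never exceeds `top`.
  deepest : ∀ f → Inv f → ∀ k v → top < lev v + k → v ≢ ρ → 1 ≤ f v →
            ∃[ u ] u ≢ ρ × 1 ≤ f u × (∀ x → x ≢ ρ → 1 ≤ f x → par x ≢ u)
  deepest f inv zero v lt ne p = ⊥-elim (<-irrefl refl (<-≤-trans lt (≤-trans (≤-reflexive (+-identityʳ _)) (lev≤top v))))
  deepest f inv (suc k) v lt ne p with any? (λ x → ¬? (x ≟ ρ) ×-dec (1 ≤? f x) ×-dec (par x ≟ v))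
  ... | no none = v , ne , p , λ x a b c → none (x , a , b , c)
  ... | yes (x , a , b , refl) = deepest f inv k x (<-≤-trans lt (≤-trans (≤-reflexive (+-suc (lev (par x)) k)) (+-monoˡ-≤ k (lower (inv x a b))))) a b

  rest : (Fin n → ℕ) → ℕ
  rest f = ∑ λ x → if x == ρ then 0 else f x

  rest-moved : ∀ f v → v ≢ ρ → 1 ≤ f v → rest (moved f v ρ) < rest f
  rest-moved f v ne p = begin
      suc (rest (moved f v ρ))                                              ≡⟨ +-comm 1 _ ⟩
      rest (moved f v ρ) + 1                                                ≡⟨ cong (rest (moved f v ρ) +_) (sym (card-single v)) ⟩
      rest (moved f v ρ) + card (_== v)                                     ≡⟨ sym (∑-+ (λ x → if x == ρ then 0 else moved f v ρ x) (λ x → ⟦ x == v ⟧)) ⟩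
      ∑ (λ x → (if x == ρ then 0 else moved f v ρ x) + ⟦ x == v ⟧)          ≤⟨ ∑-mono pt ⟩
      rest f                                                                ∎
    where
    open ≤-Reasoning
    pt : ∀ x → (if x == ρ then 0 else moved f v ρ x) + ⟦ x == v ⟧ ≤ (if x == ρ then 0 else f x)
    pt x with x ≟ ρ | x ≟ v
    ... | yes refl | yes refl = ⊥-elim (ne refl)
    ... | yes refl | no _ = z≤n
    ... | no _ | yes refl = ≤-reflexive (m∸n+n≡m p)
    ... | no _ | no _ = ≤-reflexive (+-identityʳ _)

  -- A lighter `v` could harm only live vertices whose parent is `v`, and there are none; a heavier
  -- root harms nobody.
  inv-moved : ∀ f → Inv f → ∀ v → v ≢ ρ → 1 ≤ f v → (∀ x → x ≢ ρ → 1 ≤ f x → par x ≢ v) → Inv (moved f v ρ)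
  inv-moved f inv v ne p childless u u≢ρ q = record
      { alive = ≤-trans (alive D) up ; edge = edge D ; lower = lower D ; inner = inner D
      ; strict = λ nl → ≤-<-trans down (<-≤-trans (strict D nl) up) ; weak = ≤-trans down (≤-trans (weak D) up) }
    where
    down : moved f v ρ u ≤ f u
    down = value (u ≟ v)
      where
      value : Dec (u ≡ v) → moved f v ρ u ≤ f u
      value (yes refl) = ≤-trans (≤-reflexive (at-source f u ρ 1)) (m∸n≤m (f u) 1)
      value (no h) = ≤-reflexive (elsewhere f v ρ 1 h u≢ρ)
    D = inv u u≢ρ (≤-trans q down)
    up : f (par u) ≤ moved f v ρ (par u)
    up = value (par u ≟ ρ)
      where
      p≢v = childless u u≢ρ (≤-trans q down)
      value : Dec (par u ≡ ρ) → f (par u) ≤ moved f v ρ (par u)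
      value (yes e) rewrite e = ≤-trans (m≤m+n _ 1) (≤-reflexive (sym (at-target f v ρ 1 (ne ∘ sym))))
      value (no h) = ≤-reflexive (sym (elsewhere f v ρ 1 p≢v h))

  drain : ∀ k f → rest f < k → Inv f → 1 ≤ f ρ → ∃[ g ] Can f g × (∀ v → v ≢ ρ → g v ≡ 0) × 1 ≤ g ρ
  drain zero f () inv root
  drain (suc k) f lt inv root with any? (λ x → ¬? (x ≟ ρ) ×-dec (1 ≤? f x))
  ... | no none = f , can-refl (λ _ → refl) , (λ v ne → n<1⇒n≡0 (≰⇒> λ p → none (v , ne , p))) , root
  ... | yes (x , ne , p) with deepest f inv (suc top) x (m≤n+m (suc top) (lev x)) ne p
  ... | v , v≢ρ , q , childless with drain k (moved f v ρ) (<-≤-trans (rest-moved f v v≢ρ q) (≤-pred lt)) (inv-moved f inv v v≢ρ q childless)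
                                       (≤-trans (m≤n+m 1 (f ρ)) (≤-reflexive (sym (at-target f v ρ 1 (v≢ρ ∘ sym)))))
  ... | g , can , off , on = g , can-∘ (push f inv v v≢ρ q) can , off , on

data Role (n : ℕ) : Set where
  atCore atSpare : Cell n → Role n
  inGad : Cell n → Bool → Role n
  inBase inRest : Role n

-- Consolidating a graph that contains the core tree

module Assembly {n h μ : ℕ} {adj : Fin n → Fin n → Bool} (adj-sym : ∀ u v → adj u v ≡ true → adj v u ≡ true)
                (S : Structure adj h μ) (E : EdgeList n) (loopless : ∀ u → ¬ Adj E u u)
                (real : ∀ {u v} → adj u v ≡ true → Adj E u v) (connected : Connected E) where
  open Structure S renaming (base to isBase; parent to coreParent; ok to cellOK)

  -- Vertices of one cell count as linked even if they are not adjacent, because choosing the gadget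
  -- to be eaten makes all parts of the cell depend on each other.
  data Link (u v : Fin n) : Set where
    edge : Adj E u v → Link u v
    same : ∀ {c} → c ∈ cells → u ∈ flat c → v ∈ flat c → Link u v

  infixr 5 _▷_
  data Walk : ℕ → Fin n → Fin n → Set where
    stop : ∀ {u} → Walk 0 u u
    _▷_ : ∀ {k u v w} → Link u v → Walk k v w → Walk (suc k) u w

  flip : ∀ {u v} → Adj E u v → Adj E v u
  flip (inj₁ p) = inj₂ p
  flip (inj₂ p) = inj₁ p

  module _ (weak : Fin n → Bool)
           (strong-base : ∀ v → weak v ≡ false → isBase v ≡ false → ∃[ b ] isBase b ≡ true × Adj E v b)
           (far : ∀ {u v k} → weak u ≡ true → weak v ≡ true → u ≢ v → k ≤ 6 → ¬ Walk k u v) where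

    Spec : Fin n → Role n → Set
    Spec v (atCore c) = c ∈ cells × v ≡ center c
    Spec v (atSpare c) = c ∈ cells × v ≡ spare c
    Spec v (inGad c i) = c ∈ cells × v ∈ G c i
    Spec v inBase = isBase v ≡ true
    Spec v inRest = isBase v ≡ false × v ∉ flats cells

    flat-gad : ∀ (c : Cell n) i {v} → v ∈ G c i → v ∈ flat c
    flat-gad c false m = there (∈-++⁺ˡ m)
    flat-gad c true m = there (∈-++⁺ʳ (G c false) (∈-++⁺ˡ m))

    flat-unique : ∀ {c} → c ∈ cells → Unique (flat c)
    flat-unique k = go k distinct
      where
      go : ∀ {cs c} → c ∈ cs → Unique (flats cs) → Unique (flat c)
      go {c ∷ cs} (here refl) u = unique-++ˡ (flat c) u
      go {c ∷ cs} (there k) u = go k (unique-++ʳ (flat c) u)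

    findRole : ∀ v → Σ (Role n) (Spec v)
    findRole v with bool? (isBase v) | bool? (mem v (flats cells))
    ... | inj₁ b | _ = inBase , b
    ... | inj₂ b | inj₂ m = inRest , b , λ k → true≢false (∈⇒mem k) m
    ... | inj₂ _ | inj₁ m with flats-∈ cells (mem⇒∈ (flats cells) m)
    ... | c , k , here e = atCore c , k , e
    ... | c , k , there p with ∈-++⁻ (G c false) p
    ... | inj₁ q = inGad c false , k , q
    ... | inj₂ q with ∈-++⁻ (G c true) q
    ... | inj₁ r = inGad c true , k , r
    ... | inj₂ (here e) = atSpare c , k , e

    data InCell (v : Fin n) (c : Cell n) : Role n → Set where
      icore : v ≡ center c → InCell v c (atCore c)
      ispare : v ≡ spare c → InCell v c (atSpare c)
      igad : ∀ {i} → v ∈ G c i → InCell v c (inGad c i)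

    incell-unique : ∀ {v c r r'} → Unique (flat c) → InCell v c r → InCell v c r' → r ≡ r'
    incell-unique u (icore _) (icore _) = refl
    incell-unique u (ispare _) (ispare _) = refl
    incell-unique {c = c} (a ∷ _) (icore refl) (ispare e) = ⊥-elim (All.lookup a (∈-++⁺ʳ (G c false) (∈-++⁺ʳ (G c true) (here refl))) e)
    incell-unique {c = c} (a ∷ _) (ispare e) (icore refl) = ⊥-elim (All.lookup a (∈-++⁺ʳ (G c false) (∈-++⁺ʳ (G c true) (here refl))) e)
    incell-unique {c = c} (a ∷ _) (icore refl) (igad {false} m) = ⊥-elim (All.lookup a (∈-++⁺ˡ m) refl)
    incell-unique {c = c} (a ∷ _) (icore refl) (igad {true} m) = ⊥-elim (All.lookup a (∈-++⁺ʳ (G c false) (∈-++⁺ˡ m)) refl)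
    incell-unique {c = c} (a ∷ _) (igad {false} m) (icore refl) = ⊥-elim (All.lookup a (∈-++⁺ˡ m) refl)
    incell-unique {c = c} (a ∷ _) (igad {true} m) (icore refl) = ⊥-elim (All.lookup a (∈-++⁺ʳ (G c false) (∈-++⁺ˡ m)) refl)
    incell-unique {c = c} (_ ∷ u) (ispare refl) (igad {false} m) = ⊥-elim (unique-disjoint (G c false) u m (∈-++⁺ʳ (G c true) (here refl)))
    incell-unique {c = c} (_ ∷ u) (ispare refl) (igad {true} m) = ⊥-elim (unique-disjoint (G c true) (unique-++ʳ (G c false) u) m (here refl))
    incell-unique {c = c} (_ ∷ u) (igad {false} m) (ispare refl) = ⊥-elim (unique-disjoint (G c false) u m (∈-++⁺ʳ (G c true) (here refl)))
    incell-unique {c = c} (_ ∷ u) (igad {true} m) (ispare refl) = ⊥-elim (unique-disjoint (G c true) (unique-++ʳ (G c false) u) m (here refl))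
    incell-unique u (igad {false} _) (igad {false} _) = refl
    incell-unique u (igad {true} _) (igad {true} _) = refl
    incell-unique {c = c} (_ ∷ u) (igad {false} m) (igad {true} m') = ⊥-elim (unique-disjoint (G c false) u m (∈-++⁺ˡ m'))
    incell-unique {c = c} (_ ∷ u) (igad {true} m) (igad {false} m') = ⊥-elim (unique-disjoint (G c false) u m' (∈-++⁺ˡ m))

    -- Bundles the roles inside a cell, so that uniqueness of roles splits into disjointness of
    -- cells and `incell-unique`.
    View : Fin n → Role n → Set
    View v r = (r ≡ inBase × isBase v ≡ true) ⊎ (r ≡ inRest × isBase v ≡ false × v ∉ flats cells) ⊎ (∃[ c ] c ∈ cells × v ∈ flat c × InCell v c r)

    view : ∀ {v} r → Spec v r → View v r
    view (atCore c) (k , refl) = inj₂ (inj₂ (c , k , center∈flat c , icore refl))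
    view (atSpare c) (k , refl) = inj₂ (inj₂ (c , k , spare∈flat c , ispare refl))
    view (inGad c i) (k , m) = inj₂ (inj₂ (c , k , flat-gad c i m , igad m))
    view inBase b = inj₁ (refl , b)
    view inRest s = inj₂ (inj₁ (refl , s))

    view-unique : ∀ {v r r'} → View v r → View v r' → r ≡ r'
    view-unique (inj₁ (refl , _)) (inj₁ (refl , _)) = refl
    view-unique (inj₁ (_ , b)) (inj₂ (inj₁ (_ , b' , _))) = ⊥-elim (true≢false b b')
    view-unique (inj₁ (_ , b)) (inj₂ (inj₂ (c , k , m , _))) = ⊥-elim (base∉ b (∈-flats k m))
    view-unique (inj₂ (inj₁ (_ , b' , _))) (inj₁ (_ , b)) = ⊥-elim (true≢false b b')
    view-unique (inj₂ (inj₁ (refl , _))) (inj₂ (inj₁ (refl , _))) = refl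
    view-unique (inj₂ (inj₁ (_ , _ , o))) (inj₂ (inj₂ (c , k , m , _))) = ⊥-elim (o (∈-flats k m))
    view-unique (inj₂ (inj₂ (c , k , m , _))) (inj₁ (_ , b)) = ⊥-elim (base∉ b (∈-flats k m))
    view-unique (inj₂ (inj₂ (c , k , m , _))) (inj₂ (inj₁ (_ , _ , o))) = ⊥-elim (o (∈-flats k m))
    view-unique (inj₂ (inj₂ (c , k , m , p))) (inj₂ (inj₂ (c' , k' , m' , p'))) with owner-unique distinct k k' m m'
    ... | refl = incell-unique (flat-unique k) p p'

    role : Fin n → Role n
    role v = proj₁ (findRole v)

    spec : ∀ v → Spec v (role v)
    spec v = proj₂ (findRole v)

    role≡ : ∀ {v} r → Spec v r → role v ≡ r
    role≡ {v} r s = view-unique (view (role v) (spec v)) (view r s)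

    spec≡ : ∀ {v r} → role v ≡ r → Spec v r
    spec≡ {v} refl = spec v

    ρ : Fin n
    ρ = center top

    neighbour : ∀ v → ∃[ u ] Adj E v u
    neighbour v = first (other (v ≟ ρ))
      where
      other : Dec (v ≡ ρ) → ∃[ u ] v ≢ u
      other (yes refl) = spare top , λ e → loopless _ (subst (Adj E (center top)) (sym e) (real (CellOK.spareAdj (cellOK top∈))))
      other (no ne) = ρ , ne
      start : ∀ {a b} → a ≢ b → Star (Adj E) a b → ∃[ u ] Adj E a u
      start ne ε = ⊥-elim (ne refl)
      start ne (e ◅ _) = _ , e
      first : ∃[ u ] v ≢ u → ∃[ u ] Adj E v u
      first (u , ne) = start ne (connected v u)

    y : Fin n → Fin n
    y v = proj₁ (neighbour v)

    y-adj : ∀ v → Adj E v (y v)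
    y-adj v = proj₂ (neighbour v)

    -- The value `v` at weak or base vertices is a placeholder; `a-spec` speaks of strong vertices
    -- outside the base only.
    a : Fin n → Fin n
    a v with bool? (weak v) | bool? (isBase v)
    ... | inj₂ w | inj₂ b = proj₁ (strong-base v w b)
    ... | _ | _ = v

    a-spec : ∀ {v} → weak v ≡ false → isBase v ≡ false → isBase (a v) ≡ true × Adj E v (a v)
    a-spec {v} w b with bool? (weak v) | bool? (isBase v)
    ... | inj₂ w' | inj₂ b' = proj₂ (strong-base v w' b')
    ... | inj₁ w' | _ = ⊥-elim (true≢false w' w)
    ... | inj₂ _ | inj₁ b' = ⊥-elim (true≢false b' b)

    baseCell spareCell : Fin n → Cell n
    baseCell v with bool? (isBase v)
    ... | inj₁ b = proj₁ (base-parent b)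
    ... | inj₂ _ = top
    spareCell v with bool? (isBase v)
    ... | inj₁ b = proj₁ (base-spare b)
    ... | inj₂ _ = top

    baseCell-spec : ∀ {v} → isBase v ≡ true → baseCell v ∈ cells × Adj E v (center (baseCell v))
    baseCell-spec {v} b with bool? (isBase v)
    ... | inj₁ b' = let c , k , e = base-parent b' in k , flip (real e)
    ... | inj₂ b' = ⊥-elim (true≢false b b')

    spareCell-spec : ∀ {v} → isBase v ≡ true → spareCell v ∈ cells × adj v (spare (spareCell v)) ≡ true
    spareCell-spec {v} b with bool? (isBase v)
    ... | inj₁ b' = let c , k , e = base-spare b' in k , adj-sym _ _ e
    ... | inj₂ b' = ⊥-elim (true≢false b b')

    isRest needsBase : Role n → Bool
    isRest inRest = true
    isRest _ = false
    needsBase inRest = true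
    needsBase (inGad _ _) = true
    needsBase _ = false

    -- The weak vertices outside tree and base. A weak vertex in the tree is no obstacle: a center
    -- or a spare has its tree parent, and a weak gadget vertex is eaten by the choice below.
    isX : Fin n → Bool
    isX v = isRest (role v) ∧ weak v

    weakIn dirty : Cell n → Bool → Bool
    weakIn c i = anyᵇ λ x → mem x (G c i) ∧ weak x
    dirty c i = anyᵇ λ x → isX x ∧ mem (y x) (G c i)

    -- Gadget `true` is eaten if it contains a weak vertex, which must go, or if gadget `false`
    -- contains some `y x` through which a weak vertex leaves and which must stay. Otherwise `false`
    -- is eaten. Contradictory wishes would put two weak vertices close together.
    choice : Cell n → Bool
    choice c = weakIn c true ∨ dirty c false

    -- A carrier `y x` relays the unit of a weak `x`. If it sits in a gadget or outside the
    -- structure, it passes the unit to a chain base, which must therefore have weight 2.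
    chainBase carrier : Fin n → Bool
    chainBase b = anyᵇ λ x → isX x ∧ (needsBase (role (y x)) ∧ (a (y x) == b))
    carrier v = anyᵇ λ x → isX x ∧ (y x == v)

    X-spec : ∀ {x} → isX x ≡ true → role x ≡ inRest × weak x ≡ true
    X-spec {x} e with role x | ∧-elim {isRest (role x)} e
    ... | inRest | _ , w = refl , w

    needsBase⇒¬base : ∀ {v} → needsBase (role v) ≡ true → isBase v ≡ false
    needsBase⇒¬base {v} q with role v | spec v
    ... | inRest | b , _ = b
    ... | inGad c i | k , m = ¬true λ b → base∉ b (∈-flats k (flat-gad c i m))

    y-strong : ∀ {x} → isX x ≡ true → weak (y x) ≡ false
    y-strong {x} e = ¬true λ w → far (proj₂ (X-spec e)) w (λ q → loopless x (subst (Adj E x) (sym q) (y-adj x))) (s≤s z≤n) (edge (y-adj x) ▷ stop)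

    chain-spec : ∀ {b} → chainBase b ≡ true → ∃[ x ] isX x ≡ true × needsBase (role (y x)) ≡ true × a (y x) ≡ b × Adj E (y x) b
    chain-spec {b} q with anyᵇ-elim {p = λ x → isX x ∧ (needsBase (role (y x)) ∧ (a (y x) == b))} q
    ... | x , r with ∧-elim {isX x} r
    ... | e , r' with ∧-elim {needsBase (role (y x))} r'
    ... | nb , eq = x , e , nb , ==-true eq , subst (Adj E (y x)) (==-true {i = a (y x)} eq) (proj₂ (a-spec (y-strong e) (needsBase⇒¬base nb)))

    gad-apart : ∀ (c : Cell n) {u v} → c ∈ cells → u ∈ G c true → v ∈ G c false → u ≢ v
    gad-apart c k m m' refl with incell-unique {c = c} (flat-unique k) (igad {i = true} m) (igad {i = false} m')
    ... | ()

    weakIn-elim : ∀ (c : Cell n) i → weakIn c i ≡ true → ∃[ x ] x ∈ G c i × weak x ≡ true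
    weakIn-elim c i q with anyᵇ-elim {p = λ x → mem x (G c i) ∧ weak x} q
    ... | x , r = x , mem⇒∈ (G c i) (proj₁ (∧-elim {mem x (G c i)} r)) , proj₂ (∧-elim {mem x (G c i)} r)

    dirty-elim : ∀ (c : Cell n) i → dirty c i ≡ true → ∃[ x ] isX x ≡ true × y x ∈ G c i
    dirty-elim c i q with anyᵇ-elim {p = λ x → isX x ∧ mem (y x) (G c i)} q
    ... | x , r = x , proj₁ (∧-elim {isX x} r) , mem⇒∈ (G c i) (proj₂ (∧-elim {isX x} r))

    no-weak-dirty : ∀ (c : Cell n) i j {x z} → c ∈ cells → isX x ≡ true → y x ∈ G c i → z ∈ G c j → weak z ≡ true → ⊥
    no-weak-dirty c i j {x} {z} k e m m' w = far (proj₂ (X-spec e)) w x≢z (s≤s (s≤s z≤n))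
        (edge (y-adj x) ▷ same k (flat-gad c i m) (flat-gad c j m') ▷ stop)
      where
      x≢z : x ≢ z
      x≢z refl with trans (sym (proj₁ (X-spec e))) (role≡ (inGad c j) (k , m'))
      ... | ()

    choice-clean : ∀ {c x} → c ∈ cells → isX x ≡ true → y x ∈ G c (choice c) → ⊥
    choice-clean {c} {x} k e m with choice c in eq
    ... | false = true≢false (∨-introʳ {weakIn c true} (anyᵇ-intro {p = λ x → isX x ∧ mem (y x) (G c false)} x (∧-intro e (∈⇒mem m)))) eq
    ... | true with ∨-elim {weakIn c true} eq
    ... | inj₁ q = let z , m' , w = weakIn-elim c true q in no-weak-dirty c true true k e m m' w
    ... | inj₂ q with dirty-elim c false q
    ... | x' , e' , m' = far (proj₂ (X-spec e)) (proj₂ (X-spec e')) (λ { refl → gad-apart c k m m' refl }) (s≤s (s≤s (s≤s z≤n)))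
          (edge (y-adj x) ▷ same k (flat-gad c true m) (flat-gad c false m') ▷ edge (flip (y-adj x')) ▷ stop)

    other-strong : ∀ {c i x} → c ∈ cells → x ∈ G c i → i ≢ choice c → weak x ≡ false
    other-strong {c} {i} {x} k m ne with choice c in eq
    other-strong {c} {true} {x} k m ne | true = ⊥-elim (ne refl)
    other-strong {c} {false} {x} k m ne | false = ⊥-elim (ne refl)
    other-strong {c} {true} {x} k m ne | false = ¬true λ w → true≢false
      (∨-introˡ {weakIn c true} (anyᵇ-intro {p = λ x → mem x (G c true) ∧ weak x} x (∧-intro (∈⇒mem m) w))) eq
    other-strong {c} {false} {x} k m ne | true with ∨-elim {weakIn c true} eq
    ... | inj₁ q = ¬true λ w → let z , m' , w' = weakIn-elim c true q in
          far w w' (λ e → gad-apart c k m' m (sym e)) (s≤s z≤n) (same k (flat-gad c false m) (flat-gad c true m') ▷ stop)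
    ... | inj₂ q = ¬true λ w → let x' , e' , m' = dirty-elim c false q in no-weak-dirty c false false k e' m' m w

    gR : Fin n → Role n → List (Fin n)
    gR v (atCore c) = G c (choice c)
    gR v inBase = if chainBase v then spare (spareCell v) ∷ [] else []
    gR v _ = []

    g : Fin n → List (Fin n)
    g v = gR v (role v)

    parR : ∀ v r → Spec v r → Fin n
    parR v (atCore c) (k , _) with coreParent k
    ... | inj₁ _ = v
    ... | inj₂ (p , _) = center p
    parR v (atSpare c) _ = center c
    parR v (inGad c i) _ = a v
    parR v inBase _ = center (baseCell v)
    parR v inRest _ = if weak v then y v else a v

    par : Fin n → Fin n
    par v = parR v (role v) (spec v)

    -- Levels count the distance class from the root: a core parent has larger height, hence lower
    -- level; bases and spares point to centers, remaining gadget vertices and strong outsiders to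
    -- bases, and weak outsiders to any neighbour.
    levR : Fin n → Role n → ℕ
    levR v (atCore c) = h ∸ height c
    levR v (atSpare c) = suc h
    levR v inBase = suc h
    levR v (inGad c i) = 2 + h
    levR v inRest = if weak v then 3 + h else 2 + h

    lev : Fin n → ℕ
    lev v = levR v (role v)

    lev≤top : ∀ v → lev v ≤ 3 + h
    lev≤top v with role v
    ... | atCore c = ≤-trans (m∸n≤m h (height c)) (m≤n+m h 3)
    ... | atSpare c = s≤s (m≤n+m h 2)
    ... | inBase = s≤s (m≤n+m h 2)
    ... | inGad c i = s≤s (s≤s (m≤n+m h 1))
    ... | inRest with weak v
    ... | true = ≤-refl
    ... | false = s≤s (s≤s (m≤n+m h 1))

    -- Gadget vertices and strong outsiders weigh as much as an ordinary base vertex; strictness is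
    -- demanded of them only if they carry for a weak vertex.
    leafR : Fin n → Role n → Bool
    leafR v (inGad c i) = not (carrier v)
    leafR v inRest = if weak v then true else not (carrier v)
    leafR v _ = false

    leaf : Fin n → Bool
    leaf v = leafR v (role v)

    chain-x : ∀ {b} → chainBase b ≡ true → ∃[ x ] isX x ≡ true × a (y x) ≡ b × Adj E (y x) b × needsBase (role (y x)) ≡ true
    chain-x q with chain-spec q
    ... | x , e , nb , eq , ad = x , e , eq , ad , nb

    data Eaten (x v : Fin n) : Set where
      byCore : ∀ {c} → c ∈ cells → v ≡ center c → x ∈ G c (choice c) → Eaten x v
      byBase : isBase v ≡ true → chainBase v ≡ true → x ≡ spare (spareCell v) → Eaten x v

    eaten : ∀ {x v} → x ∈ g v → Eaten x v
    eaten {x} {v} m = go (role v) (spec v) m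
      where
      go : ∀ r → Spec v r → x ∈ gR v r → Eaten x v
      go (atCore c) (k , e) m = byCore k e m
      go inBase b m with chainBase v in q
      go inBase b (here e) | true = byBase b q e

    eaten-role : ∀ {x v} → Eaten x v → (∃[ c ] role x ≡ inGad c (choice c)) ⊎ (∃[ c ] role x ≡ atSpare c)
    eaten-role (byCore {c} k _ m) = inj₁ (c , role≡ (inGad c (choice c)) (k , m))
    eaten-role {v = v} (byBase b q refl) = inj₂ (spareCell v , role≡ (atSpare (spareCell v)) (proj₁ (spareCell-spec b) , refl))

    g-inert : ∀ {x v} → x ∈ g v → g x ≡ []
    g-inert {x} m with eaten-role (eaten m)
    ... | inj₁ (c , e) = cong (gR x) e
    ... | inj₂ (c , e) = cong (gR x) e

    -- Two chain bases with a common spare give a walk from a weak vertex over its carrier, base,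
    -- the spare, and back down to another weak vertex. It has six links, the longest conflict of
    -- all; this is where the radius in `far` comes from.
    same-spare : ∀ {b b'} → isBase b ≡ true → isBase b' ≡ true → chainBase b ≡ true → chainBase b' ≡ true →
                 spare (spareCell b) ≡ spare (spareCell b') → b ≡ b'
    same-spare {b} {b'} p p' q q' e with b ≟ b'
    ... | yes eq = eq
    ... | no ne with chain-x q | chain-x q'
    ... | x , X , ax , e₁ , _ | x' , X' , ax' , e₁' , _ = ⊥-elim (far (proj₂ (X-spec X)) (proj₂ (X-spec X'))
        (λ { refl → ne (trans (sym ax) ax') }) ≤-refl
        (edge (y-adj x) ▷ edge e₁ ▷ edge (real (proj₂ (spareCell-spec p))) ▷
         edge (flip (subst (Adj E b') (sym e) (real (proj₂ (spareCell-spec p'))))) ▷ edge (flip e₁') ▷ edge (flip (y-adj x')) ▷ stop))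

    g-disjoint : ∀ {x v v'} → x ∈ g v → x ∈ g v' → v ≡ v'
    g-disjoint {x} {v} {v'} m m' = go (eaten m) (eaten m')
      where
      go : Eaten x v → Eaten x v' → v ≡ v'
      go (byCore {c} k refl p) (byCore {c'} k' refl p') with owner-unique distinct k k' (flat-gad c _ p) (flat-gad c' _ p')
      ... | refl = refl
      go (byCore {c} k e p) (byBase b q refl) with trans (sym (role≡ (inGad c (choice c)) (k , p))) (role≡ (atSpare (spareCell v')) (proj₁ (spareCell-spec b) , refl))
      ... | ()
      go (byBase b q refl) (byCore {c} k e p) with trans (sym (role≡ (inGad c (choice c)) (k , p))) (role≡ (atSpare (spareCell v)) (proj₁ (spareCell-spec b) , refl))
      ... | ()
      go (byBase b q e) (byBase b' q' e') = same-spare b b' q q' (trans (sym e) e')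

    g-eats : ∀ v → Eats adj v (g v)
    g-eats v = go (role v) (spec v)
      where
      go : ∀ r → Spec v r → Eats adj v (gR v r)
      go (atCore c) (k , refl) = CellOK.eats (cellOK k) (choice c)
      go (atSpare c) _ = eats-none
      go (inGad c i) _ = eats-none
      go inRest _ = eats-none
      go inBase b with chainBase v
      ... | false = eats-none
      ... | true = absorb eats-none (proj₂ (spareCell-spec b)) eats-none z≤n

    g-unique : ∀ v → Unique (v ∷ g v)
    g-unique v = go (role v) (spec v)
      where
      go : ∀ r → Spec v r → Unique (v ∷ gR v r)
      go (atCore c) (k , refl) with choice c | flat-unique k
      ... | false | p ∷ u = All.tabulate (λ m → All.lookup p (∈-++⁺ˡ m)) ∷ unique-++ˡ (G c false) u
      ... | true | p ∷ u = All.tabulate (λ m → All.lookup p (∈-++⁺ʳ (G c false) (∈-++⁺ˡ m))) ∷ unique-++ˡ (G c true) (unique-++ʳ (G c false) u)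
      go (atSpare c) _ = [] ∷ []
      go (inGad c i) _ = [] ∷ []
      go inRest _ = [] ∷ []
      go inBase b with chainBase v
      ... | false = [] ∷ []
      ... | true = ((λ e → loopless v (subst (Adj E v) (sym e) (real (proj₂ (spareCell-spec b))))) ∷ []) ∷ [] ∷ []

    open Acquisition E loopless
    open CollectAll real g g-eats g-unique g-disjoint g-inert
    open Flow E loopless ρ par lev (3 + h) lev≤top leaf

    F : Fin n → ℕ
    F = weight (allFin n)

    Free : Fin n → Set
    Free v = eatenBy (allFin n) v ≡ false

    F-free : ∀ {v} → Free v → F v ≡ suc (length (g v))
    F-free {v} e = trans (cong (λ b → if b then 0 else (if mem v (allFin n) then suc (length (g v)) else 1)) e)
                     (cong (λ b → if b then suc (length (g v)) else 1) (∈⇒mem (∈-allFin v)))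

    free-of-F : ∀ {v} → 1 ≤ F v → Free v
    free-of-F {v} p with eatenBy (allFin n) v
    ... | false = refl
    free-of-F {v} () | true

    free : ∀ {v} → (∀ {u} → ¬ Eaten v u) → Free v
    free {v} never = ¬true λ q → let u , _ , m = eatenBy-elim (allFin n) q in never (eaten m)

    not-free : ∀ {v u} → v ∈ g u → Free v → ⊥
    not-free {u = u} m e = true≢false (eatenBy-intro (∈-allFin u) m) e

    uneaten : ∀ {v} r → role v ≡ r → (∀ c i → r ≢ inGad c i) → (∀ c → r ≢ atSpare c) → Free v
    uneaten r e h₁ h₂ = free λ q → contra (eaten-role q)
      where
      contra : _ ⊎ _ → ⊥
      contra (inj₁ (c , e')) = h₁ c (choice c) (trans (sym e) e')
      contra (inj₂ (c , e')) = h₂ c (trans (sym e) e')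

    core-F : ∀ {v c} → role v ≡ atCore c → F v ≡ height c + 3
    core-F {v} {c} e = trans (F-free (uneaten (atCore c) e (λ _ _ ()) (λ _ ())))
      (trans (cong suc (trans (cong (length ∘ gR v) e) (CellOK.lengths (cellOK (proj₁ (spec≡ e))) (choice c)))) (sym (+-suc (height c) 2)))

    base-F : ∀ {v} → role v ≡ inBase → F v ≡ suc (length (gR v inBase))
    base-F {v} e = trans (F-free (uneaten inBase e (λ _ _ ()) (λ _ ()))) (cong (suc ∘ length ∘ gR v) e)

    base-F≤2 : ∀ {v} → role v ≡ inBase → F v ≤ 2
    base-F≤2 {v} e = ≤-trans (≤-reflexive (base-F e)) (bound (chainBase v))
      where
      bound : ∀ b → suc (length (if b then spare (spareCell v) ∷ [] else [])) ≤ 2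
      bound true = ≤-refl
      bound false = s≤s z≤n

    chain-F : ∀ {v} → role v ≡ inBase → chainBase v ≡ true → F v ≡ 2
    chain-F {v} e q = trans (base-F e) (cong (λ b → suc (length (if b then spare (spareCell v) ∷ [] else []))) q)

    F≡1 : ∀ {v} → Free v → g v ≡ [] → F v ≡ 1
    F≡1 p e = trans (F-free p) (cong (suc ∘ length) e)

    center-role : ∀ {c} → c ∈ cells → role (center c) ≡ atCore c
    center-role {c} k = role≡ (atCore c) (k , refl)

    leaf≡ : ∀ {v r} → role v ≡ r → leaf v ≡ leafR v r
    leaf≡ {v} e = cong (leafR v) e

    lev≡ : ∀ {v r} → role v ≡ r → lev v ≡ levR v r
    lev≡ {v} e = cong (levR v) e

    record To (v p : Fin n) : Set where
      field
        alive : 1 ≤ F p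
        edge' : Adj E v p
        lower : lev p < lev v
        inner : leaf p ≡ false
        strict : leaf v ≡ false → F v < F p
        weak≤ : F v ≤ F p

    toCore : ∀ {v c} → c ∈ cells → Adj E v (center c) → h ∸ height c < lev v → F v < height c + 3 → To v (center c)
    toCore {v} {c} k e l s = record { alive = ≤-trans (m≤n+m 1 _) (≤-trans (≤-reflexive (+-assoc (height c) 2 1)) (≤-reflexive (sym F≡)))
      ; edge' = e ; lower = subst (_< lev v) (sym (lev≡ (center-role k))) l ; inner = leaf≡ (center-role k)
      ; strict = λ _ → lt ; weak≤ = <⇒≤ lt }
      where
      F≡ = core-F (center-role k)
      lt : F v < F (center c)
      lt = subst (F v <_) (sym F≡) s

    carried : ∀ {x v} → isX x ≡ true → y x ≡ v → carrier v ≡ true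
    carried {x} X refl = anyᵇ-intro {p = λ x' → isX x' ∧ (y x' == y x)} x (∧-intro X (==-refl (y x)))

    -- A carrier needs weight two at its base, and gets it because the base then eats its spare.
    toBase : ∀ {v} → F v ≡ 1 → needsBase (role v) ≡ true → weak v ≡ false → lev v ≡ 2 + h → (leaf v ≡ false → carrier v ≡ true) → To v (a v)
    toBase {v} F1 nb w lv car = record
      { alive = ≤-trans (s≤s z≤n) (≤-reflexive (sym (base-F ab)))
      ; edge' = proj₂ as ; lower = subst₂ _<_ (sym (lev≡ ab)) (sym lv) ≤-refl ; inner = leaf≡ ab
      ; strict = λ q → subst₂ _<_ (sym F1) (sym (chain-F ab (chained (car q)))) ≤-refl
      ; weak≤ = subst₂ _≤_ (sym F1) (sym (base-F ab)) (s≤s z≤n) }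
      where
      as = a-spec w (needsBase⇒¬base nb)
      ab : role (a v) ≡ inBase
      ab = role≡ inBase (proj₁ as)
      chained : carrier v ≡ true → chainBase (a v) ≡ true
      chained q with anyᵇ-elim {p = λ x → isX x ∧ (y x == v)} q
      ... | x , r with ∧-elim {isX x} r
      ... | X , e with ==-true {i = y x} e
      ... | refl = anyᵇ-intro {p = λ x' → isX x' ∧ (needsBase (role (y x')) ∧ (a (y x') == a v))} x (∧-intro X (∧-intro nb (==-refl (a v))))

    not-carrier : ∀ {b} → not b ≡ false → b ≡ true
    not-carrier {true} _ = refl

    uneaten-gad : ∀ {v c i} → role v ≡ inGad c i → Free v → i ≢ choice c
    uneaten-gad {v} {c} e p refl = not-free (subst (v ∈_) (sym (cong (gR (center c)) (center-role (proj₁ (spec≡ e))))) (proj₂ (spec≡ e))) p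

    -- A chain base eating this spare would belong to another weak vertex four links away.
    spare-free : ∀ {x c} → isX x ≡ true → role (y x) ≡ atSpare c → Free (y x)
    spare-free {x} {c} X e = free contra
      where
      contra : ∀ {u} → ¬ Eaten (y x) u
      contra (byCore {c'} k _ m) with trans (sym e) (role≡ (inGad c' (choice c')) (k , m))
      ... | ()
      contra {u} (byBase b q eq) with chain-x q
      ... | x' , X' , _ , e₁ , nb = far (proj₂ (X-spec X)) (proj₂ (X-spec X')) (λ { refl → clash nb }) (s≤s (s≤s (s≤s (s≤s z≤n))))
            (edge (y-adj x) ▷ edge (flip (subst (Adj E u) (sym eq) (real (proj₂ (spareCell-spec b))))) ▷ edge (flip e₁) ▷ edge (flip (y-adj x')) ▷ stop)
        where
        clash : needsBase (role (y x)) ≡ true → ⊥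
        clash nb rewrite e with nb
        ... | ()

    -- `x` is a leaf of weight 1, so any neighbour that has not been eaten can take its unit. The
    -- cases check that `y x` survives in each role and is at a lower level.
    toNeighbour : ∀ {x} → isX x ≡ true → F x ≡ 1 → To x (y x)
    toNeighbour {x} X F1 = go (role (y x)) refl
      where
      lx : lev x ≡ 3 + h
      lx = trans (lev≡ (proj₁ (X-spec X))) (cong (if_then 3 + h else 2 + h) (proj₂ (X-spec X)))
      leafx : leaf x ≡ true
      leafx = trans (leaf≡ (proj₁ (X-spec X))) (cong (if_then true else not (carrier x)) (proj₂ (X-spec X)))
      make : 1 ≤ F (y x) → lev (y x) ≤ 2 + h → leaf (y x) ≡ false → To x (y x)
      make p l i = record { alive = p ; edge' = y-adj x ; lower = subst (lev (y x) <_) (sym lx) (s≤s l) ; inner = i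
        ; strict = λ q → ⊥-elim (true≢false leafx q) ; weak≤ = subst (_≤ F (y x)) (sym F1) p }
      carry : leaf (y x) ≡ not (carrier (y x)) → leaf (y x) ≡ false
      carry e = trans e (cong not (carried X refl))
      go : ∀ r → role (y x) ≡ r → To x (y x)
      go (atCore c) e = make (≤-trans (m≤n+m 1 (height c + 2)) (≤-reflexive (trans (+-assoc (height c) 2 1) (sym (core-F e)))))
        (≤-trans (≤-reflexive (lev≡ e)) (≤-trans (m∸n≤m h (height c)) (m≤n+m h 2))) (leaf≡ e)
      go (atSpare c) e = make (≤-reflexive (sym (F≡1 (spare-free X e) (cong (gR (y x)) e))))
        (≤-trans (≤-reflexive (lev≡ e)) (n≤1+n _)) (leaf≡ e)
      go inBase e = make (≤-trans (s≤s z≤n) (≤-reflexive (sym (base-F e)))) (≤-trans (≤-reflexive (lev≡ e)) (n≤1+n _)) (leaf≡ e)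
      go inRest e = make (≤-reflexive (sym (F≡1 (uneaten inRest e (λ _ _ ()) (λ _ ())) (cong (gR (y x)) e))))
        (≤-reflexive (trans (lev≡ e) (cong (if_then 3 + h else 2 + h) (y-strong X))))
        (carry (trans (leaf≡ e) (cong (if_then true else not (carrier (y x))) (y-strong X))))
      go (inGad c i) e = make (≤-reflexive (sym (F≡1 (free clean) (cong (gR (y x)) e)))) (≤-reflexive (lev≡ e)) (carry (leaf≡ e))
        where
        clean : ∀ {u} → ¬ Eaten (y x) u
        clean (byCore k _ m) = choice-clean k X m
        clean (byBase b q eq) with trans (sym e) (role≡ (atSpare (spareCell _)) (proj₁ (spareCell-spec b) , eq))
        ... | ()

    to : ∀ v r (s : Spec v r) → role v ≡ r → v ≢ ρ → Free v → To v (parR v r s)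
    to v (atCore c) (k , refl) e ne fr with coreParent k
    ... | inj₁ q = ⊥-elim (ne q)
    ... | inj₂ (p , kp , hp , ad) = toCore kp (flip (real ad))
          (subst (h ∸ height p <_) (sym (lev≡ e)) (∸-monoʳ-< (≤-reflexive (sym hp)) (bounded kp)))
          (subst₂ _<_ (sym (core-F e)) (cong (_+ 3) (sym hp)) ≤-refl)
    to v (atSpare c) (k , refl) e ne fr = toCore k (flip (real (CellOK.spareAdj (cellOK k))))
          (subst (h ∸ height c <_) (sym (lev≡ e)) (s≤s (m∸n≤m h (height c))))
          (subst (_< height c + 3) (sym (F≡1 fr (cong (gR v) e))) (≤-trans (s≤s (s≤s z≤n)) (m≤n+m 3 (height c))))
    to v inBase b e ne fr = toCore (proj₁ (baseCell-spec b)) (proj₂ (baseCell-spec b))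
          (subst (h ∸ height (baseCell v) <_) (sym (lev≡ e)) (s≤s (m∸n≤m h (height (baseCell v)))))
          (≤-trans (s≤s (base-F≤2 e)) (m≤n+m 3 (height (baseCell v))))
    to v (inGad c i) (k , m) e ne fr = toBase (F≡1 fr (cong (gR v) e)) (cong needsBase e) (other-strong k m (uneaten-gad e fr)) (lev≡ e)
          (λ q → not-carrier (trans (sym (leaf≡ e)) q))
    to v inRest s e ne fr = split (weak v) refl
      where
      split : ∀ b → weak v ≡ b → To v (if b then y v else a v)
      split true w = toNeighbour (∧-intro (cong isRest e) w) (F≡1 fr (cong (gR v) e))
      split false w = toBase (F≡1 fr (cong (gR v) e)) (cong needsBase e) w (trans (lev≡ e) (cong (if_then 3 + h else 2 + h) w))
          (λ q → not-carrier (trans (sym (trans (leaf≡ e) (cong (if_then true else not (carrier v)) w))) q))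

    downhill : Inv F
    downhill v ne p = record { alive = To.alive t ; edge = To.edge' t ; lower = To.lower t ; inner = To.inner t
                             ; strict = To.strict t ; weak = To.weak≤ t }
      where t = to v (role v) (spec v) refl ne (free-of-F p)

    acquired : FracAcqNumber E 1 × UnitAcqNumber E 1
    acquired = conclude (drain (suc (rest F)) F (n<1+n _) downhill
        (≤-trans (m≤n+m 1 (height top + 2)) (≤-reflexive (trans (+-assoc (height top) 2 1) (sym (core-F (center-role top∈)))))))
      where
      open Outcome E loopless
      conclude : ∃[ f ] Can F f × (∀ v → v ≢ ρ → f v ≡ 0) × 1 ≤ f ρ → FracAcqNumber E 1 × UnitAcqNumber E 1
      conclude (f , can , off , on) = frac-one ρ whole off on , unit-one ρ whole off on
        where
        whole : Can (λ _ → 1) f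
        whole = can-∘ (collectAll (allFin n) (allFin⁺ n)) can

-- Summation over all orderings

module _ {A : Set} where

  insSum : A → List A → (List A → ℕ) → ℕ
  insSum x [] f = f (x ∷ [])
  insSum x (y ∷ τ) f = f (x ∷ y ∷ τ) + insSum x τ (λ ρ → f (y ∷ ρ))

  -- 𝔼 L f is the sum of f over all |L|! orderings of L.
  𝔼 : List A → (List A → ℕ) → ℕ
  𝔼 [] f = f []
  𝔼 (x ∷ L) f = 𝔼 L λ τ → insSum x τ f

  data Ins (x : A) : List A → List A → Set where
    here : ∀ {τ} → Ins x τ (x ∷ τ)
    there : ∀ {y τ σ} → Ins x τ σ → Ins x (y ∷ τ) (y ∷ σ)

  Ins-↭ : ∀ {x τ σ} → Ins x τ σ → σ ↭ x ∷ τ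
  Ins-↭ here = ↭-refl
  Ins-↭ {x} (there {y} i) = ↭-trans (prep y (Ins-↭ i)) (swap y x ↭-refl)

  insSum-mono : ∀ x τ {f g : List A → ℕ} → (∀ {σ} → Ins x τ σ → f σ ≤ g σ) → insSum x τ f ≤ insSum x τ g
  insSum-mono x [] h = h here
  insSum-mono x (y ∷ τ) h = +-mono-≤ (h here) (insSum-mono x τ (λ i → h (there i)))

  𝔼-mono : ∀ L {f g : List A → ℕ} → (∀ {σ} → σ ↭ L → f σ ≤ g σ) → 𝔼 L f ≤ 𝔼 L g
  𝔼-mono [] h = h ↭-refl
  𝔼-mono (x ∷ L) h = 𝔼-mono L λ {τ} q → insSum-mono x τ λ i → h (↭-trans (Ins-↭ i) (prep x q))

  𝔼-cong : ∀ L {f g : List A → ℕ} → (∀ {σ} → σ ↭ L → f σ ≡ g σ) → 𝔼 L f ≡ 𝔼 L g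
  𝔼-cong L h = ≤-antisym (𝔼-mono L λ q → ≤-reflexive (h q)) (𝔼-mono L λ q → ≤-reflexive (sym (h q)))

  insSum-+ : ∀ x τ (f g : List A → ℕ) → insSum x τ (λ ρ → f ρ + g ρ) ≡ insSum x τ f + insSum x τ g
  insSum-+ x [] f g = refl
  insSum-+ x (y ∷ τ) f g = trans (cong (f (x ∷ y ∷ τ) + g (x ∷ y ∷ τ) +_) (insSum-+ x τ _ _)) (+-interchange (f (x ∷ y ∷ τ)) _ _ _)

  insSum-* : ∀ c x τ (f : List A → ℕ) → insSum x τ (λ ρ → c * f ρ) ≡ c * insSum x τ f
  insSum-* c x [] f = refl
  insSum-* c x (y ∷ τ) f = trans (cong (c * f (x ∷ y ∷ τ) +_) (insSum-* c x τ _)) (sym (*-distribˡ-+ c _ _))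

  𝔼-+ : ∀ L (f g : List A → ℕ) → 𝔼 L (λ ρ → f ρ + g ρ) ≡ 𝔼 L f + 𝔼 L g
  𝔼-+ [] f g = refl
  𝔼-+ (x ∷ L) f g = trans (𝔼-cong L λ {τ} _ → insSum-+ x τ f g) (𝔼-+ L _ _)

  𝔼-* : ∀ c L (f : List A → ℕ) → 𝔼 L (λ ρ → c * f ρ) ≡ c * 𝔼 L f
  𝔼-* c [] f = refl
  𝔼-* c (x ∷ L) f = trans (𝔼-cong L λ {τ} _ → insSum-* c x τ f) (𝔼-* c L _)

  𝔼-0 : ∀ L → 𝔼 L (λ _ → 0) ≡ 0
  𝔼-0 L = 𝔼-* 0 L (λ _ → 0)

  𝔼-const : ∀ L c → 𝔼 L (λ _ → c) ≡ c * 𝔼 L (λ _ → 1)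
  𝔼-const L c = trans (𝔼-cong L λ _ → sym (*-identityʳ c)) (𝔼-* c L (λ _ → 1))

  𝔼-∑ : ∀ L {n} (f : Fin n → List A → ℕ) → 𝔼 L (λ σ → ∑ λ i → f i σ) ≡ ∑ λ i → 𝔼 L (f i)
  𝔼-∑ L {zero} f = 𝔼-0 L
  𝔼-∑ L {suc n} f = trans (𝔼-+ L (f zero) _) (cong (𝔼 L (f zero) +_) (𝔼-∑ L (f ∘ suc)))

  -- `𝔼` inserts the head of the list into the orderings of the tail, so that its independence of
  -- the order of the list rests on two insertions commuting.
  insSum-comm : ∀ x y τ (f : List A → ℕ) → insSum y τ (λ ρ → insSum x ρ f) ≡ insSum x τ (λ ρ → insSum y ρ f)
  insSum-comm x y [] f = +-comm (f (x ∷ y ∷ [])) _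
  insSum-comm x y (z ∷ τ) f = begin
      f (x ∷ y ∷ z ∷ τ) + (f (y ∷ x ∷ z ∷ τ) + insSum x τ (λ ρ → f (y ∷ z ∷ ρ))) +
        insSum y τ (λ ρ → f (x ∷ z ∷ ρ) + insSum x ρ (λ π → f (z ∷ π)))
        ≡⟨ cong (f (x ∷ y ∷ z ∷ τ) + (f (y ∷ x ∷ z ∷ τ) + insSum x τ (λ ρ → f (y ∷ z ∷ ρ))) +_)
             (trans (insSum-+ y τ _ _) (cong (insSum y τ (λ ρ → f (x ∷ z ∷ ρ)) +_) (insSum-comm x y τ _))) ⟩
      f (x ∷ y ∷ z ∷ τ) + (f (y ∷ x ∷ z ∷ τ) + insSum x τ (λ ρ → f (y ∷ z ∷ ρ))) +
        (insSum y τ (λ ρ → f (x ∷ z ∷ ρ)) + insSum x τ (λ ρ → insSum y ρ (λ π → f (z ∷ π))))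
        ≡⟨ arith (f (x ∷ y ∷ z ∷ τ)) (f (y ∷ x ∷ z ∷ τ)) (insSum x τ (λ ρ → f (y ∷ z ∷ ρ))) (insSum y τ (λ ρ → f (x ∷ z ∷ ρ))) (insSum x τ (λ ρ → insSum y ρ (λ π → f (z ∷ π)))) ⟩
      f (y ∷ x ∷ z ∷ τ) + (f (x ∷ y ∷ z ∷ τ) + insSum y τ (λ ρ → f (x ∷ z ∷ ρ))) +
        (insSum x τ (λ ρ → f (y ∷ z ∷ ρ)) + insSum x τ (λ ρ → insSum y ρ (λ π → f (z ∷ π))))
        ≡⟨ cong (f (y ∷ x ∷ z ∷ τ) + (f (x ∷ y ∷ z ∷ τ) + insSum y τ (λ ρ → f (x ∷ z ∷ ρ))) +_) (sym (insSum-+ x τ _ _)) ⟩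
      f (y ∷ x ∷ z ∷ τ) + (f (x ∷ y ∷ z ∷ τ) + insSum y τ (λ ρ → f (x ∷ z ∷ ρ))) +
        insSum x τ (λ ρ → f (y ∷ z ∷ ρ) + insSum y ρ (λ π → f (z ∷ π))) ∎
    where
    open ≡-Reasoning
    arith : ∀ a b c d e → a + (b + c) + (d + e) ≡ b + (a + d) + (c + e)
    arith = solve-∀

  𝔼-↭ : ∀ {L L'} → L ↭ L' → ∀ (f : List A → ℕ) → 𝔼 L f ≡ 𝔼 L' f
  𝔼-↭ ↭-refl f = refl
  𝔼-↭ (prep x p) f = 𝔼-↭ p _
  𝔼-↭ {_ ∷ _ ∷ L} (swap x y p) f = trans (𝔼-cong L λ {τ} _ → insSum-comm x y τ f) (𝔼-↭ p _)
  𝔼-↭ (↭-trans p q) f = trans (𝔼-↭ p f) (𝔼-↭ q f)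

  selSum : List A → (A → List A → ℕ) → ℕ
  selSum [] k = 0
  selSum (y ∷ L) k = k y L + selSum L λ x L' → k x (y ∷ L')

  selSum-mono : ∀ L {k k' : A → List A → ℕ} → (∀ {x L'} → x ∷ L' ↭ L → k x L' ≤ k' x L') → selSum L k ≤ selSum L k'
  selSum-mono [] h = z≤n
  selSum-mono (y ∷ L) h = +-mono-≤ (h ↭-refl) (selSum-mono L λ {x} q → h (↭-trans (swap x y ↭-refl) (prep y q)))

  selSum-cong : ∀ L {k k' : A → List A → ℕ} → (∀ {x L'} → x ∷ L' ↭ L → k x L' ≡ k' x L') → selSum L k ≡ selSum L k'
  selSum-cong L h = ≤-antisym (selSum-mono L λ q → ≤-reflexive (h q)) (selSum-mono L λ q → ≤-reflexive (sym (h q)))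

  selSum-+ : ∀ L (k k' : A → List A → ℕ) → selSum L (λ x L' → k x L' + k' x L') ≡ selSum L k + selSum L k'
  selSum-+ [] k k' = refl
  selSum-+ (y ∷ L) k k' = trans (cong (k y L + k' y L +_) (selSum-+ L _ _)) (+-interchange (k y L) _ _ _)

  selSum-* : ∀ c L (k : A → List A → ℕ) → selSum L (λ x L' → c * k x L') ≡ c * selSum L k
  selSum-* c [] k = sym (*-zeroʳ c)
  selSum-* c (y ∷ L) k = trans (cong (c * k y L +_) (selSum-* c L _)) (sym (*-distribˡ-+ c (k y L) _))

  -- The same sum organised by the first item of the ordering; estimates that expose the process
  -- draw by draw use this form.
  𝔼-select : ∀ y L (f : List A → ℕ) → 𝔼 (y ∷ L) f ≡ selSum (y ∷ L) (λ x L' → 𝔼 L' λ τ → f (x ∷ τ))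
  𝔼-select y [] f = sym (+-identityʳ _)
  𝔼-select y (z ∷ L) f = begin
      𝔼 (z ∷ L) (λ τ → insSum y τ f)
        ≡⟨ 𝔼-select z L (λ τ → insSum y τ f) ⟩
      selSum (z ∷ L) (λ x L' → 𝔼 L' λ τ → f (y ∷ x ∷ τ) + insSum y τ (λ ρ → f (x ∷ ρ)))
        ≡⟨ selSum-cong (z ∷ L) (λ {x} {L'} _ → 𝔼-+ L' (λ τ → f (y ∷ x ∷ τ)) _) ⟩
      selSum (z ∷ L) (λ x L' → 𝔼 L' (λ τ → f (y ∷ x ∷ τ)) + 𝔼 L' λ τ → insSum y τ (λ ρ → f (x ∷ ρ)))
        ≡⟨ selSum-+ (z ∷ L) (λ x L' → 𝔼 L' (λ τ → f (y ∷ x ∷ τ))) (λ x L' → 𝔼 (y ∷ L') λ τ → f (x ∷ τ)) ⟩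
      selSum (z ∷ L) (λ x L' → 𝔼 L' (λ τ → f (y ∷ x ∷ τ))) + selSum (z ∷ L) (λ x L' → 𝔼 (y ∷ L') λ τ → f (x ∷ τ))
        ≡⟨ cong (_+ selSum (z ∷ L) (λ x L' → 𝔼 (y ∷ L') λ τ → f (x ∷ τ))) (sym (𝔼-select z L (λ τ → f (y ∷ τ)))) ⟩
      selSum (y ∷ z ∷ L) (λ x L' → 𝔼 L' λ τ → f (x ∷ τ)) ∎
    where open ≡-Reasoning

  count : (A → Bool) → List A → ℕ
  count p [] = 0
  count p (x ∷ L) = ⟦ p x ⟧ + count p L

  count-↭ : ∀ p {L L'} → L ↭ L' → count p L ≡ count p L'
  count-↭ p ↭-refl = refl
  count-↭ p (prep x q) = cong (⟦ p x ⟧ +_) (count-↭ p q)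
  count-↭ p (swap {xs} x y q) = trans (cong (λ z → ⟦ p x ⟧ + (⟦ p y ⟧ + z)) (count-↭ p q)) (arith ⟦ p x ⟧ ⟦ p y ⟧ _)
    where
    arith : ∀ a b c → a + (b + c) ≡ b + (a + c)
    arith = solve-∀
  count-↭ p (↭-trans q r) = trans (count-↭ p q) (count-↭ p r)

  count-++ : ∀ p L L' → count p (L ++ L') ≡ count p L + count p L'
  count-++ p [] L' = refl
  count-++ p (x ∷ L) L' = trans (cong (⟦ p x ⟧ +_) (count-++ p L L')) (sym (+-assoc ⟦ p x ⟧ _ _))

  count-not : ∀ p L → count p L + count (not ∘ p) L ≡ length L
  count-not p [] = refl
  count-not p (x ∷ L) = trans (+-interchange ⟦ p x ⟧ (count p L) ⟦ not (p x) ⟧ _) (cong₂ _+_ (⟦not⟧ (p x)) (count-not p L))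

  selSum-count : ∀ p L c → selSum L (λ x _ → ⟦ p x ⟧ * c) ≡ count p L * c
  selSum-count p [] c = refl
  selSum-count p (y ∷ L) c = trans (cong (⟦ p y ⟧ * c +_) (selSum-count p L c)) (sym (*-distribʳ-+ c ⟦ p y ⟧ _))

  insSum-one : ∀ x τ → insSum x τ (λ _ → 1) ≡ suc (length τ)
  insSum-one x [] = refl
  insSum-one x (y ∷ τ) = cong suc (insSum-one x τ)

  𝔼-one : ∀ L → 𝔼 L (λ _ → 1) ≡ length L !
  𝔼-one [] = refl
  𝔼-one (x ∷ L) = trans (𝔼-cong L λ {τ} q → trans (insSum-one x τ) (cong suc (↭-length q)))
                    (trans (𝔼-const L (suc (length L))) (cong (suc (length L) *_) (𝔼-one L)))

  avoid : (A → Bool) → ℕ → List A → Bool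
  avoid p zero σ = true
  avoid p (suc m) [] = true
  avoid p (suc m) (x ∷ σ) = not (p x) ∧ avoid p m σ

fall : ℕ → ℕ → ℕ
fall a zero = 1
fall a (suc m) = a * fall (a ∸ 1) m

-- The factors `a + N`, `a + N - 1`, ... descend. Each is the total weight of one draw from the
-- remaining items when `a` of them count twice.
rising : ℕ → ℕ → ℕ → ℕ
rising a N zero = 1
rising a N (suc m) = (a + N) * rising a (N ∸ 1) m

rising-mono : ∀ {a b} N m → a ≤ b → rising a N m ≤ rising b N m
rising-mono N zero h = ≤-refl
rising-mono N (suc m) h = *-mono-≤ (+-monoˡ-≤ N h) (rising-mono (N ∸ 1) m h)

module _ {A : Set} where

  𝔼-avoid : ∀ (p : A → Bool) m L → m ≤ length L →
            𝔼 L (λ σ → ⟦ avoid p m σ ⟧) ≡ fall (count (not ∘ p) L) m * (length L ∸ m) !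
  𝔼-avoid p zero L _ = trans (𝔼-one L) (sym (+-identityʳ _))
  𝔼-avoid p (suc m) (y ∷ L) (s≤s h) = begin
      𝔼 (y ∷ L) (λ σ → ⟦ avoid p (suc m) σ ⟧)                                    ≡⟨ 𝔼-select y L _ ⟩
      selSum (y ∷ L) (λ x L' → 𝔼 L' λ τ → ⟦ not (p x) ∧ avoid p m τ ⟧)           ≡⟨ selSum-cong (y ∷ L) step ⟩
      selSum (y ∷ L) (λ x _ → ⟦ not (p x) ⟧ * Z)                                  ≡⟨ selSum-count (not ∘ p) (y ∷ L) Z ⟩
      a * (fall (a ∸ 1) m * (length L ∸ m) !)                                     ≡⟨ sym (*-assoc a _ _) ⟩
      a * fall (a ∸ 1) m * (length L ∸ m) !                                       ∎
    where
    open ≡-Reasoning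
    a = count (not ∘ p) (y ∷ L)
    Z = fall (a ∸ 1) m * (length L ∸ m) !
    step : ∀ {x L'} → x ∷ L' ↭ y ∷ L → 𝔼 L' (λ τ → ⟦ not (p x) ∧ avoid p m τ ⟧) ≡ ⟦ not (p x) ⟧ * Z
    step {x} {L'} q with p x | count-↭ (not ∘ p) q
    ... | true | _ = 𝔼-0 L'
    ... | false | e = trans (𝔼-avoid p m L' (subst (m ≤_) (suc-injective (↭-length (↭-sym q))) h))
      (trans (cong₂ (λ u v → fall u m * (v ∸ m) !) (cong (_∸ 1) e) (suc-injective (↭-length q))) (sym (+-identityʳ _)))

  -- Conditioning on the first `m` items: if the average over the rest is at most `e / c` after
  -- every prefix, so is the average over all orderings.
  𝔼-prefix : ∀ m L (f : List A → ℕ) c e → m ≤ length L →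
             (∀ p r → length p ≡ m → p ++ r ↭ L → c * 𝔼 r (λ τ → f (p ++ τ)) ≤ e * 𝔼 r (λ _ → 1)) →
             c * 𝔼 L f ≤ e * 𝔼 L (λ _ → 1)
  𝔼-prefix zero L f c e _ h = h [] L refl ↭-refl
  𝔼-prefix (suc m) (y ∷ L) f c e (s≤s le) h = begin
      c * 𝔼 (y ∷ L) f                                                ≡⟨ cong (c *_) (𝔼-select y L f) ⟩
      c * selSum (y ∷ L) (λ x L' → 𝔼 L' λ τ → f (x ∷ τ))             ≡⟨ sym (selSum-* c (y ∷ L) (λ x L' → 𝔼 L' λ τ → f (x ∷ τ))) ⟩
      selSum (y ∷ L) (λ x L' → c * 𝔼 L' λ τ → f (x ∷ τ))             ≤⟨ selSum-mono (y ∷ L) (λ {x} {L'} q →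
                                                                          𝔼-prefix m L' (λ τ → f (x ∷ τ)) c e (subst (m ≤_) (suc-injective (↭-length (↭-sym q))) le)
                                                                            λ p r lp pr → h (x ∷ p) r (cong suc lp) (↭-trans (prep x pr) q)) ⟩
      selSum (y ∷ L) (λ x L' → e * 𝔼 L' λ _ → 1)                     ≡⟨ selSum-* e (y ∷ L) (λ x L' → 𝔼 L' λ _ → 1) ⟩
      e * selSum (y ∷ L) (λ x L' → 𝔼 L' λ _ → 1)                     ≡⟨ cong (e *_) (sym (𝔼-select y L (λ _ → 1))) ⟩
      e * 𝔼 (y ∷ L) (λ _ → 1)                                        ∎
    where open ≤-Reasoning

  -- An exponential moment, for the degree bound. A marked item that has been drawn stays counted in
  -- `a`, which only enlarges the bound.
  𝔼-2^count : ∀ (p : A → Bool) m L → m ≤ length L →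
              𝔼 L (λ σ → 2 ^ count p (take m σ)) ≤ rising (count p L) (length L) m * (length L ∸ m) !
  𝔼-2^count p zero L _ = ≤-reflexive (trans (𝔼-one L) (sym (+-identityʳ _)))
  𝔼-2^count p (suc m) (y ∷ L) (s≤s h) = begin
      𝔼 (y ∷ L) (λ σ → 2 ^ count p (take (suc m) σ))                             ≡⟨ 𝔼-select y L _ ⟩
      selSum (y ∷ L) (λ x L' → 𝔼 L' λ τ → 2 ^ (⟦ p x ⟧ + count p (take m τ)))    ≤⟨ selSum-mono (y ∷ L) step ⟩
      selSum (y ∷ L) (λ x _ → ⟦ p x ⟧ * Z + ⟦ true ⟧ * Z)                         ≡⟨ selSum-+ (y ∷ L) (λ x _ → ⟦ p x ⟧ * Z) (λ _ _ → ⟦ true ⟧ * Z) ⟩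
      selSum (y ∷ L) (λ x _ → ⟦ p x ⟧ * Z) + selSum (y ∷ L) (λ x _ → ⟦ true ⟧ * Z)
                                                                                  ≡⟨ cong₂ _+_ (selSum-count p (y ∷ L) Z) (trans (selSum-count (λ _ → true) (y ∷ L) Z) (cong (_* Z) (all (y ∷ L)))) ⟩
      a * Z + suc (length L) * Z                                                  ≡⟨ sym (*-distribʳ-+ Z a _) ⟩
      (a + suc (length L)) * (rising a (length L) m * (length L ∸ m) !)           ≡⟨ sym (*-assoc (a + suc (length L)) _ _) ⟩
      (a + suc (length L)) * rising a (length L) m * (length L ∸ m) !             ∎
    where
    open ≤-Reasoning
    a = count p (y ∷ L)
    Z = rising a (length L) m * (length L ∸ m) !
    all : ∀ (K : List A) → count (λ _ → true) K ≡ length K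
    all [] = refl
    all (_ ∷ K) = cong suc (all K)
    base : ∀ {x L'} → x ∷ L' ↭ y ∷ L → 𝔼 L' (λ τ → 2 ^ count p (take m τ)) ≤ Z
    base {x} {L'} q = ≤-trans (𝔼-2^count p m L' (subst (m ≤_) (suc-injective (↭-length (↭-sym q))) h))
      (≤-trans (≤-reflexive (cong (λ v → rising (count p L') v m * (v ∸ m) !) (suc-injective (↭-length q))))
        (*-monoˡ-≤ ((length L ∸ m) !) (rising-mono (length L) m (≤-trans (m≤n+m _ ⟦ p x ⟧) (≤-reflexive (count-↭ p q))))))
    step : ∀ {x L'} → x ∷ L' ↭ y ∷ L → 𝔼 L' (λ τ → 2 ^ (⟦ p x ⟧ + count p (take m τ))) ≤ ⟦ p x ⟧ * Z + ⟦ true ⟧ * Z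
    step {x} {L'} q with p x | base q
    ... | false | b = ≤-trans b (≤-reflexive (sym (+-identityʳ Z)))
    ... | true | b = ≤-trans (≤-reflexive (𝔼-* 2 L' (λ τ → 2 ^ count p (take m τ)))) (≤-trans (*-monoʳ-≤ 2 b) (≤-reflexive (twice Z)))
      where
      twice : ∀ c → 2 * c ≡ (c + 0) + (c + 0)
      twice = solve-∀

-- Orderings in which prescribed items come early.

module Extract {A : Set} (_≟ᴬ_ : (x y : A) → Dec (x ≡ y)) where

  elem : A → List A → Bool
  elem e [] = false
  elem e (x ∷ L) = does (e ≟ᴬ x) ∨ elem e L

  elem⇒∈ : ∀ {e} L → elem e L ≡ true → e ∈ L
  elem⇒∈ {e} (x ∷ L) h with e ≟ᴬ x
  ... | yes q = here q
  ... | no _ = there (elem⇒∈ L h)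

  ∈⇒elem : ∀ {e L} → e ∈ L → elem e L ≡ true
  ∈⇒elem {e} {x ∷ _} (here q) = ∨-introˡ (does-true (e ≟ᴬ x) q)
  ∈⇒elem {e} {x ∷ _} (there m) = ∨-introʳ {does (e ≟ᴬ x)} (∈⇒elem m)

  allIn : List A → List A → Bool
  allIn [] σ = true
  allIn (e ∷ B) σ = elem e σ ∧ allIn B σ

  -- At most `M` of the places where `e` can be inserted lie among the first `M`.
  extract-one : ∀ e τ M h b → e ∉ τ → (∀ {σ} → Ins e τ σ → h σ ≤ b) →
                insSum e τ (λ σ → ⟦ elem e (take M σ) ⟧ * h σ) ≤ M * b
  extract-one e τ zero h b e∉ hb = ≤-trans (insSum-mono e τ {g = λ _ → 0} (λ _ → z≤n)) (≤-reflexive (insSum-* 0 e τ (λ _ → 0)))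
  extract-one e [] (suc M) h b e∉ hb = ≤-trans (*-monoˡ-≤ (h (e ∷ [])) (⟦⟧≤1 (elem e (e ∷ take M [])))) (≤-trans (≤-reflexive (+-identityʳ _)) (≤-trans (hb here) (m≤m+n b (M * b))))
  extract-one e (y ∷ τ) (suc M) h b e∉ hb = +-mono-≤
      (≤-trans (*-monoˡ-≤ (h (e ∷ y ∷ τ)) (⟦⟧≤1 (elem e (e ∷ take M (y ∷ τ))))) (≤-trans (≤-reflexive (+-identityʳ _)) (hb here)))
      (≤-trans (insSum-mono e τ (λ {σ} i → ≤-reflexive (cong (λ z → ⟦ z ∨ elem e (take M σ) ⟧ * h (y ∷ σ)) (does-false (e ≟ᴬ y) (λ q → e∉ (here q))))))
        (extract-one e τ M (λ σ → h (y ∷ σ)) b (λ m → e∉ (there m)) (λ i → hb (there i))))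

  elem-ins : ∀ {e x τ σ} M → x ≢ e → Ins e τ σ → elem x (take M σ) ≡ true → elem x (take M τ) ≡ true
  elem-ins {e} {x} {τ} (suc M) ne here q = grow τ M (drop-head q)
    where
    drop-head : does (x ≟ᴬ e) ∨ elem x (take M τ) ≡ true → elem x (take M τ) ≡ true
    drop-head rewrite does-false (x ≟ᴬ e) ne = id
    grow : ∀ τ M → elem x (take M τ) ≡ true → elem x (take (suc M) τ) ≡ true
    grow (y ∷ τ) (suc M) q with does (x ≟ᴬ y)
    ... | true = refl
    ... | false = grow τ M q
  elem-ins {e} {x} (suc M) ne (there {y} i) q with does (x ≟ᴬ y)
  ... | true = refl
  ... | false = elem-ins M ne i q

  allIn-ins : ∀ {e τ σ} M B → e ∉ B → Ins e τ σ → allIn B (take M σ) ≡ true → allIn B (take M τ) ≡ true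
  allIn-ins M [] e∉ i q = refl
  allIn-ins {e} {τ} {σ} M (x ∷ B) e∉ i q with ∧-elim {elem x (take M σ)} q
  ... | q₁ , q₂ = ∧-intro (elem-ins M (λ r → e∉ (here (sym r))) i q₁) (allIn-ins M B (λ m → e∉ (there m)) i q₂)

  avoid-ins : ∀ (p : A → Bool) {e τ σ} m → Ins e τ σ → avoid p m σ ≡ true → avoid p (m ∸ 1) τ ≡ true
  avoid-ins p zero i q = refl
  avoid-ins p {e} (suc m) here q = proj₂ (∧-elim {not (p e)} q)
  avoid-ins p (suc zero) (there i) q = refl
  avoid-ins p (suc (suc m)) (there {y} {τ} {σ} i) q with ∧-elim {not (p y)} q
  ... | q₁ , q₂ = ∧-intro q₁ (avoid-ins p (suc m) i q₂)

  -- Each item of `B` has at most `M` places. Deleting it moves the others forward by at most one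
  -- place, so among the rest one draw fewer is still known to avoid `p`.
  extract : ∀ p M m B L → Unique (B ++ L) →
            𝔼 (B ++ L) (λ σ → ⟦ allIn B (take M σ) ⟧ * ⟦ avoid p m σ ⟧) ≤ M ^ length B * 𝔼 L (λ τ → ⟦ avoid p (m ∸ length B) τ ⟧)
  extract p M m [] L _ = ≤-trans (𝔼-mono L λ {σ} _ → ≤-reflexive (+-identityʳ _)) (≤-reflexive (sym (+-identityʳ _)))
  extract p M m (e ∷ B) L (e∉ ∷ u) = begin
      𝔼 (B ++ L) (λ τ → insSum e τ (λ σ → ⟦ elem e (take M σ) ∧ allIn B (take M σ) ⟧ * ⟦ avoid p m σ ⟧))
        ≤⟨ 𝔼-mono (B ++ L) step ⟩
      𝔼 (B ++ L) (λ τ → M * (⟦ allIn B (take M τ) ⟧ * ⟦ avoid p (m ∸ 1) τ ⟧))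
        ≡⟨ 𝔼-* M (B ++ L) (λ τ → ⟦ allIn B (take M τ) ⟧ * ⟦ avoid p (m ∸ 1) τ ⟧) ⟩
      M * 𝔼 (B ++ L) (λ τ → ⟦ allIn B (take M τ) ⟧ * ⟦ avoid p (m ∸ 1) τ ⟧)
        ≤⟨ *-monoʳ-≤ M (extract p M (m ∸ 1) B L u) ⟩
      M * (M ^ length B * 𝔼 L (λ τ → ⟦ avoid p (m ∸ 1 ∸ length B) τ ⟧))
        ≡⟨ sym (*-assoc M (M ^ length B) _) ⟩
      M * M ^ length B * 𝔼 L (λ τ → ⟦ avoid p (m ∸ 1 ∸ length B) τ ⟧)
        ≡⟨ cong (λ k → M * M ^ length B * 𝔼 L (λ τ → ⟦ avoid p k τ ⟧)) (∸-+-assoc m 1 (length B)) ⟩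
      M * M ^ length B * 𝔼 L (λ τ → ⟦ avoid p (m ∸ suc (length B)) τ ⟧) ∎
    where
    open ≤-Reasoning
    ⟦∧⟧ : ∀ a b c → ⟦ a ∧ b ⟧ * c ≤ ⟦ a ⟧ * (⟦ b ⟧ * c)
    ⟦∧⟧ true b c = ≤-reflexive (sym (+-identityʳ _))
    ⟦∧⟧ false b c = z≤n
    step : ∀ {τ} → τ ↭ B ++ L → insSum e τ (λ σ → ⟦ elem e (take M σ) ∧ allIn B (take M σ) ⟧ * ⟦ avoid p m σ ⟧) ≤
                                 M * (⟦ allIn B (take M τ) ⟧ * ⟦ avoid p (m ∸ 1) τ ⟧)
    step {τ} q = ≤-trans (insSum-mono e τ (λ {σ} _ → ⟦∧⟧ (elem e (take M σ)) (allIn B (take M σ)) ⟦ avoid p m σ ⟧))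
        (extract-one e τ M (λ σ → ⟦ allIn B (take M σ) ⟧ * ⟦ avoid p m σ ⟧) _ (λ k → All.lookup e∉ (∈-resp-↭ q k) refl)
          (λ i → *-mono-≤ (⟦⟧-mono (allIn-ins M B (λ k → All.lookup e∉ (∈-++⁺ˡ k) refl) i)) (⟦⟧-mono (avoid-ins p m i))))

-- Listing all orderings explicitly.

sumL : ∀ {B : Set} → (B → ℕ) → List B → ℕ
sumL f [] = 0
sumL f (x ∷ xs) = f x + sumL f xs

sumL-++ : ∀ {B : Set} (f : B → ℕ) xs ys → sumL f (xs ++ ys) ≡ sumL f xs + sumL f ys
sumL-++ f [] ys = refl
sumL-++ f (x ∷ xs) ys = trans (cong (f x +_) (sumL-++ f xs ys)) (sym (+-assoc (f x) _ _))

sumL-map : ∀ {B D : Set} (f : D → ℕ) (g : B → D) xs → sumL f (map g xs) ≡ sumL (f ∘ g) xs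
sumL-map f g [] = refl
sumL-map f g (x ∷ xs) = cong (f (g x) +_) (sumL-map f g xs)

sumL-concatMap : ∀ {B D : Set} (f : D → ℕ) (g : B → List D) xs → sumL f (concatMap g xs) ≡ sumL (sumL f ∘ g) xs
sumL-concatMap f g [] = refl
sumL-concatMap f g (x ∷ xs) = trans (sumL-++ f (g x) _) (cong (sumL f (g x) +_) (sumL-concatMap f g xs))

sumL-cong : ∀ {B : Set} {f g : B → ℕ} → f ≗ g → ∀ xs → sumL f xs ≡ sumL g xs
sumL-cong h [] = refl
sumL-cong h (x ∷ xs) = cong₂ _+_ (h x) (sumL-cong h xs)

concatMap-∈ : ∀ {B D : Set} (g : B → List D) xs {z} → z ∈ concatMap g xs → ∃[ x ] x ∈ xs × z ∈ g x
concatMap-∈ g (x ∷ xs) m with ∈-++⁻ (g x) m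
... | inj₁ k = x , here refl , k
... | inj₂ k with concatMap-∈ g xs k
... | x' , p , q = x' , there p , q

unique-map : ∀ {B D : Set} (g : B → D) → (∀ {a b} → g a ≡ g b → a ≡ b) → ∀ {xs} → Unique xs → Unique (map g xs)
unique-map g inj [] = []
unique-map g inj {x ∷ xs} (a ∷ u) = All.tabulate (λ {z} m e → let y , k , q = map-preimage g xs m in All.lookup a k (inj (trans e (sym q)))) ∷ unique-map g inj u


module _ {A : Set} where

  insList : A → List A → List (List A)
  insList x [] = (x ∷ []) ∷ []
  insList x (y ∷ τ) = (x ∷ y ∷ τ) ∷ map (y ∷_) (insList x τ)

  orderings : List A → List (List A)
  orderings [] = [] ∷ []
  orderings (x ∷ L) = concatMap (insList x) (orderings L)

  sumL-insList : ∀ (f : List A → ℕ) x τ → sumL f (insList x τ) ≡ insSum x τ f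
  sumL-insList f x [] = +-identityʳ _
  sumL-insList f x (y ∷ τ) = cong (f (x ∷ y ∷ τ) +_) (trans (sumL-map f (y ∷_) (insList x τ)) (sumL-insList (f ∘ (y ∷_)) x τ))

  sumL-orderings : ∀ (f : List A → ℕ) L → sumL f (orderings L) ≡ 𝔼 L f
  sumL-orderings f [] = +-identityʳ _
  sumL-orderings f (x ∷ L) = trans (sumL-concatMap f (insList x) (orderings L))
    (trans (sumL-cong (sumL-insList f x) (orderings L)) (sumL-orderings (λ τ → insSum x τ f) L))

  insList-Ins : ∀ {x τ σ} → σ ∈ insList x τ → Ins x τ σ
  insList-Ins {τ = []} (here refl) = here
  insList-Ins {τ = y ∷ τ} (here refl) = here
  insList-Ins {x} {y ∷ τ} (there m) with map-preimage (y ∷_) (insList x τ) m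
  ... | ρ , k , refl = there (insList-Ins k)

  orderings-↭ : ∀ {L σ} → σ ∈ orderings L → σ ↭ L
  orderings-↭ {[]} (here refl) = ↭-refl
  orderings-↭ {x ∷ L} m with concatMap-∈ (insList x) (orderings L) m
  ... | τ , k , i = ↭-trans (Ins-↭ (insList-Ins i)) (prep x (orderings-↭ k))

  -- Deleting `x` recovers the list it was inserted into, so different orderings of the tail produce
  -- disjoint blocks in `orderings`.
  Ins-functional : ∀ {x : A} {τ τ' σ} → x ∉ τ → x ∉ τ' → Ins x τ σ → Ins x τ' σ → τ ≡ τ'
  Ins-functional a b here here = refl
  Ins-functional a b here (there i) = ⊥-elim (b (here refl))
  Ins-functional a b (there i) here = ⊥-elim (a (here refl))
  Ins-functional a b (there i) (there j) = cong (_ ∷_) (Ins-functional (a ∘ there) (b ∘ there) i j)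

  insList-unique : ∀ x τ → x ∉ τ → Unique (insList x τ)
  insList-unique x [] _ = [] ∷ []
  insList-unique x (y ∷ τ) h = All.tabulate heads ∷ unique-map (y ∷_) (λ { refl → refl }) (insList-unique x τ (h ∘ there))
    where
    heads : ∀ {z} → z ∈ map (y ∷_) (insList x τ) → x ∷ y ∷ τ ≢ z
    heads m refl with map-preimage (y ∷_) (insList x τ) m
    ... | ρ , _ , refl = h (here refl)

  orderings-unique : ∀ {L} → Unique L → Unique (orderings L)
  orderings-unique [] = [] ∷ []
  orderings-unique {x ∷ L} (a ∷ u) = go (orderings L) (orderings-unique u) (λ k m → All.lookup a (∈-resp-↭ (orderings-↭ k) m) refl)
    where
    go : ∀ ps → Unique ps → (∀ {τ} → τ ∈ ps → x ∉ τ) → Unique (concatMap (insList x) ps)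
    go [] _ _ = []
    go (τ ∷ ps) (b ∷ v) h = Unique-++ (insList-unique x τ (h (here refl))) (go ps v (h ∘ there)) disj
      where
      disj : ∀ {σ} → ¬ (σ ∈ insList x τ × σ ∈ concatMap (insList x) ps)
      disj (m , m') with concatMap-∈ (insList x) ps m'
      ... | τ' , k , i = All.lookup b k (Ins-functional (h (here refl)) (h (there k)) (insList-Ins m) (insList-Ins i))

-- The edges of the complete graph and their counts.

Edge : ℕ → Set
Edge n = Fin n × Fin n

_≟ᴱ_ : ∀ {n} (e f : Edge n) → Dec (e ≡ f)
_≟ᴱ_ = ≡-dec _≟_ _≟_

up? : ∀ {n} → U.Decidable {A = Edge n} (λ e → toℕ (proj₁ e) < toℕ (proj₂ e))
up? (i , j) = toℕ i <? toℕ j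

edges : ∀ n → List (Edge n)
edges n = filter up? (cartesianProduct (allFin n) (allFin n))

edges-∈ : ∀ {n} {i j : Fin n} → toℕ i < toℕ j → (i , j) ∈ edges n
edges-∈ {n} {i} {j} h = ∈-filter⁺ up? (∈-cartesianProduct⁺ (∈-allFin i) (∈-allFin j)) h

edges-up : ∀ {n} {e} → e ∈ edges n → toℕ (proj₁ e) < toℕ (proj₂ e)
edges-up {n} m = proj₂ (∈-filter⁻ up? {xs = cartesianProduct (allFin n) (allFin n)} m)

edges-unique : ∀ n → Unique (edges n)
edges-unique n = Unique-filter up? (Unique-cartesianProduct (allFin⁺ n) (allFin⁺ n))

below : ∀ {n} → Fin n → Fin n → Bool
below i j = does (toℕ i <? toℕ j)

count-filter : ∀ {A : Set} {P : A → Set} (P? : U.Decidable P) (p : A → Bool) L → count p (filter P? L) ≡ count (λ x → does (P? x) ∧ p x) L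
count-filter P? p [] = refl
count-filter P? p (x ∷ L) with does (P? x)
... | true = cong (⟦ p x ⟧ +_) (count-filter P? p L)
... | false = count-filter P? p L

count-map : ∀ {A B : Set} (g : A → B) p L → count p (map g L) ≡ count (p ∘ g) L
count-map g p [] = refl
count-map g p (x ∷ L) = cong (⟦ p (g x) ⟧ +_) (count-map g p L)

count-tab : ∀ {A : Set} {k} (f : Fin k → A) p → count p (tabulate f) ≡ ∑ λ i → ⟦ p (f i) ⟧
count-tab {k = zero} f p = refl
count-tab {k = suc k} f p = cong (⟦ p (f zero) ⟧ +_) (count-tab (f ∘ suc) p)

count-product : ∀ {A B : Set} {k} (f : Fin k → A) (ys : List B) p →
                count p (cartesianProduct (tabulate f) ys) ≡ ∑ λ i → count (λ b → p (f i , b)) ys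
count-product {k = zero} f ys p = refl
count-product {k = suc k} f ys p = trans (count-++ p (map (f zero ,_) ys) _)
  (cong₂ _+_ (count-map (f zero ,_) p ys) (count-product (f ∘ suc) ys p))

count-edges : ∀ {n} (p : Edge n → Bool) → count p (edges n) ≡ ∑ λ i → ∑ λ j → ⟦ below i j ∧ p (i , j) ⟧
count-edges {n} p = trans (count-filter up? p (cartesianProduct (allFin n) (allFin n)))
  (trans (count-product id (allFin n) q) (∑-cong λ i → count-tab id (λ j → q (i , j))))
  where
  q : Edge n → Bool
  q e = does (up? e) ∧ p e

trichotomy : ∀ {n} (i j : Fin n) → i ≢ j → ⟦ below i j ⟧ + ⟦ below j i ⟧ ≡ 1
trichotomy i j ne with <-cmp (toℕ i) (toℕ j)
... | tri< a _ c rewrite does-true (toℕ i <? toℕ j) a | does-false (toℕ j <? toℕ i) c = refl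
... | tri≈ _ b _ = ⊥-elim (ne (Finₚ.toℕ-injective b))
... | tri> a _ c rewrite does-false (toℕ i <? toℕ j) a | does-true (toℕ j <? toℕ i) c = refl

between : ∀ {n} → (Fin n → Bool) → (Fin n → Bool) → Edge n → Bool
between A B (i , j) = (A i ∧ B j) ∨ (B i ∧ A j)

⟦∧⟧≡* : ∀ a b → ⟦ a ∧ b ⟧ ≡ ⟦ a ⟧ * ⟦ b ⟧
⟦∧⟧≡* true b = sym (+-identityʳ _)
⟦∧⟧≡* false b = refl

Disjoint : ∀ {n} → (Fin n → Bool) → (Fin n → Bool) → Set
Disjoint A B = ∀ i → A i ≡ true → B i ≡ false

-- An edge is stored with increasing ends, so a pair in `A` times `B` appears in exactly one of the
-- two halves of `between`; exchanging the sums in the second half brings both together.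
count-between : ∀ {n} (A B : Fin n → Bool) → Disjoint A B → count (between A B) (edges n) ≡ card A * card B
count-between {n} A B disj = begin
    count (between A B) (edges n)                                                     ≡⟨ count-edges (between A B) ⟩
    ∑ (λ i → ∑ λ j → ⟦ below i j ∧ between A B (i , j) ⟧)                             ≡⟨ ∑-cong (λ i → trans (∑-cong λ j → split i j) (∑-+ (λ j → u i j) (λ j → v i j))) ⟩
    ∑ (λ i → ∑ (λ j → u i j) + ∑ (λ j → v i j))                                       ≡⟨ ∑-+ (λ i → ∑ (λ j → u i j)) (λ i → ∑ (λ j → v i j)) ⟩
    ∑ (λ i → ∑ (λ j → u i j)) + ∑ (λ i → ∑ (λ j → v i j))                             ≡⟨ cong (∑ (λ i → ∑ (λ j → u i j)) +_) (∑-swap v) ⟩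
    ∑ (λ i → ∑ (λ j → u i j)) + ∑ (λ i → ∑ (λ j → v j i))                             ≡⟨ sym (∑-+ (λ i → ∑ (λ j → u i j)) _) ⟩
    ∑ (λ i → ∑ (λ j → u i j) + ∑ (λ j → v j i))                                       ≡⟨ ∑-cong (λ i → trans (sym (∑-+ (λ j → u i j) (λ j → v j i))) (trans (∑-cong λ j → merge i j) (∑-*ˡ ⟦ A i ⟧ (⟦_⟧ ∘ B)))) ⟩
    ∑ (λ i → ⟦ A i ⟧ * card B)                                                        ≡⟨ ∑-cong (λ i → *-comm ⟦ A i ⟧ (card B)) ⟩
    ∑ (λ i → card B * ⟦ A i ⟧)                                                        ≡⟨ trans (∑-*ˡ (card B) (⟦_⟧ ∘ A)) (*-comm (card B) (card A)) ⟩
    card A * card B                                                                   ∎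
  where
  open ≡-Reasoning
  u v : Fin n → Fin n → ℕ
  u i j = ⟦ below i j ⟧ * (⟦ A i ⟧ * ⟦ B j ⟧)
  v i j = ⟦ below i j ⟧ * (⟦ A j ⟧ * ⟦ B i ⟧)
  split : ∀ i j → ⟦ below i j ∧ between A B (i , j) ⟧ ≡ u i j + v i j
  split i j = trans (⟦∧⟧≡* (below i j) _) (trans (cong (⟦ below i j ⟧ *_) (inner (A i) (B i) (A j) (B j) (disj i))) (*-distribˡ-+ ⟦ below i j ⟧ _ _))
    where
    inner : ∀ a b a' b' → (a ≡ true → b ≡ false) → ⟦ (a ∧ b') ∨ (b ∧ a') ⟧ ≡ ⟦ a ⟧ * ⟦ b' ⟧ + ⟦ a' ⟧ * ⟦ b ⟧
    inner true b a' b' h rewrite h refl | *-zeroʳ ⟦ a' ⟧ with b'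
    ... | true = refl
    ... | false = refl
    inner false true a' b' h = sym (*-identityʳ ⟦ a' ⟧)
    inner false false a' b' h = sym (*-zeroʳ ⟦ a' ⟧)
  merge : ∀ i j → u i j + v j i ≡ ⟦ A i ⟧ * ⟦ B j ⟧
  merge i j with i ≟ j
  ... | no ne = trans (sym (*-distribʳ-+ (⟦ A i ⟧ * ⟦ B j ⟧) ⟦ below i j ⟧ ⟦ below j i ⟧)) (trans (cong (_* (⟦ A i ⟧ * ⟦ B j ⟧)) (trichotomy i j ne)) (+-identityʳ _))
  ... | yes refl = trans (cong (λ z → ⟦ below i i ⟧ * z + ⟦ below i i ⟧ * z) zero') (trans (cong₂ _+_ (*-zeroʳ ⟦ below i i ⟧) (*-zeroʳ ⟦ below i i ⟧)) (sym zero'))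
    where
    zero' : ⟦ A i ⟧ * ⟦ B i ⟧ ≡ 0
    zero' with A i | disj i
    ... | true | h rewrite h refl = refl
    ... | false | _ = refl

count-true : ∀ {A : Set} (L : List A) → count (λ _ → true) L ≡ length L
count-true [] = refl
count-true (x ∷ L) = cong suc (count-true L)

nC2 : ∀ n → 2 * (suc n C 2) ≡ suc n * n
nC2 zero = refl
nC2 (suc n) = begin
    2 * (suc (suc n) C 2)               ≡⟨ cong (2 *_) (sym (nCk+nC[k+1]≡[n+1]C[k+1] (suc n) 1)) ⟩
    2 * (suc n C 1 + suc n C 2)         ≡⟨ cong (λ z → 2 * (z + suc n C 2)) (nC1≡n (suc n)) ⟩
    2 * (suc n + suc n C 2)             ≡⟨ *-distribˡ-+ 2 (suc n) _ ⟩
    2 * suc n + 2 * (suc n C 2)         ≡⟨ cong (2 * suc n +_) (nC2 n) ⟩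
    2 * suc n + suc n * n               ≡⟨ arith n ⟩
    suc (suc n) * suc n                 ∎
  where
  open ≡-Reasoning
  arith : ∀ n → 2 * suc n + suc n * n ≡ suc (suc n) * suc n
  arith = solve-∀

2length-edges : ∀ m → 2 * length (edges m) ≡ m * (m ∸ 1)
2length-edges m = begin
    2 * length (edges m)                                                              ≡⟨ cong (2 *_) (trans (sym (count-true (edges m))) (count-edges {m} (λ _ → true))) ⟩
    2 * ∑ {m} (λ i → ∑ λ j → ⟦ below i j ∧ true ⟧)                                    ≡⟨ cong (2 *_) (∑-cong {m} λ i → ∑-cong {m} λ j → trans (⟦∧⟧≡* (below i j) true) (*-identityʳ ⟦ below i j ⟧)) ⟩
    2 * s                                                                             ≡⟨ cong (s +_) (+-identityʳ s) ⟩
    s + s                                                                             ≡⟨ cong (s +_) (∑-swap {m} {m} (λ i j → ⟦ below i j ⟧)) ⟩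
    s + ∑ {m} (λ i → ∑ λ j → ⟦ below j i ⟧)                                           ≡⟨ sym (∑-+ {m} (λ i → ∑ λ j → ⟦ below i j ⟧) (λ i → ∑ λ j → ⟦ below j i ⟧)) ⟩
    ∑ {m} (λ i → ∑ (λ j → ⟦ below i j ⟧) + ∑ (λ j → ⟦ below j i ⟧))                   ≡⟨ ∑-cong row ⟩
    ∑ {m} (λ _ → m ∸ 1)                                                               ≡⟨ ∑-const {m} (m ∸ 1) ⟩
    m * (m ∸ 1)                                                                       ∎
  where
  open ≡-Reasoning
  s = ∑ {m} λ i → ∑ {m} λ j → ⟦ below i j ⟧
  row : ∀ i → ∑ {m} (λ j → ⟦ below i j ⟧) + ∑ {m} (λ j → ⟦ below j i ⟧) ≡ m ∸ 1
  row i = trans (sym (∑-+ (λ j → ⟦ below i j ⟧) (λ j → ⟦ below j i ⟧))) (trans (∑-cong pt)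
      (cong (_∸ 1) (trans (cong (_+ card (λ j → not (j == i))) (sym (card-single i))) (card-not (_== i)))))
    where
    pt : ∀ j → ⟦ below i j ⟧ + ⟦ below j i ⟧ ≡ ⟦ not (j == i) ⟧
    pt j with j ≟ i
    ... | no ne = trichotomy i j (ne ∘ sym)
    ... | yes refl rewrite does-false (toℕ j <? toℕ j) (<-irrefl refl) = refl

length-edges : ∀ n → length (edges n) ≡ n C 2
length-edges zero = refl
length-edges (suc n) = *-cancelˡ-≡ _ _ 2 (trans (2length-edges (suc n)) (sym (nC2 n)))

-- Prefixes of orderings, adjacency and decidable connectivity.

avoid-false : ∀ {A : Set} (p : A → Bool) m σ → avoid p m σ ≡ false → ∃[ e ] e ∈ take m σ × p e ≡ true
avoid-false p (suc m) (x ∷ σ) h with p x in eq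
... | true = x , here refl , eq
... | false with avoid-false p m σ h
... | e , k , q = e , there k , q

avoid-true : ∀ {A : Set} (p : A → Bool) m σ → avoid p m σ ≡ true → ∀ {e} → e ∈ take m σ → p e ≡ false
avoid-true p (suc m) (x ∷ σ) h (here refl) = not-false (proj₁ (∧-elim {not (p x)} h))
avoid-true p (suc m) (x ∷ σ) h (there k) = avoid-true p m σ (proj₂ (∧-elim {not (p x)} h)) k

avoid-cong : ∀ {A : Set} {p q : A → Bool} → p ≗ q → ∀ m σ → avoid p m σ ≡ avoid q m σ
avoid-cong e zero σ = refl
avoid-cong e (suc m) [] = refl
avoid-cong e (suc m) (x ∷ σ) = cong₂ (λ a b → not a ∧ b) (e x) (avoid-cong e m σ)

avoid-take : ∀ {A : Set} (p : A → Bool) m σ → avoid p m (take m σ) ≡ avoid p m σ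
avoid-take p zero σ = refl
avoid-take p (suc m) [] = refl
avoid-take p (suc m) (x ∷ σ) = cong (not (p x) ∧_) (avoid-take p m σ)

take-mono : ∀ {A : Set} {m m'} {σ : List A} {e} → m ≤ m' → e ∈ take m σ → e ∈ take m' σ
take-mono {m = suc m} {suc m'} {x ∷ σ} h (here q) = here q
take-mono {m = suc m} {suc m'} {x ∷ σ} (s≤s h) (there k) = there (take-mono h k)

take-drop⁻ : ∀ {A : Set} m₁ m {σ : List A} {e} → e ∈ take m σ → e ∈ take m₁ σ ⊎ e ∈ take (m ∸ m₁) (drop m₁ σ)
take-drop⁻ zero m k = inj₂ k
take-drop⁻ (suc m₁) (suc m) {x ∷ σ} (here q) = inj₁ (here q)
take-drop⁻ (suc m₁) (suc m) {x ∷ σ} (there k) with take-drop⁻ m₁ m {σ} k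
... | inj₁ a = inj₁ (there a)
... | inj₂ b = inj₂ b

∉-take-[] : ∀ {A : Set} k {e : A} → e ∉ take k []
∉-take-[] zero ()
∉-take-[] (suc k) ()

take-drop⁺ : ∀ {A : Set} m₁ {m} {σ : List A} {e} → m₁ ≤ m → e ∈ take (m ∸ m₁) (drop m₁ σ) → e ∈ take m σ
take-drop⁺ zero h k = k
take-drop⁺ (suc m₁) {suc m} {[]} (s≤s h) k = ⊥-elim (∉-take-[] (m ∸ m₁) k)
take-drop⁺ (suc m₁) {suc m} {x ∷ σ} (s≤s h) k = there (take-drop⁺ m₁ h k)

take-⊆ : ∀ {A : Set} m {σ : List A} {e} → e ∈ take m σ → e ∈ σ
take-⊆ (suc m) {x ∷ σ} (here q) = here q
take-⊆ (suc m) {x ∷ σ} (there k) = there (take-⊆ m k)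

take-length++ : ∀ {A : Set} m (p τ : List A) → length p ≡ m → take m (p ++ τ) ≡ p
take-length++ zero [] τ _ = refl
take-length++ (suc m) (x ∷ p) τ h = cong (x ∷_) (take-length++ m p τ (suc-injective h))

drop-length++ : ∀ {A : Set} m (p τ : List A) → length p ≡ m → drop m (p ++ τ) ≡ τ
drop-length++ zero [] τ _ = refl
drop-length++ (suc m) (x ∷ p) τ h = drop-length++ m p τ (suc-injective h)

module _ {n : ℕ} where
  open Extract (_≟ᴱ_ {n}) public

  adjᴸ : EdgeList n → Fin n → Fin n → Bool
  adjᴸ P u v = elem (u , v) P ∨ elem (v , u) P

  adjᴸ⇒Adj : ∀ P {u v} → adjᴸ P u v ≡ true → Adj P u v
  adjᴸ⇒Adj P {u} {v} h with ∨-elim {elem (u , v) P} h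
  ... | inj₁ q = inj₁ (elem⇒∈ P q)
  ... | inj₂ q = inj₂ (elem⇒∈ P q)

  Adj⇒adjᴸ : ∀ {P : EdgeList n} {u v} → Adj P u v → adjᴸ P u v ≡ true
  Adj⇒adjᴸ (inj₁ k) = ∨-introˡ (∈⇒elem k)
  Adj⇒adjᴸ {P} {u} {v} (inj₂ k) = ∨-introʳ {elem (u , v) P} (∈⇒elem k)

  adjᴸ-sym : ∀ P u v → adjᴸ P u v ≡ true → adjᴸ P v u ≡ true
  adjᴸ-sym P u v h with ∨-elim {elem (u , v) P} h
  ... | inj₁ q = ∨-introʳ {elem (v , u) P} q
  ... | inj₂ q = ∨-introˡ q

  between-elim : ∀ {A B : Fin n → Bool} {L : EdgeList n} {e} → e ∈ L → between A B e ≡ true → ∃[ a ] ∃[ b ] A a ≡ true × B b ≡ true × Adj L a b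
  between-elim {A} {B} {e = i , j} k h with ∨-elim {A i ∧ B j} h
  ... | inj₁ q = i , j , proj₁ (∧-elim {A i} q) , proj₂ (∧-elim {A i} q) , inj₁ k
  ... | inj₂ q = j , i , proj₂ (∧-elim {B i} q) , proj₁ (∧-elim {B i} q) , inj₂ k

  between-intro : ∀ {A B : Fin n → Bool} {L : EdgeList n} {a b} → A a ≡ true → B b ≡ true → Adj L a b → ∃[ e ] e ∈ L × between A B e ≡ true
  between-intro p q (inj₁ k) = _ , k , ∨-introˡ (∧-intro p q)
  between-intro {A} {B} {a = a} {b} p q (inj₂ k) = _ , k , ∨-introʳ {A b ∧ B a} (∧-intro q p)

  adj-flip : ∀ {L : EdgeList n} {u v} → Adj L u v → Adj L v u
  adj-flip (inj₁ p) = inj₂ p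
  adj-flip (inj₂ p) = inj₁ p

  adj-⊆ : ∀ {L L' : EdgeList n} → (∀ {e} → e ∈ L → e ∈ L') → ∀ {u v} → Adj L u v → Adj L' u v
  adj-⊆ h (inj₁ p) = inj₁ (h p)
  adj-⊆ h (inj₂ p) = inj₂ (h p)

  star-⊆ : ∀ {L L' : EdgeList n} → (∀ {e} → e ∈ L → e ∈ L') → ∀ {u v} → Star (Adj L) u v → Star (Adj L') u v
  star-⊆ h ε = ε
  star-⊆ h (a ◅ s) = adj-⊆ h a ◅ star-⊆ h s

  star-flip : ∀ {L : EdgeList n} {u v} → Star (Adj L) u v → Star (Adj L) v u
  star-flip ε = ε
  star-flip (a ◅ s) = star-flip s ◅◅ (adj-flip a ◅ ε)

  -- By induction on the edges: a walk either does without the newest edge or can be shortened so as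
  -- to cross it once, in one of the two directions.
  reach? : ∀ (L : EdgeList n) u v → Dec (Star (Adj L) u v)
  reach? [] u v with u ≟ v
  ... | yes refl = yes ε
  ... | no ne = no λ { ε → ne refl ; (inj₁ () ◅ _) ; (inj₂ () ◅ _) }
  reach? ((a , b) ∷ L) u v = decide (reach? L u v) (reach? L u a ×-dec reach? L b v) (reach? L u b ×-dec reach? L a v)
    where
    ab : Adj ((a , b) ∷ L) a b
    ab = inj₁ (here refl)
    up : ∀ {x y} → Star (Adj L) x y → Star (Adj ((a , b) ∷ L)) x y
    up = star-⊆ there
    cases : ∀ {x} → Star (Adj ((a , b) ∷ L)) x v →
            Star (Adj L) x v ⊎ (Star (Adj L) x a × Star (Adj L) b v) ⊎ (Star (Adj L) x b × Star (Adj L) a v)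
    cases ε = inj₁ ε
    cases (inj₁ (here refl) ◅ s) with cases s
    ... | inj₁ q = inj₂ (inj₁ (ε , q))
    ... | inj₂ (inj₁ (_ , q)) = inj₂ (inj₁ (ε , q))
    ... | inj₂ (inj₂ (_ , q)) = inj₁ q
    cases (inj₂ (here refl) ◅ s) with cases s
    ... | inj₁ q = inj₂ (inj₂ (ε , q))
    ... | inj₂ (inj₁ (_ , q)) = inj₁ q
    ... | inj₂ (inj₂ (_ , q)) = inj₂ (inj₂ (ε , q))
    cases (inj₁ (there k) ◅ s) with cases s
    ... | inj₁ q = inj₁ (inj₁ k ◅ q)
    ... | inj₂ (inj₁ (p , q)) = inj₂ (inj₁ (inj₁ k ◅ p , q))
    ... | inj₂ (inj₂ (p , q)) = inj₂ (inj₂ (inj₁ k ◅ p , q))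
    cases (inj₂ (there k) ◅ s) with cases s
    ... | inj₁ q = inj₁ (inj₂ k ◅ q)
    ... | inj₂ (inj₁ (p , q)) = inj₂ (inj₁ (inj₂ k ◅ p , q))
    ... | inj₂ (inj₂ (p , q)) = inj₂ (inj₂ (inj₂ k ◅ p , q))
    decide : Dec (Star (Adj L) u v) → Dec (Star (Adj L) u a × Star (Adj L) b v) → Dec (Star (Adj L) u b × Star (Adj L) a v) →
             Dec (Star (Adj ((a , b) ∷ L)) u v)
    decide (yes p) _ _ = yes (up p)
    decide _ (yes (p , q)) _ = yes (up p ◅◅ (ab ◅ up q))
    decide _ _ (yes (p , q)) = yes (up p ◅◅ (adj-flip {(a , b) ∷ L} ab ◅ up q))
    decide (no h) (no k) (no k') = no λ s → refute (cases s)
      where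
      refute : _ ⊎ _ ⊎ _ → ⊥
      refute (inj₁ q) = h q
      refute (inj₂ (inj₁ q)) = k q
      refute (inj₂ (inj₂ q)) = k' q

  connected? : ∀ (L : EdgeList n) → Dec (Connected L)
  connected? L = Finₚ.all? λ u → Finₚ.all? λ v → reach? L u v

least : ∀ {P : ℕ → Set} → (∀ m → Dec (P m)) → ∀ k → P k → ∃[ m ] m ≤ k × P m × (∀ j → j < m → ¬ P j)
least d zero p = zero , z≤n , p , λ _ ()
least {P} d (suc k) p with d zero
... | yes q = zero , z≤n , q , λ _ ()
... | no h with least {P ∘ suc} (d ∘ suc) k p
... | m , le , q , below = suc m , s≤s le , q , λ { zero _ q₀ → h q₀ ; (suc j) (s≤s lt) → below j lt }

-- Sums over all subsets and over all vertex lists of a given length.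

consᵇ : ∀ {n} → Bool → (Fin n → Bool) → Fin (suc n) → Bool
consᵇ b p zero = b
consᵇ b p (suc i) = p i

∑ˢ : ∀ {n} → ((Fin n → Bool) → ℕ) → ℕ
∑ˢ {zero} F = F λ ()
∑ˢ {suc n} F = ∑ˢ (F ∘ consᵇ true) + ∑ˢ (F ∘ consᵇ false)

∑ˢ-bound : ∀ {n} (F : (Fin n → Bool) → ℕ) c → (∀ p → F p ≤ c) → ∑ˢ F ≤ 2 ^ n * c
∑ˢ-bound {zero} F c h = ≤-trans (h _) (≤-reflexive (sym (+-identityʳ c)))
∑ˢ-bound {suc n} F c h = ≤-trans (+-mono-≤ (∑ˢ-bound (F ∘ consᵇ true) c (h ∘ consᵇ true)) (∑ˢ-bound (F ∘ consᵇ false) c (h ∘ consᵇ false))) (≤-reflexive (arith (2 ^ n) c))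
  where
  arith : ∀ a c → a * c + a * c ≡ 2 * a * c
  arith = solve-∀

∑ˢ-cong : ∀ {k} {F G : (Fin k → Bool) → ℕ} → (∀ p → F p ≡ G p) → ∑ˢ F ≡ ∑ˢ G
∑ˢ-cong {zero} h = h _
∑ˢ-cong {suc k} {F} {G} h = cong₂ _+_ (∑ˢ-cong {F = F ∘ consᵇ true} {G ∘ consᵇ true} (h ∘ consᵇ true))
                                      (∑ˢ-cong {F = F ∘ consᵇ false} {G ∘ consᵇ false} (h ∘ consᵇ false))

-- The sum evaluates `F` only at sets assembled by `consᵇ`; vanishing has to be carried over to
-- other functions with the same values.
∑ˢ-zero : ∀ {n} (F : (Fin n → Bool) → ℕ) → (∀ {p q} → p ≗ q → F p ≡ 0 → F q ≡ 0) → ∑ˢ F ≡ 0 → ∀ p → F p ≡ 0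
∑ˢ-zero {zero} F ext h p = ext (λ ()) h
∑ˢ-zero {suc n} F ext h p with p zero in eq
... | true = ext (λ { zero → sym eq ; (suc i) → refl }) (∑ˢ-zero (F ∘ consᵇ true) (λ e → ext λ { zero → refl ; (suc i) → e i }) (m+n≡0⇒m≡0 _ h) (p ∘ suc))
... | false = ext (λ { zero → sym eq ; (suc i) → refl }) (∑ˢ-zero (F ∘ consᵇ false) (λ e → ext λ { zero → refl ; (suc i) → e i }) (m+n≡0⇒n≡0 (∑ˢ (F ∘ consᵇ true)) h) (p ∘ suc))

𝔼-∑ˢ : ∀ {A : Set} (L : List A) {n} (f : (Fin n → Bool) → List A → ℕ) → 𝔼 L (λ σ → ∑ˢ λ p → f p σ) ≡ ∑ˢ λ p → 𝔼 L (f p)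
𝔼-∑ˢ L {zero} f = refl
𝔼-∑ˢ L {suc n} f = trans (𝔼-+ L _ _) (cong₂ _+_ (𝔼-∑ˢ L {n} _) (𝔼-∑ˢ L {n} _))

∑ᴸ : ∀ {n} → ℕ → (List (Fin n) → ℕ) → ℕ
∑ᴸ zero F = F []
∑ᴸ (suc k) F = ∑ λ v → ∑ᴸ k λ L → F (v ∷ L)

∑-zero : ∀ {n} (f : Fin n → ℕ) → ∑ f ≡ 0 → ∀ i → f i ≡ 0
∑-zero f h i = n≤0⇒n≡0 (≤-trans (term≤∑ f i) (≤-reflexive h))

∑ᴸ-zero : ∀ {n} k (F : List (Fin n) → ℕ) → ∑ᴸ k F ≡ 0 → ∀ L → length L ≡ k → F L ≡ 0
∑ᴸ-zero zero F h [] refl = h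
∑ᴸ-zero (suc k) F h (v ∷ L) refl = ∑ᴸ-zero k _ (∑-zero _ h v) L refl

𝔼-∑ᴸ : ∀ {A : Set} (X : List A) {n} k (f : List (Fin n) → List A → ℕ) → 𝔼 X (λ σ → ∑ᴸ k λ L → f L σ) ≡ ∑ᴸ k λ L → 𝔼 X (f L)
𝔼-∑ᴸ X zero f = refl
𝔼-∑ᴸ X (suc k) f = trans (𝔼-∑ X (λ v σ → ∑ᴸ k λ L → f (v ∷ L) σ)) (∑-cong λ v → 𝔼-∑ᴸ X k (λ L → f (v ∷ L)))

∑ᴸ-mono : ∀ {n} k {F G : List (Fin n) → ℕ} → (∀ L → length L ≡ k → F L ≤ G L) → ∑ᴸ k F ≤ ∑ᴸ k G
∑ᴸ-mono zero h = h [] refl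
∑ᴸ-mono (suc k) h = ∑-mono λ v → ∑ᴸ-mono k λ L e → h (v ∷ L) (cong suc e)

∑ᴸ-* : ∀ {n} c k (F : List (Fin n) → ℕ) → ∑ᴸ k (λ L → c * F L) ≡ c * ∑ᴸ k F
∑ᴸ-* c zero F = refl
∑ᴸ-* c (suc k) F = trans (∑-cong λ v → ∑ᴸ-* c k (λ L → F (v ∷ L))) (∑-*ˡ c (λ v → ∑ᴸ k λ L → F (v ∷ L)))

⟦⟧-zero : ∀ {b} → ⟦ b ⟧ ≡ 0 → b ≡ false
⟦⟧-zero {false} _ = refl

⟦⟧*-zero : ∀ {a b} → ⟦ a ⟧ * b ≡ 0 → a ≡ true → b ≡ 0
⟦⟧*-zero {true} {b} h _ = trans (sym (+-identityʳ b)) h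

between-cong : ∀ {n} {A A' B B' : Fin n → Bool} → A ≗ A' → B ≗ B' → between A B ≗ between A' B'
between-cong e f (i , j) = cong₂ _∨_ (cong₂ _∧_ (e i) (f j)) (cong₂ _∧_ (f i) (e j))

disjointᵇ : ∀ {n} → (Fin n → Bool) → (Fin n → Bool) → Bool
disjointᵇ A B = not (anyᵇ λ i → A i ∧ B i)

disjointᵇ-intro : ∀ {n} {A B : Fin n → Bool} → Disjoint A B → disjointᵇ A B ≡ true
disjointᵇ-intro {A = A} {B} h = not-true (¬true λ q → let i , r = anyᵇ-elim {p = λ i → A i ∧ B i} q in true≢false (proj₂ (∧-elim {A i} r)) (h i (proj₁ (∧-elim {A i} r))))

disjointᵇ-elim : ∀ {n} {A B : Fin n → Bool} → disjointᵇ A B ≡ true → Disjoint A B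
disjointᵇ-elim {A = A} {B} q i a = ¬true λ b → true≢false (anyᵇ-intro {p = λ i → A i ∧ B i} i (∧-intro a b)) (not-false q)

does-elim : ∀ {A : Set} (d : Dec A) → does d ≡ true → A
does-elim (yes a) _ = a

does-elim′ : ∀ {A : Set} (d : Dec A) → does d ≡ false → ¬ A
does-elim′ (no h) _ = h

single : ∀ {n} → Fin n → Fin n → Bool
single v i = i == v

others : ∀ {n} → Fin n → Fin n → Bool
others v i = not (i == v)

uniqueᵇ : ∀ {n} → List (Fin n) → Bool
uniqueᵇ [] = true
uniqueᵇ (x ∷ L) = not (mem x L) ∧ uniqueᵇ L

lastOf : ∀ {n} → Fin n → List (Fin n) → Fin n
lastOf v [] = v
lastOf v (u ∷ L) = lastOf u L

mkEdge : ∀ {n} → Fin n → Fin n → Edge n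
mkEdge u v = if below u v then (u , v) else (v , u)

-- Events of the graph process

module Events (n m₁ m₋ m₊ μ h Δ ℓ : ℕ)
              (build : (adj : Fin n → Fin n → Bool) → (∀ u v → adj u v ≡ true → adj v u ≡ true) →
                       (∀ (A B : Fin n → Bool) → (∀ i → A i ≡ true → B i ≡ false) → μ ≤ card A → μ ≤ card B →
                         ∃[ a ] ∃[ b ] A a ≡ true × B b ≡ true × adj a b ≡ true) → Structure adj h μ) where

  bigPair : (A B : Fin n → Bool) → Bool
  bigPair A B = disjointᵇ A B ∧ (does (μ ≤? card A) ∧ does (μ ≤? card B))

  unjoined : EdgeList n → ℕ
  unjoined P = ∑ˢ λ A → ∑ˢ λ B → ⟦ bigPair A B ⟧ * ⟦ avoid (between A B) m₁ P ⟧

  degree : EdgeList n → Fin n → ℕ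
  degree P v = count (between (single v) (others v)) (take m₁ P)

  crowded : EdgeList n → ℕ
  crowded P = ∑ λ v → ⟦ does (Δ ≤? degree P v) ⟧

  isolated : EdgeList n → ℕ
  isolated σ = ∑ λ v → ⟦ avoid (between (single v) (others v)) m₋ σ ⟧

  noneIsolated : EdgeList n → ℕ
  noneIsolated σ = ⟦ does (isolated σ ≟ⁿ 0) ⟧

  module Given (P : EdgeList n) (S : Structure (adjᴸ P) h μ) where
    open Structure S

    baseEdge : Fin n → Edge n → Bool
    baseEdge v = between (single v) base

    unattached : EdgeList n → ℕ
    unattached τ = ∑ λ v → ⟦ not (base v) ∧ avoid (baseEdge v) m₁ P ⟧ * ⟦ avoid (baseEdge v) (m₊ ∸ m₁) τ ⟧

    weak : EdgeList n → Fin n → Bool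
    weak τ v = (not (base v) ∧ avoid (baseEdge v) m₁ P) ∧ avoid (baseEdge v) (m₋ ∸ m₁) τ

    sameCell : List (Cell n) → Fin n → Fin n → Bool
    sameCell [] u v = false
    sameCell (c ∷ cs) u v = (mem u (flat c) ∧ mem v (flat c)) ∨ sameCell cs u v

    linked : Fin n → Fin n → Bool
    linked u v = adjᴸ P u v ∨ sameCell cells u v

    -- Steps available at time `m₁`, by an edge or inside a cell, cost nothing. Each remaining step
    -- requires its edge to arrive between `m₁` and `m₊`.
    fresh : Fin n → List (Fin n) → EdgeList n
    fresh u [] = []
    fresh u (v ∷ L) = if linked u v then fresh v L else mkEdge u v ∷ fresh v L

    endpoints : Fin n → List (Fin n) → Fin n → Bool
    endpoints u L i = (i == u) ∨ (i == lastOf u L)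

    -- The part of the event that is settled by the path and the first `m₁` edges. The path is
    -- simple, so that its new edges are distinct and can be extracted independently.
    admissible : Fin n → List (Fin n) → Bool
    admissible u L = uniqueᵇ (u ∷ L) ∧ (not (lastOf u L == u) ∧ (disjointᵇ (endpoints u L) base ∧ avoid (between (endpoints u L) base) m₁ P))

    nearPath : Fin n → List (Fin n) → EdgeList n → ℕ
    nearPath u L τ = ⟦ admissible u L ⟧ * (⟦ allIn (fresh u L) (take (m₊ ∸ m₁) τ) ⟧ * ⟦ avoid (between (endpoints u L) base) (m₋ ∸ m₁) τ ⟧)

    nearPairs : EdgeList n → ℕ
    nearPairs τ = ∑ {ℓ} λ k → ∑ λ u → ∑ᴸ (toℕ k) λ L → nearPath u L τ

  joined-of : ∀ P → unjoined P ≡ 0 → ∀ (A B : Fin n → Bool) → (∀ i → A i ≡ true → B i ≡ false) → μ ≤ card A → μ ≤ card B →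
              ∃[ a ] ∃[ b ] A a ≡ true × B b ≡ true × adjᴸ (take m₁ P) a b ≡ true
  joined-of P z A B disj a b = finish (avoid-false (between A B) m₁ P (⟦⟧-zero (⟦⟧*-zero at-AB
      (∧-intro (disjointᵇ-intro disj) (∧-intro (does-true (μ ≤? card A) a) (does-true (μ ≤? card B) b))))))
    where
    term : (A B : Fin n → Bool) → ℕ
    term A B = ⟦ bigPair A B ⟧ * ⟦ avoid (between A B) m₁ P ⟧
    any-cong : ∀ {k} {p q : Fin k → Bool} → p ≗ q → anyᵇ p ≡ anyᵇ q
    any-cong {zero} e = refl
    any-cong {suc k} e = cong₂ _∨_ (e zero) (any-cong (e ∘ suc))
    term-cong : ∀ {A A' B B'} → A ≗ A' → B ≗ B' → term A B ≡ term A' B'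
    term-cong e f = cong₂ (λ x y → ⟦ x ⟧ * ⟦ y ⟧) (cong₂ (λ x y → not x ∧ y) (any-cong λ i → cong₂ _∧_ (e i) (f i))
      (cong₂ (λ x y → does (μ ≤? x) ∧ does (μ ≤? y)) (card-cong e) (card-cong f))) (avoid-cong (between-cong e f) m₁ P)
    at-A : ∑ˢ (term A) ≡ 0
    at-A = ∑ˢ-zero (λ A → ∑ˢ (term A)) (λ {p} {p'} e q → trans (∑ˢ-cong {F = term p'} {term p} λ B → term-cong {p'} {p} {B} {B} (sym ∘ e) (λ _ → refl)) q) z A
    at-AB : term A B ≡ 0
    at-AB = ∑ˢ-zero (term A) (λ {p} {p'} e q → trans (term-cong {A} {A} {p'} {p} (λ _ → refl) (sym ∘ e)) q) at-A B
    finish : ∃[ e ] e ∈ take m₁ P × between A B e ≡ true → ∃[ a ] ∃[ b ] A a ≡ true × B b ≡ true × adjᴸ (take m₁ P) a b ≡ true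
    finish (e , k , q) with between-elim {A = A} {B} k q
    ... | a , b , p , r , ad = a , b , p , r , Adj⇒adjᴸ ad

  structureOf : ∀ P → length P ≤ m₁ → unjoined P ≡ 0 → Structure (adjᴸ P) h μ
  structureOf P le z = build (adjᴸ P) (adjᴸ-sym P) (subst (λ Q → ∀ (A B : Fin n → Bool) → (∀ i → A i ≡ true → B i ≡ false) → μ ≤ card A → μ ≤ card B →
              ∃[ a ] ∃[ b ] A a ≡ true × B b ≡ true × adjᴸ Q a b ≡ true) (take-all m₁ P le) (joined-of P z))

  -- The structure is a function of `P` alone. A prefix without it gets the value 0, since
  -- `unjoined` and `crowded` already count that failure.
  conditionalOn : ∀ P (τ : EdgeList n) → Dec (length P ≤ m₁) → Dec (unjoined P + crowded P ≡ 0) → ℕ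
  conditionalOn P τ (yes le) (yes z) = Given.unattached P S τ + Given.nearPairs P S τ
    where S = structureOf P le (m+n≡0⇒m≡0 _ z)
  conditionalOn P τ _ _ = 0

  conditional : EdgeList n → EdgeList n → ℕ
  conditional P τ = conditionalOn P τ (length P ≤? m₁) (unjoined P + crowded P ≟ⁿ 0)

  -- Failures are counted by natural numbers. An ordering with some failure contributes at least
  -- one, so `𝔼` of this sum is union bound and Markov's inequality at once.
  bad : EdgeList n → ℕ
  bad σ = unjoined σ + crowded σ + noneIsolated σ + conditional (take m₁ σ) (drop m₁ σ)

  take-idem : ∀ (σ : EdgeList n) → take m₁ (take m₁ σ) ≡ take m₁ σ
  take-idem σ = take-all m₁ (take m₁ σ) (≤-trans (≤-reflexive (length-take m₁ σ)) (m⊓n≤m m₁ _))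

  unjoined-take : ∀ σ → unjoined (take m₁ σ) ≡ unjoined σ
  unjoined-take σ = ∑ˢ-cong {F = λ A → ∑ˢ (term (take m₁ σ) A)} {λ A → ∑ˢ (term σ A)} λ A → ∑ˢ-cong {F = term (take m₁ σ) A} {term σ A} λ B →
      cong (λ x → ⟦ bigPair A B ⟧ * ⟦ x ⟧) (avoid-take (between A B) m₁ σ)
    where
    term : EdgeList n → (A B : Fin n → Bool) → ℕ
    term P A B = ⟦ bigPair A B ⟧ * ⟦ avoid (between A B) m₁ P ⟧

  crowded-take : ∀ σ → crowded (take m₁ σ) ≡ crowded σ
  crowded-take σ = ∑-cong λ v → cong (λ L → ⟦ does (Δ ≤? count (between (single v) (others v)) L) ⟧) (take-idem σ)

  conditional-zero : ∀ P τ → length P ≤ m₁ → unjoined P + crowded P ≡ 0 → conditional P τ ≡ 0 →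
                     Σ (Structure (adjᴸ P) h μ) λ S → Given.unattached P S τ ≡ 0 × Given.nearPairs P S τ ≡ 0
  conditional-zero P τ le z = go (length P ≤? m₁) (unjoined P + crowded P ≟ⁿ 0)
    where
    go : ∀ d₁ d₂ → conditionalOn P τ d₁ d₂ ≡ 0 → Σ (Structure (adjᴸ P) h μ) λ S → Given.unattached P S τ ≡ 0 × Given.nearPairs P S τ ≡ 0
    go (no k) _ _ = ⊥-elim (k le)
    go (yes _) (no k) _ = ⊥-elim (k z)
    go (yes le') (yes z') c = S , m+n≡0⇒m≡0 _ c , m+n≡0⇒n≡0 (Given.unattached P S τ) c
      where S = structureOf P le' (m+n≡0⇒m≡0 _ z')

  module Deterministic (σ : EdgeList n) (ord : IsEdgeOrdering σ) (m₁≤m₋ : m₁ ≤ m₋) (m₋≤m₊ : m₋ ≤ m₊) (2≤n : 2 ≤ n) (6<ℓ : 6 < ℓ)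
                       (S : Structure (adjᴸ (take m₁ σ)) h μ)
                       (attached : Given.unattached (take m₁ σ) S (drop m₁ σ) ≡ 0)
                       (sparse : Given.nearPairs (take m₁ σ) S (drop m₁ σ) ≡ 0)
                       (late : isolated σ ≢ 0) where
    P = take m₁ σ
    τ = drop m₁ σ
    open Given P S
    open Structure S

    up : ∀ {i j} → (i , j) ∈ σ → toℕ i < toℕ j
    up = All.lookup (proj₁ ord)

    adj-lt : ∀ {m u v} → Adj (take m σ) u v → u ≢ v
    adj-lt {m} (inj₁ k) refl = <-irrefl refl (up (take-⊆ m k))
    adj-lt {m} (inj₂ k) refl = <-irrefl refl (up (take-⊆ m k))

    P-avoid : ∀ p → avoid p m₁ P ≡ false → ∃[ e ] e ∈ P × p e ≡ true
    P-avoid p q with avoid-false p m₁ P q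
    ... | e , k , r = e , subst (e ∈_) (take-idem σ) k , r

    attach : ∀ m → m₁ ≤ m → ∀ v → base v ≡ false → avoid (baseEdge v) m₁ P ≡ false ⊎ avoid (baseEdge v) (m ∸ m₁) τ ≡ false →
             ∃[ b ] base b ≡ true × Adj (take m σ) v b
    attach m le v nb (inj₁ q) with P-avoid (baseEdge v) q
    ... | e , k , r with between-elim {A = single v} {B = base} k r
    ... | a , b , p , q' , ad with ==-true {i = a} p
    ... | refl = b , q' , adj-⊆ (take-mono le) ad
    attach m le v nb (inj₂ q) with avoid-false (baseEdge v) (m ∸ m₁) τ q
    ... | e , k , r with between-elim {A = single v} {B = base} k r
    ... | a , b , p , q' , ad with ==-true {i = a} p
    ... | refl = b , q' , adj-⊆ (take-drop⁺ m₁ le) ad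

    m₁≤m₊ : m₁ ≤ m₊
    m₁≤m₊ = ≤-trans m₁≤m₋ m₋≤m₊

    baseNeighbour : ∀ v → base v ≡ false → ∃[ b ] base b ≡ true × Adj (take m₊ σ) v b
    baseNeighbour v nb = attach m₊ m₁≤m₊ v nb (split (bool? (avoid (baseEdge v) m₁ P)))
      where
      split : (avoid (baseEdge v) m₁ P ≡ true) ⊎ (avoid (baseEdge v) m₁ P ≡ false) → avoid (baseEdge v) m₁ P ≡ false ⊎ avoid (baseEdge v) (m₊ ∸ m₁) τ ≡ false
      split (inj₂ q) = inj₁ q
      split (inj₁ q) = inj₂ (⟦⟧-zero (⟦⟧*-zero (∑-zero _ attached v) (∧-intro (cong not nb) q)))

    fromP : ∀ {m u v} → m₁ ≤ m → adjᴸ P u v ≡ true → Adj (take m σ) u v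
    fromP le q = adj-⊆ (take-mono le) (adjᴸ⇒Adj P q)

    climbCore : ∀ k {c} → c ∈ cells → h < height c + k → Star (Adj (take m₊ σ)) (center c) (center top)
    climbCore zero m lt = ⊥-elim (<-irrefl refl (<-≤-trans lt (≤-trans (≤-reflexive (+-identityʳ _)) (bounded m))))
    climbCore (suc k) {c} m lt with parent m
    ... | inj₁ q = subst (Star (Adj (take m₊ σ)) (center c)) q ε
    ... | inj₂ (p , kp , hp , a) = adj-flip {L = take m₊ σ} (fromP m₁≤m₊ a) ◅ climbCore k kp (<-≤-trans lt (≤-reflexive (trans (+-suc (height c) k) (cong (_+ k) (sym hp)))))

    fromBase : ∀ {b} → base b ≡ true → Star (Adj (take m₊ σ)) b (center top)
    fromBase q with base-parent q
    ... | c , k , a = adj-flip {L = take m₊ σ} (fromP m₁≤m₊ a) ◅ climbCore (suc h) k (m≤n+m (suc h) (height c))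

    toRoot : ∀ v → Star (Adj (take m₊ σ)) v (center top)
    toRoot v with bool? (base v)
    ... | inj₁ q = fromBase q
    ... | inj₂ q with baseNeighbour v q
    ... | b , qb , a = a ◅ fromBase qb

    -- At time `m₊` every vertex outside the base has a neighbour in it, and the base reaches the
    -- root through the core.
    connected₊ : Connected (take m₊ σ)
    connected₊ u v = toRoot u ◅◅ star-flip (toRoot v)

    hitting = least (λ m → connected? (take m σ)) m₊ connected₊
    M = proj₁ hitting
    M≤m₊ = proj₁ (proj₂ hitting)
    connectedM = proj₁ (proj₂ (proj₂ hitting))

    lonely : ∃[ v ] avoid (between (single v) (others v)) m₋ σ ≡ true
    lonely with ∑>0 (λ v → ⟦ avoid (between (single v) (others v)) m₋ σ ⟧) (n≢0⇒n>0 late)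
    ... | v , q with bool? (avoid (between (single v) (others v)) m₋ σ)
    ... | inj₁ r = v , r
    ... | inj₂ r rewrite r with q
    ... | ()

    m₋≤M : m₋ ≤ M
    m₋≤M = ≮⇒≥ λ lt → contra lt (another (card>0 (others v) (+-cancelˡ-< 1 0 _ (subst (1 <_) (trans (sym (card-not (_== v))) (cong (_+ card (others v)) (card-single v))) 2≤n))))
      where
      v = proj₁ lonely
      another : ∃[ u ] others v u ≡ true → ∃[ u ] v ≢ u
      another (u , q) = u , λ { refl → true≢false (==-refl v) (not-false q) }
      start : ∀ {a b} → a ≢ b → Star (Adj (take M σ)) a b → ∃[ u ] Adj (take M σ) a u
      start ne ε = ⊥-elim (ne refl)
      start ne (e ◅ _) = _ , e
      contra : M < m₋ → ∃[ u ] v ≢ u → ⊥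
      contra lt (u , ne) with start ne (connectedM v u)
      ... | x , a with between-intro {A = single v} {B = others v} (==-refl v) (not-true (==-false (adj-lt {M} a ∘ sym))) (adj-⊆ (take-mono (<⇒≤ lt)) a)
      ... | e , k , r = true≢false r (avoid-true _ m₋ σ (proj₂ lonely) k)

    module AtTime (E : EdgeList n) (loopless : ∀ u → ¬ Adj E u u) (real : ∀ {u v} → adjᴸ P u v ≡ true → Adj E u v)
                  (connectedE : Connected E) (early : ∀ {e} → e ∈ E → e ∈ take m₊ σ) where
      open Assembly (adjᴸ-sym P) S E loopless real connectedE

      Chain : Fin n → List (Fin n) → Set
      Chain u [] = ⊤
      Chain u (v ∷ L) = Link u v × Chain v L

      Path : Fin n → Fin n → ℕ → Set
      Path u w k = ∃[ L ] length L ≤ k × lastOf u L ≡ w × uniqueᵇ (u ∷ L) ≡ true × Chain u L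

      suffix : ∀ {u v w k} L → u ∈ (v ∷ L) → length L ≤ k → lastOf v L ≡ w → uniqueᵇ (v ∷ L) ≡ true → Chain v L → Path u w k
      suffix L (here refl) le q un ch = L , le , q , un , ch
      suffix {v = v} (x ∷ L) (there m) le q un (_ , ch) = suffix L m (≤-trans (n≤1+n _) le) q (proj₂ (∧-elim {not (mem v (x ∷ L))} un)) ch

      -- Loop erasure: the union bound runs over simple paths only.
      erase : ∀ {k u w} → Walk k u w → Path u w k
      erase stop = [] , z≤n , refl , refl , tt
      erase {suc k} {u} (_▷_ {v = v} e W) with erase W
      ... | L , le , q , un , ch with bool? (mem u (v ∷ L))
      ... | inj₂ m = v ∷ L , s≤s le , q , ∧-intro (cong not m) un , e , ch
      ... | inj₁ m with suffix L (mem⇒∈ (v ∷ L) m) le q un ch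
      ... | L' , le' , rest = L' , m≤n⇒m≤1+n le' , rest

      sameCell-intro : ∀ {cs c u v} → c ∈ cs → u ∈ flat c → v ∈ flat c → sameCell cs u v ≡ true
      sameCell-intro (here refl) p q = ∨-introˡ (∧-intro (∈⇒mem p) (∈⇒mem q))
      sameCell-intro {c ∷ cs} {u = u} {v} (there k) p q = ∨-introʳ {mem u (flat c) ∧ mem v (flat c)} (sameCell-intro k p q)

      link-fresh : ∀ {u v} → Link u v → linked u v ≡ false → mkEdge u v ∈ take (m₊ ∸ m₁) τ
      link-fresh {u} {v} (same k p q) nl = ⊥-elim (true≢false (∨-introʳ {adjᴸ P u v} (sameCell-intro k p q)) nl)
      link-fresh {u} {v} (edge (inj₁ k)) nl with take-drop⁻ m₁ m₊ (early k)
      ... | inj₁ k' = ⊥-elim (true≢false (∨-introˡ (Adj⇒adjᴸ {P = P} (inj₁ k'))) nl)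
      ... | inj₂ k' = subst (_∈ take (m₊ ∸ m₁) τ) (sym (cong (if_then (u , v) else (v , u)) (does-true (toℕ u <? toℕ v) (up (take-⊆ m₊ (early k)))))) k'
      link-fresh {u} {v} (edge (inj₂ k)) nl with take-drop⁻ m₁ m₊ (early k)
      ... | inj₁ k' = ⊥-elim (true≢false (∨-introˡ (Adj⇒adjᴸ {P = P} (inj₂ k'))) nl)
      ... | inj₂ k' = subst (_∈ take (m₊ ∸ m₁) τ) (sym (cong (if_then (u , v) else (v , u)) (does-false (toℕ u <? toℕ v) (<-asym (up (take-⊆ m₊ (early k))))))) k'

      fresh-in : ∀ u L → Chain u L → allIn (fresh u L) (take (m₊ ∸ m₁) τ) ≡ true
      fresh-in u [] _ = refl
      fresh-in u (v ∷ L) (e , ch) with linked u v in q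
      ... | true = fresh-in v L ch
      ... | false = ∧-intro (∈⇒elem (link-fresh e q)) (fresh-in v L ch)

      weak-elim : ∀ {v} → weak τ v ≡ true → base v ≡ false × avoid (baseEdge v) m₁ P ≡ true × avoid (baseEdge v) (m₋ ∸ m₁) τ ≡ true
      weak-elim {v} q with ∧-elim {not (base v) ∧ avoid (baseEdge v) m₁ P} q
      ... | p , r with ∧-elim {not (base v)} p
      ... | p₁ , p₂ = not-false p₁ , p₂ , r

      avoid-both : ∀ m L (u : Fin n) K → avoid (baseEdge u) m L ≡ true → avoid (baseEdge (lastOf u K)) m L ≡ true → avoid (between (endpoints u K) base) m L ≡ true
      avoid-both m L u K p q with bool? (avoid (between (endpoints u K) base) m L)
      ... | inj₁ r = r
      ... | inj₂ r with avoid-false _ m L r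
      ... | e , k , s with between-elim {A = endpoints u K} {B = base} k s
      ... | a , b , ea , qb , ad with ∨-elim {a == u} ea
      ... | inj₁ ea' with between-intro {A = single u} {B = base} ea' qb ad
      ... | e' , k' , s' = ⊥-elim (true≢false s' (avoid-true _ m L p k'))
      avoid-both m L u K p q | inj₂ r | e , k , s | a , b , ea , qb , ad | inj₂ ea' with between-intro {A = single (lastOf u K)} {B = base} ea' qb ad
      ... | e' , k' , s' = ⊥-elim (true≢false s' (avoid-true _ m L q k'))

      near-zero : ∀ {k} → k < ℓ → ∀ u L → length L ≡ k → nearPath u L τ ≡ 0
      near-zero {k} lt u L e = ∑ᴸ-zero k (λ L → nearPath u L τ)
        (∑-zero (λ u → ∑ᴸ k λ L → nearPath u L τ) (subst (λ j → ∑ (λ u → ∑ᴸ j λ L → nearPath u L τ) ≡ 0) (Finₚ.toℕ-fromℕ< lt)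
          (∑-zero {ℓ} (λ k → ∑ λ u → ∑ᴸ (toℕ k) λ L → nearPath u L τ) sparse (Fin.fromℕ< lt))) u) L e

      -- A short walk between weak vertices would, after loop erasure, be an admissible path counted
      -- by `nearPairs`.
      far : ∀ {u v k} → weak τ u ≡ true → weak τ v ≡ true → u ≢ v → k ≤ 6 → ¬ Walk k u v
      far {u} {v} wu wv ne le W with erase W
      ... | L , len , refl , un , ch with weak-elim wu | weak-elim wv
      ... | bu , pu , tu | bv , pv , tv = absurd (trans (sym value) (near-zero (≤-<-trans (≤-trans len le) 6<ℓ) u L refl))
        where
        endpoint-base : Disjoint (endpoints u L) base
        endpoint-base i q with ∨-elim {i == u} q
        ... | inj₁ e rewrite ==-true {i = i} e = bu
        ... | inj₂ e rewrite ==-true {i = i} e = bv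
        value : nearPath u L τ ≡ 1
        value = cong₂ (λ x y → ⟦ x ⟧ * y)
          (∧-intro un (∧-intro (not-true (==-false (ne ∘ sym))) (∧-intro (disjointᵇ-intro endpoint-base) (avoid-both m₁ P u L pu pv))))
          (cong₂ (λ x y → ⟦ x ⟧ * ⟦ y ⟧) (fresh-in u L ch) (avoid-both (m₋ ∸ m₁) τ u L tu tv))
        absurd : 1 ≡ 0 → ⊥
        absurd ()

      acquiredE : (∀ v → weak τ v ≡ false → base v ≡ false → ∃[ b ] base b ≡ true × Adj E v b) → FracAcqNumber E 1 × UnitAcqNumber E 1
      acquiredE strong-base = acquired (weak τ) strong-base far

    strong-base : ∀ v → weak τ v ≡ false → base v ≡ false → ∃[ b ] base b ≡ true × Adj (take M σ) v b
    strong-base v w nb with attach m₋ m₁≤m₋ v nb (split (bool? (avoid (baseEdge v) m₁ P)))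
      where
      split : (avoid (baseEdge v) m₁ P ≡ true) ⊎ (avoid (baseEdge v) m₁ P ≡ false) → avoid (baseEdge v) m₁ P ≡ false ⊎ avoid (baseEdge v) (m₋ ∸ m₁) τ ≡ false
      split (inj₂ q) = inj₁ q
      split (inj₁ q) = inj₂ (trans (sym (cong₂ (λ x y → (not x ∧ y) ∧ avoid (baseEdge v) (m₋ ∸ m₁) τ) nb q)) w)
    ... | b , q , a = b , q , adj-⊆ (take-mono m₋≤M) a

    good : GoodOrdering σ
    good = M , (connectedM , proj₂ (proj₂ (proj₂ hitting))) ,
      AtTime.acquiredE (take M σ) (λ u a → adj-lt {M} a refl) (fromP (≤-trans m₁≤m₋ m₋≤M)) connectedM (take-mono M≤m₊) strong-base

  good-if : ∀ σ → IsEdgeOrdering σ → m₁ ≤ m₋ → m₋ ≤ m₊ → 2 ≤ n → 6 < ℓ → bad σ ≡ 0 → GoodOrdering σ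
  good-if σ ord le₁ le₂ two six z = finish (conditional-zero (take m₁ σ) (drop m₁ σ) (≤-trans (≤-reflexive (length-take m₁ σ)) (m⊓n≤m m₁ _))
      (cong₂ _+_ (trans (unjoined-take σ) (m+n≡0⇒m≡0 _ uc)) (trans (crowded-take σ) (m+n≡0⇒n≡0 (unjoined σ) uc))) (m+n≡0⇒n≡0 _ z))
    where
    ucn : unjoined σ + crowded σ + noneIsolated σ ≡ 0
    ucn = m+n≡0⇒m≡0 _ z
    uc : unjoined σ + crowded σ ≡ 0
    uc = m+n≡0⇒m≡0 _ ucn
    late : isolated σ ≢ 0
    late = does-elim′ (isolated σ ≟ⁿ 0) (⟦⟧-zero (m+n≡0⇒n≡0 (unjoined σ + crowded σ) ucn))
    finish : Σ (Structure (adjᴸ (take m₁ σ)) h μ) (λ S → Given.unattached (take m₁ σ) S (drop m₁ σ) ≡ 0 × Given.nearPairs (take m₁ σ) S (drop m₁ σ) ≡ 0) → GoodOrdering σ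
    finish (S , a , b) = Deterministic.good σ ord le₁ le₂ two six S a b late

-- Falling factorials, stars and avoidance counts.

fall-! : ∀ m N → m ≤ N → fall N m * (N ∸ m) ! ≡ N !
fall-! zero N _ = +-identityʳ _
fall-! (suc m) (suc N) (s≤s h) = trans (*-assoc (suc N) (fall N m) ((N ∸ m) !)) (cong (suc N *_) (fall-! m N h))

fall-mono : ∀ m {a b} → a ≤ b → fall a m ≤ fall b m
fall-mono zero h = ≤-refl
fall-mono (suc m) h = *-mono-≤ h (fall-mono m (∸-monoˡ-≤ 1 h))

2xy≤ : ∀ x y → 2 * (x * y) ≤ x * x + y * y
2xy≤ x y with ≤-total x y
... | inj₁ h with m≤n⇒∃[o]m+o≡n h
... | d , refl = ≤-trans (m≤m+n _ (d * d)) (≤-reflexive (arith x d))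
  where
  arith : ∀ x d → 2 * (x * (x + d)) + d * d ≡ x * x + (x + d) * (x + d)
  arith = solve-∀
2xy≤ x y | inj₂ h with m≤n⇒∃[o]m+o≡n h
... | d , refl = ≤-trans (m≤m+n _ (d * d)) (≤-reflexive (arith y d))
  where
  arith : ∀ y d → 2 * ((y + d) * y) + d * d ≡ (y + d) * (y + d) + y * y
  arith = solve-∀

∑-square : ∀ {n} (f : Fin n → ℕ) → ∑ f * ∑ f ≡ ∑ λ i → ∑ λ j → f i * f j
∑-square f = trans (sym (∑-*ˡ (∑ f) f)) (∑-cong λ i → trans (*-comm (∑ f) (f i)) (sym (∑-*ˡ (f i) f)))

card-others : ∀ {n} (v : Fin n) → card (others v) ≡ n ∸ 1
card-others v = cong (_∸ 1) (trans (cong (_+ card (others v)) (sym (card-single v))) (card-not (_== v)))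

single-others : ∀ {n} (v : Fin n) → Disjoint (single v) (others v)
single-others v i q = cong not q

star : ∀ {n} → Fin n → Edge n → Bool
star v = between (single v) (others v)

count-star : ∀ {n} (v : Fin n) → count (star v) (edges n) ≡ n ∸ 1
count-star v = trans (count-between (single v) (others v) (single-others v)) (trans (cong₂ _*_ (card-single v) (card-others v)) (+-identityʳ _))

count-∨ : ∀ {A : Set} {p q : A → Bool} → (∀ x → p x ≡ true → q x ≡ false) → ∀ L → count (λ x → p x ∨ q x) L ≡ count p L + count q L
count-∨ h [] = refl
count-∨ {p = p} {q} h (x ∷ L) = trans (cong₂ _+_ (pt (p x) (q x) (h x)) (count-∨ h L)) (+-interchange ⟦ p x ⟧ ⟦ q x ⟧ _ _)
  where
  pt : ∀ a b → (a ≡ true → b ≡ false) → ⟦ a ∨ b ⟧ ≡ ⟦ a ⟧ + ⟦ b ⟧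
  pt true b h rewrite h refl = refl
  pt false b h = refl

avoid-∧ : ∀ {A : Set} (p q : A → Bool) m σ → avoid p m σ ∧ avoid q m σ ≡ true → avoid (λ x → p x ∨ q x) m σ ≡ true
avoid-∧ p q zero σ h = refl
avoid-∧ p q (suc m) [] h = refl
avoid-∧ p q (suc m) (x ∷ σ) h with p x | q x
... | false | false = avoid-∧ p q m σ h
... | false | true = ⊥-elim (absurd (proj₂ (∧-elim {avoid p m σ} h)))
  where
  absurd : false ≡ true → ⊥
  absurd ()

avoid-weaken : ∀ {A : Set} {p q : A → Bool} → (∀ x → p x ≡ true → q x ≡ true) → ∀ m σ → avoid q m σ ≡ true → avoid p m σ ≡ true
avoid-weaken h zero σ k = refl
avoid-weaken h (suc m) [] k = refl
avoid-weaken {p = p} {q} h (suc m) (x ∷ σ) k with p x | q x | h x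
... | false | false | _ = avoid-weaken h m σ k
... | true | false | f = ⊥-elim (absurd (f refl))
  where
  absurd : false ≡ true → ⊥
  absurd ()

count-not-≤ : ∀ {A : Set} (p : A → Bool) L f → f ≤ count p L → count (not ∘ p) L ≤ length L ∸ f
count-not-≤ p L f h = ≤-trans (≤-reflexive (sym (m+n∸m≡n (count p L) _))) (≤-trans (≤-reflexive (cong (_∸ count p L) (count-not p L))) (∸-monoʳ-≤ (length L) h))

𝔼-avoid≤ : ∀ {A : Set} (p : A → Bool) m L f → m ≤ length L → f ≤ count p L → 𝔼 L (λ σ → ⟦ avoid p m σ ⟧) ≤ fall (length L ∸ f) m * (length L ∸ m) !
𝔼-avoid≤ p m L f h k = ≤-trans (≤-reflexive (𝔼-avoid p m L h)) (*-monoˡ-≤ ((length L ∸ m) !) (fall-mono m (count-not-≤ p L f k)))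

-- Probability estimates

-- Chebyshev's inequality for the number of occurrences.
secondMoment : ∀ {A : Set} (L : List A) {n} (x : Fin n → List A → Bool) c₁ →
  (∀ v → 𝔼 L (λ σ → ⟦ x v σ ⟧) ≡ c₁) →
  (∀ u v → u ≢ v → 𝔼 L (λ σ → ⟦ x u σ ⟧ * ⟦ x v σ ⟧) * 𝔼 L (λ _ → 1) ≤ c₁ * c₁) →
  𝔼 L (λ σ → ⟦ does (∑ (λ v → ⟦ x v σ ⟧) ≟ⁿ 0) ⟧) * (n * c₁) * (n * c₁) ≤ 𝔼 L (λ _ → 1) * 𝔼 L (λ _ → 1) * (n * c₁)
secondMoment L {n} x c₁ mean pairs = +-cancelʳ-≤ (2 * (t * m * m)) _ _ (begin
    e₀ * m * m + 2 * (t * m * m)                ≡⟨ arith₁ e₀ m t ⟩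
    m * m * e₀ + 2 * (t * m) * m                ≡⟨ cong (λ z → m * m * e₀ + 2 * (t * m) * z) (sym meanX) ⟩
    m * m * e₀ + 2 * (t * m) * 𝔼 L X            ≡⟨ cong₂ _+_ (sym (𝔼-* (m * m) L zeroX)) (sym (𝔼-* (2 * (t * m)) L X)) ⟩
    𝔼 L (λ σ → m * m * zeroX σ) + 𝔼 L (λ σ → 2 * (t * m) * X σ)
                                                ≡⟨ sym (𝔼-+ L (λ σ → m * m * zeroX σ) _) ⟩
    𝔼 L (λ σ → m * m * zeroX σ + 2 * (t * m) * X σ)
                                                ≤⟨ 𝔼-mono L (λ {σ} _ → pointwise (X σ)) ⟩
    𝔼 L (λ σ → t * t * (X σ * X σ) + m * m)     ≡⟨ 𝔼-+ L (λ σ → t * t * (X σ * X σ)) (λ _ → m * m) ⟩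
    𝔼 L (λ σ → t * t * (X σ * X σ)) + 𝔼 L (λ _ → m * m)
                                                ≡⟨ cong₂ _+_ (𝔼-* (t * t) L (λ σ → X σ * X σ)) (𝔼-const L (m * m)) ⟩
    t * t * 𝔼 L (λ σ → X σ * X σ) + m * m * t   ≤⟨ +-monoˡ-≤ (m * m * t) second ⟩
    (t * t * m + t * (m * m)) + m * m * t       ≡⟨ arith₂ t m ⟩
    t * t * m + 2 * (t * m * m)                 ∎)
  where
  open ≤-Reasoning
  t = 𝔼 L λ _ → 1
  m = n * c₁
  X zeroX : List _ → ℕ
  X σ = ∑ λ v → ⟦ x v σ ⟧
  zeroX σ = ⟦ does (X σ ≟ⁿ 0) ⟧
  e₀ = 𝔼 L zeroX
  arith₁ : ∀ e m t → e * m * m + 2 * (t * m * m) ≡ m * m * e + 2 * (t * m) * m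
  arith₁ = solve-∀
  arith₂ : ∀ t m → (t * t * m + t * (m * m)) + m * m * t ≡ t * t * m + 2 * (t * m * m)
  arith₂ = solve-∀
  meanX : 𝔼 L X ≡ m
  meanX = trans (𝔼-∑ L (λ v σ → ⟦ x v σ ⟧)) (trans (∑-cong mean) (∑-const {n} c₁))
  -- This is `(t a - m)² ≥ m²` when `a = 0` and `(t a - m)² ≥ 0` otherwise, expanded to avoid
  -- subtraction; `t` is the number of orderings, so `m / t` is the mean.
  pointwise : ∀ a → m * m * ⟦ does (a ≟ⁿ 0) ⟧ + 2 * (t * m) * a ≤ t * t * (a * a) + m * m
  pointwise zero = ≤-reflexive (arith t m)
    where
    arith : ∀ t m → m * m * 1 + 2 * (t * m) * 0 ≡ t * t * (0 * 0) + m * m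
    arith = solve-∀
  pointwise (suc a) = ≤-trans (≤-reflexive (arith m t (suc a))) (≤-trans (2xy≤ (t * suc a) m) (≤-reflexive (cong (_+ m * m) (arith' t (suc a)))))
    where
    arith : ∀ m t a → m * m * 0 + 2 * (t * m) * a ≡ 2 * (t * a * m)
    arith = solve-∀
    arith' : ∀ t a → t * a * (t * a) ≡ t * t * (a * a)
    arith' = solve-∀
  square : ∀ b → ⟦ b ⟧ * ⟦ b ⟧ ≡ ⟦ b ⟧
  square true = refl
  square false = refl
  term : ∀ u v → t * 𝔼 L (λ σ → ⟦ x u σ ⟧ * ⟦ x v σ ⟧) ≤ ⟦ u == v ⟧ * (t * c₁) + c₁ * c₁
  term u v with u ≟ v
  ... | yes refl = ≤-trans (≤-reflexive (cong (t *_) (trans (𝔼-cong L λ {σ} _ → square (x u σ)) (mean u)))) (≤-trans (≤-reflexive (sym (+-identityʳ (t * c₁)))) (m≤m+n _ (c₁ * c₁)))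
  ... | no ne = ≤-trans (≤-reflexive (*-comm t _)) (pairs u v ne)
  diag : ∀ u → ∑ (λ v → ⟦ u == v ⟧ * (t * c₁)) ≡ t * c₁
  diag u = trans (∑-single u _ (λ v ne → cong (λ b → ⟦ b ⟧ * (t * c₁)) (==-false (ne ∘ sym)))) (trans (cong (λ b → ⟦ b ⟧ * (t * c₁)) (==-refl u)) (+-identityʳ _))
  second : t * t * 𝔼 L (λ σ → X σ * X σ) ≤ t * t * m + t * (m * m)
  second = begin
      t * t * 𝔼 L (λ σ → X σ * X σ)
        ≡⟨ cong (t * t *_) (trans (𝔼-cong L λ {σ} _ → ∑-square (λ v → ⟦ x v σ ⟧)) (trans (𝔼-∑ L (λ u σ → ∑ λ v → ⟦ x u σ ⟧ * ⟦ x v σ ⟧)) (∑-cong λ u → 𝔼-∑ L (λ v σ → ⟦ x u σ ⟧ * ⟦ x v σ ⟧)))) ⟩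
      t * t * ∑ (λ u → ∑ λ v → 𝔼 L (λ σ → ⟦ x u σ ⟧ * ⟦ x v σ ⟧))
        ≡⟨ trans (*-assoc t t _) (cong (t *_) (trans (sym (∑-*ˡ t (λ u → ∑ λ v → 𝔼 L (λ σ → ⟦ x u σ ⟧ * ⟦ x v σ ⟧)))) (∑-cong λ u → sym (∑-*ˡ t (λ v → 𝔼 L (λ σ → ⟦ x u σ ⟧ * ⟦ x v σ ⟧)))))) ⟩
      t * ∑ (λ u → ∑ λ v → t * 𝔼 L (λ σ → ⟦ x u σ ⟧ * ⟦ x v σ ⟧))
        ≤⟨ *-monoʳ-≤ t (∑-mono {n} λ u → ∑-mono {n} λ v → term u v) ⟩
      t * ∑ {n} (λ u → ∑ {n} λ v → ⟦ u == v ⟧ * (t * c₁) + c₁ * c₁)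
        ≡⟨ cong (t *_) (trans (∑-cong {n} λ u → trans (∑-+ {n} (λ v → ⟦ u == v ⟧ * (t * c₁)) (λ _ → c₁ * c₁)) (cong₂ _+_ (diag u) (∑-const {n} (c₁ * c₁)))) (∑-const {n} (t * c₁ + n * (c₁ * c₁)))) ⟩
      t * (n * (t * c₁ + n * (c₁ * c₁)))
        ≡⟨ arith t n c₁ ⟩
      t * t * m + t * (m * m) ∎
    where
    arith : ∀ t n c → t * (n * (t * c + n * (c * c))) ≡ t * t * (n * c) + t * (n * c * (n * c))
    arith = solve-∀

module Bounds (n m₁ m₋ m₊ μ h Δ ℓ : ℕ)
              (build : (adj : Fin n → Fin n → Bool) → (∀ u v → adj u v ≡ true → adj v u ≡ true) →
                       (∀ (A B : Fin n → Bool) → (∀ i → A i ≡ true → B i ≡ false) → μ ≤ card A → μ ≤ card B →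
                         ∃[ a ] ∃[ b ] A a ≡ true × B b ≡ true × adj a b ≡ true) → Structure adj h μ) where
  open Events n m₁ m₋ m₊ μ h Δ ℓ build

  N = length (edges n)

  total : 𝔼 (edges n) (λ _ → 1) ≡ N !
  total = 𝔼-one (edges n)

  -- A union bound over the pairs of sets, each spanning at least `μ * μ` edges.
  unjoined-rare : ∀ κ → m₁ ≤ N → κ * (2 ^ n * (2 ^ n * fall (N ∸ μ * μ) m₁)) ≤ fall N m₁ → κ * 𝔼 (edges n) unjoined ≤ N !
  unjoined-rare κ le H = begin
      κ * 𝔼 L unjoined                                           ≡⟨ cong (κ *_) (trans (𝔼-∑ˢ L (λ A σ → ∑ˢ λ B → term A B σ)) (∑ˢ-cong λ A → 𝔼-∑ˢ L (term A))) ⟩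
      κ * ∑ˢ (λ A → ∑ˢ λ B → 𝔼 L (term A B))                     ≤⟨ *-monoʳ-≤ κ (∑ˢ-bound (λ A → ∑ˢ λ B → 𝔼 L (term A B)) (2 ^ n * c) λ A → ∑ˢ-bound (λ B → 𝔼 L (term A B)) c (each A)) ⟩
      κ * (2 ^ n * (2 ^ n * (fall (N ∸ μ * μ) m₁ * (N ∸ m₁) !)))  ≡⟨ arith κ (2 ^ n) (fall (N ∸ μ * μ) m₁) ((N ∸ m₁) !) ⟩
      κ * (2 ^ n * (2 ^ n * fall (N ∸ μ * μ) m₁)) * (N ∸ m₁) !    ≤⟨ *-monoˡ-≤ ((N ∸ m₁) !) H ⟩
      fall N m₁ * (N ∸ m₁) !                                     ≡⟨ fall-! m₁ N le ⟩
      N !                                                        ∎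
    where
    open ≤-Reasoning
    L = edges n
    c = fall (N ∸ μ * μ) m₁ * (N ∸ m₁) !
    arith : ∀ k a f r → k * (a * (a * (f * r))) ≡ k * (a * (a * f)) * r
    arith = solve-∀
    term : (A B : Fin n → Bool) → EdgeList n → ℕ
    term A B P = ⟦ bigPair A B ⟧ * ⟦ avoid (between A B) m₁ P ⟧
    each : ∀ A B → 𝔼 L (term A B) ≤ c
    each A B with bool? (bigPair A B)
    ... | inj₂ q = ≤-trans (≤-reflexive (trans (𝔼-cong L λ {σ} _ → cong (λ b → ⟦ b ⟧ * ⟦ avoid (between A B) m₁ σ ⟧) q) (𝔼-0 L))) z≤n
    ... | inj₁ q with ∧-elim {disjointᵇ A B} q
    ... | disj , q' with ∧-elim {does (μ ≤? card A)} q'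
    ... | bigA , bigB = ≤-trans (𝔼-mono L λ {σ} _ → ≤-trans (*-monoˡ-≤ ⟦ avoid (between A B) m₁ σ ⟧ (⟦⟧≤1 (bigPair A B))) (≤-reflexive (+-identityʳ _)))
          (𝔼-avoid≤ (between A B) m₁ L (μ * μ) le (≤-trans (*-mono-≤ (does-elim (μ ≤? card A) bigA) (does-elim (μ ≤? card B) bigB))
            (≤-reflexive (sym (count-between A B (disjointᵇ-elim disj))))))

  -- Markov's inequality for 2 to the power of the degree, and a union bound over the vertices.
  crowded-rare : ∀ κ → m₁ ≤ N → κ * (n * rising (n ∸ 1) N m₁) ≤ 2 ^ Δ * fall N m₁ → κ * 𝔼 (edges n) crowded ≤ N !
  crowded-rare κ le H = *-cancelˡ-≤ (2 ^ Δ) {{m^n≢0 2 Δ}} (begin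
      2 ^ Δ * (κ * 𝔼 L crowded)                                  ≡⟨ cong (λ z → 2 ^ Δ * (κ * z)) (𝔼-∑ L (λ v σ → ⟦ does (Δ ≤? degree σ v) ⟧)) ⟩
      2 ^ Δ * (κ * ∑ (λ v → 𝔼 L λ σ → ⟦ does (Δ ≤? degree σ v) ⟧)) ≡⟨ trans (swap₁ (2 ^ Δ) κ _) (cong (κ *_) (sym (∑-*ˡ (2 ^ Δ) (λ v → 𝔼 L λ σ → ⟦ does (Δ ≤? degree σ v) ⟧)))) ⟩
      κ * ∑ (λ v → 2 ^ Δ * 𝔼 L λ σ → ⟦ does (Δ ≤? degree σ v) ⟧)  ≤⟨ *-monoʳ-≤ κ (∑-bound (λ v → 2 ^ Δ * 𝔼 L λ σ → ⟦ does (Δ ≤? degree σ v) ⟧) (rising (n ∸ 1) N m₁ * (N ∸ m₁) !) each) ⟩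
      κ * (n * (rising (n ∸ 1) N m₁ * (N ∸ m₁) !))               ≡⟨ arith κ n (rising (n ∸ 1) N m₁) ((N ∸ m₁) !) ⟩
      κ * (n * rising (n ∸ 1) N m₁) * (N ∸ m₁) !                 ≤⟨ *-monoˡ-≤ ((N ∸ m₁) !) H ⟩
      2 ^ Δ * fall N m₁ * (N ∸ m₁) !                             ≡⟨ trans (*-assoc (2 ^ Δ) (fall N m₁) _) (cong (2 ^ Δ *_) (fall-! m₁ N le)) ⟩
      2 ^ Δ * N !                                                ∎)
    where
    open ≤-Reasoning
    L = edges n
    arith : ∀ k a f r → k * (a * (f * r)) ≡ k * (a * f) * r
    arith = solve-∀
    swap₁ : ∀ a b c → a * (b * c) ≡ b * (a * c)
    swap₁ = solve-∀
    each : ∀ v → 2 ^ Δ * 𝔼 L (λ σ → ⟦ does (Δ ≤? degree σ v) ⟧) ≤ rising (n ∸ 1) N m₁ * (N ∸ m₁) !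
    each v = ≤-trans (≤-reflexive (sym (𝔼-* (2 ^ Δ) L (λ σ → ⟦ does (Δ ≤? degree σ v) ⟧))))
      (≤-trans (𝔼-mono L λ {σ} _ → markov (degree σ v)) (≤-trans (𝔼-2^count (star v) m₁ L le) (≤-reflexive (cong (λ a → rising a N m₁ * (N ∸ m₁) !) (count-star v)))))
      where
      markov : ∀ d → 2 ^ Δ * ⟦ does (Δ ≤? d) ⟧ ≤ 2 ^ d
      markov d with bool? (does (Δ ≤? d))
      ... | inj₁ q = ≤-trans (≤-reflexive (trans (cong (λ b → 2 ^ Δ * ⟦ b ⟧) q) (*-identityʳ _))) (^-monoʳ-≤ 2 (does-elim (Δ ≤? d) q))
      ... | inj₂ q = ≤-trans (≤-reflexive (trans (cong (λ b → 2 ^ Δ * ⟦ b ⟧) q) (*-zeroʳ (2 ^ Δ)))) z≤n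

  -- The last hypothesis says that two vertices are isolated without positive correlation. The
  -- variance is then at most the mean, which is at least `κ`, and Chebyshev's inequality gives
  -- `1 / κ`.
  isolated-common : ∀ κ → m₋ ≤ N → 0 < n * fall (N ∸ (n ∸ 1)) m₋ → κ * fall N m₋ ≤ n * fall (N ∸ (n ∸ 1)) m₋ →
                    fall (N ∸ (n ∸ 1 + (n ∸ 2))) m₋ * fall N m₋ ≤ fall (N ∸ (n ∸ 1)) m₋ * fall (N ∸ (n ∸ 1)) m₋ →
                    κ * 𝔼 (edges n) noneIsolated ≤ N !
  isolated-common κ le pos H pairs = *-cancelʳ-≤ _ _ (N !) {{N !≢0}} (begin
      κ * e₀ * N !                     ≡⟨ arith₁ κ e₀ (N !) ⟩
      e₀ * (κ * N !)                   ≤⟨ *-monoʳ-≤ e₀ κN≤ ⟩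
      e₀ * (n * c₁)                    ≤⟨ *-cancelʳ-≤ _ _ (n * c₁) {{>-nonZero nc>0}} (≤-trans second (≤-reflexive (cong (λ t → t * t * (n * c₁)) total))) ⟩
      N ! * N !                        ∎)
    where
    open ≤-Reasoning
    L = edges n
    R = (N ∸ m₋) !
    F₁ = fall (N ∸ (n ∸ 1)) m₋
    c₁ = F₁ * R
    x : Fin n → EdgeList n → Bool
    x v σ = avoid (star v) m₋ σ
    e₀ = 𝔼 L noneIsolated
    arith₁ : ∀ k e t → k * e * t ≡ e * (k * t)
    arith₁ = solve-∀
    nc>0 : 0 < n * c₁
    nc>0 = ≤-trans (*-mono-≤ pos (1≤n! (N ∸ m₋))) (≤-reflexive (*-assoc n F₁ R))
    κN≤ : κ * N ! ≤ n * c₁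
    κN≤ = ≤-trans (≤-reflexive (trans (cong (κ *_) (sym (fall-! m₋ N le))) (sym (*-assoc κ (fall N m₋) R))))
            (≤-trans (*-monoˡ-≤ R H) (≤-reflexive (*-assoc n F₁ R)))
    mean : ∀ v → 𝔼 L (λ σ → ⟦ x v σ ⟧) ≡ c₁
    mean v = trans (𝔼-avoid (star v) m₋ L le) (cong (λ a → fall a m₋ * R)
      (trans (sym (m+n∸m≡n (count (star v) L) _)) (cong₂ _∸_ (count-not (star v) L) (count-star v))))
    -- The edge joining `u` and `v` lies in both stars and must be counted once, so the second star
    -- omits `u`.
    both : (u v : Fin n) → Edge n → Bool
    both u v e = star u e ∨ between (single v) (λ i → others u i ∧ others v i) e
    restCard : ∀ u v → u ≢ v → card (λ i → others u i ∧ others v i) ≡ n ∸ 2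
    restCard u v ne = trans (cong (_∸ 1) (trans (cong (_+ card (λ i → others u i ∧ others v i)) (sym (card-single u)))
        (trans (sym (∑-+ (λ i → ⟦ i == u ⟧) (λ i → ⟦ others u i ∧ others v i ⟧))) (∑-cong pt)))) (trans (cong (_∸ 1) (card-others v)) (∸-+-assoc n 1 1))
      where
      pt : ∀ i → ⟦ i == u ⟧ + ⟦ others u i ∧ others v i ⟧ ≡ ⟦ others v i ⟧
      pt i with i ≟ u
      ... | no _ = refl
      ... | yes refl rewrite ==-false ne = refl
    countBoth : ∀ u v → u ≢ v → count (both u v) L ≡ n ∸ 1 + (n ∸ 2)
    countBoth u v ne = trans (count-∨ exclusive L) (cong₂ _+_ (count-star u)
        (trans (count-between (single v) (λ i → others u i ∧ others v i) (λ i q → trans (cong (λ b → others u i ∧ not b) q) (∧-false (others u i))))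
          (trans (cong₂ _*_ (card-single v) (restCard u v ne)) (+-identityʳ _))))
      where
      ∧-false : ∀ a → a ∧ false ≡ false
      ∧-false true = refl
      ∧-false false = refl
      exclusive : ∀ e → star u e ≡ true → between (single v) (λ i → others u i ∧ others v i) e ≡ false
      exclusive (i , j) q with i ≟ u | j ≟ u
      exclusive (i , j) q | yes refl | _ rewrite ==-false ne = refl
      exclusive (i , j) q | no _ | yes refl rewrite ==-false ne = trans (cong (_∨ (true ∧ not (i == v)) ∧ false) (∧-false (i == v))) (∧-false (not (i == v)))
    second : e₀ * (n * c₁) * (n * c₁) ≤ 𝔼 L (λ _ → 1) * 𝔼 L (λ _ → 1) * (n * c₁)
    second = secondMoment L x c₁ mean pair
      where
      bothAvoided : ∀ u v σ → ⟦ x u σ ⟧ * ⟦ x v σ ⟧ ≤ ⟦ avoid (both u v) m₋ σ ⟧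
      bothAvoided u v σ = ≤-trans (≤-reflexive (sym (⟦∧⟧≡* (x u σ) (x v σ)))) (⟦⟧-mono λ q →
        avoid-∧ (star u) _ m₋ σ (∧-intro (proj₁ (∧-elim {x u σ} q)) (avoid-weaken (weaker v) m₋ σ (proj₂ (∧-elim {x u σ} q)))))
        where
        weaker : ∀ v e → between (single v) (λ i → others u i ∧ others v i) e ≡ true → star v e ≡ true
        weaker v (i , j) q with ∨-elim {single v i ∧ (others u j ∧ others v j)} q
        ... | inj₁ r = ∨-introˡ (∧-intro (proj₁ (∧-elim {single v i} r)) (proj₂ (∧-elim {others u j} (proj₂ (∧-elim {single v i} r)))))
        ... | inj₂ r = ∨-introʳ {single v i ∧ others v j} (∧-intro (proj₂ (∧-elim {others u i} (proj₁ (∧-elim {others u i ∧ others v i} r)))) (proj₂ (∧-elim {others u i ∧ others v i} r)))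
      pair : ∀ u v → u ≢ v → 𝔼 L (λ σ → ⟦ x u σ ⟧ * ⟦ x v σ ⟧) * 𝔼 L (λ _ → 1) ≤ c₁ * c₁
      pair u v ne = begin
        𝔼 L (λ σ → ⟦ x u σ ⟧ * ⟦ x v σ ⟧) * 𝔼 L (λ _ → 1)
          ≤⟨ *-mono-≤ (≤-trans (𝔼-mono L λ {σ} _ → bothAvoided u v σ) (𝔼-avoid≤ (both u v) m₋ L _ le (≤-reflexive (sym (countBoth u v ne)))))
                      (≤-reflexive (trans total (sym (fall-! m₋ N le)))) ⟩
        fall (N ∸ (n ∸ 1 + (n ∸ 2))) m₋ * R * (fall N m₋ * R)
          ≡⟨ arith (fall (N ∸ (n ∸ 1 + (n ∸ 2))) m₋) R (fall N m₋) ⟩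
        fall (N ∸ (n ∸ 1 + (n ∸ 2))) m₋ * fall N m₋ * (R * R)
          ≤⟨ *-monoˡ-≤ (R * R) pairs ⟩
        F₁ * F₁ * (R * R)
          ≡⟨ arith' F₁ R ⟩
        c₁ * c₁ ∎
        where
        arith : ∀ a r b → a * r * (b * r) ≡ a * b * (r * r)
        arith = solve-∀
        arith' : ∀ a r → a * a * (r * r) ≡ a * r * (a * r)
        arith' = solve-∀

-- Estimates conditional on the first `m₁` edges.

Unique-resp-↭ : ∀ {A : Set} {xs ys : List A} → xs ↭ ys → Unique xs → Unique ys
Unique-resp-↭ ↭-refl u = u
Unique-resp-↭ (prep x p) (a ∷ u) = All.tabulate (λ m → All.lookup a (∈-resp-↭ (↭-sym p) m)) ∷ Unique-resp-↭ p u
Unique-resp-↭ (swap x y p) ((ne ∷ a) ∷ (b ∷ u)) =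
  ((ne ∘ sym) ∷ All.tabulate (λ m → All.lookup b (∈-resp-↭ (↭-sym p) m))) ∷ All.tabulate (λ m → All.lookup a (∈-resp-↭ (↭-sym p) m)) ∷ Unique-resp-↭ p u
Unique-resp-↭ (↭-trans p q) u = Unique-resp-↭ q (Unique-resp-↭ p u)

fall-+ : ∀ a N b → fall N (a + b) ≡ fall N a * fall (N ∸ a) b
fall-+ zero N b = sym (+-identityʳ _)
fall-+ (suc a) N b = trans (cong (N *_) (trans (fall-+ a (N ∸ 1) b) (cong (λ z → fall (N ∸ 1) a * fall z b) (∸-+-assoc N 1 a)))) (sym (*-assoc N (fall (N ∸ 1) a) _))

pow≤fall : ∀ a {D N} → D + a ≤ N → D ^ a ≤ fall N a
pow≤fall zero h = ≤-refl
pow≤fall (suc a) {D} {N} h = *-mono-≤ (≤-trans (m≤m+n D (suc a)) h)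
  (pow≤fall a (≤-trans (≤-reflexive (sym (m+n∸n≡m (D + a) 1))) (∸-monoˡ-≤ 1 (≤-trans (≤-reflexive (trans (+-comm (D + a) 1) (sym (+-suc D a)))) h))))

avoid-count : ∀ {A : Set} (p : A → Bool) m (P : List A) → length P ≤ m → avoid p m P ≡ true → count p P ≡ 0
avoid-count p m [] _ _ = refl
avoid-count p (suc m) (x ∷ P) (s≤s h) q with ∧-elim {not (p x)} q
... | q₁ , q₂ = cong₂ _+_ (cong ⟦_⟧ (not-false q₁)) (avoid-count p m P h q₂)

split-off : ∀ {A : Set} (B r : List A) → Unique B → (∀ {e} → e ∈ B → e ∈ r) → ∃[ L ] r ↭ B ++ L
split-off [] r _ _ = r , ↭-refl
split-off (e ∷ B) r (e∉ ∷ u) h with ∈-∃++ (h (here refl))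
... | ys , zs , refl with split-off B (ys ++ zs) u inside
  where
  inside : ∀ {x} → x ∈ B → x ∈ ys ++ zs
  inside {x} k with ∈-++⁻ ys (h (there k))
  ... | inj₁ a = ∈-++⁺ˡ a
  ... | inj₂ (here refl) = ⊥-elim (All.lookup e∉ k refl)
  ... | inj₂ (there b) = ∈-++⁺ʳ ys b
... | L , q = L , ↭-trans (shift e ys zs) (prep e q)

neighbours≤ : ∀ {n} (P : EdgeList n) → (∀ {e} → e ∈ P → proj₁ e ≢ proj₂ e) → ∀ u → card (adjᴸ P u) ≤ count (star u) P
neighbours≤ {n} [] _ u = ≤-reflexive (trans (∑-const {n} 0) (*-zeroʳ n))
neighbours≤ {n} ((i , j) ∷ P) proper u = begin
    card (adjᴸ ((i , j) ∷ P) u)                                        ≤⟨ ∑-mono pt ⟩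
    ∑ (λ v → ⟦ star u (i , j) ⟧ * ⟦ v == other ⟧ + ⟦ adjᴸ P u v ⟧)     ≡⟨ ∑-+ (λ v → ⟦ star u (i , j) ⟧ * ⟦ v == other ⟧) (λ v → ⟦ adjᴸ P u v ⟧) ⟩
    ∑ (λ v → ⟦ star u (i , j) ⟧ * ⟦ v == other ⟧) + card (adjᴸ P u)    ≡⟨ cong (_+ card (adjᴸ P u)) (trans (∑-*ˡ ⟦ star u (i , j) ⟧ (λ v → ⟦ v == other ⟧)) (trans (cong (⟦ star u (i , j) ⟧ *_) (card-single other)) (*-identityʳ _))) ⟩
    ⟦ star u (i , j) ⟧ + card (adjᴸ P u)                               ≤⟨ +-monoʳ-≤ ⟦ star u (i , j) ⟧ (neighbours≤ P (proper ∘ there) u) ⟩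
    ⟦ star u (i , j) ⟧ + count (star u) P                              ∎
  where
  open ≤-Reasoning
  other : Fin n
  other = if i == u then j else i
  first : ∀ v → (u , v) ≡ (i , j) → 1 ≤ ⟦ star u (i , j) ⟧ * ⟦ v == other ⟧
  first v refl rewrite ==-refl u | ==-false {i = v} {u} (λ e → proper (here refl) (sym e)) | ==-refl v = ≤-refl
  second : ∀ v → (v , u) ≡ (i , j) → 1 ≤ ⟦ star u (i , j) ⟧ * ⟦ v == other ⟧
  second v refl rewrite ==-false {i = v} {u} (proper (here refl)) | ==-refl u | ==-refl v = ≤-refl
  pt : ∀ v → ⟦ adjᴸ ((i , j) ∷ P) u v ⟧ ≤ ⟦ star u (i , j) ⟧ * ⟦ v == other ⟧ + ⟦ adjᴸ P u v ⟧
  pt v with bool? (does ((u , v) ≟ᴱ (i , j))) | bool? (does ((v , u) ≟ᴱ (i , j)))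
  ... | inj₁ q | _ = ≤-trans (⟦⟧≤1 _) (≤-trans (first v (does-elim ((u , v) ≟ᴱ (i , j)) q)) (m≤m+n _ _))
  ... | inj₂ _ | inj₁ q = ≤-trans (⟦⟧≤1 _) (≤-trans (second v (does-elim ((v , u) ≟ᴱ (i , j)) q)) (m≤m+n _ _))
  ... | inj₂ q | inj₂ q' = ≤-trans (≤-reflexive (cong₂ (λ a b → ⟦ (a ∨ elem (u , v) P) ∨ (b ∨ elem (v , u) P) ⟧) q q')) (m≤n+m _ _)

mkEdge-∈ : ∀ {n} {u v : Fin n} → u ≢ v → mkEdge u v ∈ edges n
mkEdge-∈ {u = u} {v} ne with bool? (below u v)
... | inj₁ q = subst (_∈ edges _) (sym (cong (if_then (u , v) else (v , u)) q)) (edges-∈ (does-elim (toℕ u <? toℕ v) q))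
... | inj₂ q = subst (_∈ edges _) (sym (cong (if_then (u , v) else (v , u)) q))
                 (edges-∈ (≤∧≢⇒< (≮⇒≥ (does-elim′ (toℕ u <? toℕ v) q)) λ e → ne (Finₚ.toℕ-injective (sym e))))

mkEdge-cases : ∀ {n} (u v : Fin n) → mkEdge u v ≡ (u , v) ⊎ mkEdge u v ≡ (v , u)
mkEdge-cases u v with below u v
... | true = inj₁ refl
... | false = inj₂ refl

module Conditional (n m₁ m₋ m₊ μ h Δ ℓ : ℕ)
              (build : (adj : Fin n → Fin n → Bool) → (∀ u v → adj u v ≡ true → adj v u ≡ true) →
                       (∀ (A B : Fin n → Bool) → (∀ i → A i ≡ true → B i ≡ false) → μ ≤ card A → μ ≤ card B →
                         ∃[ a ] ∃[ b ] A a ≡ true × B b ≡ true × adj a b ≡ true) → Structure adj h μ)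
              (P r : EdgeList n) (lenP : length P ≡ m₁) (perm : P ++ r ↭ edges n) (S : Structure (adjᴸ P) h μ) where
  open Events n m₁ m₋ m₊ μ h Δ ℓ build
  open Given P S
  open Structure S

  N′ = length r

  uniquePr : Unique (P ++ r)
  uniquePr = Unique-resp-↭ (↭-sym perm) (edges-unique n)

  unique-r : Unique r
  unique-r = unique-++ʳ P uniquePr

  -- If the prefix contains no marked edge, all of them are still to come.
  countRest : ∀ p → avoid p m₁ P ≡ true → count p r ≡ count p (edges n)
  countRest p q = trans (cong (_+ count p r) (sym (avoid-count p m₁ P (≤-reflexive lenP) q))) (trans (sym (count-++ p P r)) (count-↭ p perm))

  P-proper : ∀ {e} → e ∈ P → proj₁ e ≢ proj₂ e
  P-proper k q = <-irrefl (cong toℕ q) (edges-up (∈-resp-↭ perm (∈-++⁺ˡ k)))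

  unattached-rare : ∀ κ β₀ → β₀ ≤ card base → m₊ ∸ m₁ ≤ N′ → κ * (n * fall (N′ ∸ β₀) (m₊ ∸ m₁)) ≤ fall N′ (m₊ ∸ m₁) → κ * 𝔼 r unattached ≤ N′ !
  unattached-rare κ β₀ β≤ le H = begin
      κ * 𝔼 r unattached                            ≡⟨ cong (κ *_) (𝔼-∑ r term) ⟩
      κ * ∑ (λ v → 𝔼 r (term v))                    ≤⟨ *-monoʳ-≤ κ (∑-bound (λ v → 𝔼 r (term v)) (F * R) each) ⟩
      κ * (n * (F * R))                             ≡⟨ arith κ n F R ⟩
      κ * (n * F) * R                               ≤⟨ *-monoˡ-≤ R H ⟩
      fall N′ (m₊ ∸ m₁) * R                         ≡⟨ fall-! (m₊ ∸ m₁) N′ le ⟩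
      N′ !                                          ∎
    where
    open ≤-Reasoning
    F = fall (N′ ∸ β₀) (m₊ ∸ m₁)
    R = (N′ ∸ (m₊ ∸ m₁)) !
    term : Fin n → EdgeList n → ℕ
    term v τ = ⟦ not (base v) ∧ avoid (baseEdge v) m₁ P ⟧ * ⟦ avoid (baseEdge v) (m₊ ∸ m₁) τ ⟧
    arith : ∀ k a f r → k * (a * (f * r)) ≡ k * (a * f) * r
    arith = solve-∀
    each : ∀ v → 𝔼 r (term v) ≤ F * R
    each v with bool? (not (base v) ∧ avoid (baseEdge v) m₁ P)
    ... | inj₂ q = ≤-trans (≤-reflexive (trans (𝔼-cong r λ {τ} _ → cong (λ b → ⟦ b ⟧ * ⟦ avoid (baseEdge v) (m₊ ∸ m₁) τ ⟧) q) (𝔼-0 r))) z≤n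
    ... | inj₁ q with ∧-elim {not (base v)} q
    ... | nb , av = ≤-trans (𝔼-mono r λ {τ} _ → ≤-trans (*-monoˡ-≤ ⟦ avoid (baseEdge v) (m₊ ∸ m₁) τ ⟧ (⟦⟧≤1 (not (base v) ∧ avoid (baseEdge v) m₁ P))) (≤-reflexive (+-identityʳ _)))
          (𝔼-avoid≤ (baseEdge v) (m₊ ∸ m₁) r β₀ le (≤-trans β≤ (≤-reflexive (sym (trans (countRest (baseEdge v) av)
            (trans (count-between (single v) base disj) (trans (cong (_* card base) (card-single v)) (+-identityʳ _))))))))
      where
      disj : Disjoint (single v) base
      disj i e rewrite ==-true {i = i} e = not-false nb

  M m′ : ℕ
  M = m₊ ∸ m₁
  m′ = m₋ ∸ m₁

  fresh-length : ∀ u L → length (fresh u L) ≤ length L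
  fresh-length u [] = z≤n
  fresh-length u (v ∷ L) with linked u v
  ... | true = m≤n⇒m≤1+n (fresh-length v L)
  ... | false = s≤s (fresh-length v L)

  fresh-∈ : ∀ u L {e} → uniqueᵇ (u ∷ L) ≡ true → e ∈ fresh u L →
            (∃[ x ] ∃[ y ] x ∈ (u ∷ L) × y ∈ (u ∷ L) × x ≢ y × linked x y ≡ false × e ≡ mkEdge x y)
  fresh-∈ u (v ∷ L) un k with linked u v in q | ∧-elim {not (mem u (v ∷ L))} un
  ... | true | _ , un' with fresh-∈ v L un' k
  ... | x , y , a , b , rest = x , y , there a , there b , rest
  fresh-∈ u (v ∷ L) un (here refl) | false | nu , un' = u , v , here refl , there (here refl) ,
    (λ { refl → true≢false (∈⇒mem {L = u ∷ L} (here refl)) (not-false nu) }) , q , refl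
  fresh-∈ u (v ∷ L) un (there k) | false | _ , un' with fresh-∈ v L un' k
  ... | x , y , a , b , rest = x , y , there a , there b , rest

  fresh-unique : ∀ u L → uniqueᵇ (u ∷ L) ≡ true → Unique (fresh u L)
  fresh-unique u [] _ = []
  fresh-unique u (v ∷ L) un with linked u v | ∧-elim {not (mem u (v ∷ L))} un
  ... | true | _ , un' = fresh-unique v L un'
  ... | false | nu , un' = All.tabulate new ∷ fresh-unique v L un'
    where
    u∉ : u ∉ (v ∷ L)
    u∉ k = true≢false (∈⇒mem k) (not-false nu)
    meets : ∀ {x y} → mkEdge u v ≡ mkEdge x y → u ≡ x ⊎ u ≡ y
    meets {x} {y} e with mkEdge-cases u v | mkEdge-cases x y
    ... | inj₁ p | inj₁ q = inj₁ (cong proj₁ (trans (sym p) (trans e q)))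
    ... | inj₁ p | inj₂ q = inj₂ (cong proj₁ (trans (sym p) (trans e q)))
    ... | inj₂ p | inj₁ q = inj₂ (cong proj₂ (trans (sym p) (trans e q)))
    ... | inj₂ p | inj₂ q = inj₁ (cong proj₂ (trans (sym p) (trans e q)))
    new : ∀ {e} → e ∈ fresh v L → mkEdge u v ≢ e
    new k refl with fresh-∈ v L un' k
    ... | x , y , a , b , _ , _ , e with meets e
    ... | inj₁ refl = u∉ a
    ... | inj₂ refl = u∉ b

  fresh-in-r : ∀ u L {e} → uniqueᵇ (u ∷ L) ≡ true → e ∈ fresh u L → e ∈ r
  fresh-in-r u L un k with fresh-∈ u L un k
  ... | x , y , _ , _ , ne , nl , refl with ∈-++⁻ P (∈-resp-↭ (↭-sym perm) (mkEdge-∈ ne))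
  ... | inj₂ b = b
  ... | inj₁ a with mkEdge-cases x y
  ... | inj₁ q = ⊥-elim (true≢false (∨-introˡ (Adj⇒adjᴸ {P = P} (inj₁ (subst (_∈ P) q a)))) nl)
  ... | inj₂ q = ⊥-elim (true≢false (∨-introˡ (Adj⇒adjᴸ {P = P} (inj₂ (subst (_∈ P) q a)))) nl)

  card-endpoints : ∀ u L → lastOf u L ≢ u → card (endpoints u L) ≡ 2
  card-endpoints u L ne = trans (∑-cong pt) (trans (∑-+ (λ i → ⟦ i == u ⟧) (λ i → ⟦ i == lastOf u L ⟧)) (cong₂ _+_ (card-single u) (card-single (lastOf u L))))
    where
    pt : ∀ i → ⟦ (i == u) ∨ (i == lastOf u L) ⟧ ≡ ⟦ i == u ⟧ + ⟦ i == lastOf u L ⟧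
    pt i with i ≟ u
    ... | no _ = refl
    ... | yes refl rewrite ==-false {i = i} {lastOf i L} (λ e → ne (sym e)) = refl

  module Far (x D β₀ : ℕ) (β≤ : β₀ ≤ card base) (q : ℕ) (D≤ : D + q ≤ N′) (q≤m′ : q ≤ m′) (m′≤N′ : m′ ≤ N′)
             (window : ∀ a → a ≤ q → x * fall (N′ ∸ 2 * β₀) (m′ ∸ a) ≤ fall (N′ ∸ a) (m′ ∸ a)) where

    -- Step probabilities multiplied by `D`: a linked step is free, while a new edge arrives in time
    -- with probability at most about `M / D`, where `D` bounds the number of open edges from below.
    wt : Fin n → Fin n → ℕ
    wt u v = if linked u v then D else M

    Wt : Fin n → List (Fin n) → ℕ
    Wt u [] = 1
    Wt u (v ∷ L) = wt u v * Wt v L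

    Wt-split : ∀ u L → ∃[ b ] length (fresh u L) + b ≡ length L × Wt u L ≡ M ^ length (fresh u L) * D ^ b
    Wt-split u [] = 0 , refl , refl
    Wt-split u (v ∷ L) with linked u v | Wt-split v L
    ... | true | b , e , w = suc b , trans (+-suc _ b) (cong suc e) , trans (cong (D *_) w) (arith D (M ^ length (fresh v L)) (D ^ b))
      where
      arith : ∀ d m e → d * (m * e) ≡ m * (d * e)
      arith = solve-∀
    ... | false | b , e , w = b , cong suc e , trans (cong (M *_) w) (sym (*-assoc M (M ^ length (fresh v L)) (D ^ b)))

    -- Extracting the new edges gives the power of `M`; what is left must avoid the at least
    -- `2 * β₀` edges from the two ends to the base, for which `window` yields the factor `1 / x`.
    -- The power of `D` is paid for by the draws that the extracted edges occupied.
    core-bound : ∀ u L → admissible u L ≡ true → length (fresh u L) ≤ q →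
                 x * (D ^ length (fresh u L) * 𝔼 r (λ τ → ⟦ allIn (fresh u L) (take M τ) ⟧ * ⟦ avoid (between (endpoints u L) base) m′ τ ⟧)) ≤
                 M ^ length (fresh u L) * N′ !
    core-bound u L adm a≤q with ∧-elim {uniqueᵇ (u ∷ L)} adm
    ... | un , adm' with ∧-elim {not (lastOf u L == u)} adm'
    ... | nl , adm'' with ∧-elim {disjointᵇ (endpoints u L) base} adm''
    ... | disj , av with split-off (fresh u L) r (fresh-unique u L un) (fresh-in-r u L un)
    ... | L″ , pm = begin
        x * (D ^ a * 𝔼 r f)                                                       ≤⟨ *-monoʳ-≤ x (*-monoʳ-≤ (D ^ a) e≤) ⟩
        x * (D ^ a * (M ^ a * (fall (N′ ∸ 2 * β₀) (m′ ∸ a) * R)))                 ≡⟨ arith x (D ^ a) (M ^ a) (fall (N′ ∸ 2 * β₀) (m′ ∸ a)) R ⟩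
        M ^ a * (D ^ a * (x * fall (N′ ∸ 2 * β₀) (m′ ∸ a)) * R)                   ≤⟨ *-monoʳ-≤ (M ^ a) (*-monoˡ-≤ R (*-mono-≤ (pow≤fall a (≤-trans (+-monoʳ-≤ D a≤q) D≤)) (window a a≤q))) ⟩
        M ^ a * (fall N′ a * fall (N′ ∸ a) (m′ ∸ a) * R)                          ≡⟨ cong (λ z → M ^ a * (z * R)) (trans (sym (fall-+ a N′ (m′ ∸ a))) (cong (fall N′) (m+[n∸m]≡n a≤m′))) ⟩
        M ^ a * (fall N′ m′ * R)                                                  ≡⟨ cong (M ^ a *_) (fall-! m′ N′ m′≤N′) ⟩
        M ^ a * N′ !                                                              ∎
      where
      open ≤-Reasoning
      a = length (fresh u L)
      R = (N′ ∸ m′) !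
      p = between (endpoints u L) base
      f : EdgeList n → ℕ
      f τ = ⟦ allIn (fresh u L) (take M τ) ⟧ * ⟦ avoid p m′ τ ⟧
      a≤m′ = ≤-trans a≤q q≤m′
      arith : ∀ x d m f r → x * (d * (m * (f * r))) ≡ m * (d * (x * f) * r)
      arith = solve-∀
      lens : a + length L″ ≡ N′
      lens = sym (trans (↭-length pm) (length-++ (fresh u L)))
      len″ : length L″ ≡ N′ ∸ a
      len″ = trans (sym (m+n∸m≡n a (length L″))) (cong (_∸ a) lens)
      few : count (not ∘ p) L″ ≤ N′ ∸ 2 * β₀
      few = ≤-trans (m≤n+m _ (count (not ∘ p) (fresh u L))) (≤-trans (≤-reflexive (sym (trans (count-↭ (not ∘ p) pm) (count-++ (not ∘ p) (fresh u L) L″))))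
        (count-not-≤ p r (2 * β₀) (≤-trans (*-monoʳ-≤ 2 β≤) (≤-reflexive (sym (trans (countRest p av)
          (trans (count-between (endpoints u L) base (disjointᵇ-elim disj)) (cong (_* card base) (card-endpoints u L (λ e → true≢false (trans (cong (_== u) e) (==-refl u)) (not-false nl)))))))))))
      e≤ : 𝔼 r f ≤ M ^ a * (fall (N′ ∸ 2 * β₀) (m′ ∸ a) * R)
      e≤ = begin
        𝔼 r f                                                  ≡⟨ 𝔼-↭ pm f ⟩
        𝔼 (fresh u L ++ L″) f                                  ≤⟨ extract p M m′ (fresh u L) L″ (Unique-resp-↭ pm unique-r) ⟩
        M ^ a * 𝔼 L″ (λ τ → ⟦ avoid p (m′ ∸ a) τ ⟧)            ≡⟨ cong (M ^ a *_) (𝔼-avoid p (m′ ∸ a) L″ (≤-trans (∸-monoˡ-≤ a m′≤N′) (≤-reflexive (sym len″)))) ⟩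
        M ^ a * (fall (count (not ∘ p) L″) (m′ ∸ a) * (length L″ ∸ (m′ ∸ a)) !)
                                                               ≤⟨ *-monoʳ-≤ (M ^ a) (*-mono-≤ (fall-mono (m′ ∸ a) few) (≤-reflexive (cong _! (trans (cong (_∸ (m′ ∸ a)) len″) (trans (∸-+-assoc N′ a (m′ ∸ a)) (cong (N′ ∸_) (m+[n∸m]≡n a≤m′))))))) ⟩
        M ^ a * (fall (N′ ∸ 2 * β₀) (m′ ∸ a) * R)              ∎

    path-bound : ∀ u L → length L ≤ q → x * (D ^ length L * 𝔼 r (nearPath u L)) ≤ Wt u L * N′ !
    path-bound u L le with bool? (admissible u L)
    ... | inj₂ no-adm = ≤-trans (≤-reflexive (trans (cong (λ z → x * (D ^ length L * z)) (trans (𝔼-cong r λ {τ} _ → cong (λ b → ⟦ b ⟧ * g τ) no-adm) (𝔼-0 r)))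
                   (trans (cong (x *_) (*-zeroʳ (D ^ length L))) (*-zeroʳ x)))) z≤n
      where
      g : EdgeList n → ℕ
      g τ = ⟦ allIn (fresh u L) (take M τ) ⟧ * ⟦ avoid (between (endpoints u L) base) m′ τ ⟧
    ... | inj₁ adm with Wt-split u L
    ... | b , ab , w = begin
        x * (D ^ length L * 𝔼 r (nearPath u L))                       ≡⟨ cong (λ z → x * (D ^ length L * z)) (𝔼-cong r λ {τ} _ → trans (cong (λ c → ⟦ c ⟧ * f τ) adm) (+-identityʳ (f τ))) ⟩
        x * (D ^ length L * 𝔼 r f)                                    ≡⟨ cong (λ z → x * (z * 𝔼 r f)) (trans (cong (D ^_) (sym ab)) (^-distribˡ-+-* D a b)) ⟩
        x * (D ^ a * D ^ b * 𝔼 r f)                                   ≡⟨ arith x (D ^ a) (D ^ b) (𝔼 r f) ⟩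
        D ^ b * (x * (D ^ a * 𝔼 r f))                                 ≤⟨ *-monoʳ-≤ (D ^ b) (core-bound u L adm (≤-trans (fresh-length u L) le)) ⟩
        D ^ b * (M ^ a * N′ !)                                        ≡⟨ trans (sym (*-assoc (D ^ b) (M ^ a) (N′ !))) (cong (_* N′ !) (trans (*-comm (D ^ b) (M ^ a)) (sym w))) ⟩
        Wt u L * N′ !                                                 ∎
      where
      open ≤-Reasoning
      a = length (fresh u L)
      f : EdgeList n → ℕ
      f τ = ⟦ allIn (fresh u L) (take M τ) ⟧ * ⟦ avoid (between (endpoints u L) base) m′ τ ⟧
      arith : ∀ x d e z → x * (d * e * z) ≡ e * (x * (d * z))
      arith = solve-∀

    wt≤ : ∀ u v → wt u v ≤ D * ⟦ linked u v ⟧ + M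
    wt≤ u v with linked u v
    ... | true = ≤-trans (≤-reflexive (sym (*-identityʳ D))) (m≤m+n (D * 1) M)
    ... | false = m≤n+m M (D * 0)

    length-flat : ∀ {c} → c ∈ cells → length (flat c) ≤ 2 * h + 6
    length-flat {c} k = begin
        suc (length (G c false ++ G c true ++ spare c ∷ []))       ≡⟨ cong suc (trans (length-++ (G c false)) (cong₂ _+_ (CellOK.lengths (ok k) false)
                                                                       (trans (length-++ (G c true)) (cong (_+ 1) (CellOK.lengths (ok k) true))))) ⟩
        suc (height c + 2 + (height c + 2 + 1))                    ≡⟨ arith (height c) ⟩
        2 * height c + 6                                           ≤⟨ +-monoˡ-≤ 6 (*-monoʳ-≤ 2 (bounded k)) ⟩
        2 * h + 6                                                  ∎
      where
      open ≤-Reasoning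
      arith : ∀ t → suc (t + 2 + (t + 2 + 1)) ≡ 2 * t + 6
      arith = solve-∀

    sameCell≤ : ∀ cs → (∀ {c} → c ∈ cs → length (flat c) ≤ 2 * h + 6) → Unique (flats cs) → ∀ u → card (sameCell cs u) ≤ 2 * h + 6
    sameCell≤ [] _ _ u = ≤-trans (≤-reflexive (trans (∑-const {n} 0) (*-zeroʳ n))) z≤n
    sameCell≤ (c ∷ cs) len un u with bool? (mem u (flat c))
    ... | inj₂ q = ≤-trans (≤-reflexive (card-cong λ v → cong (λ b → (b ∧ mem v (flat c)) ∨ sameCell cs u v) q)) (sameCell≤ cs (len ∘ there) (unique-++ʳ (flat c) un) u)
    ... | inj₁ q = ≤-trans (card-mono only) (≤-trans (card-mem≤ (flat c)) (len (here refl)))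
      where
      elsewhere : ∀ ds {v} → sameCell ds u v ≡ true → u ∈ flats ds
      elsewhere (d ∷ ds) {v} k with ∨-elim {mem u (flat d) ∧ mem v (flat d)} k
      ... | inj₁ k' = ∈-++⁺ˡ (mem⇒∈ (flat d) (proj₁ (∧-elim {mem u (flat d)} k')))
      ... | inj₂ k' = ∈-++⁺ʳ (flat d) (elsewhere ds k')
      only : ∀ v → (mem u (flat c) ∧ mem v (flat c)) ∨ sameCell cs u v ≡ true → mem v (flat c) ≡ true
      only v k with ∨-elim {mem u (flat c) ∧ mem v (flat c)} k
      ... | inj₁ k' = proj₂ (∧-elim {mem u (flat c)} k')
      ... | inj₂ k' = ⊥-elim (unique-disjoint (flat c) un (mem⇒∈ (flat c) q) (elsewhere cs k'))

    module _ (uncrowded : ∀ v → degree P v < Δ) where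

      -- `Λ` bounds the vertices linked to a given one: fewer than `Δ` neighbours and one cell of at
      -- most `2 * h + 6` vertices. `R` bounds the total weight of the steps out of a vertex, so
      -- `R ^ k` that of the paths with `k` steps.
      Λ R : ℕ
      Λ = Δ + (2 * h + 6)
      R = D * Λ + n * M

      linked≤ : ∀ u → card (linked u) ≤ Λ
      linked≤ u = ≤-trans (card-∨ (adjᴸ P u) (sameCell cells u)) (+-mono-≤
        (≤-trans (neighbours≤ P P-proper u) (≤-trans (≤-reflexive (cong (count (star u)) (sym (take-all m₁ P (≤-reflexive lenP))))) (<⇒≤ (uncrowded u))))
        (sameCell≤ cells length-flat distinct u))

      row≤ : ∀ u → ∑ (wt u) ≤ R
      row≤ u = ≤-trans (∑-mono (wt≤ u)) (≤-trans (≤-reflexive (trans (∑-+ (λ v → D * ⟦ linked u v ⟧) (λ _ → M))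
        (cong₂ _+_ (∑-*ˡ D (⟦_⟧ ∘ linked u)) (∑-const {n} M)))) (+-monoˡ-≤ (n * M) (*-monoʳ-≤ D (linked≤ u))))

      Wt-sum : ∀ k u → ∑ᴸ k (Wt u) ≤ R ^ k
      Wt-sum zero u = ≤-refl
      Wt-sum (suc k) u = begin
          ∑ (λ v → ∑ᴸ k λ L → wt u v * Wt v L)     ≡⟨ ∑-cong (λ v → ∑ᴸ-* (wt u v) k (Wt v)) ⟩
          ∑ (λ v → wt u v * ∑ᴸ k (Wt v))           ≤⟨ ∑-mono (λ v → *-monoʳ-≤ (wt u v) (Wt-sum k v)) ⟩
          ∑ (λ v → wt u v * R ^ k)                 ≡⟨ trans (∑-cong λ v → *-comm (wt u v) (R ^ k)) (∑-*ˡ (R ^ k) (wt u)) ⟩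
          R ^ k * ∑ (wt u)                         ≤⟨ *-monoʳ-≤ (R ^ k) (row≤ u) ⟩
          R ^ k * R                                ≡⟨ *-comm (R ^ k) R ⟩
          R * R ^ k                                ∎
        where open ≤-Reasoning

      D≤R : 1 ≤ Δ → D ≤ R
      D≤R pos = ≤-trans (≤-trans (≤-reflexive (sym (*-identityʳ D))) (*-monoʳ-≤ D (≤-trans pos (m≤m+n Δ _)))) (m≤m+n (D * Λ) (n * M))

      -- Since `D ≤ R`, shorter paths can be padded to the power `q`, and all lengths share one
      -- bound.
      level-bound : 1 ≤ Δ → ∀ k → k ≤ q → x * (D ^ q * 𝔼 r (λ τ → ∑ λ u → ∑ᴸ k λ L → nearPath u L τ)) ≤ n * R ^ q * N′ !
      level-bound pos k k≤q = begin
          x * (D ^ q * 𝔼 r (λ τ → ∑ λ u → ∑ᴸ k λ L → nearPath u L τ))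
            ≡⟨ cong₂ (λ a b → x * (a * b)) (trans (cong (D ^_) (sym (m+[n∸m]≡n k≤q))) (^-distribˡ-+-* D k (q ∸ k)))
                 (trans (𝔼-∑ r (λ u τ → ∑ᴸ k λ L → nearPath u L τ)) (∑-cong λ u → 𝔼-∑ᴸ r k (nearPath u))) ⟩
          x * (D ^ k * D ^ (q ∸ k) * ∑ (λ u → ∑ᴸ k λ L → 𝔼 r (nearPath u L)))
            ≡⟨ arith x (D ^ k) (D ^ (q ∸ k)) _ ⟩
          D ^ (q ∸ k) * (x * D ^ k * ∑ (λ u → ∑ᴸ k λ L → 𝔼 r (nearPath u L)))
            ≡⟨ cong (D ^ (q ∸ k) *_) (trans (sym (∑-*ˡ (x * D ^ k) (λ u → ∑ᴸ k λ L → 𝔼 r (nearPath u L)))) (∑-cong λ u → sym (∑ᴸ-* (x * D ^ k) k (λ L → 𝔼 r (nearPath u L))))) ⟩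
          D ^ (q ∸ k) * ∑ (λ u → ∑ᴸ k λ L → x * D ^ k * 𝔼 r (nearPath u L))
            ≤⟨ *-monoʳ-≤ (D ^ (q ∸ k)) (∑-mono λ u → ≤-trans (∑ᴸ-mono k (each u)) (≤-trans (≤-reflexive (∑ᴸ-* (N′ !) k (Wt u))) (*-monoʳ-≤ (N′ !) (Wt-sum k u)))) ⟩
          D ^ (q ∸ k) * ∑ {n} (λ u → N′ ! * R ^ k)
            ≡⟨ cong (D ^ (q ∸ k) *_) (∑-const {n} (N′ ! * R ^ k)) ⟩
          D ^ (q ∸ k) * (n * (N′ ! * R ^ k))
            ≤⟨ *-monoˡ-≤ (n * (N′ ! * R ^ k)) (^-monoˡ-≤ (q ∸ k) (D≤R pos)) ⟩
          R ^ (q ∸ k) * (n * (N′ ! * R ^ k))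
            ≡⟨ arith' (R ^ (q ∸ k)) n (N′ !) (R ^ k) ⟩
          n * (R ^ k * R ^ (q ∸ k)) * N′ !
            ≡⟨ cong (λ z → n * z * N′ !) (trans (sym (^-distribˡ-+-* R k (q ∸ k))) (cong (R ^_) (m+[n∸m]≡n k≤q))) ⟩
          n * R ^ q * N′ ! ∎
        where
        open ≤-Reasoning
        arith : ∀ x a b z → x * (a * b * z) ≡ b * (x * a * z)
        arith = solve-∀
        arith' : ∀ a n t b → a * (n * (t * b)) ≡ n * (b * a) * t
        arith' = solve-∀
        each : ∀ u L → length L ≡ k → x * D ^ k * 𝔼 r (nearPath u L) ≤ N′ ! * Wt u L
        each u L refl = ≤-trans (≤-reflexive (*-assoc x (D ^ length L) _)) (≤-trans (path-bound u L k≤q) (≤-reflexive (*-comm (Wt u L) (N′ !))))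

      nearPairs-rare : ∀ κ → 1 ≤ Δ → ℓ ≤ suc q → 0 < x * D ^ q → κ * (ℓ * (n * R ^ q)) ≤ x * D ^ q → κ * 𝔼 r nearPairs ≤ N′ !
      nearPairs-rare κ pos ℓ≤ xD>0 H = *-cancelˡ-≤ (x * D ^ q) {{>-nonZero xD>0}} (begin
          x * D ^ q * (κ * 𝔼 r nearPairs)
            ≡⟨ arith (x * D ^ q) κ (𝔼 r nearPairs) ⟩
          κ * (x * D ^ q * 𝔼 r nearPairs)
            ≡⟨ cong (λ z → κ * (x * D ^ q * z)) (𝔼-∑ r level) ⟩
          κ * (x * D ^ q * ∑ (λ k → 𝔼 r (level k)))
            ≡⟨ cong (κ *_) (sym (∑-*ˡ (x * D ^ q) (λ k → 𝔼 r (level k)))) ⟩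
          κ * ∑ (λ k → x * D ^ q * 𝔼 r (level k))
            ≤⟨ *-monoʳ-≤ κ (∑-bound (λ k → x * D ^ q * 𝔼 r (level k)) (n * R ^ q * N′ !) λ k →
                 ≤-trans (≤-reflexive (*-assoc x (D ^ q) _)) (level-bound pos (toℕ k) (≤-pred (≤-trans (Finₚ.toℕ<n k) ℓ≤)))) ⟩
          κ * (ℓ * (n * R ^ q * N′ !))
            ≡⟨ arith' κ ℓ (n * R ^ q) (N′ !) ⟩
          κ * (ℓ * (n * R ^ q)) * N′ !
            ≤⟨ *-monoˡ-≤ (N′ !) H ⟩
          x * D ^ q * N′ ! ∎)
        where
        open ≤-Reasoning
        level : Fin ℓ → EdgeList n → ℕ
        level k τ = ∑ λ u → ∑ᴸ (toℕ k) λ L → nearPath u L τ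
        arith : ∀ a k e → a * (k * e) ≡ k * (a * e)
        arith = solve-∀
        arith' : ∀ k l a t → k * (l * (a * t)) ≡ k * (l * a) * t
        arith' = solve-∀

-- The union bound and its numerical hypotheses.

-- Everything the union bound asks of the parameters. `1 / x` bounds the probability that the two
-- ends of a path stay away from the base up to `m₋`, and `D` bounds from below the number of edges
-- open after `m₁`.
record Numbers (n m₁ m₋ m₊ μ h Δ κ : ℕ) : Set where
  N = n C 2
  β₀ = n ∸ 18 * μ
  N′ = N ∸ m₁
  field
    m₁≤m₋ : m₁ + 6 ≤ m₋
    m₋≤m₊ : m₋ ≤ m₊
    m₊≤N : m₊ ≤ N
    two≤n : 2 ≤ n
    one≤Δ : 1 ≤ Δ
    joined-num : κ * (2 ^ n * (2 ^ n * fall (N ∸ μ * μ) m₁)) ≤ fall N m₁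
    degree-num : κ * (n * rising (n ∸ 1) N m₁) ≤ 2 ^ Δ * fall N m₁
    mean-pos : 0 < n * fall (N ∸ (n ∸ 1)) m₋
    mean-num : κ * fall N m₋ ≤ n * fall (N ∸ (n ∸ 1)) m₋
    pair-num : fall (N ∸ (n ∸ 1 + (n ∸ 2))) m₋ * fall N m₋ ≤ fall (N ∸ (n ∸ 1)) m₋ * fall (N ∸ (n ∸ 1)) m₋
    attach-num : κ * (n * fall (N′ ∸ β₀) (m₊ ∸ m₁)) ≤ fall N′ (m₊ ∸ m₁)
    x D : ℕ
    D≤ : D + 6 ≤ N′
    window : ∀ a → a ≤ 6 → x * fall (N′ ∸ 2 * β₀) ((m₋ ∸ m₁) ∸ a) ≤ fall (N′ ∸ a) ((m₋ ∸ m₁) ∸ a)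
    xD-pos : 0 < x * D ^ 6
    far-num : κ * (7 * (n * (D * (Δ + (2 * h + 6)) + n * (m₊ ∸ m₁)) ^ 6)) ≤ x * D ^ 6

module Rare (n m₁ m₋ m₊ μ h Δ ℓ : ℕ) (ℓ≡7 : ℓ ≡ 7)
              (build : (adj : Fin n → Fin n → Bool) → (∀ u v → adj u v ≡ true → adj v u ≡ true) →
                       (∀ (A B : Fin n → Bool) → (∀ i → A i ≡ true → B i ≡ false) → μ ≤ card A → μ ≤ card B →
                         ∃[ a ] ∃[ b ] A a ≡ true × B b ≡ true × adj a b ≡ true) → Structure adj h μ)
              (κ : ℕ) (num : Numbers n m₁ m₋ m₊ μ h Δ κ) where
  open Events n m₁ m₋ m₊ μ h Δ ℓ build
  open Numbers num
  open Bounds n m₁ m₋ m₊ μ h Δ ℓ build using (unjoined-rare; crowded-rare; isolated-common)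

  private
    L = edges n
    lenL : length L ≡ N
    lenL = length-edges n
    m₁≤m₋′ : m₁ ≤ m₋
    m₁≤m₋′ = ≤-trans (m≤m+n m₁ 6) m₁≤m₋
    m₁≤N : m₁ ≤ length L
    m₁≤N = ≤-trans m₁≤m₋′ (≤-trans m₋≤m₊ (≤-trans m₊≤N (≤-reflexive (sym lenL))))

  conditionalOn-rare : ∀ P r → length P ≡ m₁ → P ++ r ↭ L → ∀ d₁ d₂ → κ * 𝔼 r (λ τ → conditionalOn P τ d₁ d₂) ≤ 2 * 𝔼 r (λ _ → 1)
  conditionalOn-rare P r lenP perm (no _) _ = ≤-trans (≤-reflexive (trans (cong (κ *_) (𝔼-0 r)) (*-zeroʳ κ))) z≤n
  conditionalOn-rare P r lenP perm (yes _) (no _) = ≤-trans (≤-reflexive (trans (cong (κ *_) (𝔼-0 r)) (*-zeroʳ κ))) z≤n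
  conditionalOn-rare P r lenP perm (yes le) (yes z) = both (structureOf P le (m+n≡0⇒m≡0 _ z))
    where
    uncrowded : ∀ v → degree P v < Δ
    uncrowded v = ≰⇒> (does-elim′ (Δ ≤? degree P v) (⟦⟧-zero (∑-zero (λ v → ⟦ does (Δ ≤? degree P v) ⟧) (m+n≡0⇒n≡0 (unjoined P) z) v)))
    lenr : length r ≡ N′
    lenr = trans (sym (m+n∸m≡n m₁ (length r))) (cong (_∸ m₁) (trans (cong (_+ length r) (sym lenP)) (trans (sym (length-++ P)) (trans (↭-length perm) lenL))))
    both : ∀ S → κ * 𝔼 r (λ τ → Given.unattached P S τ + Given.nearPairs P S τ) ≤ 2 * 𝔼 r (λ _ → 1)
    both S = begin
        κ * 𝔼 r (λ τ → Given.unattached P S τ + Given.nearPairs P S τ)   ≡⟨ cong (κ *_) (𝔼-+ r (Given.unattached P S) (Given.nearPairs P S)) ⟩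
        κ * (𝔼 r (Given.unattached P S) + 𝔼 r (Given.nearPairs P S))     ≡⟨ *-distribˡ-+ κ (𝔼 r (Given.unattached P S)) (𝔼 r (Given.nearPairs P S)) ⟩
        κ * 𝔼 r (Given.unattached P S) + κ * 𝔼 r (Given.nearPairs P S)   ≤⟨ +-mono-≤ first second ⟩
        length r ! + length r !                                          ≡⟨ cong (length r ! +_) (sym (+-identityʳ (length r !))) ⟩
        2 * length r !                                                   ≡⟨ cong (2 *_) (sym (𝔼-one r)) ⟩
        2 * 𝔼 r (λ _ → 1)                                                ∎
      where
      open ≤-Reasoning
      module Cd = Conditional n m₁ m₋ m₊ μ h Δ ℓ build P r lenP perm S
      β≤ : β₀ ≤ card (Structure.base S)
      β≤ = ≤-trans (∸-monoˡ-≤ (18 * μ) (Structure.base-large S)) (≤-reflexive (m+n∸n≡m (card (Structure.base S)) (18 * μ)))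
      first : κ * 𝔼 r (Given.unattached P S) ≤ length r !
      first = Cd.unattached-rare κ β₀ β≤ (subst (m₊ ∸ m₁ ≤_) (sym lenr) (∸-monoˡ-≤ m₁ m₊≤N))
        (subst (λ N″ → κ * (n * fall (N″ ∸ β₀) (m₊ ∸ m₁)) ≤ fall N″ (m₊ ∸ m₁)) (sym lenr) attach-num)
      module Fr = Cd.Far x D β₀ β≤ 6 (subst (D + 6 ≤_) (sym lenr) D≤) (≤-trans (≤-reflexive (sym (m+n∸m≡n m₁ 6))) (∸-monoˡ-≤ m₁ m₁≤m₋))
        (subst (m₋ ∸ m₁ ≤_) (sym lenr) (∸-monoˡ-≤ m₁ (≤-trans m₋≤m₊ m₊≤N)))
        (subst (λ N″ → ∀ a → a ≤ 6 → x * fall (N″ ∸ 2 * β₀) ((m₋ ∸ m₁) ∸ a) ≤ fall (N″ ∸ a) ((m₋ ∸ m₁) ∸ a)) (sym lenr) window)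
      second : κ * 𝔼 r (Given.nearPairs P S) ≤ length r !
      second = Fr.nearPairs-rare uncrowded κ one≤Δ (≤-reflexive ℓ≡7) xD-pos (subst (λ l → κ * (l * (n * (D * (Δ + (2 * h + 6)) + n * (m₊ ∸ m₁)) ^ 6)) ≤ x * D ^ 6) (sym ℓ≡7) far-num)

  -- Five failures of weight `1 / κ` each: three counted outright and two inside the conditional
  -- term.
  bad-rare : κ * 𝔼 L bad ≤ 5 * length L !
  bad-rare = begin
      κ * 𝔼 L bad
        ≡⟨ cong (κ *_) (trans (𝔼-+ L (λ σ → unjoined σ + crowded σ + noneIsolated σ) cond) (cong (_+ 𝔼 L cond)
             (trans (𝔼-+ L (λ σ → unjoined σ + crowded σ) noneIsolated) (cong (_+ 𝔼 L noneIsolated) (𝔼-+ L unjoined crowded))))) ⟩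
      κ * (𝔼 L unjoined + 𝔼 L crowded + 𝔼 L noneIsolated + 𝔼 L cond)
        ≡⟨ arith κ (𝔼 L unjoined) (𝔼 L crowded) (𝔼 L noneIsolated) (𝔼 L cond) ⟩
      κ * 𝔼 L unjoined + κ * 𝔼 L crowded + κ * 𝔼 L noneIsolated + κ * 𝔼 L cond
        ≤⟨ +-mono-≤ (+-mono-≤ (+-mono-≤ one two) three) four ⟩
      length L ! + length L ! + length L ! + 2 * 𝔼 L (λ _ → 1)
        ≡⟨ trans (cong (λ z → length L ! + length L ! + length L ! + 2 * z) (𝔼-one L)) (arith' (length L !)) ⟩
      5 * length L ! ∎
    where
    open ≤-Reasoning
    cond : EdgeList n → ℕ
    cond σ = conditional (take m₁ σ) (drop m₁ σ)
    arith : ∀ k a b c d → k * (a + b + c + d) ≡ k * a + k * b + k * c + k * d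
    arith = solve-∀
    arith' : ∀ t → t + t + t + 2 * t ≡ 5 * t
    arith' = solve-∀
    at : ∀ (F : ℕ → Set) → F N → F (length L)
    at F = subst F (sym lenL)
    m₋≤N = ≤-trans m₋≤m₊ (≤-trans m₊≤N (≤-reflexive (sym lenL)))
    one = unjoined-rare κ m₁≤N (at (λ N → κ * (2 ^ n * (2 ^ n * fall (N ∸ μ * μ) m₁)) ≤ fall N m₁) joined-num)
    two = crowded-rare κ m₁≤N (at (λ N → κ * (n * rising (n ∸ 1) N m₁) ≤ 2 ^ Δ * fall N m₁) degree-num)
    three = isolated-common κ m₋≤N (at (λ N → 0 < n * fall (N ∸ (n ∸ 1)) m₋) mean-pos) (at (λ N → κ * fall N m₋ ≤ n * fall (N ∸ (n ∸ 1)) m₋) mean-num)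
      (at (λ N → fall (N ∸ (n ∸ 1 + (n ∸ 2))) m₋ * fall N m₋ ≤ fall (N ∸ (n ∸ 1)) m₋ * fall (N ∸ (n ∸ 1)) m₋) pair-num)
    four : κ * 𝔼 L cond ≤ 2 * 𝔼 L (λ _ → 1)
    four = 𝔼-prefix m₁ L cond κ 2 m₁≤N λ p r lp pr → ≤-trans
      (≤-reflexive (cong (κ *_) (𝔼-cong r λ {τ} _ → cong₂ conditional (take-length++ m₁ p τ lp) (drop-length++ m₁ p τ lp))))
      (conditionalOn-rare p r lp pr (length p ≤? m₁) (unjoined p + crowded p ≟ⁿ 0))

  probable : ∀ k → κ ≡ 5 * k → ProbAtLeast1-1/ n GoodOrdering k
  probable k κ≡ = S , uniqueS , allS , bound
    where
    open ≤-Reasoning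
    S = filter (λ σ → bad σ ≟ⁿ 0) (orderings L)
    uniqueS : Unique S
    uniqueS = Unique-filter (λ σ → bad σ ≟ⁿ 0) (orderings-unique (edges-unique n))
    isOrdering : ∀ {σ} → σ ↭ L → IsEdgeOrdering σ
    isOrdering p = All.tabulate (λ m → edges-up (∈-resp-↭ p m)) , Unique-resp-↭ (↭-sym p) (edges-unique n) , λ i j lt → ∈-resp-↭ (↭-sym p) (edges-∈ lt)
    allS : All (λ σ → IsEdgeOrdering σ × GoodOrdering σ) S
    allS = All.tabulate λ {σ} m → let m' , z = ∈-filter⁻ (λ σ → bad σ ≟ⁿ 0) {xs = orderings L} m
                                      o = isOrdering (orderings-↭ m') in
             o , good-if σ o m₁≤m₋′ m₋≤m₊ two≤n (≤-reflexive (sym ℓ≡7)) z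
    -- A discarded ordering has `bad` at least one and so pays for itself in the last sum.
    missing : ∀ xs → sumL (λ _ → 1) xs ≤ length (filter (λ σ → bad σ ≟ⁿ 0) xs) + sumL bad xs
    missing [] = z≤n
    missing (σ ∷ xs) with bad σ in eq
    ... | zero = s≤s (missing xs)
    ... | suc b = ≤-trans (s≤s (≤-trans (missing xs) (+-monoʳ-≤ (length (filter (λ σ → bad σ ≟ⁿ 0) xs)) (m≤n+m (sumL bad xs) b)))) (≤-reflexive (sym (+-suc _ _)))
    all-counted : length L ! ≤ length S + 𝔼 L bad
    all-counted = subst₂ (λ a b → a ≤ length S + b) (trans (sumL-orderings (λ _ → 1) L) (𝔼-one L)) (sumL-orderings bad L) (missing (orderings L))
    bound : k * ((n C 2) ! ∸ length S) ≤ (n C 2) !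
    bound = subst (λ N → k * (N ! ∸ length S) ≤ N !) lenL (*-cancelˡ-≤ 5 (begin
      5 * (k * (length L ! ∸ length S))       ≡⟨ sym (*-assoc 5 k _) ⟩
      5 * k * (length L ! ∸ length S)         ≤⟨ *-monoʳ-≤ (5 * k) (≤-trans (∸-monoˡ-≤ (length S) all-counted) (≤-reflexive (m+n∸m≡n (length S) _))) ⟩
      5 * k * 𝔼 L bad                         ≡⟨ cong (_* 𝔼 L bad) (sym κ≡) ⟩
      κ * 𝔼 L bad                             ≤⟨ bad-rare ⟩
      5 * length L !                          ∎))

-- Ratios of falling factorials

∸-swap : ∀ a b c → a ∸ b ∸ c ≡ a ∸ c ∸ b
∸-swap a b c = trans (∸-+-assoc a b c) (trans (cong (a ∸_) (+-comm b c)) (sym (∸-+-assoc a c b)))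

fall-suc : ∀ N s → fall N (suc s) ≡ fall N s * (N ∸ s)
fall-suc N s = trans (cong (fall N) (+-comm 1 s)) (trans (fall-+ s N 1) (cong (fall N s *_) (*-identityʳ (N ∸ s))))

fall-pos : ∀ m {N} → m ≤ N → 0 < fall N m
fall-pos zero _ = s≤s z≤n
fall-pos (suc m) {suc N} (s≤s h) = *-mono-≤ {1} {suc N} (s≤s z≤n) (fall-pos m h)

-- Bernoulli's inequality for drawing without replacement: the inverse of the probability to miss
-- `f` items in `t` draws is at least `1 + t f / N`. With `t f ≥ N` this is `halving`.
gain : ∀ f N t → (N + t * f) * fall (N ∸ f) t ≤ N * fall N t
gain f N zero = ≤-reflexive (cong (_* 1) (+-identityʳ N))
gain f N (suc t) = begin
    (N + suc t * f) * fall (N ∸ f) (suc t)          ≡⟨ cong ((N + suc t * f) *_) (fall-suc (N ∸ f) t) ⟩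
    (N + suc t * f) * (fall (N ∸ f) t * (N ∸ f ∸ t)) ≡⟨ arith (N + suc t * f) (fall (N ∸ f) t) (N ∸ f ∸ t) ⟩
    fall (N ∸ f) t * ((N + suc t * f) * (N ∸ f ∸ t)) ≤⟨ *-monoʳ-≤ (fall (N ∸ f) t) (step (≤-total (f + t) N)) ⟩
    fall (N ∸ f) t * ((N + t * f) * (N ∸ t))        ≡⟨ arith′ (fall (N ∸ f) t) (N + t * f) (N ∸ t) ⟩
    (N + t * f) * fall (N ∸ f) t * (N ∸ t)          ≤⟨ *-monoˡ-≤ (N ∸ t) (gain f N t) ⟩
    N * fall N t * (N ∸ t)                          ≡⟨ trans (*-assoc N (fall N t) (N ∸ t)) (cong (N *_) (sym (fall-suc N t))) ⟩
    N * fall N (suc t)                              ∎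
  where
  open ≤-Reasoning
  arith : ∀ a b c → a * (b * c) ≡ b * (a * c)
  arith = solve-∀
  arith′ : ∀ b a c → b * (a * c) ≡ a * b * c
  arith′ = solve-∀
  step : f + t ≤ N ⊎ N ≤ f + t → (N + suc t * f) * (N ∸ f ∸ t) ≤ (N + t * f) * (N ∸ t)
  step (inj₂ h) = ≤-trans (≤-reflexive (trans (cong ((N + suc t * f) *_) (trans (∸-+-assoc N f t) (m≤n⇒m∸n≡0 h))) (*-zeroʳ (N + suc t * f)))) z≤n
  step (inj₁ h) with m≤n⇒∃[o]m+o≡n h
  ... | c , refl = subst₂ (λ a b → (f + t + c + suc t * f) * a ≤ (f + t + c + t * f) * b)
      (sym (trans (∸-+-assoc (f + t + c) f t) (m+n∸m≡n (f + t) c)))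
      (sym (trans (cong (_∸ t) (shuffle f t c)) (m+n∸m≡n t (f + c))))
      (≤-trans (m≤m+n _ (f * (t + t * f + f))) (≤-reflexive (poly f t c)))
    where
    shuffle : ∀ f t c → f + t + c ≡ t + (f + c)
    shuffle = solve-∀
    poly : ∀ f t c → (f + t + c + suc t * f) * c + f * (t + t * f + f) ≡ (f + t + c + t * f) * (f + c)
    poly = solve-∀

halving : ∀ f N K → N ≤ K * f → 0 < K → 2 * fall (N ∸ f) K ≤ fall N K
halving f zero (suc K) _ _ = ≤-reflexive (trans (cong (λ z → 2 * (z * fall (z ∸ 1) K)) (0∸n≡0 f)) refl)
halving f N@(suc _) K h _ = *-cancelˡ-≤ N (≤-trans (≤-reflexive (arith N (fall (N ∸ f) K))) (≤-trans (*-monoˡ-≤ (fall (N ∸ f) K) (+-monoʳ-≤ N h)) (gain f N K)))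
  where
  arith : ∀ n x → n * (2 * x) ≡ (n + n) * x
  arith = solve-∀

-- Each block of `K` draws halves the probability; the hypothesis persists since later blocks start
-- from a smaller `N`.
decay : ∀ f K r N → N ≤ K * f → 0 < K → 2 ^ r * fall (N ∸ f) (r * K) ≤ fall N (r * K)
decay f K zero N _ _ = ≤-refl
decay f K (suc r) N h pos = begin
    2 * 2 ^ r * fall (N ∸ f) (K + r * K)                            ≡⟨ cong (2 * 2 ^ r *_) (fall-+ K (N ∸ f) (r * K)) ⟩
    2 * 2 ^ r * (fall (N ∸ f) K * fall (N ∸ f ∸ K) (r * K))         ≡⟨ arith (2 ^ r) (fall (N ∸ f) K) _ ⟩
    2 * fall (N ∸ f) K * (2 ^ r * fall (N ∸ f ∸ K) (r * K))         ≡⟨ cong (λ z → 2 * fall (N ∸ f) K * (2 ^ r * fall z (r * K))) (∸-swap N f K) ⟩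
    2 * fall (N ∸ f) K * (2 ^ r * fall (N ∸ K ∸ f) (r * K))         ≤⟨ *-mono-≤ (halving f N K h pos) (decay f K r (N ∸ K) (≤-trans (m∸n≤m N K) h) pos) ⟩
    fall N K * fall (N ∸ K) (r * K)                                 ≡⟨ sym (fall-+ K N (r * K)) ⟩
    fall N (K + r * K)                                              ∎
  where
  open ≤-Reasoning
  arith : ∀ a b c → 2 * a * (b * c) ≡ 2 * b * (a * c)
  arith = solve-∀

-- The opposite linear estimate: at least `W` items are present at every draw, so `s` draws miss the
-- `f` items with probability at least `1 - s f / W`.
loss : ∀ f W N s → W + s ≤ N → fall N s * (W ∸ s * f) ≤ W * fall (N ∸ f) s
loss f W N zero h = ≤-reflexive (trans (+-identityʳ W) (sym (*-identityʳ W)))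
loss f W N (suc s) h = begin
    fall N (suc s) * (W ∸ suc s * f)                ≡⟨ cong (_* (W ∸ suc s * f)) (fall-suc N s) ⟩
    fall N s * (N ∸ s) * (W ∸ suc s * f)            ≡⟨ *-assoc (fall N s) (N ∸ s) _ ⟩
    fall N s * ((N ∸ s) * (W ∸ suc s * f))          ≤⟨ *-monoʳ-≤ (fall N s) step ⟩
    fall N s * ((W ∸ s * f) * (N ∸ f ∸ s))          ≡⟨ sym (*-assoc (fall N s) (W ∸ s * f) _) ⟩
    fall N s * (W ∸ s * f) * (N ∸ f ∸ s)            ≤⟨ *-monoˡ-≤ (N ∸ f ∸ s) (loss f W N s (≤-trans (+-monoʳ-≤ W (n≤1+n s)) h)) ⟩
    W * fall (N ∸ f) s * (N ∸ f ∸ s)                ≡⟨ trans (*-assoc W (fall (N ∸ f) s) _) (cong (W *_) (sym (fall-suc (N ∸ f) s))) ⟩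
    W * fall (N ∸ f) (suc s)                        ∎
  where
  open ≤-Reasoning
  u = W ∸ s * f
  W≤ : W ≤ N ∸ s
  W≤ = ≤-trans (≤-reflexive (sym (m+n∸n≡m W s))) (∸-monoˡ-≤ s (≤-trans (+-monoʳ-≤ W (n≤1+n s)) h))
  general : ∀ v a → v ≤ a → a * (v ∸ f) ≤ v * (a ∸ f)
  general v a le with ≤-total f v
  ... | inj₂ small = ≤-trans (≤-reflexive (trans (cong (a *_) (m≤n⇒m∸n≡0 small)) (*-zeroʳ a))) z≤n
  ... | inj₁ big with m≤n⇒∃[o]m+o≡n big | m≤n⇒∃[o]m+o≡n le
  ... | u′ , refl | c , refl = subst₂ (λ x y → (f + u′ + c) * x ≤ (f + u′) * y) (sym (m+n∸m≡n f u′)) (sym (trans (cong (_∸ f) (+-assoc f u′ c)) (m+n∸m≡n f (u′ + c))))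
      (≤-trans (m≤m+n _ (f * c)) (≤-reflexive (poly f u′ c)))
    where
    poly : ∀ f u c → (f + u + c) * u + f * c ≡ (f + u) * (u + c)
    poly = solve-∀
  step : (N ∸ s) * (W ∸ suc s * f) ≤ (W ∸ s * f) * (N ∸ f ∸ s)
  step = subst₂ (λ x y → (N ∸ s) * x ≤ u * y) (trans (∸-+-assoc W (s * f) f) (cong (W ∸_) (+-comm (s * f) f))) (∸-swap N s f)
           (general u (N ∸ s) (≤-trans (m∸n≤m W (s * f)) W≤))

slow-block : ∀ f W N s → W + s ≤ N → 2 * (s * f) ≤ W → 0 < W → fall N s ≤ 2 * fall (N ∸ f) s
slow-block f W N s h k pos = *-cancelˡ-≤ W {{>-nonZero pos}} (begin
    W * fall N s                      ≤⟨ *-monoˡ-≤ (fall N s) W≤ ⟩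
    2 * (W ∸ s * f) * fall N s        ≡⟨ arith (W ∸ s * f) (fall N s) ⟩
    2 * (fall N s * (W ∸ s * f))      ≤⟨ *-monoʳ-≤ 2 (loss f W N s h) ⟩
    2 * (W * fall (N ∸ f) s)          ≡⟨ arith′ W (fall (N ∸ f) s) ⟩
    W * (2 * fall (N ∸ f) s)          ∎)
  where
  open ≤-Reasoning
  arith : ∀ a b → 2 * a * b ≡ 2 * (b * a)
  arith = solve-∀
  arith′ : ∀ a b → 2 * (a * b) ≡ a * (2 * b)
  arith′ = solve-∀
  W≤ : W ≤ 2 * (W ∸ s * f)
  W≤ = ≤-trans (≤-trans (≤-reflexive (sym (m+n∸n≡m W W))) (≤-trans (∸-monoʳ-≤ (W + W) k) (≤-reflexive (cong (_∸ 2 * (s * f)) (cong (W +_) (sym (+-identityʳ W)))))))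
         (≤-reflexive (sym (*-distribˡ-∸ 2 W (s * f))))

slow-blocks : ∀ f W s r N → W + r * s ≤ N → 2 * (s * f) ≤ W → 0 < W → fall N (r * s) ≤ 2 ^ r * fall (N ∸ f) (r * s)
slow-blocks f W s zero N h k pos = ≤-refl
slow-blocks f W s (suc r) N h k pos = begin
    fall N (s + r * s)                                            ≡⟨ fall-+ s N (r * s) ⟩
    fall N s * fall (N ∸ s) (r * s)                               ≤⟨ *-mono-≤ (slow-block f W N s (≤-trans (+-monoʳ-≤ W (m≤m+n s (r * s))) h) k pos)
                                                                       (slow-blocks f W s r (N ∸ s) (≤-trans (≤-reflexive (sym (trans (cong (_∸ s) (arith₀ W s (r * s))) (m+n∸n≡m (W + r * s) s)))) (∸-monoˡ-≤ s h)) k pos) ⟩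
    2 * fall (N ∸ f) s * (2 ^ r * fall (N ∸ s ∸ f) (r * s))       ≡⟨ cong (λ z → 2 * fall (N ∸ f) s * (2 ^ r * fall z (r * s))) (∸-swap N s f) ⟩
    2 * fall (N ∸ f) s * (2 ^ r * fall (N ∸ f ∸ s) (r * s))       ≡⟨ arith (fall (N ∸ f) s) (2 ^ r) _ ⟩
    2 * 2 ^ r * (fall (N ∸ f) s * fall (N ∸ f ∸ s) (r * s))       ≡⟨ cong (2 * 2 ^ r *_) (sym (fall-+ s (N ∸ f) (r * s))) ⟩
    2 * 2 ^ r * fall (N ∸ f) (s + r * s)                          ∎
  where
  open ≤-Reasoning
  arith₀ : ∀ w s t → w + (s + t) ≡ w + t + s
  arith₀ = solve-∀
  arith : ∀ a b c → 2 * a * (b * c) ≡ 2 * b * (a * c)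
  arith = solve-∀

-- Counterpart of `decay` for any number of draws: pad `m` to `r` full blocks, as further draws only
-- lower the probability.
slow : ∀ f W s r N m → W + r * s ≤ N → 2 * (s * f) ≤ W → 0 < W → m ≤ r * s → fall N m ≤ 2 ^ r * fall (N ∸ f) m
slow f W s r N m h k pos le = *-cancelʳ-≤ _ _ (fall (N ∸ m) t) {{>-nonZero (fall-pos t t≤)}} (begin
    fall N m * fall (N ∸ m) t                        ≡⟨ sym (fall-+ m N t) ⟩
    fall N (m + t)                                   ≡⟨ cong (fall N) mt ⟩
    fall N (r * s)                                   ≤⟨ slow-blocks f W s r N h k pos ⟩
    2 ^ r * fall (N ∸ f) (r * s)                     ≡⟨ cong (λ z → 2 ^ r * fall (N ∸ f) z) (sym mt) ⟩
    2 ^ r * fall (N ∸ f) (m + t)                     ≡⟨ cong (2 ^ r *_) (fall-+ m (N ∸ f) t) ⟩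
    2 ^ r * (fall (N ∸ f) m * fall (N ∸ f ∸ m) t)    ≤⟨ *-monoʳ-≤ (2 ^ r) (*-monoʳ-≤ (fall (N ∸ f) m) (fall-mono t (∸-monoˡ-≤ m (m∸n≤m N f)))) ⟩
    2 ^ r * (fall (N ∸ f) m * fall (N ∸ m) t)        ≡⟨ sym (*-assoc (2 ^ r) (fall (N ∸ f) m) _) ⟩
    2 ^ r * fall (N ∸ f) m * fall (N ∸ m) t          ∎)
  where
  open ≤-Reasoning
  t = r * s ∸ m
  mt : m + t ≡ r * s
  mt = m+[n∸m]≡n le
  t≤ : t ≤ N ∸ m
  t≤ = ∸-monoˡ-≤ m (≤-trans (m≤n+m (r * s) W) h)

-- Factor by factor: `(N - D)²` exceeds `(N - (2 D - 1)) N` by `D² - N`, and `N ≤ D * D` survives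
-- the decrease of `N`.
fall-pairs : ∀ D m N → N ≤ D * D → fall (N ∸ (D + (D ∸ 1))) m * fall N m ≤ fall (N ∸ D) m * fall (N ∸ D) m
fall-pairs D zero N h = ≤-refl
fall-pairs D (suc m) N h = begin
    (N ∸ E) * fall (N ∸ E ∸ 1) m * (N * fall (N ∸ 1) m)            ≡⟨ cong (λ z → (N ∸ E) * fall z m * (N * fall (N ∸ 1) m)) (∸-swap N E 1) ⟩
    (N ∸ E) * fall (N ∸ 1 ∸ E) m * (N * fall (N ∸ 1) m)            ≡⟨ arith (N ∸ E) (fall (N ∸ 1 ∸ E) m) N (fall (N ∸ 1) m) ⟩
    (N ∸ E) * N * (fall (N ∸ 1 ∸ E) m * fall (N ∸ 1) m)            ≤⟨ *-mono-≤ (term D N h) (fall-pairs D m (N ∸ 1) (≤-trans (m∸n≤m N 1) h)) ⟩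
    (N ∸ D) * (N ∸ D) * (fall (N ∸ 1 ∸ D) m * fall (N ∸ 1 ∸ D) m)  ≡⟨ cong (λ z → (N ∸ D) * (N ∸ D) * (fall z m * fall z m)) (∸-swap N 1 D) ⟩
    (N ∸ D) * (N ∸ D) * (fall (N ∸ D ∸ 1) m * fall (N ∸ D ∸ 1) m)  ≡⟨ arith′ (N ∸ D) (fall (N ∸ D ∸ 1) m) ⟩
    (N ∸ D) * fall (N ∸ D ∸ 1) m * ((N ∸ D) * fall (N ∸ D ∸ 1) m)  ∎
  where
  open ≤-Reasoning
  E = D + (D ∸ 1)
  arith : ∀ a b c d → a * b * (c * d) ≡ a * c * (b * d)
  arith = solve-∀
  arith′ : ∀ a b → a * a * (b * b) ≡ a * b * (a * b)
  arith′ = solve-∀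
  term : ∀ D N → N ≤ D * D → (N ∸ (D + (D ∸ 1))) * N ≤ (N ∸ D) * (N ∸ D)
  term zero N h rewrite n≤0⇒n≡0 h = ≤-refl
  term (suc D) N h with ≤-total (suc D + D) N
  ... | inj₂ small = ≤-trans (≤-reflexive (cong (_* N) (m≤n⇒m∸n≡0 small))) z≤n
  ... | inj₁ big with m≤n⇒∃[o]m+o≡n big
  ... | c , refl = subst₂ (λ x y → x * (suc D + D + c) ≤ y * y) (sym (m+n∸m≡n (suc D + D) c)) (sym (trans (cong (_∸ suc D) (+-assoc (suc D) D c)) (m+n∸m≡n (suc D) (D + c))))
      (+-cancelʳ-≤ (D + D + 1) _ _ (≤-trans (≤-reflexive (poly₁ D c)) (≤-trans (+-monoʳ-≤ (c * (D + D + c)) h) (≤-reflexive (poly₂ D c)))))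
    where
    poly₁ : ∀ D c → c * (suc D + D + c) + (D + D + 1) ≡ c * (D + D + c) + (suc D + D + c)
    poly₁ = solve-∀
    poly₂ : ∀ D c → c * (D + D + c) + suc D * suc D ≡ (D + c) * (D + c) + (D + D + 1)
    poly₂ = solve-∀

-- Missing `f ≥ 3 D / 2` edges has at most the probability of missing one star to the power 3/2. It
-- holds factor by factor, from `2 (N - f) ≤ 2 N - 3 D`.
fall-cubic : ∀ D f m N → m + 2 * D ≤ N → 3 * D ≤ 2 * f → fall (N ∸ f) m * fall (N ∸ f) m * fall N m ≤ fall (N ∸ D) m * fall (N ∸ D) m * fall (N ∸ D) m
fall-cubic D f zero N _ _ = ≤-refl
fall-cubic D f (suc m) N h k = begin
    (N ∸ f) * fall (N ∸ f ∸ 1) m * ((N ∸ f) * fall (N ∸ f ∸ 1) m) * (N * fall (N ∸ 1) m)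
      ≡⟨ cong (λ z → (N ∸ f) * fall z m * ((N ∸ f) * fall z m) * (N * fall (N ∸ 1) m)) (∸-swap N f 1) ⟩
    (N ∸ f) * u * ((N ∸ f) * u) * (N * fall (N ∸ 1) m)
      ≡⟨ arith (N ∸ f) u N (fall (N ∸ 1) m) ⟩
    (N ∸ f) * (N ∸ f) * N * (u * u * fall (N ∸ 1) m)
      ≤⟨ *-mono-≤ (term N (≤-trans (m≤n+m (2 * D) (suc m)) h)) (fall-cubic D f m (N ∸ 1) (∸-monoˡ-≤ 1 h) k) ⟩
    (N ∸ D) * (N ∸ D) * (N ∸ D) * (v * v * v)
      ≡⟨ arith′ (N ∸ D) v ⟩
    (N ∸ D) * v * ((N ∸ D) * v) * ((N ∸ D) * v)
      ≡⟨ cong (λ z → (N ∸ D) * fall z m * ((N ∸ D) * fall z m) * ((N ∸ D) * fall z m)) (∸-swap N 1 D) ⟩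
    (N ∸ D) * fall (N ∸ D ∸ 1) m * ((N ∸ D) * fall (N ∸ D ∸ 1) m) * ((N ∸ D) * fall (N ∸ D ∸ 1) m) ∎
  where
  open ≤-Reasoning
  u = fall (N ∸ 1 ∸ f) m
  v = fall (N ∸ 1 ∸ D) m
  arith : ∀ a u n w → a * u * (a * u) * (n * w) ≡ a * a * n * (u * u * w)
  arith = solve-∀
  arith′ : ∀ a v → a * a * a * (v * v * v) ≡ a * v * (a * v) * (a * v)
  arith′ = solve-∀
  term : ∀ N → 2 * D ≤ N → (N ∸ f) * (N ∸ f) * N ≤ (N ∸ D) * (N ∸ D) * (N ∸ D)
  term N h with m≤n⇒∃[o]m+o≡n h
  ... | b , refl = *-cancelˡ-≤ 4 (begin
      4 * (x * x * n′)                      ≡⟨ p₁ x n′ ⟩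
      2 * x * (2 * x) * n′                  ≤⟨ *-monoˡ-≤ n′ (*-mono-≤ 2x≤ 2x≤) ⟩
      (D + 2 * b) * (D + 2 * b) * n′        ≤⟨ m≤m+n _ (2 * (D * D * D) + 3 * (D * D * b)) ⟩
      (D + 2 * b) * (D + 2 * b) * n′ + (2 * (D * D * D) + 3 * (D * D * b)) ≡⟨ p₂ D b ⟩
      4 * ((D + b) * (D + b) * (D + b))     ≡⟨ cong (λ z → 4 * (z * z * z)) (sym y≡) ⟩
      4 * ((n′ ∸ D) * (n′ ∸ D) * (n′ ∸ D))  ∎)
    where
    n′ = 2 * D + b
    x = n′ ∸ f
    p₁ : ∀ x n → 4 * (x * x * n) ≡ 2 * x * (2 * x) * n
    p₁ = solve-∀
    p₂ : ∀ D b → (D + 2 * b) * (D + 2 * b) * (2 * D + b) + (2 * (D * D * D) + 3 * (D * D * b)) ≡ 4 * ((D + b) * (D + b) * (D + b))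
    p₂ = solve-∀
    p₃ : ∀ D b → 2 * (2 * D + b) ≡ 3 * D + (D + 2 * b)
    p₃ = solve-∀
    p₄ : ∀ D b → 2 * D + b ≡ D + (D + b)
    p₄ = solve-∀
    y≡ : n′ ∸ D ≡ D + b
    y≡ = trans (cong (_∸ D) (p₄ D b)) (m+n∸m≡n D (D + b))
    2x≤ : 2 * x ≤ D + 2 * b
    2x≤ = ≤-trans (≤-reflexive (trans (*-distribˡ-∸ 2 n′ f) (cong (_∸ 2 * f) (p₃ D b)))) (≤-trans (∸-monoʳ-≤ (3 * D + (D + 2 * b)) k) (≤-reflexive (m+n∸m≡n (3 * D) (D + 2 * b))))

rising≤fall : ∀ a N m → m ≤ N → rising a N m ≤ fall (N + a) m
rising≤fall a N zero _ = ≤-refl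
rising≤fall a (suc N) (suc m) (s≤s h) = *-mono-≤ (≤-reflexive (+-comm a (suc N))) (rising≤fall a N m h)

-- Choice of the parameters

lastTrue : ∀ {P : ℕ → Set} → (∀ m → Dec (P m)) → ∀ a k → P a → ¬ P (a + k) → ∃[ m ] a ≤ m × m < a + k × P m × ¬ P (suc m)
lastTrue {P} d a zero p np = ⊥-elim (np (subst P (sym (+-identityʳ a)) p))
lastTrue {P} d a (suc k) p np with d (suc a)
... | no h = a , ≤-refl , m<m+n a (s≤s z≤n) , p , h
... | yes h with lastTrue d (suc a) k h (λ q → np (subst P (sym (+-suc a k)) q))
... | m , le , lt , pm , npm = m , ≤-trans (n≤1+n a) le , subst (m <_) (sym (+-suc a k)) lt , pm , npm

-- Fractional powers of `n` are compared through integer ones: sixth powers for `n^(5/6)`, fourth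
-- powers for `n^(5/4)`.
sixth : ℕ → ℕ
sixth a = a * a * a * (a * a * a)

sixth-mono : ∀ {a b} → a ≤ b → sixth a ≤ sixth b
sixth-mono h = *-mono-≤ (*-mono-≤ (*-mono-≤ h h) h) (*-mono-≤ (*-mono-≤ h h) h)

sixth-mono-< : ∀ {a b} → a < b → sixth a < sixth b
sixth-mono-< h = *-mono-< (*-mono-< (*-mono-< h h) h) (*-mono-< (*-mono-< h h) h)

sixth-* : ∀ a b → sixth (a * b) ≡ sixth a * sixth b
sixth-* = arith
  where
  arith : ∀ a b → a * b * (a * b) * (a * b) * (a * b * (a * b) * (a * b)) ≡ a * a * a * (a * a * a) * (b * b * b * (b * b * b))
  arith = solve-∀

sixth-cancel : ∀ {a b} → sixth a ≤ sixth b → a ≤ b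
sixth-cancel h = ≮⇒≥ λ lt → <-irrefl refl (<-≤-trans (sixth-mono-< lt) h)

fourth : ℕ → ℕ
fourth a = a * a * (a * a)

fourth-cancel : ∀ {a b} → fourth a ≤ fourth b → a ≤ b
fourth-cancel h = ≮⇒≥ λ lt → <-irrefl refl (<-≤-trans (*-mono-< (*-mono-< lt lt) (*-mono-< lt lt)) h)

fifth : ℕ → ℕ
fifth a = a * a * a * a * a

-- Extracts X G ≤ A from G² A ≤ F³ and n⁵ F⁶ ≤ 64 A⁶ when 64 X⁴ ≤ n⁵.
combine : ∀ X G A F n → 0 < A → 0 < n → G * G * A ≤ F * F * F → fifth n * sixth F ≤ 64 * sixth A → fourth X * 64 ≤ fifth n → X * G ≤ A
combine X G A F n A>0 n>0 cubic up small = fourth-cancel (*-cancelʳ-≤ _ _ (A * A) {{>-nonZero (*-mono-≤ A>0 A>0)}}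
    (*-cancelˡ-≤ (fifth n) {{>-nonZero (*-mono-≤ (*-mono-≤ (*-mono-≤ (*-mono-≤ n>0 n>0) n>0) n>0) n>0)}} (begin
      fifth n * (fourth (X * G) * (A * A))              ≡⟨ arith₁ (fifth n) X G A ⟩
      fifth n * fourth X * (G * G * A * (G * G * A))    ≤⟨ *-monoʳ-≤ (fifth n * fourth X) (*-mono-≤ cubic cubic) ⟩
      fifth n * fourth X * sixth F                      ≡⟨ arith₂ (fifth n) (fourth X) (sixth F) ⟩
      fourth X * (fifth n * sixth F)                    ≤⟨ *-monoʳ-≤ (fourth X) up ⟩
      fourth X * (64 * sixth A)                         ≡⟨ sym (*-assoc (fourth X) 64 (sixth A)) ⟩
      fourth X * 64 * sixth A                           ≤⟨ *-monoˡ-≤ (sixth A) small ⟩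
      fifth n * sixth A                                 ≡⟨ cong (fifth n *_) (arith₃ A) ⟩
      fifth n * (fourth A * (A * A))                    ∎)))
  where
  open ≤-Reasoning
  arith₁ : ∀ e X G A → e * (X * G * (X * G) * (X * G * (X * G)) * (A * A)) ≡ e * (X * X * (X * X)) * (G * G * A * (G * G * A))
  arith₁ = solve-∀
  arith₂ : ∀ e x f → e * x * f ≡ x * (e * f)
  arith₂ = solve-∀
  arith₃ : ∀ A → A * A * A * (A * A * A) ≡ A * A * (A * A) * (A * A)
  arith₃ = solve-∀

n≤2^n : ∀ n → n ≤ 2 ^ n
n≤2^n zero = z≤n
n≤2^n (suc n) = +-mono-≤ (m^n>0 2 n) (≤-trans (n≤2^n n) (m≤m+n (2 ^ n) 0))

2N : ∀ {n} → 1 ≤ n → 2 * (n C 2) ≡ n * (n ∸ 1)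
2N {suc n} _ = nC2 n

-- q = 2^λ is n up to a factor 2; m₁ is of order n √λ, and m₋ ≤ (λ+1) n is a time at which the expected
-- number of isolated vertices is about to drop below n^(1/6).
module Choice (κ n λ′ s q K r Y h : ℕ)
              (q≡64s : q ≡ 64 * s) (q≡ : q ≡ 2 ^ λ′) (q≤n : q ≤ n) (n<2q : n < 2 * q) (s>0 : 0 < s)
              (K>0 : 0 < K) (K≤Y : K ≤ Y) (λ<Y : λ′ + 1 ≤ Y) (Y≤q : 4096 * Y ≤ q) (r≡ : r ≡ 1024 * K) (κ>0 : 0 < κ) (κ≤q : sixth κ ≤ q)
              (μ : ℕ) (h≤λ : h ≤ λ′) (N≤Kμ² : n C 2 ≤ K * (μ * μ)) (144μ≤n : 144 * μ ≤ n)
              (small-far : fourth (7 * κ * sixth (256 * Y) * 2 ^ r) * 64 ≤ q) where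
  open ≤-Reasoning

  N D m₁ m₊ lo : ℕ
  N = n C 2
  D = n ∸ 1
  m₁ = 4 * n * K
  m₊ = m₁ + 2 * λ′ * n
  -- The six draws beyond `m₁` leave room to extract up to six path edges from the window that ends
  -- at `m₋`.
  lo = m₁ + 6

  q>0 : 0 < q
  q>0 = ≤-trans (*-mono-≤ {1} {64} (s≤s z≤n) s>0) (≤-reflexive (sym q≡64s))

  n>0 : 0 < n
  n>0 = ≤-trans q>0 q≤n

  Y>0 : 0 < Y
  Y>0 = ≤-trans (m≤n+m 1 λ′) λ<Y

  4096≤n : 4096 ≤ n
  4096≤n = ≤-trans (≤-trans (m≤m*n 4096 Y {{>-nonZero Y>0}}) Y≤q) q≤n

  n≡1+D : n ≡ 1 + D
  n≡1+D = sym (m+[n∸m]≡n n>0)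

  16sq≤N : 16 * (s * q) ≤ N
  16sq≤N = *-cancelˡ-≤ 2 (begin
      2 * (16 * (s * q))          ≡⟨ arith₁ s q ⟩
      32 * s * q                  ≤⟨ *-mono-≤ half q≤n ⟩
      D * n                       ≡⟨ *-comm D n ⟩
      n * D                       ≡⟨ sym (2N n>0) ⟩
      2 * N                       ∎)
    where
    arith₁ : ∀ s q → 2 * (16 * (s * q)) ≡ 32 * s * q
    arith₁ = solve-∀
    half : 32 * s ≤ D
    half = ≤-trans (≤-reflexive (sym (m+n∸n≡m (32 * s) 1))) (∸-monoˡ-≤ 1 (≤-trans (+-monoʳ-≤ (32 * s) s>0) (≤-trans (≤-trans (m≤m+n (32 * s + s) (31 * s)) (≤-reflexive (arith₃ s))) (≤-trans (≤-reflexive (sym q≡64s)) q≤n))))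
      where
      arith₃ : ∀ s → 32 * s + s + 31 * s ≡ 64 * s
      arith₃ = solve-∀

  n≤128s : n ≤ 128 * s
  n≤128s = ≤-trans (<⇒≤ n<2q) (≤-reflexive (trans (cong (2 *_) q≡64s) (arith s)))
    where
    arith : ∀ s → 2 * (64 * s) ≡ 128 * s
    arith = solve-∀

  lo≤rs : lo ≤ r * s
  lo≤rs = begin
      4 * n * K + 6                 ≤⟨ +-mono-≤ (*-monoˡ-≤ K (*-monoʳ-≤ 4 n≤128s)) (≤-trans (m≤m*n 6 (K * s) {{>-nonZero (*-mono-≤ K>0 s>0)}}) ≤-refl) ⟩
      4 * (128 * s) * K + 6 * (K * s) ≡⟨ arith s K ⟩
      518 * (K * s)                 ≤⟨ *-monoˡ-≤ (K * s) (m≤m+n 518 506) ⟩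
      1024 * (K * s)                ≡⟨ sym (*-assoc 1024 K s) ⟩
      1024 * K * s                  ≡⟨ cong (_* s) (sym r≡) ⟩
      r * s                         ∎
    where
    arith : ∀ s K → 4 * (128 * s) * K + 6 * (K * s) ≡ 518 * (K * s)
    arith = solve-∀

  r≤q : r ≤ q
  r≤q = ≤-trans (≤-reflexive r≡) (≤-trans (*-mono-≤ (m≤m+n 1024 3072) K≤Y) Y≤q)

  -- The price of the first round: two stars are missed throughout with probability at least
  -- `2 ^ -r`, where `r` is of order √λ and hence `2 ^ r` is `n^o(1)`. Blocks have `s = q / 64`
  -- draws, and `r = 1024 K` of them cover `lo`.
  slow-n : ∀ f N̂ m → f ≤ 2 * n → N ≤ N̂ → m ≤ lo → fall N̂ m ≤ 2 ^ r * fall (N̂ ∸ f) m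
  slow-n f N̂ m f≤ N≤ m≤ = slow f (8 * (s * q)) s r N̂ m
      (≤-trans (+-monoʳ-≤ (8 * (s * q)) (≤-trans (*-monoˡ-≤ s r≤q) (≤-reflexive (*-comm q s)))) (≤-trans (≤-trans (m≤m+n _ (7 * (s * q))) (≤-reflexive (arith₁ (s * q)))) (≤-trans 16sq≤N N≤)))
      (≤-trans (*-monoʳ-≤ 2 (*-monoʳ-≤ s (≤-trans f≤ (*-monoʳ-≤ 2 (<⇒≤ n<2q))))) (≤-reflexive (arith₂ s q)))
      (*-mono-≤ {1} {8} (s≤s z≤n) (*-mono-≤ s>0 q>0)) (≤-trans m≤ lo≤rs)
    where
    arith₁ : ∀ a → 8 * a + a + 7 * a ≡ 16 * a
    arith₁ = solve-∀
    arith₂ : ∀ s q → 2 * (s * (2 * (2 * q))) ≡ 8 * (s * q)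
    arith₂ = solve-∀


  y z x₀ D₀ Δ β₀ hi : ℕ
  y = 7 * κ * sixth (256 * Y)
  z = 2 ^ r
  x₀ = n * y
  D₀ = 4 * (s * q)
  Δ = 2 * λ′
  β₀ = n ∸ 18 * μ
  hi = (λ′ + 1) * n

  sixth-pos : ∀ {a} → 0 < a → 0 < sixth a
  sixth-pos h = sixth-mono {1} h

  ≤sixth : ∀ a → a ≤ sixth a
  ≤sixth zero = z≤n
  ≤sixth a@(suc _) = ≤-trans (m≤m*n a (a * a * (a * a * a))) (≤-reflexive (arith a))
    where
    arith : ∀ a → a * (a * a * (a * a * a)) ≡ a * a * a * (a * a * a)
    arith = solve-∀

  ≤fourth : ∀ a → a ≤ fourth a
  ≤fourth zero = z≤n
  ≤fourth a@(suc _) = ≤-trans (m≤m*n a (a * (a * a))) (≤-reflexive (arith a))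
    where
    arith : ∀ a → a * (a * (a * a)) ≡ a * a * (a * a)
    arith = solve-∀

  fourth-mono : ∀ {a b} → a ≤ b → fourth a ≤ fourth b
  fourth-mono h = *-mono-≤ (*-mono-≤ h h) (*-mono-≤ h h)

  z>0 : 0 < z
  z>0 = m^n>0 2 r

  256Y>0 : 0 < sixth (256 * Y)
  256Y>0 = sixth-pos (*-mono-≤ {1} {256} (s≤s z≤n) Y>0)

  yz≤q : fourth (y * z) ≤ q
  yz≤q = ≤-trans (m≤m*n (fourth (y * z)) 64) small-far

  2κz≤q : 2 * κ * z ≤ q
  2κz≤q = ≤-trans (≤-trans (*-monoˡ-≤ z (≤-trans (*-monoˡ-≤ κ {2} {7} (s≤s (s≤s z≤n))) (m≤m*n (7 * κ) (sixth (256 * Y)) {{>-nonZero 256Y>0}}))) (≤fourth (y * z))) yz≤q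

  z≤yz : z ≤ y * z
  z≤yz = m≤n*m z y {{>-nonZero (*-mono-≤ {1} {7 * κ} (*-mono-≤ {1} {7} (s≤s z≤n) κ>0) 256Y>0)}}

  2κ≤q : 2 * κ ≤ q
  2κ≤q = ≤-trans (m≤m*n (2 * κ) z {{>-nonZero z>0}}) 2κz≤q

  r≤λ : r ≤ λ′
  r≤λ = ≮⇒≥ λ lt → <-irrefl refl (<-≤-trans (^-monoʳ-< 2 (s≤s (s≤s z≤n)) lt) (≤-trans (≤-trans z≤yz (≤-trans (≤fourth (y * z)) yz≤q)) (≤-reflexive q≡)))

  hi≤ : hi + 2 * n ≤ s * q
  hi≤ = begin
      (λ′ + 1) * n + 2 * n        ≤⟨ +-mono-≤ (*-monoˡ-≤ n λ<Y) (*-monoˡ-≤ n (≤-trans (m≤m*n 2 Y {{>-nonZero Y>0}}) ≤-refl)) ⟩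
      Y * n + 2 * Y * n           ≡⟨ arith Y n ⟩
      3 * Y * n                   ≤⟨ *-monoʳ-≤ (3 * Y) n≤128s ⟩
      3 * Y * (128 * s)           ≡⟨ arith′ Y s ⟩
      384 * Y * s                 ≤⟨ *-monoˡ-≤ s (≤-trans (*-monoˡ-≤ Y (m≤m+n 384 3712)) Y≤q) ⟩
      q * s                       ≡⟨ *-comm q s ⟩
      s * q                       ∎
    where
    arith : ∀ Y n → Y * n + 2 * Y * n ≡ 3 * Y * n
    arith = solve-∀
    arith′ : ∀ Y s → 3 * Y * (128 * s) ≡ 384 * Y * s
    arith′ = solve-∀

  rs≤sq : r * s ≤ s * q
  rs≤sq = ≤-trans (*-monoˡ-≤ s r≤q) (≤-reflexive (*-comm q s))

  times : ∀ a b → a ≤ b → a * (s * q) ≤ b * (s * q)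
  times a b h = *-monoˡ-≤ (s * q) h

  sq≤N : s * q ≤ N
  sq≤N = ≤-trans (≤-trans (≤-reflexive (sym (*-identityˡ (s * q)))) (times 1 16 (s≤s z≤n))) 16sq≤N

  D≤n : D ≤ n
  D≤n = m∸n≤m n 1

  hi+2D≤N : hi + 2 * D ≤ N
  hi+2D≤N = ≤-trans (+-monoʳ-≤ hi (*-monoʳ-≤ 2 D≤n)) (≤-trans hi≤ sq≤N)

  hi≤N : hi ≤ N
  hi≤N = ≤-trans (m≤m+n hi (2 * D)) hi+2D≤N

  lo≤hi : lo ≤ hi
  lo≤hi = begin
      4 * n * K + 6            ≤⟨ +-monoʳ-≤ (4 * n * K) (≤-trans (m≤m*n 6 (n * K) {{>-nonZero (*-mono-≤ n>0 K>0)}}) ≤-refl) ⟩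
      4 * n * K + 6 * (n * K)  ≡⟨ arith n K ⟩
      10 * K * n               ≤⟨ *-monoˡ-≤ n (≤-trans (≤-trans (*-monoˡ-≤ K (m≤m+n 10 1014)) (≤-trans (≤-reflexive (sym r≡)) r≤λ)) (m≤m+n λ′ 1)) ⟩
      (λ′ + 1) * n             ∎
    where
    arith : ∀ n K → 4 * n * K + 6 * (n * K) ≡ 10 * K * n
    arith = solve-∀

  lo≤N : lo ≤ N
  lo≤N = ≤-trans lo≤hi hi≤N

  m₁≤N : m₁ ≤ N
  m₁≤N = ≤-trans (m≤m+n m₁ 6) lo≤N

  -- A given vertex is isolated after `m` draws with probability at least `n^(-5/6)`.
  P : ℕ → Set
  P m = sixth (fall N m) ≤ fifth n * sixth (fall (N ∸ D) m)

  P? : ∀ m → Dec (P m)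
  P? m = sixth (fall N m) ≤? fifth n * sixth (fall (N ∸ D) m)

  fifth≥ : q * q ≤ fifth n
  fifth≥ = ≤-trans (*-mono-≤ q≤n q≤n) (≤-trans (m≤m*n (n * n) (n * n * n) {{>-nonZero (*-mono-≤ (*-mono-≤ n>0 n>0) n>0)}}) (≤-reflexive (arith n)))
    where
    arith : ∀ n → n * n * (n * n * n) ≡ n * n * n * n * n
    arith = solve-∀

  P-lo : P lo
  P-lo = begin
      sixth (fall N lo)                        ≤⟨ sixth-mono (slow-n D N lo (≤-trans D≤n (m≤m+n n _)) ≤-refl ≤-refl) ⟩
      sixth (z * fall (N ∸ D) lo)              ≡⟨ sixth-* z (fall (N ∸ D) lo) ⟩
      sixth z * sixth (fall (N ∸ D) lo)        ≤⟨ *-monoˡ-≤ (sixth (fall (N ∸ D) lo)) zz ⟩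
      fifth n * sixth (fall (N ∸ D) lo)        ∎
    where
    zz : sixth z ≤ fifth n
    zz = ≤-trans (≤-trans (m≤m*n (sixth z) (z * z) {{>-nonZero (*-mono-≤ z>0 z>0)}}) (≤-reflexive (arith z)))
      (≤-trans (*-mono-≤ (≤-trans (fourth-mono z≤yz) yz≤q) (≤-trans (fourth-mono z≤yz) yz≤q)) fifth≥)
      where
      arith : ∀ z → z * z * z * (z * z * z) * (z * z) ≡ z * z * (z * z) * (z * z * (z * z))
      arith = solve-∀

  N≤nD : N ≤ n * D
  N≤nD = ≤-trans (m≤m+n N (N + 0)) (≤-reflexive (2N n>0))

  -- After `λ′ + 1` blocks of `n` draws the probability of isolation is at most `1 / (2 q)`, below
  -- `1 / n`.
  ¬P-hi : ¬ P hi
  ¬P-hi p = <-irrefl refl (begin-strict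
      fifth n * sixth F              ≤⟨ *-monoˡ-≤ (sixth F) (≤-trans (m≤m*n (fifth n) n {{>-nonZero n>0}}) (≤-reflexive (arith n))) ⟩
      sixth n * sixth F              <⟨ *-monoˡ-< (sixth F) {{>-nonZero (sixth-pos F>0)}} (sixth-mono-< n<2q) ⟩
      sixth (2 * q) * sixth F        ≡⟨ sym (sixth-* (2 * q) F) ⟩
      sixth (2 * q * F)              ≤⟨ sixth-mono (≤-trans (≤-reflexive (cong (_* F) 2q≡)) (decay D n (λ′ + 1) N N≤nD n>0)) ⟩
      sixth (fall N hi)             ≤⟨ p ⟩
      fifth n * sixth F              ∎)
    where
    F = fall (N ∸ D) hi
    F>0 : 0 < F
    F>0 = fall-pos hi (≤-trans (≤-reflexive (sym (m+n∸n≡m hi D))) (∸-monoˡ-≤ D (≤-trans (+-monoʳ-≤ hi (m≤m+n D (D + 0))) hi+2D≤N)))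
    arith : ∀ n → n * n * n * n * n * n ≡ n * n * n * (n * n * n)
    arith = solve-∀
    2q≡ : 2 * q ≡ 2 ^ (λ′ + 1)
    2q≡ = trans (cong (2 *_) q≡) (cong (2 ^_) (+-comm 1 λ′))

  chosen : ∃[ m ] lo ≤ m × m < lo + (hi ∸ lo) × P m × ¬ P (suc m)
  chosen = lastTrue P? lo (hi ∸ lo) P-lo (subst (¬_ ∘ P) (sym (m+[n∸m]≡n lo≤hi)) ¬P-hi)

  module At (m₋ : ℕ) (lo≤ : lo ≤ m₋) (<hi : m₋ < hi) (pm : P m₋) (npm : ¬ P (suc m₋)) where

    A F : ℕ
    A = fall N m₋
    F = fall (N ∸ D) m₋

    m₋+2D≤N : m₋ + 2 * D ≤ N
    m₋+2D≤N = ≤-trans (+-monoˡ-≤ (2 * D) (<⇒≤ <hi)) hi+2D≤N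

    m₋≤N : m₋ ≤ N
    m₋≤N = ≤-trans (m≤m+n m₋ (2 * D)) m₋+2D≤N

    A>0 : 0 < A
    A>0 = fall-pos m₋ m₋≤N

    m₋≤N∸D : suc m₋ ≤ N ∸ D
    m₋≤N∸D = ≤-trans (≤-reflexive (sym (m+n∸n≡m (suc m₋) D))) (∸-monoˡ-≤ D (≤-trans (+-mono-≤ <hi (m≤m+n D (D + 0))) hi+2D≤N))

    -- `P` fails one draw later. That draw changes the probability by a factor of at most 2, whose
    -- sixth power is 64.
    upper : fifth n * sixth F ≤ 64 * sixth A
    upper = *-cancelʳ-≤ _ _ (sixth g) {{>-nonZero (sixth-pos g>0)}} (begin
        fifth n * sixth F * sixth g          ≡⟨ trans (*-assoc (fifth n) (sixth F) (sixth g)) (cong (fifth n *_) (sym (sixth-* F g))) ⟩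
        fifth n * sixth (F * g)              ≡⟨ cong (λ w → fifth n * sixth w) (sym (fall-suc (N ∸ D) m₋)) ⟩
        fifth n * sixth (fall (N ∸ D) (suc m₋)) ≤⟨ <⇒≤ (≰⇒> npm) ⟩
        sixth (fall N (suc m₋))              ≡⟨ cong sixth (fall-suc N m₋) ⟩
        sixth (A * (N ∸ m₋))                 ≤⟨ sixth-mono (*-monoʳ-≤ A e≤2g) ⟩
        sixth (A * (2 * g))                  ≡⟨ arith A g ⟩
        64 * sixth A * sixth g               ∎)
      where
      g = N ∸ D ∸ m₋
      g>0 : 0 < g
      g>0 = m<n⇒0<n∸m m₋≤N∸D
      arith : ∀ A g → A * (2 * g) * (A * (2 * g)) * (A * (2 * g)) * (A * (2 * g) * (A * (2 * g)) * (A * (2 * g))) ≡ 64 * (A * A * A * (A * A * A)) * (g * g * g * (g * g * g))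
      arith = solve-∀
      e≤2g : N ∸ m₋ ≤ 2 * g
      e≤2g = ≤-trans (≤-trans (≤-reflexive (sym (m+n∸n≡m (N ∸ m₋) (2 * D)))) (≤-trans (∸-monoˡ-≤ (2 * D) (+-monoʳ-≤ (N ∸ m₋) 2D≤)) (≤-reflexive (cong (_∸ 2 * D) (cong (N ∸ m₋ +_) (sym (+-identityʳ (N ∸ m₋))))))))
        (≤-reflexive (trans (sym (*-distribˡ-∸ 2 (N ∸ m₋) D)) (cong (2 *_) (∸-swap N m₋ D))))
        where
        2D≤ : 2 * D ≤ N ∸ m₋
        2D≤ = ≤-trans (≤-reflexive (sym (m+n∸m≡n m₋ (2 * D)))) (∸-monoˡ-≤ m₋ m₋+2D≤N)

    7n≤8β : 7 * n ≤ 8 * β₀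
    7n≤8β = begin
        7 * n                        ≡⟨ sym (trans (cong (_∸ n) (arith n)) (m+n∸m≡n n (7 * n))) ⟩
        8 * n ∸ n                    ≤⟨ ∸-monoʳ-≤ (8 * n) 144μ≤n ⟩
        8 * n ∸ 144 * μ              ≡⟨ cong (8 * n ∸_) (*-assoc 8 18 μ) ⟩
        8 * n ∸ 8 * (18 * μ)         ≡⟨ sym (*-distribˡ-∸ 8 n (18 * μ)) ⟩
        8 * β₀                       ∎
      where
      arith : ∀ n → 8 * n ≡ n + 7 * n
      arith = solve-∀

    κ≤n : κ ≤ n
    κ≤n = ≤-trans (≤sixth κ) (≤-trans κ≤q q≤n)

    qq≡2^Δ : q * q ≡ 2 ^ Δ
    qq≡2^Δ = trans (cong₂ _*_ q≡ q≡) (trans (sym (^-distribˡ-+-* 2 λ′ λ′)) (cong (λ w → 2 ^ (λ′ + w)) (sym (+-identityʳ λ′))))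

    -- The round consists of `4 n` blocks of `K` draws. Of the gain `2 ^ (4 * n)`, two factors
    -- `2 ^ n` pay for the pairs of sets and one for `κ`.
    joined-pairs : κ * (2 ^ n * (2 ^ n * fall (N ∸ μ * μ) m₁)) ≤ fall N m₁
    joined-pairs = begin
        κ * (2 ^ n * (2 ^ n * Z))                    ≤⟨ *-monoˡ-≤ (2 ^ n * (2 ^ n * Z)) (≤-trans κ≤n (n≤2^n n)) ⟩
        2 ^ n * (2 ^ n * (2 ^ n * Z))                ≤⟨ m≤n*m _ (2 ^ n) {{>-nonZero (m^n>0 2 n)}} ⟩
        2 ^ n * (2 ^ n * (2 ^ n * (2 ^ n * Z)))      ≡⟨ arith (2 ^ n) Z ⟩
        2 ^ n * (2 ^ n * (2 ^ n * 2 ^ n)) * Z        ≡⟨ cong (_* Z) (sym 2^4n) ⟩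
        2 ^ (4 * n) * Z                              ≤⟨ decay (μ * μ) K (4 * n) N N≤Kμ² K>0 ⟩
        fall N m₁                                    ∎
      where
      Z = fall (N ∸ μ * μ) m₁
      arith : ∀ a z → a * (a * (a * (a * z))) ≡ a * (a * (a * a)) * z
      arith = solve-∀
      arith′ : ∀ n → 4 * n ≡ n + (n + (n + n))
      arith′ = solve-∀
      2^4n : 2 ^ (4 * n) ≡ 2 ^ n * (2 ^ n * (2 ^ n * 2 ^ n))
      2^4n = trans (cong (2 ^_) (arith′ n)) (trans (^-distribˡ-+-* 2 n (n + (n + n))) (cong (2 ^ n *_)
               (trans (^-distribˡ-+-* 2 n (n + n)) (cong (2 ^ n *_) (^-distribˡ-+-* 2 n n)))))

    -- The moment becomes `fall (N + D) m₁` over `fall N m₁`, the inverse of the probability to miss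
    -- `D` among `N + D` items, which `slow-n` bounds by `2 ^ r`.
    degrees : κ * (n * rising D N m₁) ≤ 2 ^ Δ * fall N m₁
    degrees = begin
        κ * (n * rising D N m₁)                ≤⟨ *-monoʳ-≤ κ (*-monoʳ-≤ n (≤-trans (rising≤fall D N m₁ m₁≤N)
                                                    (slow-n D (N + D) m₁ (≤-trans D≤n (m≤m+n n _)) (m≤m+n N D) (m≤m+n m₁ 6)))) ⟩
        κ * (n * (z * fall (N + D ∸ D) m₁))    ≡⟨ cong (λ w → κ * (n * (z * fall w m₁))) (m+n∸n≡m N D) ⟩
        κ * (n * (z * fall N m₁))              ≡⟨ arith κ n z (fall N m₁) ⟩
        n * (κ * z) * fall N m₁                ≤⟨ *-monoˡ-≤ (fall N m₁) (*-monoˡ-≤ (κ * z) (<⇒≤ n<2q)) ⟩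
        2 * q * (κ * z) * fall N m₁            ≡⟨ cong (_* fall N m₁) (arith′ q κ z) ⟩
        q * (2 * κ * z) * fall N m₁            ≤⟨ *-monoˡ-≤ (fall N m₁) (*-monoʳ-≤ q 2κz≤q) ⟩
        q * q * fall N m₁                      ≡⟨ cong (_* fall N m₁) qq≡2^Δ ⟩
        2 ^ Δ * fall N m₁                      ∎
      where
      arith : ∀ k n z f → k * (n * (z * f)) ≡ n * (k * z) * f
      arith = solve-∀
      arith′ : ∀ q k z → 2 * q * (k * z) ≡ q * (2 * k * z)
      arith′ = solve-∀

    mean>0 : 0 < n * F
    mean>0 = *-mono-≤ n>0 (fall-pos m₋ (≤-trans (n≤1+n m₋) m₋≤N∸D))

    -- By `P` the expected number of isolated vertices is at least `n^(1/6)`, and `κ` is below this.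
    mean-large : κ * A ≤ n * F
    mean-large = sixth-cancel (begin
        sixth (κ * A)                   ≡⟨ sixth-* κ A ⟩
        sixth κ * sixth A               ≤⟨ *-mono-≤ (≤-trans κ≤q q≤n) pm ⟩
        n * (fifth n * sixth F)         ≡⟨ arith n F ⟩
        sixth (n * F)                   ∎)
      where
      arith : ∀ n f → n * (n * n * n * n * n * (f * f * f * (f * f * f))) ≡ n * f * (n * f) * (n * f) * (n * f * (n * f) * (n * f))
      arith = solve-∀

    pairs : fall (N ∸ (n ∸ 1 + (n ∸ 2))) m₋ * A ≤ F * F
    pairs = subst (λ w → fall (N ∸ (n ∸ 1 + w)) m₋ * A ≤ F * F) (∸-+-assoc n 1 1) (fall-pairs D m₋ N N≤DD)
      where
      N≤DD : N ≤ D * D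
      N≤DD = *-cancelˡ-≤ 2 (begin
          2 * N             ≡⟨ 2N n>0 ⟩
          n * D             ≤⟨ *-monoˡ-≤ D n≤2D ⟩
          2 * D * D         ≡⟨ *-assoc 2 D D ⟩
          2 * (D * D)       ∎)
        where
        n≤2D : n ≤ 2 * D
        n≤2D = ≤-trans (≤-reflexive n≡1+D) (≤-trans (+-monoˡ-≤ D (∸-monoˡ-≤ 1 (≤-trans (s≤s (s≤s z≤n)) 4096≤n))) (≤-reflexive (cong (D +_) (sym (+-identityʳ D)))))

    n≤2β : n ≤ 2 * β₀
    n≤2β = *-cancelˡ-≤ 4 (≤-trans (*-monoˡ-≤ n (m≤m+n 4 3)) (≤-trans 7n≤8β (≤-reflexive (*-assoc 4 2 β₀))))

    m₊-m₁ : m₊ ∸ m₁ ≡ 2 * λ′ * n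
    m₊-m₁ = m+n∸m≡n m₁ (2 * λ′ * n)

    -- As `n β₀ ≥ N`, each of the `2 λ′` blocks of `n` draws halves the probability to miss the
    -- base; the total `q²` outweighs `κ n`.
    attach : κ * (n * fall (N ∸ m₁ ∸ β₀) (m₊ ∸ m₁)) ≤ fall (N ∸ m₁) (m₊ ∸ m₁)
    attach = subst (λ w → κ * (n * fall (N ∸ m₁ ∸ β₀) w) ≤ fall (N ∸ m₁) w) (sym m₊-m₁) (begin
        κ * (n * Z)              ≡⟨ sym (*-assoc κ n Z) ⟩
        κ * n * Z                ≤⟨ *-monoˡ-≤ Z (≤-trans (*-monoʳ-≤ κ (<⇒≤ n<2q)) (≤-trans (≤-reflexive (arith κ q)) (≤-trans (*-monoˡ-≤ q 2κ≤q) (≤-reflexive qq≡2^Δ)))) ⟩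
        2 ^ Δ * Z                ≤⟨ decay β₀ n Δ (N ∸ m₁) (≤-trans (m∸n≤m N m₁) N≤) n>0 ⟩
        fall (N ∸ m₁) (Δ * n)    ∎)
      where
      Z = fall (N ∸ m₁ ∸ β₀) (2 * λ′ * n)
      arith : ∀ k q → k * (2 * q) ≡ 2 * k * q
      arith = solve-∀
      N≤ : N ≤ n * β₀
      N≤ = *-cancelˡ-≤ 2 (begin
          2 * N           ≡⟨ 2N n>0 ⟩
          n * D           ≤⟨ *-monoʳ-≤ n (≤-trans D≤n n≤2β) ⟩
          n * (2 * β₀)    ≡⟨ arith′ n β₀ ⟩
          2 * (n * β₀)    ∎)
        where
        arith′ : ∀ n b → n * (2 * b) ≡ 2 * (n * b)
        arith′ = solve-∀

    λ>0 : 0 < λ′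
    λ>0 = ≤-trans (≤-trans (*-mono-≤ {1} {1024} (s≤s z≤n) K>0) (≤-reflexive (sym r≡))) r≤λ

    m₋≤m₊ : m₋ ≤ m₊
    m₋≤m₊ = ≤-trans (<⇒≤ <hi) (≤-trans (*-monoˡ-≤ n (+-monoʳ-≤ λ′ (≤-trans λ>0 (m≤m+n λ′ 0)))) (m≤n+m (2 * λ′ * n) m₁))

    m₊≤N : m₊ ≤ N
    m₊≤N = begin
        m₁ + 2 * λ′ * n              ≤⟨ +-mono-≤ (≤-trans (m≤m+n m₁ 6) (≤-trans lo≤rs rs≤sq)) λn ⟩
        s * q + 2 * (s * q)          ≡⟨⟩
        3 * (s * q)                  ≤⟨ times 3 16 (m≤m+n 3 13) ⟩
        16 * (s * q)                 ≤⟨ 16sq≤N ⟩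
        N                            ∎
      where
      λn : 2 * λ′ * n ≤ 2 * (s * q)
      λn = ≤-trans (≤-reflexive (*-assoc 2 λ′ n)) (*-monoʳ-≤ 2 (≤-trans (*-monoˡ-≤ n (m≤m+n λ′ 1)) (≤-trans (m≤m+n hi (2 * n)) hi≤)))

    D₀≤ : D₀ + 6 ≤ N ∸ m₁
    D₀≤ = m+n≤o⇒m≤o∸n (D₀ + 6) (begin
        4 * (s * q) + 6 + m₁         ≡⟨ trans (+-assoc (4 * (s * q)) 6 m₁) (cong (4 * (s * q) +_) (+-comm 6 m₁)) ⟩
        4 * (s * q) + lo             ≤⟨ +-monoʳ-≤ (4 * (s * q)) (≤-trans lo≤rs rs≤sq) ⟩
        4 * (s * q) + s * q          ≡⟨ +-comm (4 * (s * q)) (s * q) ⟩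
        5 * (s * q)                  ≤⟨ times 5 16 (m≤m+n 5 11) ⟩
        16 * (s * q)                 ≤⟨ 16sq≤N ⟩
        N                            ∎)

    -- Reduced to the whole process up to `m₋`, where `combine` applies, by dividing off the first
    -- `m₁ + a` draws at cost `z`. Since `a` edges are already gone, `2 * β₀ - a` edges remain to be
    -- missed.
    windows : ∀ a → a ≤ 6 → x₀ * fall (N ∸ m₁ ∸ 2 * β₀) (m₋ ∸ m₁ ∸ a) ≤ fall (N ∸ m₁ ∸ a) (m₋ ∸ m₁ ∸ a)
    windows a a≤6 = subst₂ _≤_
        (cong₂ (λ u v → x₀ * fall u v) N∸b∸f (sym (∸-+-assoc m₋ m₁ a)))
        (cong₂ fall (sym (∸-+-assoc N m₁ a)) (sym (∸-+-assoc m₋ m₁ a)))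
        (*-cancelʳ-≤ _ _ (fall N b) {{>-nonZero (fall-pos b (≤-trans b≤lo lo≤N))}} (begin
          x₀ * fall (N ∸ b ∸ f) t * fall N b                   ≤⟨ *-monoʳ-≤ (x₀ * fall (N ∸ b ∸ f) t) (slow-n f N b (≤-trans (m∸n≤m (2 * β₀) a) (*-monoʳ-≤ 2 (m∸n≤m n (18 * μ)))) ≤-refl b≤lo) ⟩
          x₀ * fall (N ∸ b ∸ f) t * (z * fall (N ∸ f) b)       ≡⟨ arith x₀ (fall (N ∸ b ∸ f) t) z (fall (N ∸ f) b) ⟩
          x₀ * z * (fall (N ∸ f) b * fall (N ∸ b ∸ f) t)       ≡⟨ cong (λ w → x₀ * z * (fall (N ∸ f) b * fall w t)) (∸-swap N b f) ⟩
          x₀ * z * (fall (N ∸ f) b * fall (N ∸ f ∸ b) t)       ≡⟨ cong (x₀ * z *_) (sym (fall-+ b (N ∸ f) t)) ⟩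
          x₀ * z * fall (N ∸ f) (b + t)                        ≡⟨ cong (λ w → x₀ * z * fall (N ∸ f) w) bt ⟩
          x₀ * z * fall (N ∸ f) m₋                             ≤⟨ combine (x₀ * z) (fall (N ∸ f) m₋) A F n A>0 n>0 (fall-cubic D f m₋ N m₋+2D≤N 3D≤2f) upper small ⟩
          fall N m₋                                            ≡⟨ cong (fall N) (sym bt) ⟩
          fall N (b + t)                                       ≡⟨ fall-+ b N t ⟩
          fall N b * fall (N ∸ b) t                            ≡⟨ *-comm (fall N b) (fall (N ∸ b) t) ⟩
          fall (N ∸ b) t * fall N b                            ∎))
      where
      b f t : ℕ
      b = m₁ + a
      f = 2 * β₀ ∸ a
      t = m₋ ∸ b
      b≤lo : b ≤ lo
      b≤lo = +-monoʳ-≤ m₁ a≤6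
      bt : b + t ≡ m₋
      bt = m+[n∸m]≡n (≤-trans b≤lo lo≤)
      arith : ∀ x u z v → x * u * (z * v) ≡ x * z * (v * u)
      arith = solve-∀
      6D+24≤8β : 6 * D + 24 ≤ 8 * β₀
      6D+24≤8β = ≤-trans (+-mono-≤ (*-monoʳ-≤ 6 D≤n) (≤-trans (m≤m+n 24 4072) 4096≤n)) (≤-trans (≤-reflexive (+-comm (6 * n) n)) 7n≤8β)
      3D+2a≤4β : 3 * D + 2 * a ≤ 4 * β₀
      3D+2a≤4β = *-cancelˡ-≤ 2 (begin
          2 * (3 * D + 2 * a)    ≡⟨ arith₁ D a ⟩
          6 * D + 4 * a          ≤⟨ +-monoʳ-≤ (6 * D) (*-monoʳ-≤ 4 a≤6) ⟩
          6 * D + 24             ≤⟨ 6D+24≤8β ⟩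
          8 * β₀                 ≡⟨ *-assoc 2 4 β₀ ⟩
          2 * (4 * β₀)           ∎)
        where
        arith₁ : ∀ D a → 2 * (3 * D + 2 * a) ≡ 6 * D + 4 * a
        arith₁ = solve-∀
      a≤2β : a ≤ 2 * β₀
      a≤2β = *-cancelˡ-≤ 2 (≤-trans (m≤n+m (2 * a) (3 * D)) (≤-trans 3D+2a≤4β (≤-reflexive (*-assoc 2 2 β₀))))
      3D≤2f : 3 * D ≤ 2 * f
      3D≤2f = ≤-trans (m+n≤o⇒m≤o∸n (3 * D) (≤-trans 3D+2a≤4β (≤-reflexive (*-assoc 2 2 β₀)))) (≤-reflexive (sym (*-distribˡ-∸ 2 (2 * β₀) a)))
      N∸b∸f : N ∸ b ∸ f ≡ N ∸ m₁ ∸ 2 * β₀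
      N∸b∸f = trans (cong (_∸ f) (sym (∸-+-assoc N m₁ a))) (trans (∸-+-assoc (N ∸ m₁) a f) (cong (N ∸ m₁ ∸_) (m+[n∸m]≡n a≤2β)))
      small : fourth (x₀ * z) * 64 ≤ fifth n
      small = begin
          fourth (x₀ * z) * 64              ≡⟨ arith₂ n y z ⟩
          fourth n * (fourth (y * z) * 64)  ≤⟨ *-monoʳ-≤ (fourth n) (≤-trans small-far q≤n) ⟩
          fourth n * n                      ≡⟨ arith₃ n ⟩
          fifth n                           ∎
        where
        arith₂ : ∀ n y z → n * y * z * (n * y * z) * (n * y * z * (n * y * z)) * 64 ≡ n * n * (n * n) * (y * z * (y * z) * (y * z * (y * z)) * 64)
        arith₂ = solve-∀
        arith₃ : ∀ n → n * n * (n * n) * n ≡ n * n * n * n * n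
        arith₃ = solve-∀

    D₀>0 : 0 < D₀
    D₀>0 = *-mono-≤ {1} {4} (s≤s z≤n) (*-mono-≤ s>0 q>0)

    xD>0 : 0 < x₀ * D₀ ^ 6
    xD>0 = *-mono-≤ (*-mono-≤ n>0 (*-mono-≤ {1} {7 * κ} (*-mono-≤ {1} {7} (s≤s z≤n) κ>0) 256Y>0)) (m^n>0 D₀ {{>-nonZero D₀>0}} 6)

    -- Relative to `D₀`, the weight of the steps out of a vertex is of the order of `Y`, that is
    -- logarithmic in `n` for the final choice: `D₀` is of order `n²`, and `m₊ - m₁` of order
    -- `n λ′`.
    radius : D₀ * (Δ + (2 * h + 6)) + n * (m₊ ∸ m₁) ≤ D₀ * (256 * Y)
    radius = begin
        D₀ * (Δ + (2 * h + 6)) + n * (m₊ ∸ m₁)    ≤⟨ +-mono-≤ (*-monoʳ-≤ D₀ 6Y) other ⟩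
        D₀ * (10 * Y) + D₀ * (128 * Y)            ≡⟨ arith D₀ Y ⟩
        D₀ * (138 * Y)                            ≤⟨ *-monoʳ-≤ D₀ (*-monoˡ-≤ Y (m≤m+n 138 118)) ⟩
        D₀ * (256 * Y)                            ∎
      where
      arith : ∀ d y → d * (10 * y) + d * (128 * y) ≡ d * (138 * y)
      arith = solve-∀
      λ≤Y : λ′ ≤ Y
      λ≤Y = ≤-trans (m≤m+n λ′ 1) λ<Y
      6Y : Δ + (2 * h + 6) ≤ 10 * Y
      6Y = ≤-trans (+-mono-≤ (*-monoʳ-≤ 2 λ≤Y) (+-mono-≤ (*-monoʳ-≤ 2 (≤-trans h≤λ λ≤Y)) (*-monoʳ-≤ 6 Y>0))) (≤-reflexive (arith′ Y))
        where
        arith′ : ∀ Y → 2 * Y + (2 * Y + 6 * Y) ≡ 10 * Y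
        arith′ = solve-∀
      other : n * (m₊ ∸ m₁) ≤ D₀ * (128 * Y)
      other = begin
          n * (m₊ ∸ m₁)                 ≡⟨ cong (n *_) m₊-m₁ ⟩
          n * (2 * λ′ * n)              ≡⟨ arith₁ n λ′ ⟩
          2 * λ′ * (n * n)              ≤⟨ *-mono-≤ (*-monoʳ-≤ 2 λ≤Y) (*-mono-≤ n≤128s (<⇒≤ n<2q)) ⟩
          2 * Y * (128 * s * (2 * q))   ≡⟨ arith₂ Y s q ⟩
          D₀ * (128 * Y)                ∎
        where
        arith₁ : ∀ n l → n * (2 * l * n) ≡ 2 * l * (n * n)
        arith₁ = solve-∀
        arith₂ : ∀ Y s q → 2 * Y * (128 * s * (2 * q)) ≡ 4 * (s * q) * (128 * Y)
        arith₂ = solve-∀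

    far : κ * (7 * (n * (D₀ * (Δ + (2 * h + 6)) + n * (m₊ ∸ m₁)) ^ 6)) ≤ x₀ * D₀ ^ 6
    far = begin
        κ * (7 * (n * (D₀ * (Δ + (2 * h + 6)) + n * (m₊ ∸ m₁)) ^ 6))   ≤⟨ *-monoʳ-≤ κ (*-monoʳ-≤ 7 (*-monoʳ-≤ n (^-monoˡ-≤ 6 radius))) ⟩
        κ * (7 * (n * (D₀ * (256 * Y)) ^ 6))                           ≡⟨ cong (λ w → κ * (7 * (n * w))) (trans (pow6 (D₀ * (256 * Y))) (trans (sixth-* D₀ (256 * Y)) (cong (_* sixth (256 * Y)) (sym (pow6 D₀))))) ⟩
        κ * (7 * (n * (D₀ ^ 6 * sixth (256 * Y))))                     ≡⟨ arith κ n (D₀ ^ 6) (sixth (256 * Y)) ⟩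
        x₀ * D₀ ^ 6                                                    ∎
      where
      arith : ∀ k n d w → k * (7 * (n * (d * w))) ≡ n * (7 * k * w) * d
      arith = solve-∀
      pow6 : ∀ a → a ^ 6 ≡ sixth a
      pow6 = arith′
        where
        arith′ : ∀ a → a * (a * (a * (a * (a * (a * 1))))) ≡ a * a * a * (a * a * a)
        arith′ = solve-∀

    numbers : Numbers n m₁ m₋ m₊ μ h Δ κ
    numbers = record
      { m₁≤m₋ = lo≤ ; m₋≤m₊ = m₋≤m₊ ; m₊≤N = m₊≤N ; two≤n = ≤-trans (s≤s (s≤s z≤n)) 4096≤n ; one≤Δ = ≤-trans λ>0 (m≤m+n λ′ _)
      ; joined-num = joined-pairs ; degree-num = degrees ; mean-pos = mean>0 ; mean-num = mean-large ; pair-num = pairs ; attach-num = attach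
      ; x = x₀ ; D = D₀ ; D≤ = D₀≤ ; window = windows ; xD-pos = xD>0 ; far-num = far }

  mostly-good : (build : (adj : Fin n → Fin n → Bool) → (∀ u v → adj u v ≡ true → adj v u ≡ true) →
                  (∀ (A B : Fin n → Bool) → (∀ i → A i ≡ true → B i ≡ false) → μ ≤ card A → μ ≤ card B →
                    ∃[ a ] ∃[ b ] A a ≡ true × B b ≡ true × adj a b ≡ true) → Structure adj h μ) →
                ∀ ℓ → ℓ ≡ 7 → ∀ k → κ ≡ 5 * k → ProbAtLeast1-1/ n GoodOrdering k
  mostly-good build ℓ ℓ≡7 k κ≡ = at chosen
    where
    at : ∃[ m ] lo ≤ m × m < lo + (hi ∸ lo) × P m × ¬ P (suc m) → ProbAtLeast1-1/ n GoodOrdering k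
    at (m₋ , lo≤ , <hi , pm , npm) = Rare.probable n m₁ m₋ m₊ μ h Δ ℓ ℓ≡7 build κ
      (At.numbers m₋ lo≤ (subst (m₋ <_) (m+[n∸m]≡n lo≤hi) <hi) pm npm) k κ≡

-- Explicit scales and the conclusion.

n<2^n : ∀ n → n < 2 ^ n
n<2^n zero = s≤s z≤n
n<2^n (suc n) = +-mono-≤ (m^n>0 2 n) (≤-trans (n<2^n n) (m≤m+n (2 ^ n) 0))

floorLog : ∀ b → 2 ≤ b → ∀ n → 0 < n → ∃[ l ] b ^ l ≤ n × n < b ^ suc l
floorLog b 2≤b n n>0 with lastTrue (λ m → b ^ m ≤? n) 0 n n>0 (<⇒≱ (<-≤-trans (n<2^n n) (^-monoˡ-≤ n 2≤b)))
... | l , _ , _ , le , lt = l , le , ≰⇒> lt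

square-^ : ∀ b i → b ^ i * b ^ i ≡ (b ^ 2) ^ i
square-^ b i = trans (sym (^-distribˡ-+-* b i i)) (trans (cong (λ e → b ^ (i + e)) (sym (+-identityʳ i))) (sym (^-*-assoc b 2 i)))

*-≤-2^ : ∀ {a b x y} → a ≤ 2 ^ x → b ≤ 2 ^ y → a * b ≤ 2 ^ (x + y)
*-≤-2^ {x = x} {y} h k = ≤-trans (*-mono-≤ h k) (≤-reflexive (sym (^-distribˡ-+-* 2 x y)))

sixth-≤-2^ : ∀ {a} x → a ≤ 2 ^ x → sixth a ≤ 2 ^ (x + x + x + (x + x + x))
sixth-≤-2^ {a} x h = *-≤-2^ {a * a * a} {a * a * a} {x + x + x} {x + x + x} cube cube
  where
  cube : a * a * a ≤ 2 ^ (x + x + x)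
  cube = *-≤-2^ {a * a} {a} {x + x} {x} (*-≤-2^ {a} {a} {x} {x} h h) h

16i+46<2^i : ∀ {i} → 8 ≤ i → 16 * i + 46 < 2 ^ i
16i+46<2^i {i} 8≤i with m≤n⇒∃[o]m+o≡n 8≤i
... | o , refl = go o
  where
  go : ∀ o → 16 * (8 + o) + 46 < 2 ^ (8 + o)
  go zero = m≤m+n 175 81
  go (suc o) = begin-strict
      16 * (8 + suc o) + 46          ≡⟨ arith₁ o ⟩
      16 * (8 + o) + 46 + 16         <⟨ +-mono-<-≤ (go o) (≤-trans (m≤m+n 16 158) (≤-trans (m≤n+m 174 (16 * o)) (≤-trans (≤-reflexive (arith₂ o)) (<⇒≤ (go o))))) ⟩
      2 ^ (8 + o) + 2 ^ (8 + o)      ≡⟨ cong (2 ^ (8 + o) +_) (sym (+-identityʳ _)) ⟩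
      2 ^ (8 + suc o)                ∎
    where
    open ≤-Reasoning
    arith₁ : ∀ o → 16 * (8 + suc o) + 46 ≡ 16 * (8 + o) + 46 + 16
    arith₁ = solve-∀
    arith₂ : ∀ o → 16 * o + 174 ≡ 16 * (8 + o) + 46
    arith₂ = solve-∀

module Scale (k n λ′ i : ℕ) (2^λ≤n : 2 ^ λ′ ≤ n) (n<2^ : n < 2 ^ suc λ′)
             (16^i≤λ : 16 ^ i ≤ λ′) (λ<16^ : λ′ < 16 ^ suc i) (i-large : 8 + 5 * suc k ≤ i) where
  open ≤-Reasoning

  κ p s q K r Y h μ j d : ℕ
  κ = 5 * suc k
  -- `p * p = 16 ^ i` is `λ′` up to a factor 16, so `p` stands for its square root and `2 ^ i` for
  -- its fourth root; accordingly `μ = q / 2 ^ i` and `K = 2 p`.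
  p = 4 ^ i
  s = 2 ^ (λ′ ∸ 6)
  q = 2 ^ λ′
  K = 2 * p
  r = 1024 * K
  Y = 16 ^ suc i
  h = λ′ ∸ i
  μ = 2 ^ h
  -- Chosen so that `2 ^ j` is twice `16 ^ suc i`, hence above `h + 2`; gadgets of all heights then
  -- fit into `j` children.
  j = 4 * i + 5
  d = j + j + 3

  8≤i : 8 ≤ i
  8≤i = ≤-trans (m≤m+n 8 κ) i-large

  i≤p : i ≤ p
  i≤p = ≤-trans (n≤2^n i) (^-monoˡ-≤ i (m≤m+n 2 2))

  κ≤p : κ ≤ p
  κ≤p = ≤-trans (≤-trans (m≤n+m κ 8) i-large) i≤p

  p-large : 65536 ≤ p
  p-large = ^-monoʳ-≤ 4 8≤i

  p>0 : 0 < p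
  p>0 = m^n>0 4 i

  pp≤λ : p * p ≤ λ′
  pp≤λ = ≤-trans (≤-reflexive (square-^ 4 i)) 16^i≤λ

  -- Absorbs all constants: `i ≥ 8` gives `p ≥ 4 ^ 8 = 65536`, and so `a * p ≤ p * p ≤ λ′`.
  multiple : ∀ a → a ≤ 65536 → a * p ≤ λ′
  multiple a le = ≤-trans (*-monoˡ-≤ p (≤-trans le p-large)) pp≤λ

  i≤λ : i ≤ λ′
  i≤λ = ≤-trans i≤p (≤-trans (≤-reflexive (sym (*-identityˡ p))) (multiple 1 (s≤s z≤n)))

  6≤λ : 6 ≤ λ′
  6≤λ = ≤-trans (≤-trans (m≤m+n 6 2) 8≤i) i≤λ

  q≡64s : q ≡ 64 * s
  q≡64s = trans (cong (2 ^_) (sym (m+[n∸m]≡n 6≤λ))) (^-distribˡ-+-* 2 6 (λ′ ∸ 6))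

  q≡2^iμ : q ≡ 2 ^ i * μ
  q≡2^iμ = trans (cong (2 ^_) (sym (m+[n∸m]≡n i≤λ))) (^-distribˡ-+-* 2 i (λ′ ∸ i))

  Y≡ : Y ≡ 2 ^ (4 * suc i)
  Y≡ = ^-*-assoc 2 4 (suc i)

  Y≥2 : 2 ≤ Y
  Y≥2 = ≤-trans (m≤m+n 2 14) (*-monoʳ-≤ 16 (m^n>0 16 i))

  4096Y≤q : 4096 * Y ≤ q
  4096Y≤q = ≤-trans (≤-trans (*-monoʳ-≤ 4096 (≤-reflexive Y≡)) (≤-reflexive (sym (^-distribˡ-+-* 2 12 (4 * suc i)))))
    (^-monoʳ-≤ 2 (≤-trans (≤-trans (≤-reflexive (arith i)) (+-mono-≤ (*-monoʳ-≤ 4 i≤p) (*-monoʳ-≤ 16 p>0))) (≤-trans (≤-reflexive (arith′ p)) (multiple 20 (m≤m+n 20 65516)))))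
    where
    arith : ∀ i → 12 + 4 * suc i ≡ 4 * i + 16 * 1
    arith = solve-∀
    arith′ : ∀ p → 4 * p + 16 * p ≡ 20 * p
    arith′ = solve-∀

  K≤Y : K ≤ Y
  K≤Y = *-mono-≤ (m≤m+n 2 14) (^-monoˡ-≤ i (m≤m+n 4 12))

  sixthκ≤q : sixth κ ≤ q
  sixthκ≤q = ≤-trans (sixth-≤-2^ κ (n≤2^n κ)) (^-monoʳ-≤ 2 (≤-trans (≤-trans (≤-reflexive (arith κ)) (*-monoʳ-≤ 6 κ≤p)) (multiple 6 (m≤m+n 6 65530))))
    where
    arith : ∀ k → k + k + k + (k + k + k) ≡ 6 * k
    arith = solve-∀

  N≤Kμ² : n C 2 ≤ K * (μ * μ)
  N≤Kμ² = *-cancelˡ-≤ 2 (begin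
      2 * (n C 2)                        ≡⟨ 2N (≤-trans (m^n>0 2 λ′) 2^λ≤n) ⟩
      n * (n ∸ 1)                        ≤⟨ *-mono-≤ (<⇒≤ n<2^) (≤-trans (m∸n≤m n 1) (<⇒≤ n<2^)) ⟩
      2 * q * (2 * q)                    ≡⟨ cong (λ w → 2 * w * (2 * w)) q≡2^iμ ⟩
      2 * (2 ^ i * μ) * (2 * (2 ^ i * μ)) ≡⟨ arith (2 ^ i) μ ⟩
      2 * (2 * (2 ^ i * 2 ^ i) * (μ * μ)) ≡⟨ cong (λ w → 2 * (2 * w * (μ * μ))) (square-^ 2 i) ⟩
      2 * (K * (μ * μ))                  ∎)
    where
    arith : ∀ a μ → 2 * (a * μ) * (2 * (a * μ)) ≡ 2 * (2 * (a * a) * (μ * μ))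
    arith = solve-∀

  144μ≤n : 144 * μ ≤ n
  144μ≤n = ≤-trans (*-monoˡ-≤ μ (≤-trans (m≤m+n 144 112) (^-monoʳ-≤ 2 8≤i))) (≤-trans (≤-reflexive (sym q≡2^iμ)) 2^λ≤n)

  -- A comparison of exponents of 2: those on the left add up to a constant multiple of `p`, while
  -- `q = 2 ^ λ′` and `λ′ ≥ p * p`.
  small-far : fourth (7 * κ * sixth (256 * Y) * 2 ^ r) * 64 ≤ q
  small-far = ≤-trans (*-≤-2^ {b = 64} {e + e + (e + e)} {6} (*-≤-2^ {X * X} {X * X} {e + e} {e + e} (*-≤-2^ {X} {X} {e} {e} X≤ X≤) (*-≤-2^ {X} {X} {e} {e} X≤ X≤)) ≤-refl)
      (^-monoʳ-≤ 2 (begin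
        e + e + (e + e) + 6                     ≡⟨ arith κ i p ⟩
        4 * κ + 96 * i + 306 * 1 + 8192 * p     ≤⟨ +-monoˡ-≤ (8192 * p) (+-mono-≤ (+-mono-≤ (*-monoʳ-≤ 4 κ≤p) (*-monoʳ-≤ 96 i≤p)) (*-monoʳ-≤ 306 p>0)) ⟩
        4 * p + 96 * p + 306 * p + 8192 * p     ≡⟨ arith′ p ⟩
        8598 * p                                ≤⟨ multiple 8598 (m≤m+n 8598 56938) ⟩
        λ′                                      ∎))
    where
    X t e : ℕ
    X = 7 * κ * sixth (256 * Y) * 2 ^ r
    t = 8 + 4 * suc i
    e = 3 + κ + (t + t + t + (t + t + t)) + r
    X≤ : X ≤ 2 ^ e
    X≤ = *-≤-2^ {7 * κ * sixth (256 * Y)} {2 ^ r} {3 + κ + (t + t + t + (t + t + t))} {r}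
           (*-≤-2^ {7 * κ} {sixth (256 * Y)} {3 + κ} {t + t + t + (t + t + t)} (*-≤-2^ {7} {κ} {3} {κ} (m≤m+n 7 1) (n≤2^n κ))
             (sixth-≤-2^ t (≤-trans (*-monoʳ-≤ 256 (≤-reflexive Y≡)) (≤-reflexive (sym (^-distribˡ-+-* 2 8 (4 * suc i))))))) ≤-refl
    arith : ∀ k i p → (3 + k + (8 + 4 * suc i + (8 + 4 * suc i) + (8 + 4 * suc i) + (8 + 4 * suc i + (8 + 4 * suc i) + (8 + 4 * suc i))) + 1024 * (2 * p)) + (3 + k + (8 + 4 * suc i + (8 + 4 * suc i) + (8 + 4 * suc i) + (8 + 4 * suc i + (8 + 4 * suc i) + (8 + 4 * suc i))) + 1024 * (2 * p)) + ((3 + k + (8 + 4 * suc i + (8 + 4 * suc i) + (8 + 4 * suc i) + (8 + 4 * suc i + (8 + 4 * suc i) + (8 + 4 * suc i))) + 1024 * (2 * p)) + (3 + k + (8 + 4 * suc i + (8 + 4 * suc i) + (8 + 4 * suc i) + (8 + 4 * suc i + (8 + 4 * suc i) + (8 + 4 * suc i))) + 1024 * (2 * p))) + 6 ≡ 4 * k + 96 * i + 306 * 1 + 8192 * p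
    arith = solve-∀
    arith′ : ∀ p → 4 * p + 96 * p + 306 * p + 8192 * p ≡ 8598 * p
    arith′ = solve-∀

  build : (adj : Fin n → Fin n → Bool) → (∀ u v → adj u v ≡ true → adj v u ≡ true) →
          (∀ (A B : Fin n → Bool) → (∀ i → A i ≡ true → B i ≡ false) → μ ≤ card A → μ ≤ card B →
            ∃[ a ] ∃[ b ] A a ≡ true × B b ≡ true × adj a b ≡ true) → Structure adj h μ
  build adj adj-sym joined = Cores.structure adj adj-sym μ d (m^n>0 2 h) joined h j refl h+2<2^j ≤-refl room
    where
    h+2<2^j : h + 2 < 2 ^ j
    h+2<2^j = begin
        suc (h + 2)              ≤⟨ +-mono-≤ (≤-trans (s≤s (m∸n≤m λ′ i)) λ<16^) Y≥2 ⟩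
        Y + Y                    ≡⟨ cong₂ _+_ Y≡ (trans Y≡ (sym (+-identityʳ _))) ⟩
        2 ^ suc (4 * suc i)      ≡⟨ cong (2 ^_) (arith i) ⟩
        2 ^ j                    ∎
      where
      arith : ∀ i → suc (4 * suc i) ≡ 4 * i + 5
      arith = solve-∀
    room : (d + d + 20) * μ < n
    room = begin-strict
        (d + d + 20) * μ       ≡⟨ cong (_* μ) (arith i) ⟩
        (16 * i + 46) * μ      <⟨ *-monoˡ-< μ {{>-nonZero (m^n>0 2 h)}} (16i+46<2^i 8≤i) ⟩
        2 ^ i * μ              ≡⟨ sym q≡2^iμ ⟩
        q                      ≤⟨ 2^λ≤n ⟩
        n                      ∎
      where
      arith : ∀ i → (4 * i + 5 + (4 * i + 5) + 3) + (4 * i + 5 + (4 * i + 5) + 3) + 20 ≡ 16 * i + 46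
      arith = solve-∀

  mostly-good : ProbAtLeast1-1/ n GoodOrdering (suc k)
  mostly-good = Choice.mostly-good κ n λ′ s q K r Y h q≡64s refl 2^λ≤n n<2^ (m^n>0 2 (λ′ ∸ 6)) (*-mono-≤ {1} {2} (s≤s z≤n) p>0) K≤Y
                (≤-trans (≤-reflexive (+-comm λ′ 1)) λ<16^) 4096Y≤q refl (s≤s z≤n) sixthκ≤q μ (m∸n≤m λ′ i) N≤Kμ² 144μ≤n small-far build 7 refl (suc k) refl

theorem1p1 : (k : ℕ) → ∃[ n₀ ] ((n : ℕ) → n ≥ n₀ → ProbAtLeast1-1/ n GoodOrdering k)
-- For `k = 0` the count of exceptions is multiplied by zero, so the empty list of orderings will
-- do.
theorem1p1 zero = 0 , λ n _ → [] , [] , [] , z≤n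
theorem1p1 (suc k) = 2 ^ (16 ^ i₀) , λ n n≥ → at n n≥ (floorLog 2 ≤-refl n (≤-trans (m^n>0 2 (16 ^ i₀)) n≥))
  where
  -- The summand 8 makes `p` absorb the constants, and `5 * suc k`, which is `κ`, makes `κ ≤ i ≤ p`.
  i₀ = 8 + 5 * suc k
  at : ∀ n → 2 ^ (16 ^ i₀) ≤ n → (∃[ l ] 2 ^ l ≤ n × n < 2 ^ suc l) → ProbAtLeast1-1/ n GoodOrdering (suc k)
  at n n≥ (l , le , lt) = at′ (floorLog 16 (s≤s (s≤s z≤n)) l (≤-trans (m^n>0 16 i₀) 16^i₀≤l))
    where
    16^i₀≤l : 16 ^ i₀ ≤ l
    16^i₀≤l = ≮⇒≥ λ l< → <-irrefl refl (<-≤-trans lt (≤-trans (^-monoʳ-≤ 2 l<) n≥))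
    at′ : (∃[ i ] 16 ^ i ≤ l × l < 16 ^ suc i) → ProbAtLeast1-1/ n GoodOrdering (suc k)
    at′ (i , le′ , lt′) = Scale.mostly-good k n l i le lt le′ lt′
      (≮⇒≥ λ i< → <-irrefl refl (<-≤-trans lt′ (≤-trans (^-monoʳ-≤ 16 i<) 16^i₀≤l)))
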